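{- (Path Murnaghan–Nakayama Rule.) Let $\mu=(\mu_1,\dots,\mu_r)$ be a partition of $n$. Then $$\vec p_\mu=m(\mu)!\cdot\sum_T \mathrm{sign}(T)\cdot s_{\mathrm{shape}(T)},$$ where the sum is over all monotonic ribbon tilings $T$ whose ribbon sizes, read from west to east, form a rearrangement of $(\mu_1,\dots,\mu_r)$.
   Context: A ribbon is an edgewise connected skew shape containing no $2\times2$ square; its height is the number of rows it occupies minus one, its sign is $(-1)^{\text{height}}$, and its tail is its southwesternmost cell. A monotonic ribbon tiling $T$ of shape $\lambda$ is a decomposition of the Young diagram of $\lambda$ (English convention) into disjoint ribbons $\xi^{(1)},\dots,\xi^{(r)}$ such that the tails of $\xi^{(1)},\dots,\xi^{(r)}$ lie in distinct columns $c_1<\dots<c_r$, and each union $\xi^{(1)}\sqcup\cdots\sqcup\xi^{(i)}$, $0\le i\le r$, is the Young diagram of a partition. $\mathrm{shape}(T)=\lambda$ and $\mathrm{sign}(T)$ is the product of the signs of its ribbons. $m(\mu)!=\prod_i m_i(\mu)!$ with $m_i(\mu)$ the multiplicity of $i$ in $\mu$. The path power sum $\vec p_\mu=\sum_{\lambda\vdash n}a_\lambda p_\lambda$, where $a_\lambda$ counts permutations $w\in\mathfrak{S}_n$ of cycle type $\lambda$ with $w(i_t)=j_t$ for all $t$, for any pair $(I,J)$ of equal-length sequences of distinct elements of $[n]$ whose directed graph on $[n]$ (edges $i_t\to j_t$) is a disjoint union of directed paths with vertex counts $\mu_1,\dots,\mu_r$ (isolated vertices being one-vertex paths). $s_\lambda$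 is the Schur function. -}

module Defs where

open import Data.Nat.Base using (ℕ; zero; suc; _+_; _*_; _∸_; _⊓_; _⊔_; _≡ᵇ_; _≤ᵇ_; _<ᵇ_; _!)
open import Data.Bool.Base using (Bool; true; false; _∧_; _∨_; not; if_then_else_)
open import Data.List.Base
  using (List; []; _∷_; map; concatMap; filterᵇ; length; upTo; foldr; zip; _++_; concat; allFin)
open import Data.Nat.ListAction using (sum; product)
open import Data.Bool.ListAction using (and; all; any)
open import Data.Maybe.Base using (Maybe; just; nothing)
open import Data.Fin.Base using (Fin; toℕ)
open import Data.Vec.Base as Vec using (Vec)
open import Data.Product.Base using (_×_; _,_; proj₁; proj₂)
open import Data.Integer.Base as ℤ using (ℤ)
open import Data.List.Relation.Binary.Permutation.Propositional using (_↭_)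
open import Data.List.Relation.Unary.Unique.Propositional using (Unique)
open import Relation.Binary.PropositionalEquality using (_≡_)

-- Conventions
--  * A partition is a list of positive naturals, weakly decreasing
--    (λ₁ ≥ λ₂ ≥ … > 0).  Rows and columns of Young diagrams (English
--    convention) are indexed from 0; a cell is (row , column).
--  * A symmetric function (formal power series in x₁, x₂, …) is
--    represented by its coefficient function: a monomial x^α is given by
--    a finite exponent list α = (α₁, …, α_ℓ) (trailing variables have
--    exponent 0).  Two series are equal iff all coefficients agree.

Series : Set
Series = List ℕ → ℤ

_+ₛ_ : Series → Series → Series
(f +ₛ g) α = f α ℤ.+ g α

_·ₛ_ : ℤ → Series → Series
(c ·ₛ f) α = c ℤ.* f α

zeroₛ : Series
zeroₛ _ = ℤ.0ℤ

Σₛ : {A : Set} → List A → (A → Series) → Series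
Σₛ xs f = foldr (λ x acc → f x +ₛ acc) zeroₛ xs

at : List ℕ → ℕ → ℕ
at [] _ = 0
at (x ∷ xs) zero = x
at (x ∷ xs) (suc i) = at xs i

count : ℕ → List ℕ → ℕ
count x xs = length (filterᵇ (x ≡ᵇ_) xs)

bagEqᵇ : List ℕ → List ℕ → Bool
bagEqᵇ xs ys = all (λ x → count x xs ≡ᵇ count x ys) (xs ++ ys)

listEqᵇ : List ℕ → List ℕ → Bool
listEqᵇ [] [] = true
listEqᵇ (x ∷ xs) (y ∷ ys) = (x ≡ᵇ y) ∧ listEqᵇ xs ys
listEqᵇ _ _ = false

insertDesc : ℕ → List ℕ → List ℕ
insertDesc x [] = x ∷ []
insertDesc x (y ∷ ys) = if y ≤ᵇ x then x ∷ y ∷ ys else y ∷ insertDesc x ys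

sortDesc : List ℕ → List ℕ
sortDesc = foldr insertDesc []

partsBounded : ℕ → ℕ → ℕ → List (List ℕ)   -- fuel, size, max part
partsBounded _ zero _ = [] ∷ []
partsBounded zero (suc _) _ = []
partsBounded (suc f) n m =
  concatMap (λ k → map (k ∷_) (partsBounded f (n ∸ k) k)) (map suc (upTo (m ⊓ n)))

partitions : ℕ → List (List ℕ)
partitions n = partsBounded n n n

multFactorial : List ℕ → ℕ
multFactorial μ = product (map (λ i → count (suc i) μ !) (upTo (sum μ)))

-- Power sums  p_λ = p_{λ₁} p_{λ₂} ⋯ ,  p_k = Σ_j x_j^k

decAt : ℕ → ℕ → List ℕ → List ℕ
decAt j k [] = []
decAt zero k (x ∷ xs) = (x ∸ k) ∷ xs
decAt (suc j) k (x ∷ xs) = x ∷ decAt j k xs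

powerSumCoeff : List ℕ → List ℕ → ℕ
powerSumCoeff [] α = if all (_≡ᵇ 0) α then 1 else 0
powerSumCoeff (k ∷ λ') α =
  sum (map (λ j → if k ≤ᵇ at α j then powerSumCoeff λ' (decAt j k α) else 0)
           (upTo (length α)))

p : List ℕ → Series
p λ' α = ℤ.+ (powerSumCoeff λ' α)

-- Schur functions  s_λ = Σ_{SSYT t of shape λ} x^{content t}
-- A filling is a list of rows (row i has length λ_i), entries ≥ 1.

words : ℕ → ℕ → List (List ℕ)
words zero ℓ = [] ∷ []
words (suc k) ℓ = concatMap (λ a → map (a ∷_) (words k ℓ)) (map suc (upTo ℓ))

fillings : List ℕ → ℕ → List (List (List ℕ))
fillings [] ℓ = [] ∷ []
fillings (r ∷ λ') ℓ = concatMap (λ w → map (w ∷_) (fillings λ' ℓ)) (words r ℓ)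

weaklyIncreasing : List ℕ → Bool
weaklyIncreasing (x ∷ y ∷ xs) = (x ≤ᵇ y) ∧ weaklyIncreasing (y ∷ xs)
weaklyIncreasing _ = true

strictBelow : List ℕ → List ℕ → Bool
strictBelow (u ∷ us) (v ∷ vs) = (u <ᵇ v) ∧ strictBelow us vs
strictBelow [] (_ ∷ _) = false
strictBelow _ [] = true

columnsStrict : List (List ℕ) → Bool
columnsStrict (u ∷ v ∷ rs) = strictBelow u v ∧ columnsStrict (v ∷ rs)
columnsStrict _ = true

isSSYT : List (List ℕ) → Bool
isSSYT t = all weaklyIncreasing t ∧ columnsStrict t

-- content of t is exactly α (entry j+1 occurs α_j times, no other entries)
hasContent : List ℕ → List (List ℕ) → Bool
hasContent α t =
  and (map (λ j → count (suc j) (concat t) ≡ᵇ at α j) (upTo (length α)))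
  ∧ (length (concat t) ≡ᵇ sum α)

s : List ℕ → Series
s λ' α = ℤ.+ (length (filterᵇ (λ t → isSSYT t ∧ hasContent α t) (fillings λ' (length α))))

-- Permutations of [n] = Fin n, w(i) = lookup w i

allVecs : (n k : ℕ) → List (Vec (Fin n) k)
allVecs n zero = Vec.[] ∷ []
allVecs n (suc k) = concatMap (λ a → map (a Vec.∷_) (allVecs n k)) (allFin n)

finEqᵇ : {n : ℕ} → Fin n → Fin n → Bool
finEqᵇ a b = toℕ a ≡ᵇ toℕ b

injectiveᵇ : {n : ℕ} → List (Fin n) → Bool
injectiveᵇ [] = true
injectiveᵇ (x ∷ xs) = not (any (finEqᵇ x) xs) ∧ injectiveᵇ xs

symmetricGroup : (n : ℕ) → List (Vec (Fin n) n)
symmetricGroup n = filterᵇ (λ w → injectiveᵇ (Vec.toList w)) (allVecs n n)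

iter : {n : ℕ} → Vec (Fin n) n → ℕ → Fin n → Fin n
iter w zero i = i
iter w (suc k) i = Vec.lookup w (iter w k i)

firstTrue : List ℕ → (ℕ → Bool) → ℕ
firstTrue [] q = 0
firstTrue (k ∷ ks) q = if q k then k else firstTrue ks q

cycleLength : {n : ℕ} → Vec (Fin n) n → Fin n → ℕ
cycleLength {n} w i = firstTrue (map suc (upTo n)) (λ k → finEqᵇ (iter w k i) i)

isCycleMin : {n : ℕ} → Vec (Fin n) n → Fin n → Bool
isCycleMin {n} w i = all (λ k → toℕ i ≤ᵇ toℕ (iter w k i)) (upTo n)

cycleType : {n : ℕ} → Vec (Fin n) n → List ℕ
cycleType {n} w = sortDesc (map (cycleLength w) (filterᵇ (isCycleMin w) (allFin n)))

respectsᵇ : {n : ℕ} → Vec (Fin n) n → List (Fin n) → List (Fin n) → Bool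
respectsᵇ w I J = all (λ ij → finEqᵇ (Vec.lookup w (proj₁ ij)) (proj₂ ij)) (zip I J)

aCoeff : (n : ℕ) → List (Fin n) → List (Fin n) → List ℕ → ℕ
aCoeff n I J λ' =
  length (filterᵇ (λ w → respectsᵇ w I J ∧ listEqᵇ (cycleType w) λ') (symmetricGroup n))

pathPowerSum : (n : ℕ) → List (Fin n) → List (Fin n) → Series
pathPowerSum n I J = Σₛ (partitions n) (λ λ' → (ℤ.+ aCoeff n I J λ') ·ₛ p λ')

-- (I , J) has directed graph (edges i_t → j_t on vertex set [n]) equal to a
-- disjoint union of directed paths with vertex counts μ₁, …, μ_r.

consecutivePairs : {A : Set} → List A → List (A × A)
consecutivePairs (x ∷ y ∷ xs) = (x , y) ∷ consecutivePairs (y ∷ xs)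
consecutivePairs _ = []

record PathPair (n : ℕ) (μ : List ℕ) (I J : List (Fin n)) : Set where
  field
    sameLength      : length I ≡ length J
    distinctI       : Unique I
    distinctJ       : Unique J
    paths           : List (List (Fin n))          -- each path as its vertex sequence
    vertexPartition : concat paths ↭ allFin n
    pathSizes       : map length paths ↭ μ
    edgeSet         : zip I J ↭ concatMap consecutivePairs paths

Cell : Set
Cell = ℕ × ℕ

cellEqᵇ : Cell → Cell → Bool
cellEqᵇ (r , c) (r' , c') = (r ≡ᵇ r') ∧ (c ≡ᵇ c')

memᵇ : Cell → List Cell → Bool
memᵇ x xs = any (cellEqᵇ x) xs

containedᵇ : List ℕ → List ℕ → Bool
containedᵇ ν λ' = all (λ r → at ν r ≤ᵇ at λ' r) (upTo (length ν))

skewCells : List ℕ → List ℕ → List Cell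
skewCells λ' ν =
  concatMap (λ r → map (λ c → (r , c)) (filterᵇ (λ c → at ν r ≤ᵇ c) (upTo (at λ' r))))
            (upTo (length λ'))

adjacentᵇ : Cell → Cell → Bool
adjacentᵇ (r , c) (r' , c') =
  ((r ≡ᵇ r') ∧ ((suc c ≡ᵇ c') ∨ (suc c' ≡ᵇ c)))
  ∨ ((c ≡ᵇ c') ∧ ((suc r ≡ᵇ r') ∨ (suc r' ≡ᵇ r)))

grow : List Cell → List Cell → List Cell
grow X S = filterᵇ (λ x → memᵇ x S ∨ any (adjacentᵇ x) S) X

iterN : {A : Set} → ℕ → (A → A) → A → A
iterN zero f a = a
iterN (suc k) f a = f (iterN k f a)

connectedᵇ : List Cell → Bool
connectedᵇ [] = false
connectedᵇ (x ∷ xs) =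
  all (λ y → memᵇ y (iterN (length xs) (grow (x ∷ xs)) (x ∷ []))) (x ∷ xs)

no2x2ᵇ : List Cell → Bool
no2x2ᵇ X = not (any (λ rc → memᵇ (proj₁ rc , suc (proj₂ rc)) X
                          ∧ memᵇ (suc (proj₁ rc) , proj₂ rc) X
                          ∧ memᵇ (suc (proj₁ rc) , suc (proj₂ rc)) X) X)

isRibbonᵇ : List ℕ → List ℕ → Bool
isRibbonᵇ λ' ν = containedᵇ ν λ' ∧ connectedᵇ (skewCells λ' ν) ∧ no2x2ᵇ (skewCells λ' ν)

ribbonHeight : List ℕ → List ℕ → ℕ
ribbonHeight λ' ν =
  length (filterᵇ (λ r → any (λ x → r ≡ᵇ proj₁ x) (skewCells λ' ν)) (upTo (length λ'))) ∸ 1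

ribbonSign : List ℕ → List ℕ → ℤ
ribbonSign λ' ν = ℤ.-1ℤ ℤ.^ ribbonHeight λ' ν

minList : List ℕ → ℕ
minList [] = 0
minList (x ∷ xs) = foldr _⊓_ x xs

-- column of the tail (southwesternmost cell: lowest row, leftmost there)
tailColumn : List ℕ → List ℕ → ℕ
tailColumn λ' ν =
  let X = skewCells λ' ν
      b = foldr _⊔_ 0 (map proj₁ X)
  in minList (map proj₂ (filterᵇ (λ x → proj₁ x ≡ᵇ b) X))

-- A monotonic ribbon tiling ξ⁽¹⁾,…,ξ⁽ʳ⁾ is encoded by the chain of partitions
-- λ⁽ⁱ⁾ = ξ⁽¹⁾ ⊔ ⋯ ⊔ ξ⁽ⁱ⁾ (i = 1..r; λ⁽⁰⁾ = ∅), with ξ⁽ⁱ⁾ = λ⁽ⁱ⁾/λ⁽ⁱ⁻¹⁾.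
above : Maybe ℕ → ℕ → Bool
above nothing c = true
above (just c₀) c = c₀ <ᵇ c

monotonicᵇ : List ℕ → Maybe ℕ → List (List ℕ) → Bool
monotonicᵇ ν prev [] = true
monotonicᵇ ν prev (λ' ∷ rest) =
  isRibbonᵇ λ' ν ∧ above prev (tailColumn λ' ν)
  ∧ monotonicᵇ λ' (just (tailColumn λ' ν)) rest

ribbonSizes : List ℕ → List (List ℕ) → List ℕ
ribbonSizes ν [] = []
ribbonSizes ν (λ' ∷ rest) = length (skewCells λ' ν) ∷ ribbonSizes λ' rest

tilingSign : List ℕ → List (List ℕ) → ℤ
tilingSign ν [] = ℤ.1ℤ
tilingSign ν (λ' ∷ rest) = ribbonSign λ' ν ℤ.* tilingSign λ' rest

tilingShape : List (List ℕ) → List ℕ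
tilingShape [] = []
tilingShape (λ' ∷ []) = λ'
tilingShape (_ ∷ rest) = tilingShape rest

partitionsUpTo : ℕ → List (List ℕ)
partitionsUpTo n = concatMap partitions (upTo (suc n))

chains : ℕ → ℕ → List (List (List ℕ))
chains n zero = [] ∷ []
chains n (suc r) = concatMap (λ q → map (q ∷_) (chains n r)) (partitionsUpTo n)

-- all monotonic ribbon tilings whose ribbon sizes (west to east, i.e. in
-- order of tail columns) form a rearrangement of μ
tilingsFor : List ℕ → List (List (List ℕ))
tilingsFor μ =
  filterᵇ (λ T → monotonicᵇ [] nothing T ∧ bagEqᵇ (ribbonSizes [] T) μ)
          (chains (sum μ) (length μ))

pathMNRhs : List ℕ → Series
pathMNRhs μ = (ℤ.+ multFactorial μ) ·ₛ Σₛ (tilingsFor μ) (λ T → tilingSign [] T ·ₛ s (tilingShape T))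

{-# OPTIONS --safe #-}
-- Put beads at the positions λ_i + N - i. Adding a ribbon of size k moves one bead from b to b + k, its sign is the
-- sign of re-sorting the beads, and a tiling is monotonic exactly when the starting positions b increase. Hence
-- (collisions of beads cancel in pairs) the sum of sign(T) z_{sizes of T} over all tilings, as a vector in an exterior
-- power, is W v_0 ∧ … ∧ W v_{N-1}, where W = 1 / (1 - Σ z_k y^k) and y shifts positions up. Lowering the beads by a in
-- total, i.e. h_a^⊥, multiplies this vector by the coefficient w_a of y^a in W. As the coefficient of x^α in s_λ is the
-- result of applying h_{α_1}^⊥ h_{α_2}^⊥ ⋯ to s_λ, the sum of sign(T) z_{sizes} s_{shape T} has x^α-coefficient Π w_{α_j}.
--
-- Now let z_k be the sum of nilpotent variables ε_t (ε_t² = 0) over the parts μ_t = k. Taking the coefficient of Π ε_t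
-- turns the tiling sum into m(μ)! times the sum over tilings with sizes rearranging μ, and Π w_{α_j} into the number
-- of colourings of the parts, with total size α_j in colour j and a linear order on each colour class.
--
-- On the other side, the coefficient of x^α in p_{cycle type of w} counts the colourings of [n] of content α that are
-- constant on the cycles of w. A colouring that is constant on the paths is constant on the cycles of exactly
-- Π_j (number of paths of colour j)! permutations w extending the paths: the same count.
module Submission where

open import Defs
open import Data.Nat.Base
open import Data.Nat.Properties
open import Data.Bool.Base using (Bool; true; false; _∧_; _∨_; not; if_then_else_; T)
open import Data.List.Base
  using (List; []; _∷_; map; concatMap; filterᵇ; length; upTo; applyUpTo; foldr; foldl; tabulate; zip; _++_; concat; allFin; reverse; _∷ʳ_; replicate; cartesianProduct)
open import Data.Product.Base using (_×_; _,_; proj₁; proj₂; ∃)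
open import Data.Sum.Base using (_⊎_; inj₁; inj₂)
open import Data.Empty using (⊥; ⊥-elim)
open import Data.Unit.Base using (tt)
open import Data.Nat.ListAction using (sum; product)
open import Data.Bool.ListAction using (and; all; any)
open import Data.List.Properties
open import Data.List.Membership.Propositional using (_∈_; _∉_; find; lose)
open import Data.List.Relation.Unary.Any using (here; there)
open import Data.List.Relation.Unary.All as All using (All; []; _∷_)
open import Data.List.Relation.Unary.Linked as Linked using (Linked; []; [-]; _∷_)
open import Relation.Nullary using (¬_; yes; no; Dec)
open import Relation.Binary.PropositionalEquality
open import Function.Base using (_∘_; id; case_of_)
open import Algebra.Bundles using (CommutativeRing)
open import Algebra.Structures using (IsCommutativeRing)
import Algebra.Properties.Ring as RingProperties
import Algebra.Properties.CommutativeSemigroup as CommutativeSemigroupProperties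
import Data.List.Membership.Propositional.Properties as ∈ₚ
open import Level using (0ℓ)
open import Relation.Binary.Definitions using (tri<; tri≈; tri>)
open import Data.List.Relation.Binary.Pointwise using (Pointwise; []; _∷_)
open import Data.List.Relation.Binary.Permutation.Propositional as ↭ using (_↭_; ↭-sym; ↭-trans; ↭-reflexive)
import Data.List.Relation.Binary.Permutation.Propositional.Properties as ↭ₚ
import Data.List.Relation.Binary.Permutation.Setoid.Properties as SetoidPermutation
open import Data.List.Sort ≤-decTotalOrder using (sort; sort-↭; sort-↗)
import Data.Nat.ListAction.Properties as ActionProperties
open import Data.Integer.Base as ℤ using (ℤ)
import Data.Integer.Properties as ℤₚ
open import Data.Maybe.Base using (Maybe; just; nothing)
open import Data.List.Membership.DecPropositional _≟_ using (_∈?_)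
open import Data.Fin.Base as Fin using (Fin; toℕ)
import Data.Fin.Properties as Finₚ
open import Data.Vec.Base as Vec using (Vec; lookup; toList)
open import Data.List.Relation.Unary.Unique.Propositional using (Unique)
import Data.List.Relation.Unary.Unique.Propositional.Properties as Uniqueₚ
open import Data.List.Relation.Unary.AllPairs using ([]; _∷_)
open import Data.List.Relation.Binary.BagAndSetEquality using (∼bag⇒↭)
import Data.List.Relation.Unary.All.Properties as Allₚ
open import Data.List.Membership.Propositional.Properties.WithK using (unique∧set⇒bag)
open import Function.Bundles using (mk⇔)

-- Finite sums and alternating functions

-- No exterior power is constructed. A vector in it is known only through the values that
-- alternating functions of lists of positions take on it, and operators act on these functions:
-- `L M γ f` is the value of f on the wedge of the W v_b for b in γ, and `H a` is h_a^⊥. Determinant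
-- identities become identities of finite sums, and what they need of the scalars beyond a
-- commutative ring is that x = -x forces x = 0. This property passes from the integers to dual
-- numbers, hence to all ε_t together.
--
-- All sums are cut off: N beads, positions below M, partitions of size at most n. The cut-offs lose
-- nothing because the coefficient of x^α in a Schur function vanishes beyond them, provided that α
-- has total degree n; monomials of other degrees are settled separately.
--
-- The number of beads exceeds the number of variables. A shape with a non-zero coefficient then
-- leaves position 0 occupied, and this makes the Pieri rule an exact scalar multiplication: in κ₀ ∧
-- W₁ ∧ ... ∧ W_{N-1} only the first factor can end at 0, and ending there after a lowering by a
-- costs w_a.

record TorsionFreeRing : Set₁ where
  infixl 6 _⊕_
  infixl 7 _⊗_
  infix 8 ⊖_
  field
    R : Set
    _⊕_ _⊗_ : R → R → R
    ⊖_ : R → R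
    𝟘 𝟙 : R
    isCommutativeRing : IsCommutativeRing _≡_ _⊕_ _⊗_ ⊖_ 𝟘 𝟙
    -- Makes alternating functions vanish at repeated arguments and antisymmetric double sums
    -- vanish.
    2-torsionFree : ∀ x → x ≡ ⊖ x → x ≡ 𝟘
  open IsCommutativeRing isCommutativeRing public
    renaming ( +-assoc to ⊕-assoc; +-comm to ⊕-comm; +-identityˡ to ⊕-identityˡ; +-identityʳ to ⊕-identityʳ
             ; *-assoc to ⊗-assoc; *-comm to ⊗-comm; *-identityˡ to ⊗-identityˡ; *-identityʳ to ⊗-identityʳ
             ; distribˡ to ⊗-distribˡ; distribʳ to ⊗-distribʳ; zeroˡ to ⊗-zeroˡ; zeroʳ to ⊗-zeroʳ
             ; -‿inverseˡ to ⊖-inverseˡ; -‿inverseʳ to ⊖-inverseʳ)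
    using ()
  commutativeRing : CommutativeRing 0ℓ 0ℓ
  commutativeRing = record { isCommutativeRing = isCommutativeRing }
  open RingProperties (CommutativeRing.ring commutativeRing) public
    using () renaming ( -‿involutive to ⊖-involutive; -0#≈0# to ⊖-𝟘; +-cancelˡ to ⊕-cancelˡ; -‿+-comm to ⊖-⊕
                      ; -‿distribˡ-* to ⊖-⊗ˡ; -‿distribʳ-* to ⊖-⊗ʳ)
  open CommutativeSemigroupProperties (CommutativeRing.+-commutativeSemigroup commutativeRing) public
    using () renaming (interchange to ⊕-interchange; x∙yz≈y∙xz to ⊕-left-comm)
  open CommutativeSemigroupProperties (CommutativeRing.*-commutativeSemigroup commutativeRing) public
    using () renaming (x∙yz≈y∙xz to ⊗-left-comm)

≡ᵇ-refl : ∀ n → (n ≡ᵇ n) ≡ true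
≡ᵇ-refl zero = refl
≡ᵇ-refl (suc n) = ≡ᵇ-refl n

≡ᵇ-true : ∀ {m n} → (m ≡ᵇ n) ≡ true → m ≡ n
≡ᵇ-true {zero} {zero} _ = refl
≡ᵇ-true {suc m} {suc n} e = cong suc (≡ᵇ-true e)

≡ᵇ-false : ∀ {m n} → m ≢ n → (m ≡ᵇ n) ≡ false
≡ᵇ-false {m} {n} ne with m ≡ᵇ n in e
... | true = ⊥-elim (ne (≡ᵇ-true e))
... | false = refl

≤ᵇ-true : ∀ {m n} → m ≤ n → (m ≤ᵇ n) ≡ true
≤ᵇ-true {zero} _ = refl
≤ᵇ-true {suc m} {suc n} (s≤s le) with m | le
... | zero | _ = refl
... | suc m | le = ≤ᵇ-true le

≤ᵇ-true⁻ : ∀ {m n} → (m ≤ᵇ n) ≡ true → m ≤ n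
≤ᵇ-true⁻ {m} {n} e = ≤ᵇ⇒≤ m n (subst T (sym e) tt)

≤ᵇ-false : ∀ {m n} → n < m → (m ≤ᵇ n) ≡ false
≤ᵇ-false {m} {n} lt with m ≤ᵇ n in e
... | true = ⊥-elim (<⇒≱ lt (≤ᵇ-true⁻ e))
... | false = refl

≤ᵇ-false⁻ : ∀ {m n} → (m ≤ᵇ n) ≡ false → n < m
≤ᵇ-false⁻ {m} {n} e with m ≤? n
... | no q = ≰⇒> q
... | yes q with trans (sym e) (≤ᵇ-true q)
...   | ()

<ᵇ-true : ∀ {m n} → m < n → (m <ᵇ n) ≡ true
<ᵇ-true {m} {n} lt with m <ᵇ n in e
... | true = refl
... | false = ⊥-elim (subst T e (<⇒<ᵇ lt))

<ᵇ-true⁻ : ∀ {m n} → (m <ᵇ n) ≡ true → m < n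
<ᵇ-true⁻ {m} {n} e = <ᵇ⇒< m n (subst T (sym e) tt)

<ᵇ-false : ∀ {m n} → n ≤ m → (m <ᵇ n) ≡ false
<ᵇ-false {m} {n} le with m <ᵇ n in e
... | true = ⊥-elim (<⇒≱ (<ᵇ-true⁻ e) le)
... | false = refl

<ᵇ-false⁻ : ∀ {m n} → (m <ᵇ n) ≡ false → n ≤ m
<ᵇ-false⁻ {m} {n} e with m <? n
... | no q = ≮⇒≥ q
... | yes q with trans (sym e) (<ᵇ-true q)
...   | ()

∧-true : ∀ {a b} → (a ∧ b) ≡ true → a ≡ true × b ≡ true
∧-true {true} {true} _ = refl , refl

true-iff : ∀ {a b : Bool} → (a ≡ true → b ≡ true) → (b ≡ true → a ≡ true) → a ≡ b
true-iff {true} {true} f g = refl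
true-iff {true} {false} f g with f refl
... | ()
true-iff {false} {true} f g with g refl
... | ()
true-iff {false} {false} f g = refl

module Sums (𝓡 : TorsionFreeRing) where
  open TorsionFreeRing 𝓡

  infixr 5 _▷_
  -- The Iverson bracket as a factor: conditions on summands then commute with sums and products
  -- like scalars.
  _▷_ : Bool → R → R
  true ▷ x = x
  false ▷ x = 𝟘

  ▷-𝟘 : ∀ b → (b ▷ 𝟘) ≡ 𝟘
  ▷-𝟘 true = refl
  ▷-𝟘 false = refl

  ▷-∧ : ∀ a b x → ((a ∧ b) ▷ x) ≡ (a ▷ (b ▷ x))
  ▷-∧ true b x = refl
  ▷-∧ false b x = refl

  ▷-comm : ∀ a b x → (a ▷ (b ▷ x)) ≡ (b ▷ (a ▷ x))
  ▷-comm true b x = refl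
  ▷-comm false true x = refl
  ▷-comm false false x = refl

  ▷-⊗ʳ : ∀ b x y → (b ▷ (x ⊗ y)) ≡ x ⊗ (b ▷ y)
  ▷-⊗ʳ true x y = refl
  ▷-⊗ʳ false x y = sym (⊗-zeroʳ x)

  ▷-⊗ˡ : ∀ b x y → (b ▷ (x ⊗ y)) ≡ (b ▷ x) ⊗ y
  ▷-⊗ˡ true x y = refl
  ▷-⊗ˡ false x y = sym (⊗-zeroˡ y)

  ▷-⊕ : ∀ b x y → (b ▷ (x ⊕ y)) ≡ (b ▷ x) ⊕ (b ▷ y)
  ▷-⊕ true x y = refl
  ▷-⊕ false x y = sym (⊕-identityˡ 𝟘)

  ▷-⊖ : ∀ b x → (b ▷ (⊖ x)) ≡ ⊖ (b ▷ x)
  ▷-⊖ true x = refl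
  ▷-⊖ false x = sym ⊖-𝟘

  ▷-cong : ∀ b {x y} → (b ≡ true → x ≡ y) → (b ▷ x) ≡ (b ▷ y)
  ▷-cong true e = e refl
  ▷-cong false e = refl

  ▷-true : ∀ {b x} → b ≡ true → (b ▷ x) ≡ x
  ▷-true refl = refl

  ▷-false : ∀ {b x} → b ≡ false → (b ▷ x) ≡ 𝟘
  ▷-false refl = refl

  ▷-zero : ∀ b {x} → (b ≡ true → x ≡ 𝟘) → (b ▷ x) ≡ 𝟘
  ▷-zero true e = e refl
  ▷-zero false e = refl

  ⊗-zeroʳ′ : ∀ x {y} → y ≡ 𝟘 → x ⊗ y ≡ 𝟘
  ⊗-zeroʳ′ x refl = ⊗-zeroʳ x

  ⊗-zeroˡ′ : ∀ {x} y → x ≡ 𝟘 → x ⊗ y ≡ 𝟘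
  ⊗-zeroˡ′ y refl = ⊗-zeroˡ y

  ⊕-identityʳ′ : ∀ x {y} → y ≡ 𝟘 → x ⊕ y ≡ x
  ⊕-identityʳ′ x refl = ⊕-identityʳ x

  ⊕-identityˡ′ : ∀ {x} y → x ≡ 𝟘 → x ⊕ y ≡ y
  ⊕-identityˡ′ y refl = ⊕-identityˡ y

  private variable A B : Set

  ∑L : List A → (A → R) → R
  ∑L [] f = 𝟘
  ∑L (x ∷ xs) f = f x ⊕ ∑L xs f

  ∑L-cong∈ : ∀ (xs : List A) {f g : A → R} → (∀ x → x ∈ xs → f x ≡ g x) → ∑L xs f ≡ ∑L xs g
  ∑L-cong∈ [] e = refl
  ∑L-cong∈ (x ∷ xs) e = cong₂ _⊕_ (e x (here refl)) (∑L-cong∈ xs (λ y m → e y (there m)))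

  ∑L-cong : ∀ (xs : List A) {f g : A → R} → (∀ x → f x ≡ g x) → ∑L xs f ≡ ∑L xs g
  ∑L-cong xs e = ∑L-cong∈ xs (λ x _ → e x)

  ∑L-zero : ∀ (xs : List A) → ∑L xs (λ _ → 𝟘) ≡ 𝟘
  ∑L-zero [] = refl
  ∑L-zero (x ∷ xs) = trans (⊕-identityˡ _) (∑L-zero xs)

  ∑L-zero∈ : ∀ (xs : List A) {f : A → R} → (∀ x → x ∈ xs → f x ≡ 𝟘) → ∑L xs f ≡ 𝟘
  ∑L-zero∈ xs e = trans (∑L-cong∈ xs e) (∑L-zero xs)

  ∑L-⊕ : ∀ (xs : List A) (f g : A → R) → ∑L xs (λ x → f x ⊕ g x) ≡ ∑L xs f ⊕ ∑L xs g
  ∑L-⊕ [] f g = sym (⊕-identityˡ 𝟘)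
  ∑L-⊕ (x ∷ xs) f g = trans (cong (_ ⊕_) (∑L-⊕ xs f g)) (⊕-interchange _ _ _ _)

  ∑L-⊗ˡ : ∀ (xs : List A) c (f : A → R) → ∑L xs (λ x → c ⊗ f x) ≡ c ⊗ ∑L xs f
  ∑L-⊗ˡ [] c f = sym (⊗-zeroʳ c)
  ∑L-⊗ˡ (x ∷ xs) c f = trans (cong (_ ⊕_) (∑L-⊗ˡ xs c f)) (sym (⊗-distribˡ c _ _))

  ∑L-⊗ʳ : ∀ (xs : List A) c (f : A → R) → ∑L xs (λ x → f x ⊗ c) ≡ ∑L xs f ⊗ c
  ∑L-⊗ʳ xs c f = trans (∑L-cong xs (λ x → ⊗-comm _ c)) (trans (∑L-⊗ˡ xs c f) (⊗-comm c _))

  ∑L-⊖ : ∀ (xs : List A) (f : A → R) → ∑L xs (λ x → ⊖ f x) ≡ ⊖ ∑L xs f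
  ∑L-⊖ [] f = sym ⊖-𝟘
  ∑L-⊖ (x ∷ xs) f = trans (cong (_ ⊕_) (∑L-⊖ xs f)) (⊖-⊕ _ _)

  ∑L-▷ : ∀ (xs : List A) b (f : A → R) → ∑L xs (λ x → b ▷ f x) ≡ (b ▷ ∑L xs f)
  ∑L-▷ xs true f = refl
  ∑L-▷ xs false f = ∑L-zero xs

  ∑L-swap : ∀ (xs : List A) (ys : List B) (f : A → B → R) →
    ∑L xs (λ x → ∑L ys (f x)) ≡ ∑L ys (λ y → ∑L xs (λ x → f x y))
  ∑L-swap [] ys f = sym (∑L-zero ys)
  ∑L-swap (x ∷ xs) ys f = trans (cong (_ ⊕_) (∑L-swap xs ys f)) (sym (∑L-⊕ ys _ _))

  ∑L-++ : ∀ (xs ys : List A) (f : A → R) → ∑L (xs ++ ys) f ≡ ∑L xs f ⊕ ∑L ys f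
  ∑L-++ [] ys f = sym (⊕-identityˡ _)
  ∑L-++ (x ∷ xs) ys f = trans (cong (_ ⊕_) (∑L-++ xs ys f)) (sym (⊕-assoc _ _ _))

  ∑L-map : ∀ (h : A → B) (xs : List A) (f : B → R) → ∑L (map h xs) f ≡ ∑L xs (f ∘ h)
  ∑L-map h [] f = refl
  ∑L-map h (x ∷ xs) f = cong (_ ⊕_) (∑L-map h xs f)

  ∑L-concatMap : ∀ (h : A → List B) (xs : List A) (f : B → R) →
    ∑L (concatMap h xs) f ≡ ∑L xs (λ x → ∑L (h x) f)
  ∑L-concatMap h [] f = refl
  ∑L-concatMap h (x ∷ xs) f =
    trans (∑L-++ (h x) (concatMap h xs) f) (cong (_ ⊕_) (∑L-concatMap h xs f))

  ∑L-filter : ∀ (p : A → Bool) (xs : List A) (f : A → R) → ∑L (filterᵇ p xs) f ≡ ∑L xs (λ x → p x ▷ f x)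
  ∑L-filter p [] f = refl
  ∑L-filter p (x ∷ xs) f with p x
  ... | true = cong (_ ⊕_) (∑L-filter p xs f)
  ... | false = trans (∑L-filter p xs f) (sym (⊕-identityˡ _))

  ∑ : ℕ → (ℕ → R) → R
  ∑ n f = ∑L (upTo n) f

  ∑L-applyUpTo : ∀ (g : ℕ → A) n (f : A → R) → ∑L (applyUpTo g n) f ≡ ∑ n (f ∘ g)
  ∑L-applyUpTo g n f = trans (cong (λ l → ∑L l f) (sym (map-upTo g n))) (∑L-map g (upTo n) f)

  ∑-suc : ∀ n f → ∑ (suc n) f ≡ f 0 ⊕ ∑ n (f ∘ suc)
  ∑-suc n f = cong (f 0 ⊕_) (∑L-applyUpTo suc n f)

  ∑-last : ∀ n f → ∑ (suc n) f ≡ ∑ n f ⊕ f n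
  ∑-last n f = trans (cong (λ l → ∑L l f) (sym (upTo-∷ʳ n)))
    (trans (∑L-++ (upTo n) (n ∷ []) f) (cong (∑ n f ⊕_) (⊕-identityʳ _)))

  ∑-cong< : ∀ n {f g : ℕ → R} → (∀ i → i < n → f i ≡ g i) → ∑ n f ≡ ∑ n g
  ∑-cong< n e = ∑L-cong∈ (upTo n) (λ x m → e x (∈ₚ.∈-upTo⁻ m))

  ∑-zero< : ∀ n {f : ℕ → R} → (∀ i → i < n → f i ≡ 𝟘) → ∑ n f ≡ 𝟘
  ∑-zero< n e = trans (∑-cong< n e) (∑L-zero (upTo n))

  ∑-+ : ∀ m n f → ∑ (m + n) f ≡ ∑ m f ⊕ ∑ n (λ i → f (m + i))
  ∑-+ zero n f = sym (⊕-identityˡ _)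
  ∑-+ (suc m) n f = begin
    ∑ (suc (m + n)) f                                  ≡⟨ ∑-suc (m + n) f ⟩
    f 0 ⊕ ∑ (m + n) (f ∘ suc)                          ≡⟨ cong (_ ⊕_) (∑-+ m n (f ∘ suc)) ⟩
    f 0 ⊕ (∑ m (f ∘ suc) ⊕ ∑ n (λ i → f (suc m + i))) ≡⟨ sym (⊕-assoc _ _ _) ⟩
    (f 0 ⊕ ∑ m (f ∘ suc)) ⊕ ∑ n (λ i → f (suc m + i)) ≡⟨ cong (_⊕ ∑ n (λ i → f (suc m + i))) (sym (∑-suc m f)) ⟩
    ∑ (suc m) f ⊕ ∑ n (λ i → f (suc m + i)) ∎
    where open ≡-Reasoning

  ∑-trunc : ∀ {m n} f → m ≤ n → (∀ i → m ≤ i → f i ≡ 𝟘) → ∑ n f ≡ ∑ m f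
  ∑-trunc {m} {n} f le e = begin
    ∑ n f                                   ≡⟨ cong (λ k → ∑ k f) (sym (m+[n∸m]≡n le)) ⟩
    ∑ (m + (n ∸ m)) f                       ≡⟨ ∑-+ m (n ∸ m) f ⟩
    ∑ m f ⊕ ∑ (n ∸ m) (λ i → f (m + i))     ≡⟨ cong (_ ⊕_) (∑-zero< (n ∸ m) (λ i _ → e (m + i) (m≤m+n m i))) ⟩
    ∑ m f ⊕ 𝟘                               ≡⟨ ⊕-identityʳ _ ⟩
    ∑ m f ∎
    where open ≡-Reasoning

  ∑-δ : ∀ n x (φ : ℕ → R) → x < n → ∑ n (λ y → (y ≡ᵇ x) ▷ φ y) ≡ φ x
  ∑-δ (suc n) zero φ _ = trans (∑-suc n _) (trans (cong (_ ⊕_) (∑-zero< n (λ _ _ → refl))) (⊕-identityʳ _))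
  ∑-δ (suc n) (suc x) φ (s≤s lt) = trans (∑-suc n _) (trans (⊕-identityˡ _) (∑-δ n x (φ ∘ suc) lt))

  -- Exchanging the two summations shows that the sum is its own negative. All cancellations of bead
  -- collisions are reduced to this lemma or to `alternating-same` and `⟪⟫-same`.
  ∑L-antisym : ∀ (xs : List A) (f : A → A → R) → (∀ x y → f x y ≡ ⊖ f y x) → ∑L xs (λ x → ∑L xs (f x)) ≡ 𝟘
  ∑L-antisym xs f e = 2-torsionFree _ (begin
    ∑L xs (λ x → ∑L xs (f x))           ≡⟨ ∑L-cong xs (λ x → ∑L-cong xs (e x)) ⟩
    ∑L xs (λ x → ∑L xs (λ y → ⊖ f y x)) ≡⟨ ∑L-cong xs (λ x → ∑L-⊖ xs _) ⟩
    ∑L xs (λ x → ⊖ ∑L xs (λ y → f y x)) ≡⟨ ∑L-⊖ xs _ ⟩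
    ⊖ ∑L xs (λ x → ∑L xs (λ y → f y x)) ≡⟨ cong ⊖_ (∑L-swap xs xs _) ⟩
    ⊖ ∑L xs (λ x → ∑L xs (f x)) ∎)
    where open ≡-Reasoning

  -- Adjacent transpositions generate all permutations. The arbitrary prefix lets the property
  -- descend to `f ∘ (z ∷_)`, on which the inductions over lists run.
  Alternating : (List A → R) → Set
  Alternating {A} f = ∀ (p : List A) x y t → f (p ++ x ∷ y ∷ t) ≡ ⊖ f (p ++ y ∷ x ∷ t)

  alternating-∷ : ∀ (f : List A → R) → Alternating f → ∀ z → Alternating (f ∘ (z ∷_))
  alternating-∷ f alt z p x y t = alt (z ∷ p) x y t

  alternating-same : ∀ (f : List A → R) → Alternating f → ∀ p x t → f (p ++ x ∷ x ∷ t) ≡ 𝟘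
  alternating-same f alt p x t = 2-torsionFree (f (p ++ x ∷ x ∷ t)) (alt p x x t)

  -- The value of an alternating f on k₁ ∧ … ∧ k_N, each kᵢ being a formal combination of the points of P.
  ⟪_⟫ : List A → List (A → R) → (List A → R) → R
  ⟪ P ⟫ [] f = f []
  ⟪ P ⟫ (k ∷ ks) f = ∑L P (λ p → k p ⊗ ⟪ P ⟫ ks (f ∘ (p ∷_)))

  ⟪⟫-cong : ∀ (P : List A) ks {f g : List A → R} → (∀ t → f t ≡ g t) → ⟪ P ⟫ ks f ≡ ⟪ P ⟫ ks g
  ⟪⟫-cong P [] e = e []
  ⟪⟫-cong P (k ∷ ks) e = ∑L-cong P (λ p → cong (k p ⊗_) (⟪⟫-cong P ks (e ∘ (p ∷_))))

  ⟪⟫-zero : ∀ (P : List A) ks {f : List A → R} → (∀ t → f t ≡ 𝟘) → ⟪ P ⟫ ks f ≡ 𝟘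
  ⟪⟫-zero P [] e = e []
  ⟪⟫-zero P (k ∷ ks) e =
    trans (∑L-cong P (λ p → trans (cong (k p ⊗_) (⟪⟫-zero P ks (e ∘ (p ∷_)))) (⊗-zeroʳ _))) (∑L-zero P)

  ⟪⟫-⊖ : ∀ (P : List A) ks (f : List A → R) → ⟪ P ⟫ ks (λ t → ⊖ f t) ≡ ⊖ ⟪ P ⟫ ks f
  ⟪⟫-⊖ P [] f = refl
  ⟪⟫-⊖ P (k ∷ ks) f =
    trans (∑L-cong P (λ p → trans (cong (k p ⊗_) (⟪⟫-⊖ P ks (f ∘ (p ∷_)))) (sym (⊖-⊗ʳ _ _)))) (∑L-⊖ P _)

  ⟪⟫-∑L : ∀ (P : List A) ks (xs : List B) (f : B → List A → R) →
    ⟪ P ⟫ ks (λ t → ∑L xs (λ x → f x t)) ≡ ∑L xs (λ x → ⟪ P ⟫ ks (f x))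
  ⟪⟫-∑L P [] xs f = refl
  ⟪⟫-∑L P (k ∷ ks) xs f =
    trans (∑L-cong P (λ p → trans (cong (k p ⊗_) (⟪⟫-∑L P ks xs (λ x → f x ∘ (p ∷_)))) (sym (∑L-⊗ˡ xs (k p) _))))
          (∑L-swap P xs _)

  ⟪⟫-swap : ∀ (P : List A) k k' ks (f : List A → R) → Alternating f →
    ⟪ P ⟫ (k ∷ k' ∷ ks) f ≡ ⊖ ⟪ P ⟫ (k' ∷ k ∷ ks) f
  ⟪⟫-swap P k k' ks f alt = begin
    ∑L P (λ p → k p ⊗ ∑L P (λ q → k' q ⊗ F p q))
      ≡⟨ ∑L-cong P (λ p → sym (∑L-⊗ˡ P (k p) _)) ⟩
    ∑L P (λ p → ∑L P (λ q → k p ⊗ (k' q ⊗ F p q)))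
      ≡⟨ ∑L-cong P (λ p → ∑L-cong P (λ q → trans (⊗-left-comm _ _ _) (cong (λ u → k' q ⊗ (k p ⊗ u)) (anti p q)))) ⟩
    ∑L P (λ p → ∑L P (λ q → k' q ⊗ (k p ⊗ (⊖ F q p))))
      ≡⟨ ∑L-cong P (λ p → ∑L-cong P (λ q → trans (cong (k' q ⊗_) (sym (⊖-⊗ʳ _ _))) (sym (⊖-⊗ʳ _ _)))) ⟩
    ∑L P (λ p → ∑L P (λ q → ⊖ (k' q ⊗ (k p ⊗ F q p))))
      ≡⟨ ∑L-swap P P _ ⟩
    ∑L P (λ q → ∑L P (λ p → ⊖ (k' q ⊗ (k p ⊗ F q p))))
      ≡⟨ ∑L-cong P (λ q → trans (∑L-⊖ P _) (cong ⊖_ (∑L-⊗ˡ P (k' q) _))) ⟩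
    ∑L P (λ q → ⊖ (k' q ⊗ ∑L P (λ p → k p ⊗ F q p)))
      ≡⟨ ∑L-⊖ P _ ⟩
    ⊖ ⟪ P ⟫ (k' ∷ k ∷ ks) f ∎
    where
    open ≡-Reasoning
    F = λ p q → ⟪ P ⟫ ks (λ t → f (p ∷ q ∷ t))
    anti : ∀ p q → F p q ≡ ⊖ F q p
    anti p q = trans (⟪⟫-cong P ks (λ t → alt [] p q t)) (⟪⟫-⊖ P ks _)

  ⟪⟫-same : ∀ (P : List A) k ks (f : List A → R) → Alternating f → ⟪ P ⟫ (k ∷ k ∷ ks) f ≡ 𝟘
  ⟪⟫-same P k ks f alt = 2-torsionFree _ (⟪⟫-swap P k k ks f alt)

  ⟪⟫-kernel : ∀ (P : List A) {k k' : A → R} ks f → (∀ p → p ∈ P → k p ≡ k' p) → ⟪ P ⟫ (k ∷ ks) f ≡ ⟪ P ⟫ (k' ∷ ks) f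
  ⟪⟫-kernel P ks f e = ∑L-cong∈ P (λ p m → cong (_⊗ _) (e p m))

  ⟪⟫-kernel-⊕ : ∀ (P : List A) k k' ks f →
    ⟪ P ⟫ ((λ p → k p ⊕ k' p) ∷ ks) f ≡ ⟪ P ⟫ (k ∷ ks) f ⊕ ⟪ P ⟫ (k' ∷ ks) f
  ⟪⟫-kernel-⊕ P k k' ks f = trans (∑L-cong P (λ p → ⊗-distribʳ _ _ _)) (∑L-⊕ P _ _)

  ∑L-cartesianProduct : ∀ (xs : List A) (ys : List B) (f : A × B → R) →
    ∑L (cartesianProduct xs ys) f ≡ ∑L xs (λ x → ∑L ys (λ y → f (x , y)))
  ∑L-cartesianProduct [] ys f = refl
  ∑L-cartesianProduct (x ∷ xs) ys f =
    trans (∑L-++ (map (x ,_) ys) _ f) (cong₂ _⊕_ (∑L-map (x ,_) ys f) (∑L-cartesianProduct xs ys f))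

  ∑-≤ᵇ : ∀ {n t} → t < n → ∀ (f : ℕ → R) → ∑ n (λ y → (y ≤ᵇ t) ▷ f y) ≡ ∑ (suc t) f
  ∑-≤ᵇ {n} {t} lt f =
    trans (∑-trunc (λ y → (y ≤ᵇ t) ▷ f y) lt (λ i t<i → ▷-false (≤ᵇ-false t<i))) (∑-cong< (suc t) (λ { i (s≤s le) → ▷-true (≤ᵇ-true le) }))

  ∑-≥ᵇ : ∀ {n t} → t ≤ n → ∀ (f : ℕ → R) → ∑ n (λ y → (t ≤ᵇ y) ▷ f y) ≡ ∑ (n ∸ t) (λ d → f (t + d))
  ∑-≥ᵇ {n} {t} le f = begin
    ∑ n g                                             ≡⟨ cong (λ k → ∑ k g) (sym (m+[n∸m]≡n le)) ⟩
    ∑ (t + (n ∸ t)) g                                 ≡⟨ ∑-+ t (n ∸ t) g ⟩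
    ∑ t g ⊕ ∑ (n ∸ t) (λ d → g (t + d))               ≡⟨ cong₂ _⊕_ (∑-zero< t (λ i lt → ▷-false (≤ᵇ-false lt)))
                                                          (∑L-cong (upTo (n ∸ t)) (λ d → ▷-true (≤ᵇ-true (m≤m+n t d)))) ⟩
    𝟘 ⊕ ∑ (n ∸ t) (λ d → f (t + d))                   ≡⟨ ⊕-identityˡ _ ⟩
    ∑ (n ∸ t) (λ d → f (t + d)) ∎
    where
    open ≡-Reasoning
    g : ℕ → R
    g y = (t ≤ᵇ y) ▷ f y

-- Chains of bead moves

ins : ℕ → List ℕ → List ℕ
ins b [] = b ∷ []
ins b (x ∷ xs) = if b <ᵇ x then b ∷ x ∷ xs else x ∷ ins b xs

ins-sum : ∀ b xs → sum (ins b xs) ≡ b + sum xs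
ins-sum b [] = refl
ins-sum b (x ∷ xs) with b <ᵇ x
... | true = refl
... | false = begin
  x + sum (ins b xs) ≡⟨ cong (x +_) (ins-sum b xs) ⟩
  x + (b + sum xs)   ≡⟨ sym (+-assoc x b _) ⟩
  x + b + sum xs     ≡⟨ cong (_+ sum xs) (+-comm x b) ⟩
  b + x + sum xs     ≡⟨ +-assoc b x _ ⟩
  b + (x + sum xs) ∎
  where open ≡-Reasoning

ins-length : ∀ b xs → length (ins b xs) ≡ suc (length xs)
ins-length b [] = refl
ins-length b (x ∷ xs) with b <ᵇ x
... | true = refl
... | false = cong suc (ins-length b xs)

ins-All : ∀ {P : ℕ → Set} b xs → P b → All P xs → All P (ins b xs)
ins-All b [] pb [] = pb ∷ []
ins-All b (x ∷ xs) pb (px ∷ pxs) with b <ᵇ x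
... | true = pb ∷ px ∷ pxs
... | false = px ∷ ins-All b xs pb pxs

-- The total distance of the beads from M. Every move lowers it, so it bounds the number of moves.
deficit : ℕ → List ℕ → ℕ
deficit M [] = 0
deficit M (b ∷ γ) = (M ∸ b) + deficit M γ

deficit-ins : ∀ M b xs → deficit M (ins b xs) ≡ (M ∸ b) + deficit M xs
deficit-ins M b [] = refl
deficit-ins M b (x ∷ xs) with b <ᵇ x
... | true = refl
... | false = begin
  (M ∸ x) + deficit M (ins b xs)         ≡⟨ cong ((M ∸ x) +_) (deficit-ins M b xs) ⟩
  (M ∸ x) + ((M ∸ b) + deficit M xs)     ≡⟨ sym (+-assoc (M ∸ x) _ _) ⟩
  ((M ∸ x) + (M ∸ b)) + deficit M xs     ≡⟨ cong (_+ deficit M xs) (+-comm (M ∸ x) _) ⟩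
  ((M ∸ b) + (M ∸ x)) + deficit M xs     ≡⟨ +-assoc (M ∸ b) _ _ ⟩
  (M ∸ b) + ((M ∸ x) + deficit M xs) ∎
  where open ≡-Reasoning

module Signs (𝓡 : TorsionFreeRing) where
  open TorsionFreeRing 𝓡
  open Sums 𝓡

  -- The factor relating the values of an alternating function at `b ∷ xs` and at `ins b xs`: a sign
  -- for each bead passed, and 0 on a collision.
  insSign : ℕ → List ℕ → R
  insSign b [] = 𝟙
  insSign b (x ∷ xs) = if b <ᵇ x then 𝟙 else (if b ≡ᵇ x then 𝟘 else (⊖ insSign b xs))

-- W = 1 / (1 - Σ z_k y^k), acting on the vector space spanned by the positions 0, 1, 2, …
record GeometricSeries (𝓡 : TorsionFreeRing) : Set where
  open TorsionFreeRing 𝓡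
  open Sums 𝓡
  field
    z w : ℕ → R
    w-zero : w 0 ≡ 𝟙
    w-suc : ∀ m → w (suc m) ≡ ∑ (suc m) (λ k → z (suc k) ⊗ w (m ∸ k))

module Chains (𝓡 : TorsionFreeRing) (𝓦 : GeometricSeries 𝓡) where
  open TorsionFreeRing 𝓡
  open Sums 𝓡
  open Signs 𝓡
  open GeometricSeries 𝓦

  W : ℕ → ℕ → R
  W x y = (x ≤ᵇ y) ▷ w (y ∸ x)

  W-below : ∀ x y → y < x → W x y ≡ 𝟘
  W-below x y lt rewrite ≤ᵇ-false lt = refl

  W-+ : ∀ x d → W x (x + d) ≡ w d
  W-+ x d rewrite ≤ᵇ-true (m≤m+n x d) | m+n∸m≡n x d = refl

  W-same : ∀ x → W x x ≡ 𝟙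
  W-same x rewrite ≤ᵇ-true (≤-refl {x}) | n∸n≡0 x = w-zero

  W-shift : ∀ x y → W (suc x) (suc y) ≡ W x y
  W-shift zero y = refl
  W-shift (suc x) y = refl

  -- The equation W = 1 + (Σ z_k y^k) W, read at one matrix entry.
  W-step : ∀ {M} b y → y < M →
    W b y ≡ ((y ≡ᵇ b) ▷ 𝟙) ⊕ ∑ M (λ b' → (b <ᵇ b') ▷ (z (b' ∸ b) ⊗ W b' y))
  W-step {M} b y y<M with <-cmp y b
  ... | tri< y<b y≢b _ rewrite ≡ᵇ-false y≢b = trans (W-below b y y<b) (sym (trans (⊕-identityˡ _) (∑-zero< M zeros)))
    where
    zeros : ∀ b' → b' < M → ((b <ᵇ b') ▷ (z (b' ∸ b) ⊗ W b' y)) ≡ 𝟘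
    zeros b' _ = ▷-zero (b <ᵇ b') λ e → ⊗-zeroʳ′ _ (W-below b' y (<-trans y<b (<ᵇ-true⁻ {b} {b'} e)))
  ... | tri≈ _ refl _ rewrite ≡ᵇ-refl y = trans (W-same y) (sym (trans (cong (𝟙 ⊕_) (∑-zero< M zeros)) (⊕-identityʳ 𝟙)))
    where
    zeros : ∀ b' → b' < M → ((y <ᵇ b') ▷ (z (b' ∸ y) ⊗ W b' y)) ≡ 𝟘
    zeros b' _ = ▷-zero (y <ᵇ b') λ e → ⊗-zeroʳ′ _ (W-below b' y (<ᵇ-true⁻ {y} {b'} e))
  ... | tri> _ y≢b b<y with m , refl ← m≤n⇒∃[o]m+o≡n b<y rewrite ≡ᵇ-false y≢b = begin
    W b (suc (b + m))                  ≡⟨ cong (W b) (sym (+-suc b m)) ⟩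
    W b (b + suc m)                    ≡⟨ W-+ b (suc m) ⟩
    w (suc m)                          ≡⟨ w-suc m ⟩
    ∑ (suc m) (λ k → z (suc k) ⊗ w (m ∸ k)) ≡⟨ ∑-cong< (suc m) middle ⟩
    ∑ (suc m) (λ k → F (suc b + k))    ≡⟨ sym (⊕-identityˡ _) ⟩
    𝟘 ⊕ ∑ (suc m) (λ k → F (suc b + k)) ≡⟨ cong (_⊕ ∑ (suc m) (λ k → F (suc b + k))) (sym (∑-zero< (suc b) low)) ⟩
    ∑ (suc b) F ⊕ ∑ (suc m) (λ k → F (suc b + k)) ≡⟨ sym (∑-+ (suc b) (suc m) F) ⟩
    ∑ (suc b + suc m) F                ≡⟨ sym (∑-trunc F bound high) ⟩
    ∑ M F                              ≡⟨ sym (⊕-identityˡ _) ⟩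
    𝟘 ⊕ ∑ M F ∎
    where
    open ≡-Reasoning
    -- The targets b' fall into three ranges: up to b the guard fails, from b + 1 to b + m + 1 they
    -- give the recursion of `w`, and beyond that `W b'` vanishes at the end position.
    F : ℕ → R
    F b' = (b <ᵇ b') ▷ (z (b' ∸ b) ⊗ W b' (suc (b + m)))
    bound : suc b + suc m ≤ M
    bound = subst (_≤ M) (cong suc (sym (+-suc b m))) y<M
    low : ∀ i → i < suc b → F i ≡ 𝟘
    low i (s≤s le) rewrite <ᵇ-false le = refl
    high : ∀ i → suc b + suc m ≤ i → F i ≡ 𝟘
    high i le = ▷-zero (b <ᵇ i) (λ _ → ⊗-zeroʳ′ _ (W-below i _ (subst (_≤ i) (cong suc (+-suc b m)) le)))
    middle : ∀ k → k < suc m → z (suc k) ⊗ w (m ∸ k) ≡ F (suc b + k)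
    middle k (s≤s k≤m) = sym (trans (▷-true (<ᵇ-true (s≤s (m≤m+n b k)))) (cong₂ _⊗_
      (cong z (trans (cong (_∸ b) (sym (+-suc b k))) (m+n∸m≡n b (suc k))))
      (trans (cong (W (suc b + k)) (cong suc (trans (cong (b +_) (sym (m+[n∸m]≡n k≤m))) (sym (+-assoc b k (m ∸ k))))))
             (W-+ (suc b + k) (m ∸ k)))))

  -- The value of f on the wedge product of the vectors W v_b for b in γ, positions cut off at M.
  L : ℕ → List ℕ → (List ℕ → R) → R
  L M γ f = ⟪ upTo M ⟫ (map W γ) f

  -- Replace the first factor by W v_b = v_b + Σ z_{b'-b} W v_{b'}: the bead b either stays where it
  -- is or makes a first move to b'.
  L-step : ∀ {M} b r f → b < M →
    L M (b ∷ r) f ≡ L M r (f ∘ (b ∷_)) ⊕ ∑ M (λ b' → (b <ᵇ b') ▷ (z (b' ∸ b) ⊗ L M (b' ∷ r) f))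
  L-step {M} b r f b<M = begin
    ∑ M (λ y → W b y ⊗ X y)
      ≡⟨ ∑-cong< M (λ y lt → trans (cong (_⊗ X y) (W-step b y lt)) (⊗-distribʳ (X y) _ _)) ⟩
    ∑ M (λ y → ((y ≡ᵇ b) ▷ 𝟙) ⊗ X y ⊕ ∑ M (λ b' → (b <ᵇ b') ▷ (z (b' ∸ b) ⊗ W b' y)) ⊗ X y)
      ≡⟨ ∑L-⊕ (upTo M) _ _ ⟩
    ∑ M (λ y → ((y ≡ᵇ b) ▷ 𝟙) ⊗ X y) ⊕ ∑ M (λ y → ∑ M (λ b' → (b <ᵇ b') ▷ (z (b' ∸ b) ⊗ W b' y)) ⊗ X y)
      ≡⟨ cong₂ _⊕_
           (trans (∑L-cong (upTo M) (λ y → trans (sym (▷-⊗ˡ (y ≡ᵇ b) 𝟙 (X y))) (cong ((y ≡ᵇ b) ▷_) (⊗-identityˡ _)))) (∑-δ M b X b<M))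
           (trans (∑L-cong (upTo M) (λ y → sym (∑L-⊗ʳ (upTo M) (X y) _))) (∑L-swap (upTo M) (upTo M) _)) ⟩
    X b ⊕ ∑ M (λ b' → ∑ M (λ y → ((b <ᵇ b') ▷ (z (b' ∸ b) ⊗ W b' y)) ⊗ X y))
      ≡⟨ cong (X b ⊕_) (∑L-cong (upTo M) λ b' → trans (∑L-cong (upTo M) (λ y →
           trans (sym (▷-⊗ˡ (b <ᵇ b') _ (X y))) (cong ((b <ᵇ b') ▷_) (⊗-assoc _ _ _))))
           (trans (∑L-▷ (upTo M) (b <ᵇ b') _) (cong ((b <ᵇ b') ▷_) (∑L-⊗ˡ (upTo M) _ _)))) ⟩
    X b ⊕ ∑ M (λ b' → (b <ᵇ b') ▷ (z (b' ∸ b) ⊗ L M (b' ∷ r) f)) ∎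
    where
    open ≡-Reasoning
    X : ℕ → R
    X y = L M r (f ∘ (y ∷_))

  L-ins : ∀ M b r f → Alternating f → L M (b ∷ r) f ≡ insSign b r ⊗ L M (ins b r) f
  L-ins M b [] f alt = sym (⊗-identityˡ _)
  L-ins M b (x ∷ r) f alt with b <ᵇ x | b ≡ᵇ x in eq
  ... | true | _ = sym (⊗-identityˡ _)
  ... | false | true with refl ← ≡ᵇ-true {b} {x} eq =
    trans (⟪⟫-same (upTo M) (W b) (map W r) f alt) (sym (⊗-zeroˡ _))
  ... | false | false = begin
    L M (b ∷ x ∷ r) f
      ≡⟨ ⟪⟫-swap (upTo M) (W b) (W x) (map W r) f alt ⟩
    ⊖ ∑ M (λ y → W x y ⊗ L M (b ∷ r) (f ∘ (y ∷_)))
      ≡⟨ cong ⊖_ (∑L-cong (upTo M) (λ y →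
           trans (cong (W x y ⊗_) (L-ins M b r (f ∘ (y ∷_)) (alternating-∷ f alt y))) (⊗-left-comm _ _ _))) ⟩
    ⊖ ∑ M (λ y → insSign b r ⊗ (W x y ⊗ L M (ins b r) (f ∘ (y ∷_))))
      ≡⟨ cong ⊖_ (∑L-⊗ˡ (upTo M) _ _) ⟩
    ⊖ (insSign b r ⊗ L M (x ∷ ins b r) f)
      ≡⟨ ⊖-⊗ˡ _ _ ⟩
    (⊖ insSign b r) ⊗ L M (x ∷ ins b r) f ∎
    where open ≡-Reasoning

  -- Signed sum over all ways of moving beads s times, the starting positions of the moves
  -- strictly increasing: the lowest bead either stays forever or moves next.
  Y : ℕ → ℕ → List ℕ → (List ℕ → R) → R
  Y M zero γ f = f γ
  Y M (suc s) [] f = 𝟘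
  Y M (suc s) (b ∷ r) f = Y M (suc s) r (f ∘ (b ∷_)) ⊕
    ∑ M (λ b' → (b <ᵇ b') ▷ (insSign b' r ⊗ (z (b' ∸ b) ⊗ Y M s (ins b' r) f)))

  Y-cong : ∀ M s γ {f g : List ℕ → R} → (∀ t → f t ≡ g t) → Y M s γ f ≡ Y M s γ g
  Y-cong M zero γ e = e γ
  Y-cong M (suc s) [] e = refl
  Y-cong M (suc s) (b ∷ r) e = cong₂ _⊕_ (Y-cong M (suc s) r (e ∘ (b ∷_))) (∑L-cong (upTo M) (λ b' →
    cong (λ v → (b <ᵇ b') ▷ (insSign b' r ⊗ (z (b' ∸ b) ⊗ v))) (Y-cong M s (ins b' r) e)))

  -- Moves preserve the number of beads and only increase the sum of their positions, so f is
  -- evaluated at no other lists.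
  Y-zero : ∀ M s γ f → (∀ t → length t ≡ length γ → sum γ ≤ sum t → f t ≡ 𝟘) → Y M s γ f ≡ 𝟘
  Y-zero M zero γ f e = e γ refl ≤-refl
  Y-zero M (suc s) [] f e = refl
  Y-zero M (suc s) (b ∷ r) f e =
    trans (cong₂ _⊕_ (Y-zero M (suc s) r (f ∘ (b ∷_)) (λ t l le → e (b ∷ t) (cong suc l) (+-monoʳ-≤ b le)))
                     (∑L-zero∈ (upTo M) (λ b' _ → ▷-zero (b <ᵇ b') (later b'))))
          (⊕-identityˡ 𝟘)
    where
    later : ∀ b' → (b <ᵇ b') ≡ true → insSign b' r ⊗ (z (b' ∸ b) ⊗ Y M s (ins b' r) f) ≡ 𝟘
    later b' lt = trans (cong (λ v → insSign b' r ⊗ (z (b' ∸ b) ⊗ v)) (Y-zero M s (ins b' r) f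
        (λ t l le → e t (trans l (ins-length b' r))
          (≤-trans (+-monoˡ-≤ (sum r) (<⇒≤ (<ᵇ-true⁻ lt))) (subst (_≤ sum t) (ins-sum b' r) le)))))
      (trans (cong (insSign b' r ⊗_) (⊗-zeroʳ _)) (⊗-zeroʳ _))

  -- `Y` follows the recursion of `L`: by `L-step` the first bead is frozen or moves, and by `L-ins`
  -- a moved bead can be re-sorted at the cost of `insSign`. Since `L` does not record how many
  -- moves were made, all numbers of moves are summed; `deficit M γ` bounds them.
  ∑-Y : ∀ M s γ f → Alternating f → All (_< M) γ → deficit M γ ≤ s → ∑ (suc s) (λ i → Y M i γ f) ≡ L M γ f
  ∑-Y M s [] f alt _ _ = trans (∑-suc s _) (trans (cong (f [] ⊕_) (∑L-zero (upTo s))) (⊕-identityʳ _))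
  ∑-Y M zero (b ∷ r) f alt (b<M ∷ _) le = ⊥-elim (<⇒≱ (m<n⇒0<n∸m b<M) (m+n≤o⇒m≤o (M ∸ b) le))
  ∑-Y M (suc s) (b ∷ r) f alt (b<M ∷ all<) le = begin
    ∑ (suc (suc s)) (λ i → Y M i (b ∷ r) f)
      ≡⟨ ∑-suc (suc s) _ ⟩
    f (b ∷ r) ⊕ ∑ (suc s) (λ i → Y M (suc i) r (f ∘ (b ∷_)) ⊕ ∑ M (move i))
      ≡⟨ cong (f (b ∷ r) ⊕_) (∑L-⊕ (upTo (suc s)) _ _) ⟩
    f (b ∷ r) ⊕ (∑ (suc s) (λ i → Y M (suc i) r (f ∘ (b ∷_))) ⊕ ∑ (suc s) (λ i → ∑ M (move i)))
      ≡⟨ sym (⊕-assoc _ _ _) ⟩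
    (f (b ∷ r) ⊕ ∑ (suc s) (λ i → Y M (suc i) r (f ∘ (b ∷_)))) ⊕ ∑ (suc s) (λ i → ∑ M (move i))
      ≡⟨ cong₂ _⊕_ (sym (∑-suc (suc s) (λ i → Y M i r (f ∘ (b ∷_))))) (∑L-swap (upTo (suc s)) (upTo M) _) ⟩
    ∑ (suc (suc s)) (λ i → Y M i r (f ∘ (b ∷_))) ⊕ ∑ M (λ b' → ∑ (suc s) (λ i → move i b'))
      ≡⟨ cong₂ _⊕_ (∑-Y M (suc s) r (f ∘ (b ∷_)) (alternating-∷ f alt b) all< (m+n≤o⇒n≤o (M ∸ b) le))
                   (∑-cong< M moves) ⟩
    L M r (f ∘ (b ∷_)) ⊕ ∑ M (λ b' → (b <ᵇ b') ▷ (z (b' ∸ b) ⊗ L M (b' ∷ r) f))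
      ≡⟨ sym (L-step b r f b<M) ⟩
    L M (b ∷ r) f ∎
    where
    open ≡-Reasoning
    move : ℕ → ℕ → R
    move i b' = (b <ᵇ b') ▷ (insSign b' r ⊗ (z (b' ∸ b) ⊗ Y M i (ins b' r) f))
    moves : ∀ b' → b' < M → ∑ (suc s) (λ i → move i b') ≡ ((b <ᵇ b') ▷ (z (b' ∸ b) ⊗ L M (b' ∷ r) f))
    moves b' b'<M = trans (∑L-▷ (upTo (suc s)) (b <ᵇ b') _) (▷-cong (b <ᵇ b') λ lt → begin
      ∑ (suc s) (λ i → insSign b' r ⊗ (z (b' ∸ b) ⊗ Y M i (ins b' r) f))
        ≡⟨ trans (∑L-⊗ˡ (upTo (suc s)) _ _) (cong (insSign b' r ⊗_) (∑L-⊗ˡ (upTo (suc s)) _ _)) ⟩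
      insSign b' r ⊗ (z (b' ∸ b) ⊗ ∑ (suc s) (λ i → Y M i (ins b' r) f))
        ≡⟨ cong (λ v → insSign b' r ⊗ (z (b' ∸ b) ⊗ v)) (∑-Y M s (ins b' r) f alt (ins-All b' r b'<M all<) (fits (<ᵇ-true⁻ lt))) ⟩
      insSign b' r ⊗ (z (b' ∸ b) ⊗ L M (ins b' r) f)
        ≡⟨ ⊗-left-comm _ _ _ ⟩
      z (b' ∸ b) ⊗ (insSign b' r ⊗ L M (ins b' r) f)
        ≡⟨ cong (z (b' ∸ b) ⊗_) (sym (L-ins M b' r f alt)) ⟩
      z (b' ∸ b) ⊗ L M (b' ∷ r) f ∎)
      where
      -- The move from b to b' < M lowers the deficit by at least one, which pays for the decrease
      -- of s.
      fits : b < b' → deficit M (ins b' r) ≤ s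
      fits b<b' = s≤s⁻¹ (≤-trans (subst (_< (M ∸ b) + deficit M r) (sym (deficit-ins M b' r))
        (+-monoˡ-< (deficit M r) (∸-monoʳ-< b<b' (<⇒≤ b'<M)))) le)

-- Lowering beads and the Pieri rule

range : ℕ → ℕ → List ℕ
range g zero = []
range g (suc m) = g ∷ range (suc g) m

length-range : ∀ g m → length (range g m) ≡ m
length-range g zero = refl
length-range g (suc m) = cong suc (length-range (suc g) m)

range-≥ : ∀ g m → All (g ≤_) (range g m)
range-≥ g zero = []
range-≥ g (suc m) = ≤-refl ∷ All.map <⇒≤ (range-≥ (suc g) m)

sum-swap : ∀ p x y t → sum (p ++ x ∷ y ∷ t) ≡ sum (p ++ y ∷ x ∷ t)
sum-swap [] x y t = trans (sym (+-assoc x y _)) (trans (cong (_+ sum t) (+-comm x y)) (+-assoc y x _))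
sum-swap (z ∷ p) x y t = cong (z +_) (sum-swap p x y t)

module Lowering (𝓡 : TorsionFreeRing) where
  open TorsionFreeRing 𝓡
  open Sums 𝓡

  Down : List ℕ → (List ℕ → R) → R
  Down [] φ = φ []
  Down (x ∷ xs) φ = ∑ (suc x) (λ y → Down xs (φ ∘ (y ∷_)))

  -- h_a^⊥ on alternating functions: all beads move down by a in total.
  H : ℕ → (List ℕ → R) → List ℕ → R
  H a f t = Down t (λ t' → (sum t ≡ᵇ sum t' + a) ▷ f t')

  Down-cong : ∀ t {φ ψ : List ℕ → R} → (∀ t' → φ t' ≡ ψ t') → Down t φ ≡ Down t ψ
  Down-cong [] e = e []
  Down-cong (x ∷ t) e = ∑L-cong (upTo (suc x)) (λ y → Down-cong t (e ∘ (y ∷_)))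

  Down-zero : ∀ t {φ : List ℕ → R} → (∀ t' → φ t' ≡ 𝟘) → Down t φ ≡ 𝟘
  Down-zero [] e = e []
  Down-zero (x ∷ t) e = trans (∑L-cong (upTo (suc x)) (λ y → Down-zero t (e ∘ (y ∷_)))) (∑L-zero (upTo (suc x)))

  Down-⊖ : ∀ t (φ : List ℕ → R) → Down t (λ t' → ⊖ φ t') ≡ ⊖ Down t φ
  Down-⊖ [] φ = refl
  Down-⊖ (x ∷ t) φ = trans (∑L-cong (upTo (suc x)) (λ y → Down-⊖ t (φ ∘ (y ∷_)))) (∑L-⊖ (upTo (suc x)) _)

  -- Two functions are needed because the size test inside `H` mentions the list that is being
  -- lowered, which differs on the two sides.
  Down-swap : ∀ p x y t (φ ψ : List ℕ → R) → (∀ p' a b t' → φ (p' ++ a ∷ b ∷ t') ≡ ⊖ ψ (p' ++ b ∷ a ∷ t')) →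
    Down (p ++ x ∷ y ∷ t) φ ≡ ⊖ Down (p ++ y ∷ x ∷ t) ψ
  Down-swap [] x y t φ ψ e = begin
    ∑ (suc x) (λ a → ∑ (suc y) (λ b → Down t (λ t' → φ (a ∷ b ∷ t'))))
      ≡⟨ ∑L-swap (upTo (suc x)) (upTo (suc y)) _ ⟩
    ∑ (suc y) (λ b → ∑ (suc x) (λ a → Down t (λ t' → φ (a ∷ b ∷ t'))))
      ≡⟨ ∑L-cong (upTo (suc y)) (λ b → trans (∑L-cong (upTo (suc x)) (λ a →
           trans (Down-cong t (λ t' → e [] a b t')) (Down-⊖ t _))) (∑L-⊖ (upTo (suc x)) _)) ⟩
    ∑ (suc y) (λ b → ⊖ ∑ (suc x) (λ a → Down t (λ t' → ψ (b ∷ a ∷ t'))))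
      ≡⟨ ∑L-⊖ (upTo (suc y)) _ ⟩
    ⊖ Down (y ∷ x ∷ t) ψ ∎
    where open ≡-Reasoning
  Down-swap (z ∷ p) x y t φ ψ e =
    trans (∑L-cong (upTo (suc z)) (λ u → Down-swap p x y t (φ ∘ (u ∷_)) (ψ ∘ (u ∷_)) (λ p' → e (u ∷ p'))))
          (∑L-⊖ (upTo (suc z)) _)

  H-alternating : ∀ a f → Alternating f → Alternating (H a f)
  H-alternating a f alt p x y t = Down-swap p x y t _ _ λ p' u v t' →
    trans (cong₂ _▷_ (cong₂ _≡ᵇ_ (sum-swap p x y t) (cong (_+ a) (sum-swap p' u v t'))) (alt p' u v t')) (▷-⊖ (sum (p ++ y ∷ x ∷ t) ≡ᵇ sum (p' ++ v ∷ u ∷ t') + a) _)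

  BoundedBy : ℕ → (List ℕ → R) → Set
  BoundedBy M f = ∀ p x t → M ≤ x → f (p ++ x ∷ t) ≡ 𝟘

  Down-zero≤ : ∀ t {φ : List ℕ → R} → (∀ t' → Pointwise _≤_ t' t → φ t' ≡ 𝟘) → Down t φ ≡ 𝟘
  Down-zero≤ [] e = e [] []
  Down-zero≤ (x ∷ t) e = ∑-zero< (suc x) (λ { y (s≤s y≤x) → Down-zero≤ t (λ t' pw → e (y ∷ t') (y≤x ∷ pw)) })

  Pointwise-sum : ∀ {t' t} → Pointwise _≤_ t' t → sum t' ≤ sum t
  Pointwise-sum [] = z≤n
  Pointwise-sum (le ∷ pw) = +-mono-≤ le (Pointwise-sum pw)

  -- An entry that is at least M + a stays at least M when the entries are lowered by a in total.
  H-boundedBy : ∀ a M f → BoundedBy M f → BoundedBy (M + a) (H a f)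
  H-boundedBy a M f bd p x t M+a≤x = Down-zero≤ (p ++ x ∷ t) (λ t' pw → ▷-zero (sum (p ++ x ∷ t) ≡ᵇ sum t' + a) (λ e →
      vanish f bd t' p pw (subst (_≤ sum t' + a) (+-identityʳ _) (≤-reflexive (trans (+-identityʳ _) (≡ᵇ-true e))))))
    where
    -- The equality of sizes is weakened to an inequality, which survives dropping the entries in
    -- front of x.
    vanish : ∀ f → BoundedBy M f → ∀ t' p → Pointwise _≤_ t' (p ++ x ∷ t) → sum (p ++ x ∷ t) ≤ sum t' + a → f t' ≡ 𝟘
    vanish f bd (y ∷ t') [] (_ ∷ pw) le = bd [] y t' (+-cancelʳ-≤ a M y (≤-trans M+a≤x (+-cancelʳ-≤ (sum t) x (y + a) (begin
      x + sum t      ≤⟨ le ⟩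
      y + sum t' + a ≤⟨ +-monoˡ-≤ a (+-monoʳ-≤ y (Pointwise-sum pw)) ⟩
      y + sum t + a  ≡⟨ trans (+-assoc y _ a) (trans (cong (y +_) (+-comm (sum t) a)) (sym (+-assoc y a _))) ⟩
      y + a + sum t ∎))))
      where open ≤-Reasoning
    vanish f bd (y ∷ t') (z ∷ p) (y≤z ∷ pw) le = vanish (f ∘ (y ∷_)) (λ p → bd (y ∷ p)) t' p pw (+-cancelˡ-≤ z _ _ (begin
      z + sum (p ++ x ∷ t) ≤⟨ le ⟩
      y + sum t' + a       ≤⟨ +-monoˡ-≤ a (+-monoˡ-≤ (sum t') y≤z) ⟩
      z + sum t' + a       ≡⟨ +-assoc z _ a ⟩
      z + (sum t' + a) ∎))
      where open ≤-Reasoning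

-- H a ∘ L is the evaluation on the columns κ_g(d , y) = W(g , y + d), where y is the final position and d the
-- amount lowered; subtracting multiples of neighbouring columns leaves κ₀ ∧ W₁ ∧ … ∧ W_{N-1}.
module Pieri (𝓡 : TorsionFreeRing) (𝓦 : GeometricSeries 𝓡) where
  open TorsionFreeRing 𝓡
  open Sums 𝓡
  open GeometricSeries 𝓦
  open Chains 𝓡 𝓦
  open Lowering 𝓡

  κ κ↑ τ : ℕ → ℕ × ℕ → R
  κ g (d , y) = W g (y + d)
  κ↑ g (zero , y) = 𝟘
  κ↑ g (suc d , y) = κ g (d , y)
  τ g (d , y) = (d ≡ᵇ 0) ▷ W g y

  -- `W` depends only on differences, so for d ≥ 1 starting one position higher is the same as
  -- lowering by one less. The column g + 1 thus agrees with the shifted column g except at d = 0,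
  -- where `τ` takes over.
  κ-suc : ∀ g p → κ (suc g) p ≡ τ (suc g) p ⊕ κ↑ g p
  κ-suc g (zero , y) = trans (cong (W (suc g)) (+-identityʳ y)) (sym (⊕-identityʳ _))
  κ-suc g (suc d , y) = trans (cong (W (suc g)) (+-suc y d)) (trans (W-shift g (y + d)) (sym (⊕-identityˡ _)))

  -- c is the amount already lowered by entries that have been fixed; the total must reach a.
  graded : ℕ → ℕ → (List ℕ → R) → List (ℕ × ℕ) → R
  graded a c f ps = (c + sum (map proj₁ ps) ≡ᵇ a) ▷ f (map proj₂ ps)

  graded-∷ : ∀ a c f p ps → graded a c f (p ∷ ps) ≡ graded a (c + proj₁ p) (f ∘ (proj₂ p ∷_)) ps
  graded-∷ a c f (d , y) ps = cong (λ n → (n ≡ᵇ a) ▷ f (y ∷ map proj₂ ps)) (sym (+-assoc c d _))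

  graded-over : ∀ {a c} f → a < c → ∀ ps → graded a c f ps ≡ 𝟘
  graded-over {a} {c} f lt ps = ▷-false (≡ᵇ-false (λ e → <⇒≱ lt (≤-trans (m≤m+n c _) (≤-reflexive e))))

  box : ℕ → ℕ → List (ℕ × ℕ)
  box D M = cartesianProduct (upTo D) (upTo M)

  -- Substitute t = y + d for the raised position, y being the final position and d the amount
  -- lowered. Only y < M and d ≤ a contribute, which explains the cut-off `suc (M + a)` on the left
  -- and the box on the right.
  L-H : ∀ a M c f gs → BoundedBy M f →
    L (suc (M + a)) gs (λ ts → Down ts (λ ys → (c + sum ts ≡ᵇ sum ys + a) ▷ f ys)) ≡ ⟪ box (suc a) M ⟫ (map (κ) gs) (graded a c f)
  L-H a M c f [] bd = refl
  L-H a M c f (g ∷ gs) bd = begin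
    ∑ M' (λ t → W g t ⊗ L M' gs (λ ts → ∑ (suc t) (λ y → Down ts (λ ys → (c + (t + sum ts) ≡ᵇ (y + sum ys) + a) ▷ f (y ∷ ys)))))
      ≡⟨ ∑L-cong (upTo M') (λ t → trans (cong (W g t ⊗_) (⟪⟫-∑L (upTo M') (map W gs) (upTo (suc t)) _)) (sym (∑L-⊗ˡ (upTo (suc t)) _ _))) ⟩
    ∑ M' (λ t → ∑ (suc t) (λ y → W g t ⊗ L M' gs (λ ts → Down ts (λ ys → (c + (t + sum ts) ≡ᵇ (y + sum ys) + a) ▷ f (y ∷ ys)))))
      ≡⟨ ∑-cong< M' (λ t lt → sym (∑-≤ᵇ lt _)) ⟩
    ∑ M' (λ t → ∑ M' (λ y → (y ≤ᵇ t) ▷ W g t ⊗ L M' gs (λ ts → Down ts (λ ys → (c + (t + sum ts) ≡ᵇ (y + sum ys) + a) ▷ f (y ∷ ys)))))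
      ≡⟨ ∑L-swap (upTo M') (upTo M') _ ⟩
    ∑ M' (λ y → ∑ M' (λ t → (y ≤ᵇ t) ▷ W g t ⊗ L M' gs (λ ts → Down ts (λ ys → (c + (t + sum ts) ≡ᵇ (y + sum ys) + a) ▷ f (y ∷ ys)))))
      ≡⟨ ∑-cong< M' (λ y lt → ∑-≥ᵇ (<⇒≤ lt) _) ⟩
    ∑ M' (λ y → ∑ (M' ∸ y) (λ d → W g (y + d) ⊗ L M' gs (λ ts → Down ts (λ ys → (c + (y + d + sum ts) ≡ᵇ (y + sum ys) + a) ▷ f (y ∷ ys)))))
      ≡⟨ ∑L-cong (upTo M') (λ y → ∑L-cong (upTo (M' ∸ y)) (λ d → cong (W g (y + d) ⊗_) (inner y d))) ⟩
    ∑ M' (λ y → ∑ (M' ∸ y) (λ d → G d y))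
      ≡⟨ ∑-trunc _ (m≤n⇒m≤1+n (m≤m+n M a)) (λ y M≤y → trans (∑L-cong (upTo (M' ∸ y)) (λ d → ⊗-zeroʳ′ _ (⟪⟫-zero _ (map κ gs)
           (λ t → ▷-zero (c + d + sum (map proj₁ t) ≡ᵇ a) (λ _ → bd [] y (map proj₂ t) M≤y))))) (∑L-zero (upTo (M' ∸ y)))) ⟩
    ∑ M (λ y → ∑ (M' ∸ y) (λ d → G d y))
      ≡⟨ ∑-cong< M (λ y y<M → ∑-trunc _ (fits y y<M) (λ d a<d → ⊗-zeroʳ′ _ (⟪⟫-zero _ (map κ gs) (graded-over (f ∘ (y ∷_)) (<-≤-trans a<d (m≤n+m d c)))))) ⟩
    ∑ M (λ y → ∑ (suc a) (λ d → G d y))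
      ≡⟨ ∑L-swap (upTo M) (upTo (suc a)) _ ⟩
    ∑ (suc a) (λ d → ∑ M (λ y → G d y))
      ≡⟨ sym (∑L-cartesianProduct (upTo (suc a)) (upTo M) _) ⟩
    ∑L (box (suc a) M) (λ p → κ g p ⊗ ⟪ box (suc a) M ⟫ (map κ gs) (graded a (c + proj₁ p) (f ∘ (proj₂ p ∷_))))
      ≡⟨ ∑L-cong (box (suc a) M) (λ p → cong (κ g p ⊗_) (⟪⟫-cong _ (map κ gs) (λ ps → sym (graded-∷ a c f p ps)))) ⟩
    ⟪ box (suc a) M ⟫ (map κ (g ∷ gs)) (graded a c f) ∎
    where
    open ≡-Reasoning
    M' = suc (M + a)
    G : ℕ → ℕ → R
    G d y = κ g (d , y) ⊗ ⟪ box (suc a) M ⟫ (map κ gs) (graded a (c + d) (f ∘ (y ∷_)))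
    fits : ∀ y → y < M → suc a ≤ M' ∸ y
    fits y y<M = m+n≤o⇒m≤o∸n (suc a) (s≤s (subst (a + y ≤_) (+-comm a M) (+-monoʳ-≤ a (<⇒≤ y<M))))
    ≡ᵇ-cancel : ∀ y m n → (y + m ≡ᵇ y + n) ≡ (m ≡ᵇ n)
    ≡ᵇ-cancel zero m n = refl
    ≡ᵇ-cancel (suc y) m n = ≡ᵇ-cancel y m n
    shuffle : ∀ y d s → c + (y + d + s) ≡ y + (c + d + s)
    shuffle y d s = begin
      c + (y + d + s)   ≡⟨ cong (c +_) (+-assoc y d s) ⟩
      c + (y + (d + s)) ≡⟨ sym (+-assoc c y _) ⟩
      c + y + (d + s)   ≡⟨ cong (_+ (d + s)) (+-comm c y) ⟩
      y + c + (d + s)   ≡⟨ +-assoc y c _ ⟩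
      y + (c + (d + s)) ≡⟨ cong (y +_) (sym (+-assoc c d s)) ⟩
      y + (c + d + s) ∎
    inner : ∀ y d → L M' gs (λ ts → Down ts (λ ys → (c + (y + d + sum ts) ≡ᵇ (y + sum ys) + a) ▷ f (y ∷ ys))) ≡
      ⟪ box (suc a) M ⟫ (map κ gs) (graded a (c + d) (f ∘ (y ∷_)))
    inner y d = trans (⟪⟫-cong _ (map W gs) (λ ts → Down-cong ts (λ ys → cong (_▷ f (y ∷ ys))
        (trans (cong₂ _≡ᵇ_ (shuffle y d (sum ts)) (+-assoc y (sum ys) a)) (≡ᵇ-cancel y _ _)))))
      (L-H a M (c + d) (f ∘ (y ∷_)) gs (λ p → bd (y ∷ p)))

  -- Only the sum of the lowerings is tested, so the extra unit may sit in either pair; exchanging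
  -- the final positions costs the sign.
  graded-antisym : ∀ a c f ks D M d y d' y' → Alternating f →
    ⟪ box D M ⟫ ks (λ ps → graded a c f ((d , y) ∷ (suc d' , y') ∷ ps)) ≡
    ⊖ ⟪ box D M ⟫ ks (λ ps → graded a c f ((d' , y') ∷ (suc d , y) ∷ ps))
  graded-antisym a c f ks D M d y d' y' alt = trans
    (⟪⟫-cong _ ks (λ ps → trans (cong₂ _▷_ (cong (λ n → c + n ≡ᵇ a) (flip (sum (map proj₁ ps)))) (alt [] y y' (map proj₂ ps))) (▷-⊖ (c + (d' + (suc d + sum (map proj₁ ps))) ≡ᵇ a) _)))
    (⟪⟫-⊖ _ ks _)
    where
    flip : ∀ s → d + (suc d' + s) ≡ d' + (suc d + s)
    flip s = begin
      d + suc (d' + s)   ≡⟨ +-suc d _ ⟩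
      suc (d + (d' + s)) ≡⟨ cong suc (trans (sym (+-assoc d d' s)) (trans (cong (_+ s) (+-comm d d')) (+-assoc d' d s))) ⟩
      suc (d' + (d + s)) ≡⟨ sym (+-suc d' _) ⟩
      d' + suc (d + s) ∎
      where open ≡-Reasoning

  -- Shifting d in the second factor gives both factors the weight `κ g`, and the summand becomes
  -- antisymmetric in the two pairs by `graded-antisym`.
  κ∧κ↑ : ∀ a M c f g ks → Alternating f → ⟪ box (suc a) M ⟫ (κ g ∷ κ↑ g ∷ ks) (graded a c f) ≡ 𝟘
  κ∧κ↑ a M c f g ks alt = begin
    ∑L P (λ p → κ g p ⊗ ∑L P (λ q → κ↑ g q ⊗ F p q))
      ≡⟨ ∑L-cong P (λ p → cong (κ g p ⊗_) (shifted p)) ⟩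
    ∑L P (λ p → κ g p ⊗ ∑L P⁻ (λ q → κ g q ⊗ F p (up q)))
      ≡⟨ trans (∑L-cartesianProduct (upTo (suc a)) (upTo M) _) (trans (∑-last a _) (cong₂ _⊕_ (sym (∑L-cartesianProduct (upTo a) (upTo M) _)) top)) ⟩
    ∑L P⁻ (λ p → κ g p ⊗ ∑L P⁻ (λ q → κ g q ⊗ F p (up q))) ⊕ 𝟘
      ≡⟨ ⊕-identityʳ _ ⟩
    ∑L P⁻ (λ p → κ g p ⊗ ∑L P⁻ (λ q → κ g q ⊗ F p (up q)))
      ≡⟨ ∑L-cong P⁻ (λ p → sym (∑L-⊗ˡ P⁻ (κ g p) _)) ⟩
    ∑L P⁻ (λ p → ∑L P⁻ (λ q → κ g p ⊗ (κ g q ⊗ F p (up q))))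
      ≡⟨ ∑L-antisym P⁻ _ anti ⟩
    𝟘 ∎
    where
    open ≡-Reasoning
    P P⁻ : List (ℕ × ℕ)
    P = box (suc a) M
    P⁻ = box a M
    F : ℕ × ℕ → ℕ × ℕ → R
    F p q = ⟪ P ⟫ ks (λ ps → graded a c f (p ∷ q ∷ ps))
    up : ℕ × ℕ → ℕ × ℕ
    up (d , y) = suc d , y
    shifted : ∀ p → ∑L P (λ q → κ↑ g q ⊗ F p q) ≡ ∑L P⁻ (λ q → κ g q ⊗ F p (up q))
    shifted p = begin
      ∑L P (λ q → κ↑ g q ⊗ F p q)                                ≡⟨ ∑L-cartesianProduct (upTo (suc a)) (upTo M) _ ⟩
      ∑ (suc a) (λ d → ∑ M (λ y → κ↑ g (d , y) ⊗ F p (d , y)))   ≡⟨ ∑-suc a _ ⟩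
      ∑ M (λ y → 𝟘 ⊗ F p (0 , y)) ⊕ ∑ a (λ d → ∑ M (λ y → κ g (d , y) ⊗ F p (suc d , y)))
        ≡⟨ cong₂ _⊕_ (trans (∑L-cong (upTo M) (λ y → ⊗-zeroˡ _)) (∑L-zero (upTo M))) (sym (∑L-cartesianProduct (upTo a) (upTo M) _)) ⟩
      𝟘 ⊕ ∑L P⁻ (λ q → κ g q ⊗ F p (up q))                        ≡⟨ ⊕-identityˡ _ ⟩
      ∑L P⁻ (λ q → κ g q ⊗ F p (up q)) ∎
    -- If the first factor is lowered by all of a, the second, lowered by at least 1, exceeds the
    -- total. Hence both pairs run over the same smaller box `P⁻`, as antisymmetry requires.
    top : ∑ M (λ y → κ g (a , y) ⊗ ∑L P⁻ (λ q → κ g q ⊗ F (a , y) (up q))) ≡ 𝟘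
    top = trans (∑L-cong (upTo M) (λ y → ⊗-zeroʳ′ _ (trans (∑L-cong P⁻ (λ { (d , y') → ⊗-zeroʳ′ _ (⟪⟫-zero P ks (λ ps →
      ▷-false (≡ᵇ-false (λ e → <⇒≱ (<-≤-trans (m<m+n a (s≤s z≤n)) (m≤n+m _ c)) (≤-reflexive e))))) })) (∑L-zero P⁻)))) (∑L-zero (upTo M))
    anti : ∀ p q → κ g p ⊗ (κ g q ⊗ F p (up q)) ≡ ⊖ (κ g q ⊗ (κ g p ⊗ F q (up p)))
    anti (d , y) (d' , y') = trans (⊗-left-comm _ _ _) (trans (cong (λ v → κ g (d' , y') ⊗ (κ g (d , y) ⊗ v)) (graded-antisym a c f ks (suc a) M d y d' y' alt))
      (trans (cong (κ g (d' , y') ⊗_) (sym (⊖-⊗ʳ _ _))) (sym (⊖-⊗ʳ _ _))))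

  -- Column operations from right to left: split κ_{g+1} = τ_{g+1} + κ↑_g, where κ↑_g dies against
  -- the factor κ_g to its left.
  reduce : ∀ a M c f m g → Alternating f →
    ⟪ box (suc a) M ⟫ (map κ (range g (suc m))) (graded a c f) ≡ ⟪ box (suc a) M ⟫ (κ g ∷ map τ (range (suc g) m)) (graded a c f)
  reduce a M c f zero g alt = refl
  reduce a M c f (suc m) g alt = begin
    ∑L P (λ p → κ g p ⊗ ⟪ P ⟫ (map κ (range (suc g) (suc m))) (graded a c f ∘ (p ∷_)))
      ≡⟨ ∑L-cong P (λ p → cong (κ g p ⊗_) (trans (⟪⟫-cong P (map κ (range (suc g) (suc m))) (graded-∷ a c f p)) (trans
           (reduce a M (c + proj₁ p) (f ∘ (proj₂ p ∷_)) m (suc g) (alternating-∷ f alt (proj₂ p)))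
           (⟪⟫-cong P (κ (suc g) ∷ ks) (λ ps → sym (graded-∷ a c f p ps)))))) ⟩
    ∑L P (λ p → κ g p ⊗ ⟪ P ⟫ (κ (suc g) ∷ ks) (graded a c f ∘ (p ∷_)))
      ≡⟨ ∑L-cong P (λ p → trans (cong (κ g p ⊗_) (trans (⟪⟫-kernel P ks (graded a c f ∘ (p ∷_)) (λ q _ → κ-suc g q)) (⟪⟫-kernel-⊕ P (τ (suc g)) (κ↑ g) ks (graded a c f ∘ (p ∷_))))) (⊗-distribˡ _ _ _)) ⟩
    ∑L P (λ p → κ g p ⊗ ⟪ P ⟫ (τ (suc g) ∷ ks) (graded a c f ∘ (p ∷_)) ⊕ κ g p ⊗ ⟪ P ⟫ (κ↑ g ∷ ks) (graded a c f ∘ (p ∷_)))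
      ≡⟨ ∑L-⊕ P _ _ ⟩
    ⟪ P ⟫ (κ g ∷ τ (suc g) ∷ ks) (graded a c f) ⊕ ⟪ P ⟫ (κ g ∷ κ↑ g ∷ ks) (graded a c f)
      ≡⟨ ⊕-identityʳ′ _ (κ∧κ↑ a M c f g ks alt) ⟩
    ⟪ P ⟫ (κ g ∷ τ (suc g) ∷ ks) (graded a c f) ∎
    where
    open ≡-Reasoning
    P = box (suc a) M
    ks = map τ (range (suc (suc g)) m)

  ⟪⟫-τ : ∀ a M c f gs → ⟪ box (suc a) M ⟫ (map τ gs) (graded a c f) ≡ ((c ≡ᵇ a) ▷ L M gs f)
  ⟪⟫-τ a M c f [] = cong (λ n → (n ≡ᵇ a) ▷ f []) (+-identityʳ c)
  ⟪⟫-τ a M c f (g ∷ gs) = begin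
    ∑L (box (suc a) M) (λ p → τ g p ⊗ ⟪ box (suc a) M ⟫ (map τ gs) (graded a c f ∘ (p ∷_)))
      ≡⟨ ∑L-cong (box (suc a) M) (λ { (d , y) → cong (τ g (d , y) ⊗_) (trans (⟪⟫-cong _ (map τ gs) (graded-∷ a c f (d , y))) (⟪⟫-τ a M (c + d) (f ∘ (y ∷_)) gs)) }) ⟩
    ∑L (box (suc a) M) (λ p → τ g p ⊗ ((c + proj₁ p ≡ᵇ a) ▷ L M gs (f ∘ (proj₂ p ∷_))))
      ≡⟨ trans (∑L-cartesianProduct (upTo (suc a)) (upTo M) _) (∑-suc a _) ⟩
    ∑ M (λ y → W g y ⊗ ((c + 0 ≡ᵇ a) ▷ L M gs (f ∘ (y ∷_)))) ⊕ ∑ a (λ d → ∑ M (λ y → 𝟘 ⊗ ((c + suc d ≡ᵇ a) ▷ L M gs (f ∘ (y ∷_)))))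
      ≡⟨ cong₂ _⊕_ (trans (∑L-cong (upTo M) (λ y → trans (sym (▷-⊗ʳ (c + 0 ≡ᵇ a) _ _)) (cong (λ n → (n ≡ᵇ a) ▷ _) (+-identityʳ c)))) (∑L-▷ (upTo M) (c ≡ᵇ a) _))
                   (trans (∑L-cong (upTo a) (λ d → trans (∑L-cong (upTo M) (λ y → ⊗-zeroˡ _)) (∑L-zero (upTo M)))) (∑L-zero (upTo a))) ⟩
    ((c ≡ᵇ a) ▷ L M (g ∷ gs) f) ⊕ 𝟘
      ≡⟨ ⊕-identityʳ _ ⟩
    ((c ≡ᵇ a) ▷ L M (g ∷ gs) f) ∎
    where open ≡-Reasoning

  -- W only raises positions, so no bead can come back to 0.
  L-zero : ∀ M gs f → All (1 ≤_) gs → (∀ t → length t ≡ length gs → All (1 ≤_) t → f t ≡ 𝟘) → L M gs f ≡ 𝟘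
  L-zero M [] f _ e = e [] refl []
  L-zero M (g ∷ gs) f (1≤g ∷ all) e = ∑-zero< M λ
    { zero _ → ⊗-zeroˡ′ _ (W-below g 0 1≤g)
    ; (suc y) _ → ⊗-zeroʳ′ _ (L-zero M gs (f ∘ (suc y ∷_)) all (λ t l pos → e (suc y ∷ t) (cong suc l) (s≤s z≤n ∷ pos))) }

  -- After `reduce` the whole lowering by a is carried by the first factor. The other beads start at
  -- 1 or higher, so f vanishes unless the first one ends at 0, and `κ 0 (a , 0)` is w_a.
  pieri : ∀ a M N f → Alternating f → BoundedBy (suc M) f → (∀ t → length t ≡ suc N → All (1 ≤_) t → f t ≡ 𝟘) →
    L (suc (suc M + a)) (range 0 (suc N)) (H a f) ≡ w a ⊗ L (suc M) (range 0 (suc N)) f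
  pieri a M N f alt bd e = begin
    L (suc (suc M + a)) (range 0 (suc N)) (H a f)
      ≡⟨ L-H a (suc M) 0 f (range 0 (suc N)) bd ⟩
    ⟪ box (suc a) (suc M) ⟫ (map κ (range 0 (suc N))) (graded a 0 f)
      ≡⟨ reduce a (suc M) 0 f N 0 alt ⟩
    ∑L (box (suc a) (suc M)) (λ p → κ 0 p ⊗ ⟪ box (suc a) (suc M) ⟫ (map τ gs) (graded a 0 f ∘ (p ∷_)))
      ≡⟨ ∑L-cong (box (suc a) (suc M)) (λ { (d , y) → cong (κ 0 (d , y) ⊗_) (⟪⟫-τ a (suc M) d (f ∘ (y ∷_)) gs) }) ⟩
    ∑L (box (suc a) (suc M)) (λ p → κ 0 p ⊗ ((proj₁ p ≡ᵇ a) ▷ L (suc M) gs (f ∘ (proj₂ p ∷_))))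
      ≡⟨ ∑L-cartesianProduct (upTo (suc a)) (upTo (suc M)) _ ⟩
    ∑ (suc a) (λ d → ∑ (suc M) (λ y → W 0 (y + d) ⊗ ((d ≡ᵇ a) ▷ L (suc M) gs (f ∘ (y ∷_)))))
      ≡⟨ ∑L-cong (upTo (suc a)) (λ d → only (λ y → W 0 (y + d) ⊗ ((d ≡ᵇ a) ▷ L (suc M) gs (f ∘ (y ∷_))))
           (λ y → ⊗-zeroʳ′ _ (▷-zero (d ≡ᵇ a) (λ _ → positive y)))) ⟩
    ∑ (suc a) (λ d → w d ⊗ ((d ≡ᵇ a) ▷ L (suc M) gs (f ∘ (0 ∷_))))
      ≡⟨ ∑L-cong (upTo (suc a)) (λ d → sym (▷-⊗ʳ (d ≡ᵇ a) _ _)) ⟩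
    ∑ (suc a) (λ d → (d ≡ᵇ a) ▷ w d ⊗ L (suc M) gs (f ∘ (0 ∷_)))
      ≡⟨ ∑-δ (suc a) a _ ≤-refl ⟩
    w a ⊗ L (suc M) gs (f ∘ (0 ∷_))
      ≡⟨ cong (w a ⊗_) (sym (trans (only (λ y → W 0 y ⊗ L (suc M) gs (f ∘ (y ∷_))) (λ y → ⊗-zeroʳ′ _ (positive y)))
           (trans (cong (_⊗ L (suc M) gs (f ∘ (0 ∷_))) w-zero) (⊗-identityˡ _)))) ⟩
    w a ⊗ L (suc M) (range 0 (suc N)) f ∎
    where
    open ≡-Reasoning
    gs = range 1 N
    positive : ∀ y → L (suc M) gs (f ∘ (suc y ∷_)) ≡ 𝟘
    positive y = L-zero (suc M) gs _ (range-≥ 1 N) (λ t l pos → e (suc y ∷ t) (cong suc (trans l (length-range 1 N))) (s≤s z≤n ∷ pos))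
    only : ∀ (F : ℕ → R) → (∀ y → F (suc y) ≡ 𝟘) → ∑ (suc M) F ≡ F 0
    only F z = trans (∑-suc M F) (trans (cong (F 0 ⊕_) (trans (∑L-cong (upTo M) z) (∑L-zero (upTo M)))) (⊕-identityʳ _))

-- Alternants

split-at : ∀ t k → k < length t → ∃ λ p → ∃ λ q → t ≡ p ++ at t k ∷ q
split-at (x ∷ t) zero _ = [] , t , refl
split-at (x ∷ t) (suc k) (s≤s lt) with p , q , e ← split-at t k lt = x ∷ p , q , cong (x ∷_) e

linked-lower : ∀ {g y t} → g ≤ y → Linked _<_ (y ∷ t) → All (g ≤_) (y ∷ t)
linked-lower le [-] = le ∷ []
linked-lower le (y<z ∷ lk) = le ∷ linked-lower (≤-trans le (<⇒≤ y<z)) lk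

ascending-at : ∀ {t} g → Linked _<_ t → All (g ≤_) t → ∀ k → k < length t → g + k ≤ at t k
ascending-at {x ∷ t} g _ (g≤x ∷ _) zero _ = subst (_≤ x) (sym (+-identityʳ g)) g≤x
ascending-at {x ∷ []} g lk (g≤x ∷ _) (suc k) (s≤s ())
ascending-at {x ∷ y ∷ t} g (x<y ∷ lk) (g≤x ∷ _) (suc k) (s≤s lt) =
  subst (_≤ at (y ∷ t) k) (sym (+-suc g k)) (ascending-at (suc g) lk (linked-lower (≤-<-trans g≤x x<y) lk) k lt)

ascending-range : ∀ {t} g → Linked _<_ t → All (g ≤_) t → All (_< g + length t) t → t ≡ range g (length t)
ascending-range {[]} g _ _ _ = refl
ascending-range {x ∷ []} g _ (g≤x ∷ _) (x<g ∷ _) = cong (_∷ []) (≤-antisym (s≤s⁻¹ (subst (x <_) (+-comm g 1) x<g)) g≤x)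
ascending-range {x ∷ y ∷ t} g (x<y ∷ lk) (g≤x ∷ _) (_ ∷ bd) =
  cong₂ _∷_ x≡g rest
  where
  rest : y ∷ t ≡ range (suc g) (length (y ∷ t))
  rest = ascending-range (suc g) lk (linked-lower (≤-<-trans g≤x x<y) lk) (All.map (λ {v} → subst (v <_) (+-suc g (length (y ∷ t)))) bd)
  x≡g : x ≡ g
  x≡g = ≤-antisym (s≤s⁻¹ (subst (x <_) (proj₁ (∷-injective rest)) x<y)) g≤x

range-ascending : ∀ g m → Linked _<_ (range g m)
range-ascending g zero = []
range-ascending g (suc zero) = [-]
range-ascending g (suc (suc m)) = ≤-refl ∷ range-ascending (suc g) (suc m)

range-< : ∀ g m → All (_< g + m) (range g m)
range-< g zero = []
range-< g (suc m) = m<m+n g (s≤s z≤n) ∷ subst (λ n → All (_< n) (range (suc g) m)) (sym (+-suc g m)) (range-< (suc g) m)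

module Alternants (𝓡 : TorsionFreeRing) where
  open TorsionFreeRing 𝓡
  open Sums 𝓡
  open Lowering 𝓡

  alternating-↭ : ∀ {t t'} → t ↭ t' → ∀ (f : List ℕ → R) → Alternating f → f t' ≡ 𝟘 → f t ≡ 𝟘
  alternating-↭ ↭.refl f alt e = e
  alternating-↭ (↭.prep x p) f alt e = alternating-↭ p (f ∘ (x ∷_)) (alternating-∷ f alt x) e
  alternating-↭ (↭.swap {xs} {ys} x y p) f alt e = trans (alt [] x y xs) (trans (cong ⊖_
    (alternating-↭ p (f ∘ (y ∷_) ∘ (x ∷_)) (alternating-∷ (f ∘ (y ∷_)) (alternating-∷ f alt y) x) e)) ⊖-𝟘)
  alternating-↭ (↭.trans p q) f alt e = alternating-↭ p f alt (alternating-↭ q f alt e)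

  alternating-sorted : ∀ {t} → Linked _≤_ t → ∀ (f : List ℕ → R) → Alternating f → (Linked _<_ t → f t ≡ 𝟘) → f t ≡ 𝟘
  alternating-sorted [] f alt e = e []
  alternating-sorted [-] f alt e = e [-]
  alternating-sorted {x ∷ y ∷ t} (x≤y ∷ lk) f alt e with m≤n⇒m<n∨m≡n x≤y
  ... | inj₁ x<y = alternating-sorted lk (f ∘ (x ∷_)) (alternating-∷ f alt x) (λ lk' → e (x<y ∷ lk'))
  ... | inj₂ refl = alternating-same f alt [] x t

  -- Sorting changes the value at most by a sign, and a sorted list that is not strictly increasing
  -- contains a repetition.
  alternating-vanishes : ∀ {P : List ℕ → Set} (f : List ℕ → R) → Alternating f → (∀ {t t'} → t ↭ t' → P t → P t') →
    (∀ t → Linked _<_ t → P t → f t ≡ 𝟘) → ∀ t → P t → f t ≡ 𝟘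
  alternating-vanishes f alt resp e t pt = alternating-↭ (↭-sym (sort-↭ t)) f alt
    (alternating-sorted (sort-↗ t) f alt (λ lk → e (sort t) lk (resp (↭-sym (sort-↭ t)) pt)))

  sgn : ℕ → ℕ → R
  sgn x y = if x <ᵇ y then 𝟙 else (if y <ᵇ x then ⊖ 𝟙 else 𝟘)

  sgn-swap : ∀ x y → sgn x y ≡ ⊖ sgn y x
  sgn-swap x y with x <ᵇ y in e₁ | y <ᵇ x in e₂
  ... | true | true = ⊥-elim (<-asym (<ᵇ-true⁻ {x} e₁) (<ᵇ-true⁻ {y} e₂))
  ... | true | false = sym (⊖-involutive 𝟙)
  ... | false | true = refl
  ... | false | false = sym ⊖-𝟘

  sgns : ℕ → List ℕ → R
  sgns x [] = 𝟙
  sgns x (y ∷ ys) = sgn x y ⊗ sgns x ys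

  -- The alternating indicator of the staircase (0 , 1 , … , N - 1), as a sign of Vandermonde type.
  staircase : ℕ → List ℕ → R
  staircase N [] = 𝟙
  staircase N (x ∷ xs) = (x <ᵇ N) ▷ (sgns x xs ⊗ staircase N xs)

  sgns-swap : ∀ z p x y t → sgns z (p ++ x ∷ y ∷ t) ≡ sgns z (p ++ y ∷ x ∷ t)
  sgns-swap z [] x y t = ⊗-left-comm _ _ _
  sgns-swap z (u ∷ p) x y t = cong (sgn z u ⊗_) (sgns-swap z p x y t)

  staircase-alternating : ∀ N → Alternating (staircase N)
  staircase-alternating N (z ∷ p) x y t = trans
    (cong ((z <ᵇ N) ▷_) (trans (cong₂ _⊗_ (sgns-swap z p x y t) (staircase-alternating N p x y t)) (sym (⊖-⊗ʳ _ _))))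
    (▷-⊖ (z <ᵇ N) _)
  staircase-alternating N [] x y t = trans (pull x y) (trans (trans (cong (λ b → (x <ᵇ N) ▷ (y <ᵇ N) ▷ b)
      (trans (cong₂ _⊗_ (sgn-swap x y) (⊗-left-comm _ _ _)) (sym (⊖-⊗ˡ _ _)))) (trans (▷-comm (x <ᵇ N) (y <ᵇ N) _)
        (trans (cong ((y <ᵇ N) ▷_) (▷-⊖ (x <ᵇ N) _)) (▷-⊖ (y <ᵇ N) _)))) (cong ⊖_ (sym (pull y x))))
    where
    pull : ∀ x y → staircase N (x ∷ y ∷ t) ≡ ((x <ᵇ N) ▷ (y <ᵇ N) ▷ (sgn x y ⊗ (sgns x t ⊗ (sgns y t ⊗ staircase N t))))
    pull x y = cong ((x <ᵇ N) ▷_) (trans (⊗-assoc _ _ _) (trans (cong (sgn x y ⊗_) (sym (▷-⊗ʳ (y <ᵇ N) _ _))) (sym (▷-⊗ʳ (y <ᵇ N) _ _))))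

  staircase-bounded : ∀ N → BoundedBy N (staircase N)
  staircase-bounded N [] x t le = ▷-false (<ᵇ-false le)
  staircase-bounded N (z ∷ p) x t le = ▷-zero (z <ᵇ N) (λ _ → ⊗-zeroʳ′ _ (staircase-bounded N p x t le))

  staircase-one : ∀ N t → Linked _<_ t → All (_< N) t → staircase N t ≡ 𝟙
  staircase-one N [] _ _ = refl
  staircase-one N (x ∷ t) lk (x<N ∷ bd) = trans (▷-true (<ᵇ-true x<N))
    (trans (cong₂ _⊗_ (signs lk) (staircase-one N t (Linked.tail lk) bd)) (⊗-identityˡ 𝟙))
    where
    signs : ∀ {x t} → Linked _<_ (x ∷ t) → sgns x t ≡ 𝟙
    signs [-] = refl
    signs {x} {y ∷ t} (x<y ∷ lk) = trans (cong₂ _⊗_ (cong (λ b → if b then 𝟙 else (if y <ᵇ x then ⊖ 𝟙 else 𝟘)) (<ᵇ-true x<y)) (signs (weaken x<y lk))) (⊗-identityˡ 𝟙)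
      where
      weaken : ∀ {x y t} → x < y → Linked _<_ (y ∷ t) → Linked _<_ (x ∷ t)
      weaken lt [-] = [-]
      weaken lt (lt' ∷ lk) = <-trans lt lt' ∷ lk

  -- The coefficients of x^α (α = reverse r) in the Schur functions of at most N rows, as an
  -- alternating function of the bead positions λ_i + N - i.
  schur : ℕ → List ℕ → List ℕ → R
  schur N [] = staircase N
  schur N (a ∷ r) = H a (schur N r)

  schur-alternating : ∀ N r → Alternating (schur N r)
  schur-alternating N [] = staircase-alternating N
  schur-alternating N (a ∷ r) = H-alternating a _ (schur-alternating N r)

  -- A lowering by a can start a positions higher; the additional `suc` makes the cut-off match the
  -- one in `pieri`.
  bound : ℕ → List ℕ → ℕ
  bound N [] = N
  bound N (a ∷ r) = suc (bound N r) + a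

  schur-bounded : ∀ N r → BoundedBy (suc (bound N r)) (schur (suc N) r)
  schur-bounded N [] = staircase-bounded (suc N)
  schur-bounded N (a ∷ r) p x t le = H-boundedBy a _ _ (schur-bounded N r) p x t (<⇒≤ le)

  -- Homogeneity: among lists of length N, the staircase function lives on rearrangements of 0, ...,
  -- N - 1, and each `H a` adds a to the sum of the positions.
  schur-size : ∀ N r t → length t ≡ N → sum t ≢ sum (range 0 N) + sum r → schur N r t ≡ 𝟘
  schur-size N [] t l ne = alternating-vanishes {λ t → length t ≡ N × sum t ≢ sum (range 0 N) + 0} (staircase N) (staircase-alternating N)
      (λ p (l , ne) → trans (sym (↭ₚ.↭-length p)) l , λ e → ne (trans (ActionProperties.sum-↭ p) e)) small t (l , ne)
    where
    small : ∀ t → Linked _<_ t → length t ≡ N × sum t ≢ sum (range 0 N) + 0 → staircase N t ≡ 𝟘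
    small t lk (refl , ne) with All.all? (λ x → x <? length t) t
    ... | yes bd = ⊥-elim (ne (trans (cong sum (ascending-range 0 lk (All.universal (λ _ → z≤n) t) bd)) (sym (+-identityʳ _))))
    ... | no ¬bd = big (staircase (length t)) (staircase-bounded (length t)) t ¬bd
      where
      big : ∀ {M} f → BoundedBy M f → ∀ s → ¬ All (_< M) s → f s ≡ 𝟘
      big f bdd [] na = ⊥-elim (na [])
      big {M} f bdd (x ∷ s) na with x <? M
      ... | no x≥M = bdd [] x s (≮⇒≥ x≥M)
      ... | yes x<M = big (f ∘ (x ∷_)) (λ p → bdd (x ∷ p)) s (λ al → na (x<M ∷ al))
  schur-size N (a ∷ r) t l ne = Down-zero≤ t (λ t' pw → ▷-zero (sum t ≡ᵇ sum t' + a) (λ e →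
    schur-size N r t' (trans (lengths pw) l) (λ e' → ne (trans (≡ᵇ-true e) (trans (cong (_+ a) e') (trans (+-assoc _ (sum r) a)
      (cong (sum (range 0 N) +_) (+-comm (sum r) a))))))))
    where
    lengths : ∀ {t' t} → Pointwise _≤_ t' t → length t' ≡ length t
    lengths [] = refl
    lengths (_ ∷ pw) = cong suc (lengths pw)

  -- The removal of a horizontal strip in terms of beads: each bead goes down but stays strictly
  -- above the old position of its lower neighbour.
  StripSum : ℕ → List ℕ → (List ℕ → R) → R
  StripSum lo [] φ = φ []
  StripSum lo (x ∷ xs) φ = ∑ (suc x ∸ lo) (λ d → StripSum (suc x) xs (φ ∘ ((lo + d) ∷_)))

  data Strip (lo : ℕ) : List ℕ → List ℕ → Set where
    [] : Strip lo [] []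
    cons : ∀ {x y xs ys} → lo ≤ y → y ≤ x → Strip (suc x) xs ys → Strip lo (x ∷ xs) (y ∷ ys)

  StripSum-cong : ∀ lo t {φ ψ : List ℕ → R} → (∀ t' → Strip lo t t' → φ t' ≡ ψ t') → StripSum lo t φ ≡ StripSum lo t ψ
  StripSum-cong lo [] e = e [] []
  StripSum-cong lo (x ∷ xs) e = ∑-cong< (suc x ∸ lo) (λ d lt → StripSum-cong (suc x) xs (λ t' st →
    e _ (cons (m≤m+n lo d) (s≤s⁻¹ (subst (_≤ suc x) (trans (+-comm (suc d) lo) (+-suc lo d)) (m≤o∸n⇒m+n≤o (suc d) (lo≤ d lt) lt))) st)))
    where
    lo≤ : ∀ d → d < suc x ∸ lo → lo ≤ suc x
    lo≤ d lt with lo ≤? suc x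
    ... | yes le = le
    ... | no gt = ⊥-elim (n≮0 (subst (d <_) (m≤n⇒m∸n≡0 (<⇒≤ (≰⇒> gt))) lt))

  StripSum-zero : ∀ lo t {φ : List ℕ → R} → (∀ t' → Strip lo t t' → φ t' ≡ 𝟘) → StripSum lo t φ ≡ 𝟘
  StripSum-zero lo t e = trans (StripSum-cong lo t e) (constant lo t)
    where
    constant : ∀ lo t → StripSum lo t (λ _ → 𝟘) ≡ 𝟘
    constant lo [] = refl
    constant lo (x ∷ t) = trans (∑L-cong (upTo (suc x ∸ lo)) (λ d → constant (suc x) t)) (∑L-zero (upTo (suc x ∸ lo)))

  StripSum-⊖ : ∀ lo t (φ : List ℕ → R) → StripSum lo t (λ t' → ⊖ φ t') ≡ ⊖ StripSum lo t φ
  StripSum-⊖ lo [] φ = refl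
  StripSum-⊖ lo (x ∷ xs) φ =
    trans (∑L-cong (upTo (suc x ∸ lo)) (λ d → StripSum-⊖ (suc x) xs (φ ∘ ((lo + d) ∷_)))) (∑L-⊖ (upTo (suc x ∸ lo)) _)

  -- Lowered positions y₁ ≤ x₀ and y₀ ≤ x₀ cancel in pairs, from the top bead downwards.
  Down-strip : ∀ t φ → Alternating φ → Linked _<_ t → Down t φ ≡ StripSum 0 t φ
  Down-strip [] φ alt lk = refl
  Down-strip (x ∷ []) φ alt lk = refl
  Down-strip (x ∷ x' ∷ t) φ alt (x<x' ∷ lk) = begin
    ∑ (suc x) (λ y → Down (x' ∷ t) (φ ∘ (y ∷_)))
      ≡⟨ ∑L-cong (upTo (suc x)) (λ y → Down-strip (x' ∷ t) (φ ∘ (y ∷_)) (alternating-∷ φ alt y) lk) ⟩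
    ∑ (suc x) (λ y → ∑ (suc x') (S y))
      ≡⟨ ∑L-cong (upTo (suc x)) (λ y → trans (cong (λ n → ∑ n (S y)) (sym (m+[n∸m]≡n (s≤s (<⇒≤ x<x'))))) (∑-+ (suc x) (suc x' ∸ suc x) (S y))) ⟩
    ∑ (suc x) (λ y → ∑ (suc x) (S y) ⊕ ∑ (suc x' ∸ suc x) (λ d → S y (suc x + d)))
      ≡⟨ ∑L-⊕ (upTo (suc x)) _ _ ⟩
    ∑ (suc x) (λ y → ∑ (suc x) (S y)) ⊕ ∑ (suc x) (λ y → ∑ (suc x' ∸ suc x) (λ d → S y (suc x + d)))
      ≡⟨ ⊕-identityˡ′ _ (∑L-antisym (upTo (suc x)) S (λ y y' →
           trans (StripSum-cong (suc x') t (λ t' _ → alt [] y y' t')) (StripSum-⊖ (suc x') t _))) ⟩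
    ∑ (suc x) (λ y → ∑ (suc x' ∸ suc x) (λ d → S y (suc x + d))) ∎
    where
    open ≡-Reasoning
    S : ℕ → ℕ → R
    S y y' = StripSum (suc x') t (λ t' → φ (y ∷ y' ∷ t'))

  H-strip : ∀ a f t → Alternating f → Linked _<_ t → H a f t ≡ StripSum 0 t (λ t' → (sum t ≡ᵇ sum t' + a) ▷ f t')
  H-strip a f t alt lk = Down-strip t _ (λ p x y t' → trans
    (cong₂ _▷_ (cong (λ n → sum t ≡ᵇ n + a) (sum-swap p x y t')) (alt p x y t')) (▷-⊖ (sum t ≡ᵇ sum (p ++ y ∷ x ∷ t') + a) _)) lk

  strip-length : ∀ {lo t t'} → Strip lo t t' → length t' ≡ length t
  strip-length [] = refl
  strip-length (cons _ _ st) = cong suc (strip-length st)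

  strip-ascending : ∀ {lo t t'} → Strip lo t t' → Linked _<_ t'
  strip-ascending [] = []
  strip-ascending (cons _ _ []) = [-]
  strip-ascending (cons _ y≤x (cons x<y' le st)) = ≤-<-trans y≤x x<y' ∷ strip-ascending (cons x<y' le st)

  strip-at : ∀ {lo t t'} → Strip lo t t' → ∀ k → suc k < length t → at t k < at t' (suc k)
  strip-at (cons _ _ (cons lt _ _)) zero _ = lt
  strip-at (cons _ _ st) (suc k) (s≤s lt) = strip-at st k lt
  strip-at (cons _ _ []) zero (s≤s ())

  -- A Schur function of `length r` variables vanishes for more than `length r` rows. Here
  -- `k < at t k` says that the beads k, ..., N, one too many, are raised above the staircase; by
  -- `strip-at` a strip passes this on to k + 1, one variable fewer.
  schur-rows : ∀ N r t k → k + length r ≡ N → Linked _<_ t → length t ≡ suc N → k < at t k → schur (suc N) r t ≡ 𝟘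
  schur-rows N [] t k refl lk l lt
    with p , q , e ← split-at t k (subst (k <_) (sym l) (s≤s (m≤m+n k 0))) =
    subst (λ s → staircase (suc (k + 0)) s ≡ 𝟘) (sym e) (staircase-bounded _ p (at t k) q (subst (λ n → suc n ≤ at t k) (sym (+-identityʳ k)) lt))
  schur-rows N (a ∷ r) t k eq lk l lt = trans (H-strip a _ t (schur-alternating (suc N) r) lk)
    (StripSum-zero 0 t (λ t' st → ▷-zero (sum t ≡ᵇ sum t' + a) (λ _ →
      schur-rows N r t' (suc k) (trans (sym (+-suc k _)) eq) (strip-ascending st) (trans (strip-length st) l)
        (≤-trans (s≤s lt) (strip-at st k (subst (suc k <_) (sym l) (s≤s (subst (suc k ≤_) eq (m<m+n k (s≤s z≤n))))))))))

  -- With no bead at 0 all N + 1 rows are non-empty, more than there are variables. This is the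
  -- hypothesis of `pieri`.
  schur-no-zero : ∀ N r → length r ≤ N → ∀ t → length t ≡ suc N → All (1 ≤_) t → schur (suc N) r t ≡ 𝟘
  schur-no-zero N r le t l pos = alternating-vanishes {λ t → length t ≡ suc N × All (1 ≤_) t} _ (schur-alternating (suc N) r)
    (λ p (l , pos) → trans (sym (↭ₚ.↭-length p)) l , ↭ₚ.All-resp-↭ p pos)
    (λ t lk (l , pos) → schur-rows N r t (N ∸ length r) (m∸n+n≡m le) lk l
       (ascending-at 1 lk pos (N ∸ length r) (subst (N ∸ length r <_) (sym l) (s≤s (m∸n≤m N (length r))))))
    t (l , pos)

-- Semistandard tableaux and their beads

headOr0 : List ℕ → ℕ
headOr0 [] = 0
headOr0 (x ∷ _) = x

lastOr : ℕ → List ℕ → ℕ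
lastOr p [] = p
lastOr p (x ∷ xs) = lastOr x xs

lastOr-∷ʳ : ∀ p xs x → lastOr p (xs ∷ʳ x) ≡ x
lastOr-∷ʳ p [] x = refl
lastOr-∷ʳ p (y ∷ xs) x = lastOr-∷ʳ y xs x

lastOr-reverse : ∀ ρ → lastOr 0 (reverse ρ) ≡ headOr0 ρ
lastOr-reverse [] = refl
lastOr-reverse (x ∷ ρ) = trans (cong (lastOr 0) (unfold-reverse x ρ)) (lastOr-∷ʳ 0 (reverse ρ) x)

addIndex : ℕ → List ℕ → List ℕ
addIndex j [] = []
addIndex j (x ∷ xs) = x + j ∷ addIndex (suc j) xs

-- Rows are listed from the top, beads in increasing order.
beads : List ℕ → List ℕ
beads ρ = addIndex 0 (reverse ρ)

addIndex-∷ʳ : ∀ j σ x → addIndex j (σ ∷ʳ x) ≡ addIndex j σ ∷ʳ (x + (j + length σ))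
addIndex-∷ʳ j [] x = cong (λ n → x + n ∷ []) (sym (+-identityʳ j))
addIndex-∷ʳ j (y ∷ σ) x = cong (y + j ∷_) (trans (addIndex-∷ʳ (suc j) σ x) (cong (λ n → addIndex (suc j) σ ∷ʳ (x + n)) (sym (+-suc j _))))

sum-addIndex : ∀ j σ → sum (addIndex j σ) ≡ sum σ + sum (range j (length σ))
sum-addIndex j [] = refl
sum-addIndex j (x ∷ σ) = begin
  x + j + sum (addIndex (suc j) σ)                       ≡⟨ cong (x + j +_) (sum-addIndex (suc j) σ) ⟩
  x + j + (sum σ + sum (range (suc j) (length σ)))       ≡⟨ +-assoc x j _ ⟩
  x + (j + (sum σ + sum (range (suc j) (length σ))))     ≡⟨ cong (x +_) (trans (sym (+-assoc j _ _)) (trans (cong (_+ sum (range (suc j) (length σ))) (+-comm j (sum σ))) (+-assoc (sum σ) j _))) ⟩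
  x + (sum σ + (j + sum (range (suc j) (length σ))))     ≡⟨ sym (+-assoc x _ _) ⟩
  x + sum σ + (j + sum (range (suc j) (length σ))) ∎
  where open ≡-Reasoning

sum-reverse : ∀ xs → sum (reverse xs) ≡ sum xs
sum-reverse xs = ActionProperties.sum-↭ (↭ₚ.↭-reverse xs)

sum-beads : ∀ ρ → sum (beads ρ) ≡ sum ρ + sum (range 0 (length ρ))
sum-beads ρ = trans (sum-addIndex 0 (reverse ρ)) (cong₂ (λ s l → s + sum (range 0 l)) (sum-reverse ρ) (length-reverse ρ))

Linked-∷ʳ : ∀ {p σ x} → Linked _≤_ (p ∷ σ) → lastOr p σ ≤ x → Linked _≤_ (p ∷ σ ∷ʳ x)
Linked-∷ʳ {σ = []} lk le = le ∷ [-]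
Linked-∷ʳ {σ = y ∷ σ} (le' ∷ lk) le = le' ∷ Linked-∷ʳ lk le

descending-head : ∀ {x ρ} → Linked _≥_ (x ∷ ρ) → headOr0 ρ ≤ x
descending-head [-] = z≤n
descending-head (le ∷ _) = le

reverse-ascending : ∀ ρ → Linked _≥_ ρ → Linked _≤_ (0 ∷ reverse ρ)
reverse-ascending [] lk = [-]
reverse-ascending (x ∷ ρ) lk = subst (λ l → Linked _≤_ (0 ∷ l)) (sym (unfold-reverse x ρ))
  (Linked-∷ʳ (reverse-ascending ρ (Linked.tail lk)) (subst (_≤ x) (sym (lastOr-reverse ρ)) (descending-head lk)))

addIndex-ascending : ∀ j {σ} → Linked _≤_ σ → Linked _<_ (addIndex j σ)
addIndex-ascending j [] = []
addIndex-ascending j [-] = [-]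
addIndex-ascending j {x ∷ y ∷ σ} (le ∷ lk) = subst (x + j <_) (sym (+-suc y j)) (s≤s (+-monoˡ-≤ j le)) ∷ addIndex-ascending (suc j) lk

beads-ascending : ∀ ρ → Linked _≥_ ρ → Linked _<_ (beads ρ)
beads-ascending ρ lk = addIndex-ascending 0 (Linked.tail (reverse-ascending ρ lk))

-- Tests the lower bounds only; the upper bounds y ≤ x come from `Down`.
interlaced : List ℕ → List ℕ → Bool
interlaced (x ∷ ρ) (y ∷ ν) = (headOr0 ρ ≤ᵇ y) ∧ interlaced ρ ν
interlaced _ _ = true

data Interlaced : List ℕ → List ℕ → Set where
  [] : Interlaced [] []
  cons : ∀ {x y ρ ν} → headOr0 ρ ≤ y → y ≤ x → Interlaced ρ ν → Interlaced (x ∷ ρ) (y ∷ ν)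

Interlaced-length : ∀ {ρ ν} → Interlaced ρ ν → length ν ≡ length ρ
Interlaced-length [] = refl
Interlaced-length (cons _ _ i) = cong suc (Interlaced-length i)

Interlaced-descending : ∀ {ρ ν} → Interlaced ρ ν → Linked _≥_ ν
Interlaced-descending [] = []
Interlaced-descending (cons _ _ []) = [-]
Interlaced-descending (cons le _ (cons le' y≤x i)) = ≤-trans y≤x le ∷ Interlaced-descending (cons le' y≤x i)

pad : ℕ → ℕ → List ℕ → List ℕ
pad m x w = w ++ replicate (x ∸ length w) m

-- A tableau of shape ρ is one of shape ν ⊆ ρ with entries < m, extended by entries m in each row.
extend : ℕ → List ℕ → List (List ℕ) → List (List ℕ)
extend m (x ∷ ρ) (w ∷ t) = pad m x w ∷ extend m ρ t
extend m _ _ = []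

data Filling (ℓ : ℕ) : List ℕ → List (List ℕ) → Set where
  [] : Filling ℓ [] []
  cons : ∀ {x w ν t} → length w ≡ x → All (λ e → suc e ≤ suc ℓ) w → Filling ℓ ν t → Filling ℓ (x ∷ ν) (w ∷ t)

words-member : ∀ k ℓ w → w ∈ words k ℓ → length w ≡ k × All (_≤ ℓ) w
words-member zero ℓ w (here refl) = refl , []
words-member (suc k) ℓ w w∈ with ∈ₚ.∈-concatMap⁻ (λ a → map (a ∷_) (words k ℓ)) {xs = map suc (upTo ℓ)} w∈
... | x∈ = go (find x∈)
  where
  go : (∃ λ a → a ∈ map suc (upTo ℓ) × w ∈ map (a ∷_) (words k ℓ)) → length w ≡ suc k × All (_≤ ℓ) w
  go (a , a∈ , w∈) with w' , w'∈ , refl ← ∈ₚ.∈-map⁻ (a ∷_) w∈ | i , i∈ , refl ← ∈ₚ.∈-map⁻ suc a∈ =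
    let l , al = words-member k ℓ w' w'∈ in cong suc l , ∈ₚ.∈-upTo⁻ i∈ ∷ al

fillings-member : ∀ ν ℓ t → t ∈ fillings ν ℓ → Filling ℓ ν t
fillings-member [] ℓ t (here refl) = []
fillings-member (x ∷ ν) ℓ t t∈ = go (find (∈ₚ.∈-concatMap⁻ (λ w → map (w ∷_) (fillings ν ℓ)) {xs = words x ℓ} t∈))
  where
  go : (∃ λ w → w ∈ words x ℓ × t ∈ map (w ∷_) (fillings ν ℓ)) → Filling ℓ (x ∷ ν) t
  go (w , w∈ , t∈) with t' , t'∈ , refl ← ∈ₚ.∈-map⁻ (w ∷_) t∈ =
    let l , al = words-member x ℓ w w∈ in cons l (All.map s≤s al) (fillings-member ν ℓ t' t'∈)

strictBelow-[] : ∀ u → strictBelow u [] ≡ true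
strictBelow-[] [] = refl
strictBelow-[] (_ ∷ _) = refl

≤ᵇ-suc : ∀ k l → (k ≤ᵇ l) ≡ (suc k ≤ᵇ suc l)
≤ᵇ-suc zero l = refl
≤ᵇ-suc (suc k) l = refl

strictBelow-replicate-replicate : ∀ j k m → strictBelow (replicate j m) (replicate (suc k) m) ≡ false
strictBelow-replicate-replicate zero k m = refl
strictBelow-replicate-replicate (suc j) k m rewrite <ᵇ-false (≤-refl {m}) = refl

-- Nothing exceeds m, so no entry m of the upper row can have a cell below it: the whole padded
-- lower row must fit under the old part of the upper row. This is the horizontal strip condition.
strictBelow-pad : ∀ m u v j k → All (_< m) u → All (_< m) v →
  strictBelow (u ++ replicate j m) (v ++ replicate k m) ≡ (length v + k ≤ᵇ length u) ∧ strictBelow u v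
strictBelow-pad m [] [] j zero _ _ = strictBelow-[] (replicate j m)
strictBelow-pad m [] [] j (suc k) _ _ = strictBelow-replicate-replicate j k m
strictBelow-pad m [] (y ∷ v) zero k _ _ = refl
strictBelow-pad m [] (y ∷ v) (suc j) k _ (y<m ∷ _) rewrite <ᵇ-false (<⇒≤ y<m) = refl
strictBelow-pad m (x ∷ u) [] j zero _ _ = refl
strictBelow-pad m (x ∷ u) [] j (suc k) (x<m ∷ au) _ rewrite <ᵇ-true x<m =
  trans (strictBelow-pad m u [] j k au []) (trans (cong ((k ≤ᵇ length u) ∧_) (strictBelow-[] u)) (cong (_∧ true) (≤ᵇ-suc k (length u))))
strictBelow-pad m (x ∷ u) (y ∷ v) j k (_ ∷ au) (_ ∷ av) =
  trans (cong ((x <ᵇ y) ∧_) (strictBelow-pad m u v j k au av)) (shuffle (x <ᵇ y) (length v + k) (length u) (strictBelow u v))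
  where
  shuffle : ∀ a p q c → (a ∧ ((p ≤ᵇ q) ∧ c)) ≡ ((suc p ≤ᵇ suc q) ∧ (a ∧ c))
  shuffle true zero q c = refl
  shuffle true (suc p) q c = refl
  shuffle false zero q c = refl
  shuffle false (suc p) q c with p <ᵇ q
  ... | true = refl
  ... | false = refl

columnsStrict-extend : ∀ ℓ {ρ ν t} → Filling ℓ ν t → Pointwise _≤_ ν ρ →
  columnsStrict (extend (suc ℓ) ρ t) ≡ interlaced ρ ν ∧ columnsStrict t
columnsStrict-extend ℓ [] [] = refl
columnsStrict-extend ℓ (cons _ _ []) (_ ∷ []) = refl
columnsStrict-extend ℓ {x ∷ x' ∷ ρ} {y ∷ y' ∷ ν} {w ∷ w' ∷ t} (cons refl aw (cons refl aw' fl)) (y≤x ∷ y'≤x' ∷ pw) = trans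
  (cong₂ _∧_ (trans (strictBelow-pad (suc ℓ) w w' _ _ aw aw') (cong (λ n → (n ≤ᵇ length w) ∧ strictBelow w w') (m+[n∸m]≡n y'≤x')))
             (columnsStrict-extend ℓ (cons refl aw' fl) (y'≤x' ∷ pw)))
  (interchange (x' ≤ᵇ length w) (strictBelow w w') (interlaced (x' ∷ ρ) (length w' ∷ ν)) _)
  where
  interchange : ∀ a b c d → ((a ∧ b) ∧ (c ∧ d)) ≡ ((a ∧ c) ∧ (b ∧ d))
  interchange true true c d = refl
  interchange true false true d = refl
  interchange true false false d = refl
  interchange false b c d = refl

count-++ : ∀ x xs ys → count x (xs ++ ys) ≡ count x xs + count x ys
count-++ x [] ys = refl
count-++ x (y ∷ xs) ys with x ≡ᵇ y
... | true = cong suc (count-++ x xs ys)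
... | false = count-++ x xs ys

count-replicate : ∀ x k → count x (replicate k x) ≡ k
count-replicate x zero = refl
count-replicate x (suc k) rewrite ≡ᵇ-refl x = cong suc (count-replicate x k)

count-absent : ∀ x xs → All (x ≢_) xs → count x xs ≡ 0
count-absent x [] _ = refl
count-absent x (y ∷ xs) (ne ∷ al) rewrite ≡ᵇ-false ne = count-absent x xs al

count-extend-old : ∀ {ℓ ρ ν t} → Filling ℓ ν t → Pointwise _≤_ ν ρ → ∀ x → x ≢ suc ℓ →
  count x (concat (extend (suc ℓ) ρ t)) ≡ count x (concat t)
count-extend-old [] [] x ne = refl
count-extend-old {ℓ} {x' ∷ ρ} {t = w ∷ t} (cons _ _ fl) (_ ∷ pw) x ne = begin
  count x (pad (suc ℓ) x' w ++ concat (extend (suc ℓ) ρ t))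
    ≡⟨ count-++ x (pad (suc ℓ) x' w) _ ⟩
  count x (pad (suc ℓ) x' w) + count x (concat (extend (suc ℓ) ρ t))
    ≡⟨ cong₂ _+_ (trans (count-++ x w _) (trans (cong (count x w +_) (count-absent x _ (absent (x' ∸ length w)))) (+-identityʳ _)))
                 (count-extend-old fl pw x ne) ⟩
  count x w + count x (concat t)
    ≡⟨ sym (count-++ x w _) ⟩
  count x (concat (w ∷ t)) ∎
  where
  open ≡-Reasoning
  absent : ∀ k → All (x ≢_) (replicate k (suc ℓ))
  absent zero = []
  absent (suc k) = ne ∷ absent k

count-extend-new : ∀ {ℓ ρ ν t} → Filling ℓ ν t → Pointwise _≤_ ν ρ →
  count (suc ℓ) (concat (extend (suc ℓ) ρ t)) + sum ν ≡ sum ρ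
count-extend-new [] [] = refl
count-extend-new {ℓ} {x ∷ ρ} {.(length w) ∷ ν} {w ∷ t} (cons refl aw fl) (y≤x ∷ pw) = begin
  count (suc ℓ) (pad (suc ℓ) x w ++ concat (extend (suc ℓ) ρ t)) + (length w + sum ν)
    ≡⟨ cong (_+ (length w + sum ν)) (trans (count-++ (suc ℓ) (pad (suc ℓ) x w) _) (cong (_+ c) (trans (count-++ (suc ℓ) w _)
         (cong₂ _+_ (count-absent (suc ℓ) w (All.map (λ lt e → <⇒≢ lt (sym e)) aw)) (count-replicate (suc ℓ) (x ∸ length w)))))) ⟩
  (x ∸ length w) + c + (length w + sum ν)
    ≡⟨ +-assoc (x ∸ length w) c _ ⟩
  (x ∸ length w) + (c + (length w + sum ν))
    ≡⟨ cong ((x ∸ length w) +_) (trans (sym (+-assoc c _ _)) (trans (cong (_+ sum ν) (+-comm c _)) (+-assoc (length w) c _))) ⟩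
  (x ∸ length w) + (length w + (c + sum ν))
    ≡⟨ trans (sym (+-assoc (x ∸ length w) _ _)) (cong₂ _+_ (m∸n+n≡m y≤x) (count-extend-new fl pw)) ⟩
  x + sum ρ ∎
  where
  open ≡-Reasoning
  c = count (suc ℓ) (concat (extend (suc ℓ) ρ t))

length-concat-filling : ∀ {ℓ ν t} → Filling ℓ ν t → length (concat t) ≡ sum ν
length-concat-filling [] = refl
length-concat-filling {t = w ∷ t} (cons refl _ fl) = trans (length-++ w) (cong (length w +_) (length-concat-filling fl))

length-concat-extend : ∀ {ℓ ρ ν t} → Filling ℓ ν t → Pointwise _≤_ ν ρ → length (concat (extend (suc ℓ) ρ t)) ≡ sum ρ
length-concat-extend [] [] = refl
length-concat-extend {ℓ} {x ∷ ρ} {t = w ∷ t} (cons refl _ fl) (y≤x ∷ pw) = trans (length-++ (pad (suc ℓ) x w)) (cong₂ _+_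
  (trans (length-++ w) (trans (cong (length w +_) (length-replicate (x ∸ length w))) (m+[n∸m]≡n y≤x))) (length-concat-extend fl pw))

at-∷ʳ-< : ∀ α a j → j < length α → at (α ∷ʳ a) j ≡ at α j
at-∷ʳ-< (x ∷ α) a zero _ = refl
at-∷ʳ-< (x ∷ α) a (suc j) (s≤s lt) = at-∷ʳ-< α a j lt

at-∷ʳ-last : ∀ α a → at (α ∷ʳ a) (length α) ≡ a
at-∷ʳ-last [] a = refl
at-∷ʳ-last (x ∷ α) a = at-∷ʳ-last α a

and-map-cong : ∀ {A : Set} {f g : A → Bool} xs → (∀ x → x ∈ xs → f x ≡ g x) → and (map f xs) ≡ and (map g xs)
and-map-cong [] e = refl
and-map-cong (x ∷ xs) e = cong₂ _∧_ (e x (here refl)) (and-map-cong xs (λ y m → e y (there m)))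

and-++ : ∀ xs ys → and (xs ++ ys) ≡ and xs ∧ and ys
and-++ [] ys = refl
and-++ (true ∷ xs) ys = and-++ xs ys
and-++ (false ∷ xs) ys = refl

sum-∷ʳ : ∀ xs x → sum (xs ∷ʳ x) ≡ sum xs + x
sum-∷ʳ xs x = trans (ActionProperties.sum-++ xs (x ∷ [])) (cong (sum xs +_) (+-identityʳ x))

-- The new letter fills exactly the cells of ρ outside ν, so its multiplicity is a exactly when the
-- sizes differ by a.
hasContent-extend : ∀ α a {ρ ν t} → Filling (length α) ν t → Pointwise _≤_ ν ρ →
  hasContent (α ∷ʳ a) (extend (suc (length α)) ρ t) ≡ (sum ρ ≡ᵇ sum ν + a) ∧ hasContent α t
hasContent-extend α a {ρ} {ν} {t} fl pw = begin
  and (map f' (upTo (length (α ∷ʳ a)))) ∧ (length (concat t') ≡ᵇ sum (α ∷ʳ a))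
    ≡⟨ cong₂ (λ n s → and (map f' n) ∧ (s ≡ᵇ sum (α ∷ʳ a)))
         (trans (cong upTo (trans (length-++ α) (+-comm (length α) 1))) (sym (upTo-∷ʳ (length α)))) (length-concat-extend fl pw) ⟩
  and (map f' (upTo (length α) ∷ʳ length α)) ∧ (sum ρ ≡ᵇ sum (α ∷ʳ a))
    ≡⟨ cong₂ _∧_ (trans (cong and (map-++ f' (upTo (length α)) _)) (trans (and-++ (map f' (upTo (length α))) _)
         (cong₂ _∧_ (and-map-cong (upTo (length α)) old) new))) (cong (sum ρ ≡ᵇ_) (sum-∷ʳ α a)) ⟩
  (and (map f (upTo (length α))) ∧ (c ≡ᵇ a) ∧ true) ∧ (sum ρ ≡ᵇ sum α + a)
    ≡⟨ rearrange (and (map f (upTo (length α)))) ⟩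
  (sum ρ ≡ᵇ sum ν + a) ∧ (and (map f (upTo (length α))) ∧ (sum ν ≡ᵇ sum α))
    ≡⟨ cong (λ n → (sum ρ ≡ᵇ sum ν + a) ∧ (and (map f (upTo (length α))) ∧ (n ≡ᵇ sum α))) (sym (length-concat-filling fl)) ⟩
  (sum ρ ≡ᵇ sum ν + a) ∧ hasContent α t ∎
  where
  open ≡-Reasoning
  t' = extend (suc (length α)) ρ t
  c = count (suc (length α)) (concat t')
  f f' : ℕ → Bool
  f' j = count (suc j) (concat t') ≡ᵇ at (α ∷ʳ a) j
  f j = count (suc j) (concat t) ≡ᵇ at α j
  old : ∀ j → j ∈ upTo (length α) → f' j ≡ f j
  old j j∈ = let lt = ∈ₚ.∈-upTo⁻ j∈ in
    cong₂ _≡ᵇ_ (count-extend-old fl pw (suc j) (λ e → <⇒≢ lt (suc-injective e))) (at-∷ʳ-< α a j lt)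
  new : f' (length α) ∧ true ≡ (c ≡ᵇ a) ∧ true
  new = cong (λ n → (c ≡ᵇ n) ∧ true) (at-∷ʳ-last α a)
  arith : ((c ≡ᵇ a) ∧ (sum ρ ≡ᵇ sum α + a)) ≡ ((sum ρ ≡ᵇ sum ν + a) ∧ (sum ν ≡ᵇ sum α))
  arith = true-iff
    (λ e → let e₁ , e₂ = ∧-true {c ≡ᵇ a} e
               c≡a = ≡ᵇ-true {c} e₁
               ρ≡ = trans (sym (count-extend-new fl pw)) (trans (cong (_+ sum ν) c≡a) (+-comm a (sum ν)))
           in cong₂ _∧_ (trans (cong (_≡ᵇ sum ν + a) ρ≡) (≡ᵇ-refl (sum ν + a)))
                (trans (cong (sum ν ≡ᵇ_) (+-cancelʳ-≡ a (sum α) (sum ν) (trans (sym (≡ᵇ-true {sum ρ} e₂)) ρ≡))) (≡ᵇ-refl (sum ν))))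
    (λ e → let e₁ , e₂ = ∧-true {sum ρ ≡ᵇ sum ν + a} e
               ρ≡ = ≡ᵇ-true {sum ρ} e₁
               ν≡α = ≡ᵇ-true {sum ν} e₂
           in cong₂ _∧_ (trans (cong (_≡ᵇ a) (+-cancelʳ-≡ (sum ν) c a (trans (count-extend-new fl pw) (trans ρ≡ (+-comm (sum ν) a))))) (≡ᵇ-refl a))
                (trans (cong₂ _≡ᵇ_ ρ≡ (cong (_+ a) (sym ν≡α))) (≡ᵇ-refl (sum ν + a))))
  rearrange : ∀ b → ((b ∧ (c ≡ᵇ a) ∧ true) ∧ (sum ρ ≡ᵇ sum α + a)) ≡ ((sum ρ ≡ᵇ sum ν + a) ∧ (b ∧ (sum ν ≡ᵇ sum α)))
  rearrange true = trans (cong (_∧ (sum ρ ≡ᵇ sum α + a)) (drop (c ≡ᵇ a))) arith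
    where
    drop : ∀ b → b ∧ true ≡ b
    drop true = refl
    drop false = refl
  rearrange false with sum ρ ≡ᵇ sum ν + a
  ... | true = refl
  ... | false = refl

-- The branching rule for Schur functions

module Tableaux (𝓡 : TorsionFreeRing) where
  open TorsionFreeRing 𝓡
  open Sums 𝓡
  open Lowering 𝓡
  open Alternants 𝓡

  Down-∑L : ∀ {A : Set} ρ (xs : List A) (f : A → List ℕ → R) →
    Down ρ (λ ν → ∑L xs (λ x → f x ν)) ≡ ∑L xs (λ x → Down ρ (f x))
  Down-∑L [] xs f = refl
  Down-∑L (x ∷ ρ) xs f =
    trans (∑L-cong (upTo (suc x)) (λ y → Down-∑L ρ xs (λ a → f a ∘ (y ∷_)))) (∑L-swap (upTo (suc x)) xs _)

  Down-▷ : ∀ ρ b (φ : List ℕ → R) → Down ρ (λ ν → b ▷ φ ν) ≡ (b ▷ Down ρ φ)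
  Down-▷ ρ true φ = refl
  Down-▷ ρ false φ = Down-zero ρ (λ _ → refl)

  Down-cong≤ : ∀ ρ {φ ψ : List ℕ → R} → (∀ ν → Pointwise _≤_ ν ρ → φ ν ≡ ψ ν) → Down ρ φ ≡ Down ρ ψ
  Down-cong≤ [] e = e [] []
  Down-cong≤ (x ∷ ρ) e = ∑-cong< (suc x) (λ { y (s≤s le) → Down-cong≤ ρ (λ ν pw → e (y ∷ ν) (le ∷ pw)) })

  ∑-words-suc : ∀ k ℓ (φ : List ℕ → R) → ∑L (words (suc k) ℓ) φ ≡ ∑ ℓ (λ i → ∑L (words k ℓ) (λ w → φ (suc i ∷ w)))
  ∑-words-suc k ℓ φ = trans (∑L-concatMap (λ a → map (a ∷_) (words k ℓ)) (map suc (upTo ℓ)) φ)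
    (trans (∑L-map suc (upTo ℓ) _) (∑L-cong (upTo ℓ) (λ i → ∑L-map (suc i ∷_) (words k ℓ) φ)))

  ∑-words-maximal : ∀ k ℓ (φ : List ℕ → R) →
    ∑L (words k (suc ℓ)) (λ w → weaklyIncreasing (suc ℓ ∷ w) ▷ φ w) ≡ φ (replicate k (suc ℓ))
  ∑-words-maximal zero ℓ φ = ⊕-identityʳ _
  ∑-words-maximal (suc k) ℓ φ = begin
    ∑L (words (suc k) (suc ℓ)) (λ w → weaklyIncreasing (suc ℓ ∷ w) ▷ φ w)
      ≡⟨ trans (∑-words-suc k (suc ℓ) _) (∑-last ℓ _) ⟩
    ∑ ℓ (λ i → ∑L (words k (suc ℓ)) (λ w → ((suc ℓ ≤ᵇ suc i) ∧ weaklyIncreasing (suc i ∷ w)) ▷ φ (suc i ∷ w))) ⊕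
      ∑L (words k (suc ℓ)) (λ w → ((suc ℓ ≤ᵇ suc ℓ) ∧ weaklyIncreasing (suc ℓ ∷ w)) ▷ φ (suc ℓ ∷ w))
      ≡⟨ ⊕-identityˡ′ _ (∑-zero< ℓ (λ i lt → trans (∑L-cong (words k (suc ℓ)) (λ w →
           cong (λ b → (b ∧ weaklyIncreasing (suc i ∷ w)) ▷ φ (suc i ∷ w)) (≤ᵇ-false (s≤s lt)))) (∑L-zero (words k (suc ℓ))))) ⟩
    ∑L (words k (suc ℓ)) (λ w → ((suc ℓ ≤ᵇ suc ℓ) ∧ weaklyIncreasing (suc ℓ ∷ w)) ▷ φ (suc ℓ ∷ w))
      ≡⟨ ∑L-cong (words k (suc ℓ)) (λ w → cong (λ b → (b ∧ weaklyIncreasing (suc ℓ ∷ w)) ▷ φ (suc ℓ ∷ w)) (≤ᵇ-true (≤-refl {suc ℓ}))) ⟩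
    ∑L (words k (suc ℓ)) (λ w → weaklyIncreasing (suc ℓ ∷ w) ▷ φ (suc ℓ ∷ w))
      ≡⟨ ∑-words-maximal k ℓ (φ ∘ (suc ℓ ∷_)) ⟩
    φ (replicate (suc k) (suc ℓ)) ∎
    where open ≡-Reasoning

  -- A weakly increasing word consists of c letters below the maximal one, followed by maximal
  -- letters only; x is the letter preceding the word.
  ∑-words-from : ∀ x k ℓ (φ : List ℕ → R) → x ≤ ℓ →
    ∑L (words k (suc ℓ)) (λ w → weaklyIncreasing (x ∷ w) ▷ φ w) ≡
    ∑ (suc k) (λ c → ∑L (words c ℓ) (λ w → weaklyIncreasing (x ∷ w) ▷ φ (pad (suc ℓ) k w)))
  ∑-words-from x zero ℓ φ x≤ℓ = trans (⊕-identityʳ (φ [])) (sym (trans (⊕-identityʳ _) (⊕-identityʳ _)))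
  ∑-words-from x (suc k) ℓ φ x≤ℓ = begin
    ∑L (words (suc k) (suc ℓ)) (λ w → weaklyIncreasing (x ∷ w) ▷ φ w)
      ≡⟨ trans (∑-words-suc k (suc ℓ) _) (∑-last ℓ _) ⟩
    ∑ ℓ (λ i → ∑L (words k (suc ℓ)) (λ w → ((x ≤ᵇ suc i) ∧ weaklyIncreasing (suc i ∷ w)) ▷ φ (suc i ∷ w))) ⊕
      ∑L (words k (suc ℓ)) (λ w → ((x ≤ᵇ suc ℓ) ∧ weaklyIncreasing (suc ℓ ∷ w)) ▷ φ (suc ℓ ∷ w))
      ≡⟨ cong₂ _⊕_ (∑-cong< ℓ first) last ⟩
    ∑ ℓ (λ i → ∑ (suc k) (λ c → G c i)) ⊕ φ (replicate (suc k) (suc ℓ))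
      ≡⟨ trans (⊕-comm _ _) (cong₂ _⊕_ (sym (⊕-identityʳ _)) (∑L-swap (upTo ℓ) (upTo (suc k)) _)) ⟩
    (φ (replicate (suc k) (suc ℓ)) ⊕ 𝟘) ⊕ ∑ (suc k) (λ c → ∑ ℓ (G c))
      ≡⟨ cong ((φ (replicate (suc k) (suc ℓ)) ⊕ 𝟘) ⊕_) (∑L-cong (upTo (suc k)) (λ c → sym (∑-words-suc c ℓ _))) ⟩
    (φ (replicate (suc k) (suc ℓ)) ⊕ 𝟘) ⊕ ∑ (suc k) (λ c → ∑L (words (suc c) ℓ) (λ w → weaklyIncreasing (x ∷ w) ▷ φ (pad (suc ℓ) (suc k) w)))
      ≡⟨ sym (∑-suc (suc k) _) ⟩
    ∑ (suc (suc k)) (λ c → ∑L (words c ℓ) (λ w → weaklyIncreasing (x ∷ w) ▷ φ (pad (suc ℓ) (suc k) w))) ∎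
    where
    open ≡-Reasoning
    G : ℕ → ℕ → R
    G c i = ∑L (words c ℓ) (λ w → ((x ≤ᵇ suc i) ∧ weaklyIncreasing (suc i ∷ w)) ▷ φ (suc i ∷ pad (suc ℓ) k w))
    first : ∀ i → i < ℓ → ∑L (words k (suc ℓ)) (λ w → ((x ≤ᵇ suc i) ∧ weaklyIncreasing (suc i ∷ w)) ▷ φ (suc i ∷ w)) ≡ ∑ (suc k) (λ c → G c i)
    first i lt with x ≤ᵇ suc i
    ... | true = ∑-words-from (suc i) k ℓ (φ ∘ (suc i ∷_)) lt
    ... | false = trans (∑L-zero (words k (suc ℓ))) (sym (trans (∑L-cong (upTo (suc k)) (λ c → ∑L-zero (words c ℓ))) (∑L-zero (upTo (suc k)))))
    last : ∑L (words k (suc ℓ)) (λ w → ((x ≤ᵇ suc ℓ) ∧ weaklyIncreasing (suc ℓ ∷ w)) ▷ φ (suc ℓ ∷ w)) ≡ φ (replicate (suc k) (suc ℓ))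
    last rewrite ≤ᵇ-true (m≤n⇒m≤1+n x≤ℓ) = ∑-words-maximal k ℓ (φ ∘ (suc ℓ ∷_))

  weaklyIncreasing-0 : ∀ w → weaklyIncreasing (0 ∷ w) ≡ weaklyIncreasing w
  weaklyIncreasing-0 [] = refl
  weaklyIncreasing-0 (_ ∷ _) = refl

  ∑-fillings-∷ : ∀ x ρ ℓ (φ : List (List ℕ) → R) →
    ∑L (fillings (x ∷ ρ) ℓ) φ ≡ ∑L (words x ℓ) (λ w → ∑L (fillings ρ ℓ) (φ ∘ (w ∷_)))
  ∑-fillings-∷ x ρ ℓ φ = trans (∑L-concatMap (λ w → map (w ∷_) (fillings ρ ℓ)) (words x ℓ) φ)
    (∑L-cong (words x ℓ) (λ w → ∑L-map (w ∷_) (fillings ρ ℓ) φ))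

  ∑-rows : ∀ x ρ ℓ (φ : List (List ℕ) → R) → ∑L (fillings (x ∷ ρ) ℓ) (λ t → all weaklyIncreasing t ▷ φ t) ≡
    ∑L (words x ℓ) (λ w → weaklyIncreasing w ▷ ∑L (fillings ρ ℓ) (λ t → all weaklyIncreasing t ▷ φ (w ∷ t)))
  ∑-rows x ρ ℓ φ = trans (∑-fillings-∷ x ρ ℓ _) (∑L-cong (words x ℓ) (λ w →
    trans (∑L-cong (fillings ρ ℓ) (λ t → ▷-∧ (weaklyIncreasing w) _ _)) (∑L-▷ (fillings ρ ℓ) (weaklyIncreasing w) _)))

  ∑-fillings-extend : ∀ ρ ℓ (φ : List (List ℕ) → R) →
    ∑L (fillings ρ (suc ℓ)) (λ t → all weaklyIncreasing t ▷ φ t) ≡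
    Down ρ (λ ν → ∑L (fillings ν ℓ) (λ t → all weaklyIncreasing t ▷ φ (extend (suc ℓ) ρ t)))
  ∑-fillings-extend [] ℓ φ = refl
  ∑-fillings-extend (x ∷ ρ) ℓ φ = begin
    ∑L (fillings (x ∷ ρ) (suc ℓ)) (λ t → all weaklyIncreasing t ▷ φ t)
      ≡⟨ ∑-rows x ρ (suc ℓ) φ ⟩
    ∑L (words x (suc ℓ)) (λ w → weaklyIncreasing w ▷ ∑L (fillings ρ (suc ℓ)) (λ t → all weaklyIncreasing t ▷ φ (w ∷ t)))
      ≡⟨ ∑L-cong (words x (suc ℓ)) (λ w → cong₂ _▷_ (sym (weaklyIncreasing-0 w)) (∑-fillings-extend ρ ℓ (φ ∘ (w ∷_)))) ⟩
    ∑L (words x (suc ℓ)) (λ w → weaklyIncreasing (0 ∷ w) ▷ Down ρ (Ψ w))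
      ≡⟨ ∑-words-from 0 x ℓ (λ w → Down ρ (Ψ w)) z≤n ⟩
    ∑ (suc x) (λ c → ∑L (words c ℓ) (λ w → weaklyIncreasing (0 ∷ w) ▷ Down ρ (Ψ (pad (suc ℓ) x w))))
      ≡⟨ ∑L-cong (upTo (suc x)) (λ c → trans (∑L-cong (words c ℓ) (λ w → trans (cong (_▷ Down ρ (Ψ (pad (suc ℓ) x w))) (weaklyIncreasing-0 w))
           (sym (Down-▷ ρ (weaklyIncreasing w) _)))) (sym (Down-∑L ρ (words c ℓ) _))) ⟩
    ∑ (suc x) (λ c → Down ρ (λ ν → ∑L (words c ℓ) (λ w → weaklyIncreasing w ▷ Ψ (pad (suc ℓ) x w) ν)))
      ≡⟨ ∑L-cong (upTo (suc x)) (λ c → Down-cong ρ (λ ν → sym (∑-rows c ν ℓ (φ ∘ extend (suc ℓ) (x ∷ ρ))))) ⟩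
    Down (x ∷ ρ) (λ ν → ∑L (fillings ν ℓ) (λ t → all weaklyIncreasing t ▷ φ (extend (suc ℓ) (x ∷ ρ) t))) ∎
    where
    open ≡-Reasoning
    Ψ : List ℕ → List ℕ → R
    Ψ w ν = ∑L (fillings ν ℓ) (λ t → all weaklyIncreasing t ▷ φ (w ∷ extend (suc ℓ) ρ t))

  schurCoeff : List ℕ → List ℕ → R
  schurCoeff ρ α = ∑L (fillings ρ (length α)) (λ t → (isSSYT t ∧ hasContent α t) ▷ 𝟙)

  -- Erasing the largest letter leaves a tableau of a shape ν that differs from ρ by a horizontal
  -- strip of a cells.
  schurCoeff-∷ʳ-Down : ∀ ρ α a → schurCoeff ρ (α ∷ʳ a) ≡
    Down ρ (λ ν → interlaced ρ ν ▷ (sum ρ ≡ᵇ sum ν + a) ▷ schurCoeff ν α)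
  schurCoeff-∷ʳ-Down ρ α a = begin
    schurCoeff ρ (α ∷ʳ a)
      ≡⟨ cong (λ n → ∑L (fillings ρ n) (λ t → (isSSYT t ∧ hasContent (α ∷ʳ a) t) ▷ 𝟙)) (trans (length-++ α) (+-comm (length α) 1)) ⟩
    ∑L (fillings ρ (suc ℓ)) (λ t → (isSSYT t ∧ hasContent (α ∷ʳ a) t) ▷ 𝟙)
      ≡⟨ ∑L-cong (fillings ρ (suc ℓ)) (λ t → split (all weaklyIncreasing t) (columnsStrict t) (hasContent (α ∷ʳ a) t)) ⟩
    ∑L (fillings ρ (suc ℓ)) (λ t → all weaklyIncreasing t ▷ columnsStrict t ▷ hasContent (α ∷ʳ a) t ▷ 𝟙)
      ≡⟨ ∑-fillings-extend ρ ℓ _ ⟩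
    Down ρ (λ ν → ∑L (fillings ν ℓ) (λ t → all weaklyIncreasing t ▷ columnsStrict (extend (suc ℓ) ρ t) ▷ hasContent (α ∷ʳ a) (extend (suc ℓ) ρ t) ▷ 𝟙))
      ≡⟨ Down-cong≤ ρ step ⟩
    Down ρ (λ ν → interlaced ρ ν ▷ (sum ρ ≡ᵇ sum ν + a) ▷ schurCoeff ν α) ∎
    where
    open ≡-Reasoning
    ℓ = length α
    split : ∀ a b c → (((a ∧ b) ∧ c) ▷ 𝟙) ≡ (a ▷ b ▷ c ▷ 𝟙)
    split a b c = trans (▷-∧ (a ∧ b) c 𝟙) (▷-∧ a b _)
    pull : ∀ w i s c h → (w ▷ (i ∧ c) ▷ (s ∧ h) ▷ 𝟙) ≡ (i ▷ s ▷ ((w ∧ c) ∧ h) ▷ 𝟙)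
    pull w true s c h = trans (cong (λ v → w ▷ c ▷ v) (▷-∧ s h 𝟙)) (trans (cong (w ▷_) (▷-comm c s _)) (trans (▷-comm w s _) (cong (s ▷_) (sym (split w c h)))))
    pull w false s c h = ▷-𝟘 w
    step : ∀ ν → Pointwise _≤_ ν ρ →
      ∑L (fillings ν ℓ) (λ t → all weaklyIncreasing t ▷ columnsStrict (extend (suc ℓ) ρ t) ▷ hasContent (α ∷ʳ a) (extend (suc ℓ) ρ t) ▷ 𝟙) ≡
      (interlaced ρ ν ▷ (sum ρ ≡ᵇ sum ν + a) ▷ schurCoeff ν α)
    step ν pw = trans (∑L-cong∈ (fillings ν ℓ) (λ t t∈ → let fl = fillings-member ν ℓ t t∈ in trans
        (cong₂ (λ c h → all weaklyIncreasing t ▷ c ▷ h ▷ 𝟙) (columnsStrict-extend ℓ fl pw) (hasContent-extend α a fl pw))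
        (pull (all weaklyIncreasing t) (interlaced ρ ν) (sum ρ ≡ᵇ sum ν + a) (columnsStrict t) (hasContent α t))))
      (trans (∑L-▷ (fillings ν ℓ) (interlaced ρ ν) _) (cong (interlaced ρ ν ▷_) (∑L-▷ (fillings ν ℓ) (sum ρ ≡ᵇ sum ν + a) _)))

  InterlacedSum : List ℕ → (List ℕ → R) → R
  InterlacedSum [] φ = φ []
  InterlacedSum (x ∷ ρ) φ = ∑ (suc x ∸ headOr0 ρ) (λ d → InterlacedSum ρ (φ ∘ ((headOr0 ρ + d) ∷_)))

  Down-interlaced : ∀ ρ (φ : List ℕ → R) → Linked _≥_ ρ → Down ρ (λ ν → interlaced ρ ν ▷ φ ν) ≡ InterlacedSum ρ φ
  Down-interlaced [] φ lk = refl
  Down-interlaced (x ∷ ρ) φ lk = begin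
    ∑ (suc x) (λ y → Down ρ (λ ν → ((headOr0 ρ ≤ᵇ y) ∧ interlaced ρ ν) ▷ φ (y ∷ ν)))
      ≡⟨ ∑L-cong (upTo (suc x)) (λ y → trans (Down-cong ρ (λ ν → ▷-∧ (headOr0 ρ ≤ᵇ y) _ _)) (trans (Down-▷ ρ (headOr0 ρ ≤ᵇ y) _)
           (cong ((headOr0 ρ ≤ᵇ y) ▷_) (Down-interlaced ρ (φ ∘ (y ∷_)) (Linked.tail lk))))) ⟩
    ∑ (suc x) (λ y → (headOr0 ρ ≤ᵇ y) ▷ InterlacedSum ρ (φ ∘ (y ∷_)))
      ≡⟨ ∑-≥ᵇ (m≤n⇒m≤1+n (descending-head lk)) _ ⟩
    InterlacedSum (x ∷ ρ) φ ∎
    where open ≡-Reasoning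

  InterlacedSum-cong : ∀ ρ {φ ψ : List ℕ → R} → Linked _≥_ ρ → (∀ ν → Interlaced ρ ν → φ ν ≡ ψ ν) → InterlacedSum ρ φ ≡ InterlacedSum ρ ψ
  InterlacedSum-cong [] lk e = e [] []
  InterlacedSum-cong (x ∷ ρ) lk e = ∑-cong< (suc x ∸ headOr0 ρ) (λ d lt → InterlacedSum-cong ρ (Linked.tail lk) (λ ν i →
    e _ (cons (m≤m+n (headOr0 ρ) d) (s≤s⁻¹ (subst (_≤ suc x) (trans (+-comm (suc d) (headOr0 ρ)) (+-suc (headOr0 ρ) d))
      (m≤o∸n⇒m+n≤o (suc d) (m≤n⇒m≤1+n (descending-head lk)) lt))) i)))

  -- `InterlacedSum` with the rows listed from the bottom, which is the order of the beads; p is the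
  -- preceding row.
  AscendingSum : ℕ → List ℕ → (List ℕ → R) → R
  AscendingSum p [] φ = φ []
  AscendingSum p (x ∷ σ) φ = ∑ (suc x ∸ p) (λ d → AscendingSum x σ (φ ∘ ((p + d) ∷_)))

  -- Neighbouring rows have offsets differing by 1, which turns weak interlacing of rows into strict
  -- interlacing of beads.
  StripSum-addIndex : ∀ j p σ φ → StripSum (p + j) (addIndex j σ) φ ≡ AscendingSum p σ (φ ∘ addIndex j)
  StripSum-addIndex j p [] φ = refl
  StripSum-addIndex j p (x ∷ σ) φ = begin
    ∑ (suc (x + j) ∸ (p + j)) (λ d → StripSum (suc (x + j)) (addIndex (suc j) σ) (φ ∘ ((p + j + d) ∷_)))
      ≡⟨ cong (λ n → ∑ n (λ d → StripSum (suc (x + j)) (addIndex (suc j) σ) (φ ∘ ((p + j + d) ∷_)))) ([m+n]∸[o+n]≡m∸o (suc x) p j) ⟩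
    ∑ (suc x ∸ p) (λ d → StripSum (suc (x + j)) (addIndex (suc j) σ) (φ ∘ ((p + j + d) ∷_)))
      ≡⟨ ∑L-cong (upTo (suc x ∸ p)) (λ d → trans (cong₂ (λ l y → StripSum l (addIndex (suc j) σ) (φ ∘ (y ∷_))) (sym (+-suc x j))
           (trans (+-assoc p j d) (trans (cong (p +_) (+-comm j d)) (sym (+-assoc p d j))))) (StripSum-addIndex (suc j) x σ _)) ⟩
    AscendingSum p (x ∷ σ) (φ ∘ addIndex j) ∎
    where
    open ≡-Reasoning
    [m+n]∸[o+n]≡m∸o : ∀ m o n → (m + n) ∸ (o + n) ≡ m ∸ o
    [m+n]∸[o+n]≡m∸o m o n = trans (cong₂ _∸_ (+-comm m n) (+-comm o n)) ([m+n]∸[m+o]≡n∸o n m o)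

  AscendingSum-∷ʳ : ∀ p σ x φ → AscendingSum p (σ ∷ʳ x) φ ≡
    ∑ (suc x ∸ lastOr p σ) (λ d → AscendingSum p σ (λ ν → φ (ν ∷ʳ (lastOr p σ + d))))
  AscendingSum-∷ʳ p [] x φ = refl
  AscendingSum-∷ʳ p (y ∷ σ) x φ = trans (∑L-cong (upTo (suc y ∸ p)) (λ d → AscendingSum-∷ʳ y σ x (φ ∘ ((p + d) ∷_))))
    (∑L-swap (upTo (suc y ∸ p)) (upTo (suc x ∸ lastOr y σ)) _)

  AscendingSum-reverse : ∀ ρ φ → AscendingSum 0 (reverse ρ) φ ≡ InterlacedSum ρ (φ ∘ reverse)
  AscendingSum-reverse [] φ = refl
  AscendingSum-reverse (x ∷ ρ) φ = begin
    AscendingSum 0 (reverse (x ∷ ρ)) φ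
      ≡⟨ cong (λ l → AscendingSum 0 l φ) (unfold-reverse x ρ) ⟩
    AscendingSum 0 (reverse ρ ∷ʳ x) φ
      ≡⟨ AscendingSum-∷ʳ 0 (reverse ρ) x φ ⟩
    ∑ (suc x ∸ lastOr 0 (reverse ρ)) (λ d → AscendingSum 0 (reverse ρ) (λ ν → φ (ν ∷ʳ (lastOr 0 (reverse ρ) + d))))
      ≡⟨ cong (λ l → ∑ (suc x ∸ l) (λ d → AscendingSum 0 (reverse ρ) (λ ν → φ (ν ∷ʳ (l + d))))) (lastOr-reverse ρ) ⟩
    ∑ (suc x ∸ headOr0 ρ) (λ d → AscendingSum 0 (reverse ρ) (λ ν → φ (ν ∷ʳ (headOr0 ρ + d))))
      ≡⟨ ∑L-cong (upTo (suc x ∸ headOr0 ρ)) (λ d → trans (AscendingSum-reverse ρ _)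
           (InterlacedSum-cong′ ρ (λ ν → cong φ (sym (unfold-reverse (headOr0 ρ + d) ν))))) ⟩
    InterlacedSum (x ∷ ρ) (φ ∘ reverse) ∎
    where
    open ≡-Reasoning
    InterlacedSum-cong′ : ∀ ρ {φ ψ : List ℕ → R} → (∀ ν → φ ν ≡ ψ ν) → InterlacedSum ρ φ ≡ InterlacedSum ρ ψ
    InterlacedSum-cong′ [] e = e []
    InterlacedSum-cong′ (x ∷ ρ) e = ∑L-cong (upTo (suc x ∸ headOr0 ρ)) (λ d → InterlacedSum-cong′ ρ (e ∘ ((headOr0 ρ + d) ∷_)))

  -- Without variables only the empty filling counts. A positive first row puts the top bead beyond
  -- the staircase; zero rows give the staircase itself.
  schur-beads-[] : ∀ ρ → Linked _≥_ ρ → schur (length ρ) [] (beads ρ) ≡ schurCoeff ρ []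
  schur-beads-[] [] lk = sym (⊕-identityʳ 𝟙)
  schur-beads-[] (suc x ∷ ρ) lk = trans (cong (staircase (suc (length ρ)))
      (trans (cong (addIndex 0) (unfold-reverse (suc x) ρ)) (addIndex-∷ʳ 0 (reverse ρ) (suc x))))
    (staircase-bounded (suc (length ρ)) (addIndex 0 (reverse ρ)) _ [] (s≤s (subst (_≤ x + length (reverse ρ)) (length-reverse ρ) (m≤n+m _ x))))
  schur-beads-[] (zero ∷ ρ) lk = trans (staircase-one _ (beads (0 ∷ ρ)) (beads-ascending (0 ∷ ρ) lk)
      (subst (All (_< length (0 ∷ ρ))) (sym (beads-zeros (0 ∷ ρ) (zeros lk))) (range-< 0 (length (0 ∷ ρ)))))
    (sym (empty (0 ∷ ρ) (zeros lk)))
    where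
    zeros : ∀ {ρ} → Linked _≥_ (0 ∷ ρ) → All (_≡ 0) (0 ∷ ρ)
    zeros [-] = refl ∷ []
    zeros (z≤n ∷ lk) = refl ∷ zeros lk
    addIndex-zeros : ∀ j σ → All (_≡ 0) σ → addIndex j σ ≡ range j (length σ)
    addIndex-zeros j [] _ = refl
    addIndex-zeros j (.0 ∷ σ) (refl ∷ al) = cong (j ∷_) (addIndex-zeros (suc j) σ al)
    beads-zeros : ∀ ρ → All (_≡ 0) ρ → beads ρ ≡ range 0 (length ρ)
    beads-zeros ρ al = trans (addIndex-zeros 0 (reverse ρ) (↭ₚ.All-resp-↭ (↭-sym (↭ₚ.↭-reverse ρ)) al)) (cong (range 0) (length-reverse ρ))
    fillings-zeros : ∀ ρ → All (_≡ 0) ρ → fillings ρ 0 ≡ replicate (length ρ) [] ∷ []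
    fillings-zeros [] _ = refl
    fillings-zeros (.0 ∷ ρ) (refl ∷ al) rewrite fillings-zeros ρ al = refl
    valid : ∀ k → (isSSYT (replicate k []) ∧ hasContent [] (replicate k [])) ≡ true
    valid k = cong₂ _∧_ (cong₂ _∧_ (wi k) (cs k)) (cong (λ l → length l ≡ᵇ 0) (ct k))
      where
      wi : ∀ k → all weaklyIncreasing (replicate k []) ≡ true
      wi zero = refl
      wi (suc k) = wi k
      cs : ∀ k → columnsStrict (replicate k []) ≡ true
      cs zero = refl
      cs (suc zero) = refl
      cs (suc (suc k)) = cs (suc k)
      ct : ∀ k → concat {A = ℕ} (replicate k []) ≡ []
      ct zero = refl
      ct (suc k) = ct k
    empty : ∀ ρ → All (_≡ 0) ρ → schurCoeff ρ [] ≡ 𝟙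
    empty ρ al rewrite fillings-zeros ρ al | valid (length ρ) = ⊕-identityʳ 𝟙

  -- Both sides obey the branching rule: `H-strip` removes a horizontal strip from the beads,
  -- `schurCoeff-∷ʳ-Down` removes one from the tableau. The head of r belongs to the last letter,
  -- hence the reversal.
  schur-beads : ∀ r ρ → Linked _≥_ ρ → schur (length ρ) r (beads ρ) ≡ schurCoeff ρ (reverse r)
  schur-beads [] ρ lk = schur-beads-[] ρ lk
  schur-beads (a ∷ r) ρ lk = begin
    H a (schur (length ρ) r) (beads ρ)
      ≡⟨ H-strip a _ (beads ρ) (schur-alternating (length ρ) r) (beads-ascending ρ lk) ⟩
    StripSum 0 (beads ρ) (λ t → (sum (beads ρ) ≡ᵇ sum t + a) ▷ schur (length ρ) r t)
      ≡⟨ trans (StripSum-addIndex 0 0 (reverse ρ) _) (AscendingSum-reverse ρ _) ⟩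
    InterlacedSum ρ (λ ν → (sum (beads ρ) ≡ᵇ sum (beads ν) + a) ▷ schur (length ρ) r (beads ν))
      ≡⟨ InterlacedSum-cong ρ lk (λ ν i → cong₂ _▷_ (sizes {ν} (Interlaced-length i))
           (trans (cong (λ n → schur n r (beads ν)) (sym (Interlaced-length i))) (schur-beads r ν (Interlaced-descending i)))) ⟩
    InterlacedSum ρ (λ ν → (sum ρ ≡ᵇ sum ν + a) ▷ schurCoeff ν (reverse r))
      ≡⟨ sym (Down-interlaced ρ _ lk) ⟩
    Down ρ (λ ν → interlaced ρ ν ▷ (sum ρ ≡ᵇ sum ν + a) ▷ schurCoeff ν (reverse r))
      ≡⟨ sym (schurCoeff-∷ʳ-Down ρ (reverse r) a) ⟩
    schurCoeff ρ (reverse r ∷ʳ a)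
      ≡⟨ cong (schurCoeff ρ) (sym (unfold-reverse a r)) ⟩
    schurCoeff ρ (reverse (a ∷ r)) ∎
    where
    open ≡-Reasoning
    ≡ᵇ-cancelʳ : ∀ c m n → (m + c ≡ᵇ n + c) ≡ (m ≡ᵇ n)
    ≡ᵇ-cancelʳ c m n = true-iff {m + c ≡ᵇ n + c}
      (λ e → trans (cong (_≡ᵇ n) (+-cancelʳ-≡ c m n (≡ᵇ-true e))) (≡ᵇ-refl n))
      (λ e → trans (cong (λ k → k + c ≡ᵇ n + c) (≡ᵇ-true {m} e)) (≡ᵇ-refl (n + c)))
    sizes : ∀ {ν} → length ν ≡ length ρ → (sum (beads ρ) ≡ᵇ sum (beads ν) + a) ≡ (sum ρ ≡ᵇ sum ν + a)
    sizes {ν} l = trans (cong₂ _≡ᵇ_ (sum-beads ρ) (trans (cong (_+ a) (trans (sum-beads ν) (cong (λ n → sum ν + sum (range 0 n)) l)))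
      (trans (+-assoc (sum ν) _ a) (trans (cong (sum ν +_) (+-comm _ a)) (sym (+-assoc (sum ν) a _))))))
      (≡ᵇ-cancelʳ (sum (range 0 (length ρ))) (sum ρ) (sum ν + a))

  schurCoeff-pad : ∀ ρ k α → schurCoeff (ρ ++ replicate k 0) α ≡ schurCoeff ρ α
  schurCoeff-pad ρ k α = trans (rows ρ (λ t → (isSSYT t ∧ hasContent α t) ▷ 𝟙))
      (∑L-cong (fillings ρ (length α)) (λ t → cong (λ b → b ▷ 𝟙) (cong₂ _∧_ (cong₂ _∧_ (wi t) (cs t)) (hc t))))
    where
    es : List (List ℕ)
    es = replicate k []
    zeros : ∀ k (φ : List (List ℕ) → R) → ∑L (fillings (replicate k 0) (length α)) φ ≡ φ (replicate k [])
    zeros zero φ = ⊕-identityʳ _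
    zeros (suc k) φ = trans (∑-fillings-∷ 0 (replicate k 0) (length α) φ) (trans (⊕-identityʳ _) (zeros k (φ ∘ ([] ∷_))))
    rows : ∀ ρ (φ : List (List ℕ) → R) → ∑L (fillings (ρ ++ replicate k 0) (length α)) φ ≡ ∑L (fillings ρ (length α)) (λ t → φ (t ++ es))
    rows [] φ = trans (zeros k φ) (sym (⊕-identityʳ _))
    rows (x ∷ ρ) φ = trans (∑-fillings-∷ x (ρ ++ replicate k 0) (length α) φ)
      (trans (∑L-cong (words x (length α)) (λ w → rows ρ (φ ∘ (w ∷_)))) (sym (∑-fillings-∷ x ρ (length α) _)))
    wi : ∀ t → all weaklyIncreasing (t ++ es) ≡ all weaklyIncreasing t
    wi [] = go k
      where
      go : ∀ k → all weaklyIncreasing (replicate k []) ≡ true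
      go zero = refl
      go (suc k) = go k
    wi (w ∷ t) = cong (weaklyIncreasing w ∧_) (wi t)
    cs : ∀ t → columnsStrict (t ++ es) ≡ columnsStrict t
    cs [] = go k
      where
      go : ∀ k → columnsStrict (replicate k []) ≡ true
      go zero = refl
      go (suc zero) = refl
      go (suc (suc k)) = go (suc k)
    cs (w ∷ []) = go k w
      where
      go : ∀ k w → columnsStrict (w ∷ replicate k []) ≡ true
      go zero w = refl
      go (suc k) w rewrite strictBelow-[] w = go k []
    cs (w ∷ w' ∷ t) = cong (strictBelow w w' ∧_) (cs (w' ∷ t))
    ct : ∀ t → concat (t ++ es) ≡ concat t
    ct [] = go k
      where
      go : ∀ k → concat {A = ℕ} (replicate k []) ≡ []
      go zero = refl
      go (suc k) = go k
    ct (w ∷ t) = cong (w ++_) (ct t)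
    hc : ∀ t → hasContent α (t ++ es) ≡ hasContent α t
    hc t = cong (λ l → and (map (λ j → count (suc j) l ≡ᵇ at α j) (upTo (length α))) ∧ (length l ≡ᵇ sum α)) (ct t)

-- Ribbons

filterᵇ-∈⁺ : ∀ {A : Set} (p : A → Bool) {x} xs → x ∈ xs → p x ≡ true → x ∈ filterᵇ p xs
filterᵇ-∈⁺ p (y ∷ xs) (here refl) e rewrite e = here refl
filterᵇ-∈⁺ p (y ∷ xs) (there m) e with p y
... | true = there (filterᵇ-∈⁺ p xs m e)
... | false = filterᵇ-∈⁺ p xs m e

filterᵇ-∈⁻ : ∀ {A : Set} (p : A → Bool) {x} xs → x ∈ filterᵇ p xs → x ∈ xs × p x ≡ true
filterᵇ-∈⁻ p (y ∷ xs) m with p y in e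
filterᵇ-∈⁻ p (y ∷ xs) (here refl) | true = here refl , e
filterᵇ-∈⁻ p (y ∷ xs) (there m) | true = let m' , e' = filterᵇ-∈⁻ p xs m in there m' , e'
filterᵇ-∈⁻ p (y ∷ xs) m | false = let m' , e' = filterᵇ-∈⁻ p xs m in there m' , e'

any-true⁺ : ∀ {A : Set} (p : A → Bool) {x} xs → x ∈ xs → p x ≡ true → any p xs ≡ true
any-true⁺ p (y ∷ xs) (here refl) e rewrite e = refl
any-true⁺ p (y ∷ xs) (there m) e with p y
... | true = refl
... | false = any-true⁺ p xs m e

any-true⁻ : ∀ {A : Set} (p : A → Bool) xs → any p xs ≡ true → ∃ λ x → x ∈ xs × p x ≡ true
any-true⁻ p (y ∷ xs) e with p y in eq
... | true = y , here refl , eq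
... | false = let x , m , e' = any-true⁻ p xs e in x , there m , e'

all-true⁺ : ∀ {A : Set} (p : A → Bool) xs → (∀ x → x ∈ xs → p x ≡ true) → all p xs ≡ true
all-true⁺ p [] e = refl
all-true⁺ p (x ∷ xs) e = cong₂ _∧_ (e x (here refl)) (all-true⁺ p xs (λ y m → e y (there m)))

all-true⁻ : ∀ {A : Set} (p : A → Bool) xs → all p xs ≡ true → ∀ x → x ∈ xs → p x ≡ true
all-true⁻ p (y ∷ xs) e x (here refl) = proj₁ (∧-true {p y} e)
all-true⁻ p (y ∷ xs) e x (there m) = all-true⁻ p xs (proj₂ (∧-true {p y} e)) x m

∨-true : ∀ {a b} → (a ∨ b) ≡ true → a ≡ true ⊎ b ≡ true
∨-true {true} _ = inj₁ refl
∨-true {false} e = inj₂ e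

∨-trueʳ : ∀ a {b} → b ≡ true → (a ∨ b) ≡ true
∨-trueʳ true _ = refl
∨-trueʳ false e = e

∨-trueˡ : ∀ {a b} → a ≡ true → (a ∨ b) ≡ true
∨-trueˡ refl = refl

cellEqᵇ-true : ∀ x y → cellEqᵇ x y ≡ true → x ≡ y
cellEqᵇ-true (r , c) (r' , c') e = let e₁ , e₂ = ∧-true {r ≡ᵇ r'} e in cong₂ _,_ (≡ᵇ-true e₁) (≡ᵇ-true e₂)

cellEqᵇ-refl : ∀ x → cellEqᵇ x x ≡ true
cellEqᵇ-refl (r , c) rewrite ≡ᵇ-refl r = ≡ᵇ-refl c

memᵇ⁺ : ∀ {x} xs → x ∈ xs → memᵇ x xs ≡ true
memᵇ⁺ {x} xs m = any-true⁺ (cellEqᵇ x) xs m (cellEqᵇ-refl x)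

memᵇ⁻ : ∀ {x} xs → memᵇ x xs ≡ true → x ∈ xs
memᵇ⁻ {x} xs e with y , m , eq ← any-true⁻ (cellEqᵇ x) xs e with refl ← cellEqᵇ-true x y eq = m

data Adjacent : Cell → Cell → Set where
  right : ∀ {r c} → Adjacent (r , c) (r , suc c)
  left : ∀ {r c} → Adjacent (r , suc c) (r , c)
  below : ∀ {r c} → Adjacent (r , c) (suc r , c)
  atop : ∀ {r c} → Adjacent (suc r , c) (r , c)

adjacentᵇ⁺ : ∀ {x y} → Adjacent x y → adjacentᵇ x y ≡ true
adjacentᵇ⁺ (right {r} {c}) rewrite ≡ᵇ-refl r | ≡ᵇ-refl c = refl
adjacentᵇ⁺ (left {r} {c}) rewrite ≡ᵇ-refl r | ≡ᵇ-refl c = ∨-trueˡ (∨-trueʳ (suc (suc c) ≡ᵇ c) refl)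
adjacentᵇ⁺ (below {r} {c}) rewrite ≡ᵇ-refl r | ≡ᵇ-refl c = ∨-trueʳ _ refl
adjacentᵇ⁺ (atop {r} {c}) rewrite ≡ᵇ-refl r | ≡ᵇ-refl c = ∨-trueʳ ((suc r ≡ᵇ r) ∧ ((suc c ≡ᵇ c) ∨ (suc c ≡ᵇ c))) (∨-trueʳ (suc (suc r) ≡ᵇ r) refl)

adjacentᵇ⁻ : ∀ x y → adjacentᵇ x y ≡ true → Adjacent x y
adjacentᵇ⁻ (r , c) (r' , c') e with ∨-true {(r ≡ᵇ r') ∧ ((suc c ≡ᵇ c') ∨ (suc c' ≡ᵇ c))} e
... | inj₁ e₁ with e₂ , e₃ ← ∧-true {r ≡ᵇ r'} e₁ with refl ← ≡ᵇ-true {r} {r'} e₂ with ∨-true {suc c ≡ᵇ c'} e₃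
...   | inj₁ e₄ with refl ← ≡ᵇ-true {suc c} {c'} e₄ = right
...   | inj₂ e₄ with refl ← ≡ᵇ-true {suc c'} {c} e₄ = left
adjacentᵇ⁻ (r , c) (r' , c') e | inj₂ e₁ with e₂ , e₃ ← ∧-true {c ≡ᵇ c'} e₁ with refl ← ≡ᵇ-true {c} {c'} e₂ with ∨-true {suc r ≡ᵇ r'} e₃
...   | inj₁ e₄ with refl ← ≡ᵇ-true {suc r} {r'} e₄ = below
...   | inj₂ e₄ with refl ← ≡ᵇ-true {suc r'} {r} e₄ = atop

touches : List Cell → Cell → Bool
touches S x = memᵇ x S ∨ any (adjacentᵇ x) S

-- The flood fill from the first cell never leaves a set that contains this cell and is closed under
-- adjacency.
connected-closed : ∀ X → connectedᵇ X ≡ true → ∃ λ x₀ → x₀ ∈ X × (∀ (q : Cell → Set) →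
  (∀ x y → x ∈ X → y ∈ X → q y → Adjacent x y → q x) → q x₀ → ∀ y → y ∈ X → q y)
connected-closed (x₀ ∷ xs) e = x₀ , here refl , λ q closed q₀ y m →
  proj₂ (reach q closed q₀ (length xs) y (memᵇ⁻ _ (all-true⁻ _ (x₀ ∷ xs) e y m)))
  where
  reach : ∀ (q : Cell → Set) → (∀ x y → x ∈ x₀ ∷ xs → y ∈ x₀ ∷ xs → q y → Adjacent x y → q x) → q x₀ →
    ∀ k y → y ∈ iterN k (grow (x₀ ∷ xs)) (x₀ ∷ []) → y ∈ x₀ ∷ xs × q y
  reach q closed q₀ zero y (here refl) = here refl , q₀
  reach q closed q₀ (suc k) y m with y∈ , e ← filterᵇ-∈⁻ (touches (iterN k (grow (x₀ ∷ xs)) (x₀ ∷ []))) (x₀ ∷ xs) m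
    with ∨-true {memᵇ y (iterN k (grow (x₀ ∷ xs)) (x₀ ∷ []))} e
  ... | inj₁ e₁ = reach q closed q₀ k y (memᵇ⁻ _ e₁)
  ... | inj₂ e₁ with z , z∈ , e₂ ← any-true⁻ (adjacentᵇ y) _ e₁ =
    let z∈X , qz = reach q closed q₀ k z z∈ in y∈ , closed y z y∈ z∈X qz (adjacentᵇ⁻ y z e₂)

-- The cells of a connected ribbon are ordered by their content.
connected-by-content : ∀ X (pos : Cell → ℕ) → (∃ λ x → x ∈ X) →
  (∀ x y → x ∈ X → y ∈ X → pos x ≡ pos y → x ≡ y) →
  (∀ x y → x ∈ X → y ∈ X → pos x < pos y → ∃ λ z → z ∈ X × Adjacent y z × pos y ≡ suc (pos z)) →
  (∀ x y → x ∈ X → y ∈ X → pos y < pos x → ∃ λ z → z ∈ X × Adjacent y z × suc (pos y) ≡ pos z) →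
  (∀ x y → x ∈ X → y ∈ X → pos y < pos x + length X) → connectedᵇ X ≡ true
connected-by-content [] pos (_ , ()) _ _ _ _
connected-by-content (x₀ ∷ xs) pos _ inj down up bound = all-true⁺ _ X (λ y m → memᵇ⁺ _ (reach (length xs) y m
    (s≤s⁻¹ (subst (pos y <_) (+-suc (pos x₀) (length xs)) (bound x₀ y (here refl) m)))
    (s≤s⁻¹ (subst (pos x₀ <_) (+-suc (pos y) (length xs)) (bound y x₀ m (here refl))))))
  where
  X = x₀ ∷ xs
  S : ℕ → List Cell
  S k = iterN k (grow X) (x₀ ∷ [])
  -- After k rounds the flood has covered all cells whose `pos` differs from that of the start by at
  -- most k.
  reach : ∀ k y → y ∈ X → pos y ≤ pos x₀ + k → pos x₀ ≤ pos y + k → y ∈ S k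
  reach zero y y∈ le ge with refl ← inj y x₀ y∈ (here refl)
    (≤-antisym (subst (pos y ≤_) (+-identityʳ _) le) (subst (pos x₀ ≤_) (+-identityʳ _) ge)) = here refl
  reach (suc k) y y∈ le ge with pos y ≤? pos x₀ + k | pos x₀ ≤? pos y + k
  ... | yes le' | yes ge' = filterᵇ-∈⁺ (touches (S k)) X y∈ (∨-trueˡ (memᵇ⁺ (S k) (reach k y y∈ le' ge')))
  ... | no gt | _ = let z , z∈ , adj , e = down x₀ y (here refl) y∈ (≤-<-trans (m≤m+n (pos x₀) k) (≰⇒> gt)) in
    filterᵇ-∈⁺ (touches (S k)) X y∈ (∨-trueʳ (memᵇ y (S k)) (any-true⁺ (adjacentᵇ y) (S k)
      (reach k z z∈ (s≤s⁻¹ (subst₂ _≤_ e (+-suc (pos x₀) k) le))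
        (≤-trans (m≤m+n (pos x₀) k) (≤-trans (s≤s⁻¹ (subst (pos x₀ + k <_) e (≰⇒> gt))) (m≤m+n (pos z) k)))) (adjacentᵇ⁺ adj)))
  ... | yes _ | no gt = let z , z∈ , adj , e = up x₀ y (here refl) y∈ (≤-<-trans (m≤m+n (pos y) k) (≰⇒> gt)) in
    filterᵇ-∈⁺ (touches (S k)) X y∈ (∨-trueʳ (memᵇ y (S k)) (any-true⁺ (adjacentᵇ y) (S k)
      (reach k z z∈ (≤-trans (subst (_≤ pos x₀) e (≤-<-trans (m≤m+n (pos y) k) (≰⇒> gt))) (m≤m+n (pos x₀) k))
        (subst (pos x₀ ≤_) (trans (+-suc (pos y) k) (cong (_+ k) e)) ge)) (adjacentᵇ⁺ adj)))

-- Skew shapes and ribbons in terms of row lengths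

at-beyond : ∀ λ' r → length λ' ≤ r → at λ' r ≡ 0
at-beyond [] r _ = refl
at-beyond (x ∷ λ') (suc r) (s≤s le) = at-beyond λ' r le

at-occupied : ∀ λ' r {c} → c < at λ' r → r < length λ'
at-occupied λ' r {c} lt with r <? length λ'
... | yes p = p
... | no np = ⊥-elim (n≮0 (subst (c <_) (at-beyond λ' r (≮⇒≥ np)) lt))

at-decreasing : ∀ {λ'} → Linked _≥_ λ' → ∀ {r s} → r ≤ s → at λ' s ≤ at λ' r
at-decreasing [] _ = z≤n
at-decreasing {x ∷ λ'} lk {zero} {zero} _ = ≤-refl
at-decreasing {x ∷ []} lk {zero} {suc s} _ = z≤n
at-decreasing {x ∷ y ∷ λ'} (x≥y ∷ lk) {zero} {suc s} _ = ≤-trans (at-decreasing lk {0} {s} z≤n) x≥y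
at-decreasing {x ∷ λ'} lk {suc r} {suc s} (s≤s le) = at-decreasing (Linked.tail lk) le

skewCells-∈⁺ : ∀ λ' ν {r c} → at ν r ≤ c → c < at λ' r → (r , c) ∈ skewCells λ' ν
skewCells-∈⁺ λ' ν {r} {c} le lt = ∈ₚ.∈-concatMap⁺ (λ r → map (λ c → (r , c)) (filterᵇ (λ c → at ν r ≤ᵇ c) (upTo (at λ' r))))
  (lose (∈ₚ.∈-upTo⁺ (at-occupied λ' r lt))
    (∈ₚ.∈-map⁺ (λ c → (r , c)) (filterᵇ-∈⁺ (at ν r ≤ᵇ_) (upTo (at λ' r)) (∈ₚ.∈-upTo⁺ lt) (≤ᵇ-true le))))

skewCells-∈⁻ : ∀ λ' ν {r c} → (r , c) ∈ skewCells λ' ν → at ν r ≤ c × c < at λ' r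
skewCells-∈⁻ λ' ν {r} {c} m
  with r' , r'∈ , m' ← find (∈ₚ.∈-concatMap⁻ (λ r → map (λ c → (r , c)) (filterᵇ (λ c → at ν r ≤ᵇ c) (upTo (at λ' r)))) {xs = upTo (length λ')} m)
  with c' , c'∈ , refl ← ∈ₚ.∈-map⁻ (λ c → (r' , c)) m'
  with c∈ , e ← filterᵇ-∈⁻ (λ c → at ν r ≤ᵇ c) (upTo (at λ' r)) c'∈ = ≤ᵇ-true⁻ e , ∈ₚ.∈-upTo⁻ c∈

contained⁺ : ∀ ν λ' → (∀ r → at ν r ≤ at λ' r) → containedᵇ ν λ' ≡ true
contained⁺ ν λ' e = all-true⁺ _ (upTo (length ν)) (λ r _ → ≤ᵇ-true (e r))

contained⁻ : ∀ ν λ' → containedᵇ ν λ' ≡ true → ∀ r → at ν r ≤ at λ' r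
contained⁻ ν λ' e r with r <? length ν
... | yes lt = ≤ᵇ-true⁻ (all-true⁻ _ (upTo (length ν)) e r (∈ₚ.∈-upTo⁺ lt))
... | no nlt = subst (_≤ at λ' r) (sym (at-beyond ν r (≮⇒≥ nlt))) z≤n

-- h is the top row and i the bottom row. Row r begins in column ν_r and row r + 1 ends in column
-- λ'_{r+1} - 1, so `next-row` says that consecutive rows overlap in exactly one column.
record Ribbon (λ' ν : List ℕ) (i h : ℕ) : Set where
  field
    h≤i : h ≤ i
    above-same : ∀ r → r < h → at λ' r ≡ at ν r
    below-same : ∀ r → i < r → at λ' r ≡ at ν r
    head-row : at ν h < at λ' h
    next-row : ∀ r → h ≤ r → r < i → at λ' (suc r) ≡ suc (at ν r)

tailRow : List ℕ → List ℕ → ℕ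
tailRow λ' ν = foldr _⊔_ 0 (map proj₁ (skewCells λ' ν))

foldr-⊔-upper : ∀ xs x → x ∈ xs → x ≤ foldr _⊔_ 0 xs
foldr-⊔-upper (y ∷ xs) x (here refl) = m≤m⊔n y _
foldr-⊔-upper (y ∷ xs) x (there m) = ≤-trans (foldr-⊔-upper xs x m) (m≤n⊔m y _)

foldr-⊔-least : ∀ xs b → (∀ x → x ∈ xs → x ≤ b) → foldr _⊔_ 0 xs ≤ b
foldr-⊔-least [] b e = z≤n
foldr-⊔-least (y ∷ xs) b e = ⊔-lub (e y (here refl)) (foldr-⊔-least xs b (λ x m → e x (there m)))

foldr-⊔-attained : ∀ x xs → foldr _⊔_ 0 (x ∷ xs) ∈ x ∷ xs
foldr-⊔-attained x [] = here (⊔-identityʳ x)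
foldr-⊔-attained x (y ∷ xs) with ⊔-sel x (foldr _⊔_ 0 (y ∷ xs))
... | inj₁ e = here e
... | inj₂ e = there (subst (_∈ y ∷ xs) (sym e) (foldr-⊔-attained y xs))

minList-≡ : ∀ xs a → a ∈ xs → (∀ x → x ∈ xs → a ≤ x) → minList xs ≡ a
minList-≡ (x ∷ xs) a m e = ≤-antisym (lower x xs m) (upper x xs (e x (here refl)) (λ y m → e y (there m)))
  where
  lower : ∀ x xs → a ∈ x ∷ xs → foldr _⊓_ x xs ≤ a
  lower x [] (here refl) = ≤-refl
  lower x (y ∷ xs) (here refl) = ≤-trans (m⊓n≤n y _) (lower x xs (here refl))
  lower x (y ∷ xs) (there (here refl)) = m⊓n≤m y _
  lower x (y ∷ xs) (there (there m)) = ≤-trans (m⊓n≤n y _) (lower x xs (there m))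
  upper : ∀ x xs → a ≤ x → (∀ y → y ∈ xs → a ≤ y) → a ≤ foldr _⊓_ x xs
  upper x [] le _ = le
  upper x (y ∷ xs) le e = ⊓-glb (e y (here refl)) (upper x xs le (λ z m → e z (there m)))

tailRow-≡ : ∀ λ' ν i → at ν i < at λ' i → (∀ r → i < r → at λ' r ≤ at ν r) → tailRow λ' ν ≡ i
tailRow-≡ λ' ν i lt e = ≤-antisym
  (foldr-⊔-least _ i (λ x x∈ → case ∈ₚ.∈-map⁻ proj₁ x∈ of λ { ((r , c) , m , refl) →
    ≮⇒≥ (λ i<r → let le , lt' = skewCells-∈⁻ λ' ν m in <⇒≱ (≤-<-trans le lt') (e r i<r)) }))
  (foldr-⊔-upper _ i (∈ₚ.∈-map⁺ proj₁ (skewCells-∈⁺ λ' ν ≤-refl lt)))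

tailRow-occupied : ∀ λ' ν x → x ∈ skewCells λ' ν → at ν (tailRow λ' ν) < at λ' (tailRow λ' ν)
tailRow-occupied λ' ν x m = attained (skewCells λ' ν) refl m
  where
  attained : ∀ X → X ≡ skewCells λ' ν → x ∈ X → at ν (tailRow λ' ν) < at λ' (tailRow λ' ν)
  attained (y ∷ ys) e _ with (r , c) , m , e' ← ∈ₚ.∈-map⁻ proj₁ (foldr-⊔-attained (proj₁ y) (map proj₁ ys)) =
    let le , lt = skewCells-∈⁻ λ' ν (subst ((r , c) ∈_) e m)
        e″ = trans (cong (λ X → foldr _⊔_ 0 (map proj₁ X)) (sym e)) e'
    in subst (λ i → at ν i < at λ' i) (sym e″) (≤-<-trans le lt)

tailRow-below : ∀ λ' ν r → tailRow λ' ν < r → at λ' r ≤ at ν r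
tailRow-below λ' ν r lt = ≮⇒≥ (λ occ → <⇒≱ lt (foldr-⊔-upper _ r (∈ₚ.∈-map⁺ proj₁ (skewCells-∈⁺ λ' ν ≤-refl occ))))

tailColumn-≡ : ∀ λ' ν → at ν (tailRow λ' ν) < at λ' (tailRow λ' ν) → tailColumn λ' ν ≡ at ν (tailRow λ' ν)
tailColumn-≡ λ' ν occ = minList-≡ _ (at ν i)
  (∈ₚ.∈-map⁺ proj₂ (filterᵇ-∈⁺ (λ x → proj₁ x ≡ᵇ i) _ (skewCells-∈⁺ λ' ν ≤-refl occ) (≡ᵇ-refl i)))
  (λ c c∈ → lower c (∈ₚ.∈-map⁻ proj₂ c∈))
  where
  i = tailRow λ' ν
  lower : ∀ c → (∃ λ x → x ∈ filterᵇ (λ x → proj₁ x ≡ᵇ i) (skewCells λ' ν) × c ≡ proj₂ x) → at ν i ≤ c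
  lower c ((r , .c) , m , refl) with m' , e ← filterᵇ-∈⁻ (λ x → proj₁ x ≡ᵇ i) (skewCells λ' ν) m
    = subst (λ j → at ν j ≤ c) (≡ᵇ-true {r} e) (proj₁ (skewCells-∈⁻ λ' ν m'))

least : ∀ {P : ℕ → Set} → (∀ n → Dec (P n)) → ∀ n → P n → ∃ λ h → h ≤ n × P h × (∀ r → r < h → ¬ P r)
least {P} P? n pn = search n 0 (+-identityʳ n) (λ r ())
  where
  search : ∀ k m → k + m ≡ n → (∀ r → r < m → ¬ P r) → ∃ λ h → h ≤ n × P h × (∀ r → r < h → ¬ P r)
  search k m e none with P? m
  search k m e none | yes pm = m , subst (m ≤_) e (m≤n+m m k) , pm , none
  search zero m refl none | no ¬pm = ⊥-elim (¬pm pn)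
  search (suc k) m e none | no ¬pm = search k (suc m) (trans (+-suc k m) e) (λ r lt → case m≤n⇒m<n∨m≡n (s≤s⁻¹ lt) of λ
    { (inj₁ r<m) → none r r<m ; (inj₂ refl) → ¬pm })

no2x2⁻ : ∀ X → no2x2ᵇ X ≡ true → ∀ r c → (r , c) ∈ X → (r , suc c) ∈ X → (suc r , c) ∈ X → (suc r , suc c) ∈ X → ⊥
no2x2⁻ X e r c m₁ m₂ m₃ m₄ with any block X in eq
  where
  block : Cell → Bool
  block rc = memᵇ (proj₁ rc , suc (proj₂ rc)) X ∧ memᵇ (suc (proj₁ rc) , proj₂ rc) X ∧ memᵇ (suc (proj₁ rc) , suc (proj₂ rc)) X
... | false = case trans (sym eq) (any-true⁺ _ X m₁ (cong₂ _∧_ (memᵇ⁺ X m₂) (cong₂ _∧_ (memᵇ⁺ X m₃) (memᵇ⁺ X m₄)))) of λ ()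
no2x2⁻ X () r c m₁ m₂ m₃ m₄ | true

no2x2⁺ : ∀ X → (∀ r c → (r , c) ∈ X → (suc r , suc c) ∈ X → ⊥) → no2x2ᵇ X ≡ true
no2x2⁺ X none with any block X in eq
  where
  block : Cell → Bool
  block rc = memᵇ (proj₁ rc , suc (proj₂ rc)) X ∧ memᵇ (suc (proj₁ rc) , proj₂ rc) X ∧ memᵇ (suc (proj₁ rc) , suc (proj₂ rc)) X
... | false = refl
... | true with (r , c) , m , e ← any-true⁻ _ X eq =
  ⊥-elim (none r c m (memᵇ⁻ X (proj₂ (∧-true {memᵇ (suc r , c) X} (proj₂ (∧-true {memᵇ (r , suc c) X} e))))))

-- Consecutive rows overlap in at most one column because there is no 2×2 square, and in at least
-- one because of connectedness.
ribbon⇒ : ∀ λ' ν → Linked _≥_ λ' → Linked _≥_ ν → isRibbonᵇ λ' ν ≡ true → ∃ λ h → Ribbon λ' ν (tailRow λ' ν) h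
ribbon⇒ λ' ν lkλ lkν e = h , record
  { h≤i = h≤i
  ; above-same = λ r r<h → ≤-antisym (≮⇒≥ (first r r<h)) (contained r)
  ; below-same = λ r i<r → ≤-antisym (tailRow-below λ' ν r i<r) (contained r)
  ; head-row = occ-h
  ; next-row = λ r h≤r r<i → ≤-antisym (≮⇒≥ (narrow r)) (bridge r h≤r r<i) }
  where
  X = skewCells λ' ν
  i = tailRow λ' ν
  e₂ = proj₂ (∧-true {containedᵇ ν λ'} e)
  conn = proj₁ (∧-true {connectedᵇ X} e₂)
  no2x2 = proj₂ (∧-true {connectedᵇ X} e₂)
  contained : ∀ r → at ν r ≤ at λ' r
  contained = contained⁻ ν λ' (proj₁ (∧-true {containedᵇ ν λ'} e))
  occ-i : at ν i < at λ' i
  occ-i = let x , m , _ = connected-closed X conn in tailRow-occupied λ' ν x m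
  lst = least (λ r → at ν r <? at λ' r) i occ-i
  h = proj₁ lst
  h≤i = proj₁ (proj₂ lst)
  occ-h : at ν h < at λ' h
  occ-h = proj₁ (proj₂ (proj₂ lst))
  first : ∀ r → r < h → ¬ (at ν r < at λ' r)
  first = proj₂ (proj₂ (proj₂ lst))
  -- A longer row r + 1 would complete the 2×2 square whose upper left cell is (r, ν_r).
  narrow : ∀ r → ¬ (suc (at ν r) < at λ' (suc r))
  narrow r lt = no2x2⁻ X no2x2 r (at ν r)
    (skewCells-∈⁺ λ' ν ≤-refl (≤-trans (<⇒≤ lt) lower))
    (skewCells-∈⁺ λ' ν (n≤1+n _) (≤-trans lt lower))
    (skewCells-∈⁺ λ' ν (at-decreasing lkν (n≤1+n r)) (<⇒≤ lt))
    (skewCells-∈⁺ λ' ν (m≤n⇒m≤1+n (at-decreasing lkν (n≤1+n r))) lt)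
    where
    lower : at λ' (suc r) ≤ at λ' r
    lower = at-decreasing lkλ (n≤1+n r)
  -- If ν_m ≥ λ'_{m+1}, rows m and m + 1 share no column and no adjacency crosses between them. The
  -- flood then stays on the side where it started, although row h lies on one side and row i on the
  -- other.
  bridge : ∀ m → h ≤ m → m < i → at ν m < at λ' (suc m)
  bridge m h≤m m<i with at ν m <? at λ' (suc m)
  ... | yes lt = lt
  ... | no nlt = ⊥-elim stuck
    where
    gap : ∀ {c} → (m , c) ∈ X → (suc m , c) ∈ X → ⊥
    gap m₁ m₂ = nlt (≤-<-trans (proj₁ (skewCells-∈⁻ λ' ν m₁)) (proj₂ (skewCells-∈⁻ λ' ν m₂)))
    upper : ∀ x y → x ∈ X → y ∈ X → proj₁ y ≤ m → Adjacent x y → proj₁ x ≤ m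
    upper _ _ _ _ le right = le
    upper _ _ _ _ le left = le
    upper _ _ _ _ le below = <⇒≤ le
    upper (suc r , c) _ x∈ y∈ le atop with m≤n⇒m<n∨m≡n le
    ... | inj₁ lt = lt
    ... | inj₂ refl = ⊥-elim (gap y∈ x∈)
    lower : ∀ x y → x ∈ X → y ∈ X → m < proj₁ y → Adjacent x y → m < proj₁ x
    lower _ _ _ _ lt right = lt
    lower _ _ _ _ lt left = lt
    lower (r , c) _ x∈ y∈ lt below with m≤n⇒m<n∨m≡n (s≤s⁻¹ lt)
    ... | inj₁ lt' = lt'
    ... | inj₂ refl = ⊥-elim (gap x∈ y∈)
    lower _ _ _ _ lt atop = m<n⇒m<1+n lt
    stuck : ⊥
    stuck = let x₀ , _ , closed = connected-closed X conn in case proj₁ x₀ ≤? m of λ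
      { (yes le) → <⇒≱ m<i (closed (λ x → proj₁ x ≤ m) upper le (i , at ν i) (skewCells-∈⁺ λ' ν ≤-refl occ-i))
      ; (no gt) → <⇒≱ (closed (λ x → m < proj₁ x) lower (≰⇒> gt) (h , at ν h) (skewCells-∈⁺ λ' ν ≤-refl occ-h)) h≤m }

length-filterᵇ-suc : ∀ (p : ℕ → Bool) n → length (filterᵇ p (upTo (suc n))) ≡ length (filterᵇ p (upTo n)) + (if p n then 1 else 0)
length-filterᵇ-suc p n = trans (cong (length ∘ filterᵇ p) (sym (upTo-∷ʳ n))) (go (upTo n))
  where
  go : ∀ xs → length (filterᵇ p (xs ∷ʳ n)) ≡ length (filterᵇ p xs) + (if p n then 1 else 0)
  go [] with p n
  ... | true = refl
  ... | false = refl
  go (x ∷ xs) with p x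
  ... | true = cong suc (go xs)
  ... | false = go xs

count-≥ : ∀ a n → length (filterᵇ (a ≤ᵇ_) (upTo n)) ≡ n ∸ a
count-≥ a zero = sym (0∸n≡0 a)
count-≥ a (suc n) with a ≤? n
... | yes le = trans (length-filterᵇ-suc (a ≤ᵇ_) n) (trans (cong₂ (λ k b → k + (if b then 1 else 0)) (count-≥ a n) (≤ᵇ-true le))
  (trans (+-comm (n ∸ a) 1) (sym (+-∸-assoc 1 le))))
... | no nle = trans (length-filterᵇ-suc (a ≤ᵇ_) n) (trans (cong₂ (λ k b → k + (if b then 1 else 0)) (count-≥ a n) (≤ᵇ-false (≰⇒> nle)))
  (trans (+-identityʳ _) (trans (m≤n⇒m∸n≡0 (<⇒≤ (≰⇒> nle))) (sym (m≤n⇒m∸n≡0 (≰⇒> nle))))))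

count-interval : ∀ (p : ℕ → Bool) h i → h ≤ i → (∀ r → p r ≡ (h ≤ᵇ r) ∧ (r ≤ᵇ i)) → ∀ n → i < n →
  length (filterᵇ p (upTo n)) ≡ suc i ∸ h
count-interval p h i h≤i e n i<n = trans (upto n) (cong (_∸ h) (m≥n⇒m⊓n≡n i<n))
  where
  upto : ∀ n → length (filterᵇ p (upTo n)) ≡ (n ⊓ suc i) ∸ h
  upto zero = sym (0∸n≡0 h)
  upto (suc n) = trans (length-filterᵇ-suc p n) (step (h ≤? n) (n ≤? i))
    where
    value : Bool → ℕ
    value b = length (filterᵇ p (upTo n)) + (if b then 1 else 0)
    step : Dec (h ≤ n) → Dec (n ≤ i) → value (p n) ≡ (suc n ⊓ suc i) ∸ h
    step (no h≰n) _ = trans (cong value (trans (e n) (cong (_∧ (n ≤ᵇ i)) (≤ᵇ-false (≰⇒> h≰n))))) (trans (+-identityʳ _)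
      (trans (upto n) (trans (m≤n⇒m∸n≡0 (≤-trans (m⊓n≤m n _) (<⇒≤ (≰⇒> h≰n)))) (sym (m≤n⇒m∸n≡0 (≤-trans (m⊓n≤m (suc n) _) (≰⇒> h≰n)))))))
    step (yes h≤n) (yes n≤i) = trans (cong value (trans (e n) (cong₂ _∧_ (≤ᵇ-true h≤n) (≤ᵇ-true n≤i)))) (trans (+-comm _ 1)
      (trans (cong suc (trans (upto n) (cong (_∸ h) (m≤n⇒m⊓n≡m (m≤n⇒m≤1+n n≤i))))) (trans (sym (+-∸-assoc 1 h≤n)) (cong (_∸ h) (sym (m≤n⇒m⊓n≡m (s≤s n≤i)))))))
    step (yes h≤n) (no n≰i) = trans (cong value (trans (e n) (cong₂ _∧_ (≤ᵇ-true h≤n) (≤ᵇ-false (≰⇒> n≰i))))) (trans (+-identityʳ _)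
      (trans (upto n) (cong (_∸ h) (trans (m≥n⇒m⊓n≡n (≰⇒> n≰i)) (sym (m≥n⇒m⊓n≡n (s≤s (<⇒≤ (≰⇒> n≰i)))))))))

rowSum : (ℕ → ℕ) → ℕ → ℕ
rowSum f zero = 0
rowSum f (suc n) = rowSum f n + f n

rowSum-shift : ∀ f n → rowSum f (suc n) ≡ f 0 + rowSum (f ∘ suc) n
rowSum-shift f zero = +-comm 0 (f 0)
rowSum-shift f (suc n) = trans (cong (_+ f (suc n)) (rowSum-shift f n)) (+-assoc (f 0) _ _)

rowSum-zero : ∀ f m d → (∀ r → m ≤ r → f r ≡ 0) → rowSum f (m + d) ≡ rowSum f m
rowSum-zero f m zero e = cong (rowSum f) (+-identityʳ m)
rowSum-zero f m (suc d) e = trans (cong (rowSum f) (+-suc m d))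
  (trans (cong₂ _+_ (rowSum-zero f m d e) (e (m + d) (m≤m+n m d))) (+-identityʳ _))

length-skewCells : ∀ λ' ν → length (skewCells λ' ν) ≡ rowSum (λ r → at λ' r ∸ at ν r) (length λ')
length-skewCells λ' ν = trans (go (λ r → map (λ c → (r , c)) (filterᵇ (λ c → at ν r ≤ᵇ c) (upTo (at λ' r)))) id (length λ'))
    (congruent (length λ'))
  where
  go : ∀ (f : ℕ → List Cell) (g : ℕ → ℕ) n → length (concatMap f (applyUpTo g n)) ≡ rowSum (length ∘ f ∘ g) n
  go f g zero = refl
  go f g (suc n) = trans (length-++ (f (g 0))) (trans (cong (length (f (g 0)) +_) (go f (g ∘ suc) n)) (sym (rowSum-shift (length ∘ f ∘ g) n)))
  congruent : ∀ n → rowSum (λ r → length (map {B = Cell} (λ c → (r , c)) (filterᵇ (λ c → at ν r ≤ᵇ c) (upTo (at λ' r))))) n ≡ rowSum (λ r → at λ' r ∸ at ν r) n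
  congruent zero = refl
  congruent (suc n) = cong₂ _+_ (congruent n) (trans (length-map _ (filterᵇ (λ c → at ν n ≤ᵇ c) (upTo (at λ' n)))) (count-≥ (at ν n) (at λ' n)))

module _ {λ' ν i h} (lkλ : Linked _≥_ λ') (lkν : Linked _≥_ ν) (rib : Ribbon λ' ν i h) where
  open Ribbon rib

  ribbon-row-occupied : ∀ r → h ≤ r → r ≤ i → at ν r < at λ' r
  ribbon-row-occupied r h≤r r≤i with m≤n⇒m<n∨m≡n h≤r
  ... | inj₂ refl = head-row
  ribbon-row-occupied (suc r) h≤r r≤i | inj₁ (s≤s h≤r') =
    subst (at ν (suc r) <_) (sym (next-row r h≤r' r≤i)) (s≤s (at-decreasing lkν (n≤1+n r)))

  ribbon-occupied-row : ∀ r → at ν r < at λ' r → h ≤ r × r ≤ i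
  ribbon-occupied-row r lt = ≮⇒≥ (λ r<h → <⇒≢ lt (sym (above-same r r<h))) , ≮⇒≥ (λ i<r → <⇒≢ lt (sym (below-same r i<r)))

  ribbon-contained : ∀ r → at ν r ≤ at λ' r
  ribbon-contained r with r <? h | i <? r
  ... | yes p | _ = ≤-reflexive (sym (above-same r p))
  ... | no _ | yes q = ≤-reflexive (sym (below-same r q))
  ... | no p | no q = <⇒≤ (ribbon-row-occupied r (≮⇒≥ p) (≮⇒≥ q))

  ribbon-rows : i < length λ'
  ribbon-rows = at-occupied λ' i (ribbon-row-occupied i h≤i ≤-refl)

  -- Telescoping sum over the rows by `next-row`. Up to a common shift by 1 the bracket on the left
  -- is the bead of row i before the move and the right-hand side the bead of row h after it, so the
  -- size of the ribbon is the displacement.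
  ribbon-size : ∀ N → i < N → length (skewCells λ' ν) + (at ν i + (N ∸ i)) ≡ at λ' h + (N ∸ h)
  ribbon-size N i<N = trans (cong (_+ (at ν i + (N ∸ i))) (trans (length-skewCells λ' ν)
      (trans (cong (rowSum D) (sym (m+[n∸m]≡n ribbon-rows))) (rowSum-zero D (suc i) (length λ' ∸ suc i) (λ r lt → m≤n⇒m∸n≡0 (≤-reflexive (below-same r lt))))))) (tele i h≤i ≤-refl)
    where
    D : ℕ → ℕ
    D r = at λ' r ∸ at ν r
    tele : ∀ k → h ≤ k → k ≤ i → rowSum D (suc k) + (at ν k + (N ∸ k)) ≡ at λ' h + (N ∸ h)
    tele k h≤k k≤i with m≤n⇒m<n∨m≡n h≤k
    ... | inj₂ refl = trans (cong (λ n → n + D h + (at ν h + (N ∸ h))) (empty h (λ r lt → lt)))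
        (trans (sym (+-assoc (D h) (at ν h) (N ∸ h))) (cong (_+ (N ∸ h)) (m∸n+n≡m (<⇒≤ head-row))))
      where
      empty : ∀ k → (∀ r → r < k → r < h) → rowSum D k ≡ 0
      empty zero _ = refl
      empty (suc k) lt = cong₂ _+_ (empty k (λ r l → lt r (m<n⇒m<1+n l))) (m≤n⇒m∸n≡0 (≤-reflexive (above-same k (lt k ≤-refl))))
    tele (suc k) h≤k k≤i | inj₁ (s≤s h≤k') = begin
      rowSum D (suc k) + D (suc k) + (at ν (suc k) + (N ∸ suc k))   ≡⟨ +-assoc (rowSum D (suc k)) _ _ ⟩
      rowSum D (suc k) + (D (suc k) + (at ν (suc k) + (N ∸ suc k))) ≡⟨ cong (rowSum D (suc k) +_) (trans (sym (+-assoc (D (suc k)) (at ν (suc k)) _))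
                                                                        (cong (_+ (N ∸ suc k)) (trans (m∸n+n≡m (ribbon-contained (suc k))) (next-row k h≤k' k≤i)))) ⟩
      rowSum D (suc k) + (suc (at ν k) + (N ∸ suc k))               ≡⟨ cong (rowSum D (suc k) +_) (trans (sym (+-suc (at ν k) _)) (cong (at ν k +_) (suc-∸ (<-trans k≤i i<N)))) ⟩
      rowSum D (suc k) + (at ν k + (N ∸ k))                         ≡⟨ tele k h≤k' (<⇒≤ k≤i) ⟩
      at λ' h + (N ∸ h) ∎
      where
      open ≡-Reasoning
      suc-∸ : ∀ {k} → k < N → suc (N ∸ suc k) ≡ N ∸ k
      suc-∸ k<N = sym (+-∸-assoc 1 k<N)

  ribbon-height : ribbonHeight λ' ν ≡ i ∸ h
  ribbon-height = trans (cong (_∸ 1) (count-interval _ h i h≤i occupied (length λ') ribbon-rows)) (cong (_∸ 1) (+-∸-assoc 1 h≤i))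
    where
    occupied : ∀ r → any (λ x → r ≡ᵇ proj₁ x) (skewCells λ' ν) ≡ (h ≤ᵇ r) ∧ (r ≤ᵇ i)
    occupied r = true-iff
      (λ e → let (r' , c) , m , e' = any-true⁻ (λ x → r ≡ᵇ proj₁ x) (skewCells λ' ν) e
                 le , lt = skewCells-∈⁻ λ' ν (subst (λ k → (k , c) ∈ skewCells λ' ν) (sym (≡ᵇ-true {r} e')) m)
                 h≤r , r≤i = ribbon-occupied-row r (≤-<-trans le lt)
             in cong₂ _∧_ (≤ᵇ-true h≤r) (≤ᵇ-true r≤i))
      (λ e → let e₁ , e₂ = ∧-true {h ≤ᵇ r} e in
        any-true⁺ (λ x → r ≡ᵇ proj₁ x) _ (skewCells-∈⁺ λ' ν ≤-refl (ribbon-row-occupied r (≤ᵇ-true⁻ e₁) (≤ᵇ-true⁻ e₂))) (≡ᵇ-refl r))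

  ribbon-tailRow : tailRow λ' ν ≡ i
  ribbon-tailRow = tailRow-≡ λ' ν i (ribbon-row-occupied i h≤i ≤-refl) (λ r lt → ≤-reflexive (below-same r lt))

  ribbon⇐ : isRibbonᵇ λ' ν ≡ true
  ribbon⇐ = cong₂ _∧_ (contained⁺ ν λ' ribbon-contained) (cong₂ _∧_ connected (no2x2⁺ X thin))
    where
    X = skewCells λ' ν
    Λ = length λ'
    thin : ∀ r c → (r , c) ∈ X → (suc r , suc c) ∈ X → ⊥
    thin r c m m' with le , lt ← skewCells-∈⁻ λ' ν m with le' , lt' ← skewCells-∈⁻ λ' ν m' =
      <⇒≱ lt' (subst (_≤ suc c) (sym (next-row r (proj₁ (ribbon-occupied-row r (≤-<-trans le lt))) (proj₂ (ribbon-occupied-row (suc r) (≤-<-trans le' lt'))))) (s≤s le))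
    -- The content c - r, shifted by the number of rows to remain a natural number.
    content : Cell → ℕ
    content (r , c) = c + (Λ ∸ r)
    row< : ∀ {r c} → (r , c) ∈ X → r < Λ
    row< {r} m = at-occupied λ' r (proj₂ (skewCells-∈⁻ λ' ν m))
    rows : ∀ {r c} → (r , c) ∈ X → h ≤ r × r ≤ i
    rows {r} m = let le , lt = skewCells-∈⁻ λ' ν m in ribbon-occupied-row r (≤-<-trans le lt)
    ∸-suc : ∀ {r} → r < Λ → Λ ∸ r ≡ suc (Λ ∸ suc r)
    ∸-suc lt = +-∸-assoc 1 lt
    lowest : ∀ {r c} → (r , c) ∈ X → at ν i + (Λ ∸ i) ≤ content (r , c)
    lowest {r} m = +-mono-≤ (≤-trans (at-decreasing lkν (proj₂ (rows m))) (proj₁ (skewCells-∈⁻ λ' ν m))) (∸-monoʳ-≤ Λ (proj₂ (rows m)))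
    highest : ∀ {r c} → (r , c) ∈ X → content (r , c) < at λ' h + (Λ ∸ h)
    highest m = +-mono-≤ (≤-trans (proj₂ (skewCells-∈⁻ λ' ν m)) (at-decreasing lkλ (proj₁ (rows m)))) (∸-monoʳ-≤ Λ (proj₁ (rows m)))
    different-rows : ∀ {r c r' c'} → r < r' → (r , c) ∈ X → (r' , c') ∈ X → content (r' , c') < content (r , c)
    different-rows {r} {c} {r'} {c'} r<r' m m' = +-mono-≤-<
      (s≤s⁻¹ (≤-trans (proj₂ (skewCells-∈⁻ λ' ν m')) (≤-trans (at-decreasing lkλ r<r')
        (subst (_≤ suc c) (sym (next-row r (proj₁ (rows m)) (<-≤-trans r<r' (proj₂ (rows m'))))) (s≤s (proj₁ (skewCells-∈⁻ λ' ν m)))))))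
      (∸-monoʳ-< r<r' (<⇒≤ (row< m')))
    injective : ∀ x y → x ∈ X → y ∈ X → content x ≡ content y → x ≡ y
    injective (r , c) (r' , c') m m' e with <-cmp r r'
    ... | tri< lt _ _ = ⊥-elim (<⇒≢ (different-rows lt m m') (sym e))
    ... | tri> _ _ gt = ⊥-elim (<⇒≢ (different-rows gt m' m) e)
    ... | tri≈ _ refl _ = cong (r ,_) (+-cancelʳ-≡ (Λ ∸ r) c c' e)
    leftwards : ∀ r c → at ν r < c → c < at λ' r → ∃ λ z → z ∈ X × Adjacent (r , c) z × content (r , c) ≡ suc (content z)
    leftwards r (suc c) (s≤s le) lt = (r , c) , skewCells-∈⁺ λ' ν le (<⇒≤ lt) , left , refl
    down : ∀ x y → x ∈ X → y ∈ X → content x < content y → ∃ λ z → z ∈ X × Adjacent y z × content y ≡ suc (content z)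
    down x (r , c) x∈ m lt with le , lt' ← skewCells-∈⁻ λ' ν m with m≤n⇒m<n∨m≡n le
    ... | inj₁ le' = leftwards r c le' lt'
    ... | inj₂ refl with m≤n⇒m<n∨m≡n (proj₂ (rows m))
    ...   | inj₂ refl = ⊥-elim (<⇒≱ lt (lowest x∈))
    ...   | inj₁ r<i = (suc r , c) , skewCells-∈⁺ λ' ν (at-decreasing lkν (n≤1+n r)) (subst (c <_) (sym (next-row r (proj₁ (rows m)) r<i)) ≤-refl) ,
      below , trans (cong (c +_) (∸-suc (row< m))) (+-suc c _)
    up : ∀ x y → x ∈ X → y ∈ X → content y < content x → ∃ λ z → z ∈ X × Adjacent y z × suc (content y) ≡ content z
    up x (r , c) x∈ m lt with le , lt' ← skewCells-∈⁻ λ' ν m with m≤n⇒m<n∨m≡n lt'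
    ... | inj₁ lt″ = (r , suc c) , skewCells-∈⁺ λ' ν (m≤n⇒m≤1+n le) lt″ , right , refl
    ... | inj₂ e with m≤n⇒m<n∨m≡n (proj₁ (rows m))
    ...   | inj₂ refl = ⊥-elim (<⇒≱ (highest x∈) (subst (λ n → n + (Λ ∸ r) ≤ content x) e lt))
    up x (suc r , c) x∈ m lt | inj₂ e | inj₁ (s≤s h≤r) =
      (r , c) , skewCells-∈⁺ λ' ν (≤-reflexive (suc-injective (trans (sym (next-row r h≤r (proj₂ (rows m)))) (sym e)))) (<-≤-trans lt' (at-decreasing lkλ (n≤1+n r))) ,
      atop , trans (sym (+-suc c _)) (cong (c +_) (sym (∸-suc (<-trans ≤-refl (row< m)))))
    connected : connectedᵇ X ≡ true
    connected = connected-by-content X content (_ , skewCells-∈⁺ λ' ν ≤-refl head-row) injective down up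
      -- All contents lie between those of the two ends, and by `ribbon-size` this interval has as
      -- many values as there are cells.
      (λ { x@(r , c) y@(r' , c') m m' → <-≤-trans (highest m') (subst (_≤ content x + length X)
        (trans (+-comm (at ν i + (Λ ∸ i)) (length X)) (ribbon-size Λ ribbon-rows)) (+-monoˡ-≤ (length X) (lowest m))) })

-- Partitions, beads and ribbon moves

listEqᵇ-refl : ∀ xs → listEqᵇ xs xs ≡ true
listEqᵇ-refl [] = refl
listEqᵇ-refl (x ∷ xs) = cong₂ _∧_ (≡ᵇ-refl x) (listEqᵇ-refl xs)

listEqᵇ-true : ∀ xs ys → listEqᵇ xs ys ≡ true → xs ≡ ys
listEqᵇ-true [] [] _ = refl
listEqᵇ-true (x ∷ xs) (y ∷ ys) e = let e₁ , e₂ = ∧-true {x ≡ᵇ y} e in cong₂ _∷_ (≡ᵇ-true e₁) (listEqᵇ-true xs ys e₂)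

record Partition (ρ : List ℕ) : Set where
  constructor partition
  field
    descending : Linked _≥_ ρ
    positive : All (1 ≤_) ρ
open Partition

length≤sum : ∀ {ρ} → All (1 ≤_) ρ → length ρ ≤ sum ρ
length≤sum [] = z≤n
length≤sum (p ∷ ps) = +-mono-≤ p (length≤sum ps)

descending-∷ : ∀ {x ρ} → headOr0 ρ ≤ x → Linked _≥_ ρ → Linked _≥_ (x ∷ ρ)
descending-∷ {ρ = []} _ _ = [-]
descending-∷ {ρ = y ∷ ρ} le lk = le ∷ lk

partsBounded-∈ : ∀ f n m ρ → ρ ∈ partsBounded f n m → Partition ρ × sum ρ ≡ n × headOr0 ρ ≤ m
partsBounded-∈ zero zero m .[] (here refl) = partition [] [] , refl , z≤n
partsBounded-∈ (suc f) zero m .[] (here refl) = partition [] [] , refl , z≤n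
partsBounded-∈ (suc f) (suc n) m ρ ρ∈
  with k , k∈ , ρ∈′ ← find (∈ₚ.∈-concatMap⁻ (λ k → map (k ∷_) (partsBounded f (suc n ∸ k) k)) {xs = map suc (upTo (m ⊓ suc n))} ρ∈)
  with k' , k'∈ , refl ← ∈ₚ.∈-map⁻ suc k∈
  with ρ' , ρ'∈ , refl ← ∈ₚ.∈-map⁻ (suc k' ∷_) ρ∈′ =
  let part , s , h = partsBounded-∈ f (n ∸ k') (suc k') ρ' ρ'∈
      lt = ∈ₚ.∈-upTo⁻ k'∈
  in partition (descending-∷ h (descending part)) (s≤s z≤n ∷ positive part) ,
     cong suc (trans (cong (k' +_) s) (m+[n∸m]≡n (s≤s⁻¹ (≤-trans lt (m⊓n≤n m (suc n)))))) , ≤-trans lt (m⊓n≤m m (suc n))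

partitions-∈ : ∀ n ρ → ρ ∈ partitions n → Partition ρ × sum ρ ≡ n
partitions-∈ n ρ ρ∈ = let part , s , _ = partsBounded-∈ n n n ρ ρ∈ in part , s

partitionsUpTo-∈ : ∀ n ρ → ρ ∈ partitionsUpTo n → Partition ρ × sum ρ ≤ n
partitionsUpTo-∈ n ρ ρ∈ with k , k∈ , ρ∈′ ← find (∈ₚ.∈-concatMap⁻ partitions {xs = upTo (suc n)} ρ∈) =
  let part , s = partitions-∈ k ρ ρ∈′ in part , subst (_≤ n) (sym s) (s≤s⁻¹ (∈ₚ.∈-upTo⁻ k∈))

at-ext : ∀ {ρ ν} → All (1 ≤_) ρ → All (1 ≤_) ν → (∀ r → at ρ r ≡ at ν r) → ρ ≡ ν
at-ext [] [] e = refl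
at-ext [] (p ∷ _) e = ⊥-elim (<⇒≢ p (e 0))
at-ext (p ∷ _) [] e = ⊥-elim (<⇒≢ p (sym (e 0)))
at-ext (_ ∷ ps) (_ ∷ qs) e = cong₂ _∷_ (e 0) (at-ext ps qs (e ∘ suc))

-- Beads of the rows m - 1, …, 0, the row m - 1 - i having offset j + i.
rowBeads : List ℕ → ℕ → ℕ → List ℕ
rowBeads ν zero j = []
rowBeads ν (suc m) j = (at ν m + j) ∷ rowBeads ν m (suc j)

-- Beads of the rows d + m - 1, …, m.
lowBeads : List ℕ → ℕ → ℕ → ℕ → List ℕ
lowBeads ν m zero j = []
lowBeads ν m (suc d) j = (at ν (d + m) + j) ∷ lowBeads ν m d (suc j)

rowBeads-split : ∀ ν m d j → rowBeads ν (d + m) j ≡ lowBeads ν m d j ++ rowBeads ν m (d + j)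
rowBeads-split ν m zero j = refl
rowBeads-split ν m (suc d) j = cong (at ν (d + m) + j ∷_) (trans (rowBeads-split ν m d (suc j)) (cong (λ k → lowBeads ν m d (suc j) ++ rowBeads ν m k) (+-suc d j)))

lowBeads-∷ʳ : ∀ ν m d j → lowBeads ν m (suc d) j ≡ lowBeads ν (suc m) d j ∷ʳ (at ν m + (d + j))
lowBeads-∷ʳ ν m zero j = refl
lowBeads-∷ʳ ν m (suc d) j = cong₂ _∷_ (cong (λ k → at ν k + j) (sym (+-suc d m)))
  (trans (lowBeads-∷ʳ ν m d (suc j)) (cong (λ k → lowBeads ν (suc m) d (suc j) ∷ʳ (at ν m + k)) (+-suc d j)))

length-lowBeads : ∀ ν m d j → length (lowBeads ν m d j) ≡ d
length-lowBeads ν m zero j = refl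
length-lowBeads ν m (suc d) j = cong suc (length-lowBeads ν m d (suc j))

length-rowBeads : ∀ ν m j → length (rowBeads ν m j) ≡ m
length-rowBeads ν zero j = refl
length-rowBeads ν (suc m) j = cong suc (length-rowBeads ν m (suc j))

++-injective : ∀ {A : Set} {p p' q q' : List A} → length p ≡ length p' → p ++ q ≡ p' ++ q' → p ≡ p' × q ≡ q'
++-injective {p = []} {[]} l e = refl , e
++-injective {p = x ∷ p} {y ∷ p'} l e with e₁ , e₂ ← ∷-injective e =
  let e₃ , e₄ = ++-injective (suc-injective l) e₂ in cong₂ _∷_ e₁ e₃ , e₄

rowBeads-cong : ∀ {ρ ν} m j → (∀ r → r < m → at ρ r ≡ at ν r) → rowBeads ρ m j ≡ rowBeads ν m j
rowBeads-cong zero j e = refl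
rowBeads-cong (suc m) j e = cong₂ _∷_ (cong (_+ j) (e m ≤-refl)) (rowBeads-cong m (suc j) (λ r lt → e r (m<n⇒m<1+n lt)))

lowBeads-cong : ∀ {ρ ν} m d j → (∀ r → m ≤ r → at ρ r ≡ at ν r) → lowBeads ρ m d j ≡ lowBeads ν m d j
lowBeads-cong m zero j e = refl
lowBeads-cong m (suc d) j e = cong₂ _∷_ (cong (_+ j) (e (d + m) (m≤n+m m d))) (lowBeads-cong m d (suc j) e)

rowBeads-injective : ∀ {ρ ν} m j → rowBeads ρ m j ≡ rowBeads ν m j → ∀ r → r < m → at ρ r ≡ at ν r
rowBeads-injective (suc m) j e r (s≤s r≤m) with e₁ , e₂ ← ∷-injective e with m≤n⇒m<n∨m≡n r≤m
... | inj₁ r<m = rowBeads-injective m (suc j) e₂ r r<m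
... | inj₂ refl = +-cancelʳ-≡ j _ _ e₁

lowBeads-injective : ∀ {ρ ν} m d j → lowBeads ρ m d j ≡ lowBeads ν m d j → ∀ r → m ≤ r → r < d + m → at ρ r ≡ at ν r
lowBeads-injective m zero j e r m≤r r<m = ⊥-elim (<⇒≱ r<m m≤r)
lowBeads-injective m (suc d) j e r m≤r (s≤s r≤) with e₁ , e₂ ← ∷-injective e with m≤n⇒m<n∨m≡n r≤
... | inj₁ r< = lowBeads-injective m d (suc j) e₂ r m≤r r<
... | inj₂ refl = +-cancelʳ-≡ j _ _ e₁

padRows : ℕ → List ℕ → List ℕ
padRows N ν = ν ++ replicate (N ∸ length ν) 0

length-padRows : ∀ {N ν} → length ν ≤ N → length (padRows N ν) ≡ N
length-padRows {N} {ν} le = trans (length-++ ν) (trans (cong (length ν +_) (length-replicate (N ∸ length ν))) (m+[n∸m]≡n le))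

at-padRows : ∀ ν k r → at (ν ++ replicate k 0) r ≡ at ν r
at-padRows [] zero r = refl
at-padRows [] (suc k) zero = refl
at-padRows [] (suc k) (suc r) = at-padRows [] k r
at-padRows (x ∷ ν) k zero = refl
at-padRows (x ∷ ν) k (suc r) = at-padRows ν k r

headOr0-zeros : ∀ k → headOr0 (replicate k 0) ≤ 0
headOr0-zeros zero = z≤n
headOr0-zeros (suc k) = z≤n

padRows-descending : ∀ {ν} k → Linked _≥_ ν → Linked _≥_ (ν ++ replicate k 0)
padRows-descending {[]} zero lk = []
padRows-descending {[]} (suc k) lk = descending-∷ (headOr0-zeros k) (padRows-descending {[]} k [])
padRows-descending {x ∷ ν} k lk = descending-∷ (head≤ ν (descending-head lk)) (padRows-descending k (Linked.tail lk))
  where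
  head≤ : ∀ ν → headOr0 ν ≤ x → headOr0 (ν ++ replicate k 0) ≤ x
  head≤ [] _ = ≤-trans (headOr0-zeros k) z≤n
  head≤ (y ∷ ν) le = le

beads-rowBeads : ∀ ρ → beads ρ ≡ rowBeads ρ (length ρ) 0
beads-rowBeads ρ = go ρ 0
  where
  snoc : ∀ x ρ m j → rowBeads (x ∷ ρ) (suc m) j ≡ rowBeads ρ m j ∷ʳ (x + (j + m))
  snoc x ρ zero j = cong (λ n → x + n ∷ []) (sym (+-identityʳ j))
  snoc x ρ (suc m) j = cong (at ρ m + j ∷_) (trans (snoc x ρ m (suc j)) (cong (λ n → rowBeads ρ m (suc j) ∷ʳ (x + n)) (sym (+-suc j m))))
  go : ∀ ρ j → addIndex j (reverse ρ) ≡ rowBeads ρ (length ρ) j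
  go [] j = refl
  go (x ∷ ρ) j = begin
    addIndex j (reverse (x ∷ ρ))                              ≡⟨ cong (addIndex j) (unfold-reverse x ρ) ⟩
    addIndex j (reverse ρ ∷ʳ x)                               ≡⟨ addIndex-∷ʳ j (reverse ρ) x ⟩
    addIndex j (reverse ρ) ∷ʳ (x + (j + length (reverse ρ)))  ≡⟨ cong₂ (λ l n → l ∷ʳ (x + (j + n))) (go ρ j) (length-reverse ρ) ⟩
    rowBeads ρ (length ρ) j ∷ʳ (x + (j + length ρ))           ≡⟨ sym (snoc x ρ (length ρ) j) ⟩
    rowBeads (x ∷ ρ) (length (x ∷ ρ)) j ∎
    where open ≡-Reasoning

rowBeads-padRows : ∀ {N ν} → length ν ≤ N → rowBeads ν N 0 ≡ beads (padRows N ν)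
rowBeads-padRows {N} {ν} le = sym (trans (beads-rowBeads (padRows N ν)) (trans (cong (λ k → rowBeads (padRows N ν) k 0) (length-padRows {N} {ν} le))
  (rowBeads-cong N 0 (λ r _ → at-padRows ν (N ∸ length ν) r))))

rowBeads-ascending : ∀ {N ν} → length ν ≤ N → Linked _≥_ ν → Linked _<_ (rowBeads ν N 0)
rowBeads-ascending {N} {ν} le lk = subst (Linked _<_) (sym (rowBeads-padRows le)) (beads-ascending _ (padRows-descending (N ∸ length ν) lk))

sum-replicate-0 : ∀ k → sum (replicate k 0) ≡ 0
sum-replicate-0 zero = refl
sum-replicate-0 (suc k) = sum-replicate-0 k

sum-rowBeads : ∀ {N ν} → length ν ≤ N → sum (rowBeads ν N 0) ≡ sum ν + sum (range 0 N)
sum-rowBeads {N} {ν} le = trans (cong sum (rowBeads-padRows le)) (trans (sum-beads (padRows N ν)) (cong₂ (λ a k → a + sum (range 0 k))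
  (trans (ActionProperties.sum-++ ν _) (trans (cong (sum ν +_) (sum-replicate-0 (N ∸ length ν))) (+-identityʳ _))) (length-padRows {N} {ν} le)))

subIndex : ℕ → List ℕ → List ℕ
subIndex j [] = []
subIndex j (x ∷ xs) = (x ∸ j) ∷ subIndex (suc j) xs

add-subIndex : ∀ j t → Linked _<_ t → All (j ≤_) t → addIndex j (subIndex j t) ≡ t
add-subIndex j [] _ _ = refl
add-subIndex j (x ∷ []) _ (le ∷ _) = cong (_∷ []) (m∸n+n≡m le)
add-subIndex j (x ∷ y ∷ t) (x<y ∷ lk) (le ∷ _) =
  cong₂ _∷_ (m∸n+n≡m le) (add-subIndex (suc j) (y ∷ t) lk (linked-lower (≤-<-trans le x<y) lk))

subIndex-ascending : ∀ j t → Linked _<_ t → Linked _≤_ (subIndex j t)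
subIndex-ascending j [] _ = []
subIndex-ascending j (x ∷ []) _ = [-]
subIndex-ascending j (x ∷ y ∷ t) (x<y ∷ lk) = ∸-monoˡ-≤ (suc j) x<y ∷ subIndex-ascending (suc j) (y ∷ t) lk

length-subIndex : ∀ j t → length (subIndex j t) ≡ length t
length-subIndex j [] = refl
length-subIndex j (x ∷ t) = cong suc (length-subIndex (suc j) t)

reverse-descending : ∀ {σ} → Linked _≤_ σ → Linked _≥_ (reverse σ)
reverse-descending [] = []
reverse-descending {x ∷ σ} lk = go x [] σ [-] lk
  where
  go : ∀ x acc σ → Linked _≥_ (x ∷ acc) → Linked _≤_ (x ∷ σ) → Linked _≥_ (foldl (λ a b → b ∷ a) (x ∷ acc) σ)
  go x acc [] lk _ = lk
  go x acc (y ∷ σ) lk (x≤y ∷ lk') = go y (x ∷ acc) σ (x≤y ∷ lk) lk'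

trim : List ℕ → List ℕ
trim [] = []
trim (zero ∷ ρ) = []
trim (suc x ∷ ρ) = suc x ∷ trim ρ

trim-at : ∀ ρ → Linked _≥_ ρ → ∀ r → at (trim ρ) r ≡ at ρ r
trim-at [] lk r = refl
trim-at (zero ∷ ρ) lk r = sym (n≤0⇒n≡0 (at-decreasing lk {0} {r} z≤n))
trim-at (suc x ∷ ρ) lk zero = refl
trim-at (suc x ∷ ρ) lk (suc r) = trim-at ρ (Linked.tail lk) r

trim-partition : ∀ ρ → Linked _≥_ ρ → Partition (trim ρ)
trim-partition [] lk = partition [] []
trim-partition (zero ∷ ρ) lk = partition [] []
trim-partition (suc x ∷ ρ) lk = let part = trim-partition ρ (Linked.tail lk) in
  partition (descending-∷ (head≤ ρ (descending-head lk)) (descending part)) (s≤s z≤n ∷ positive part)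
  where
  head≤ : ∀ ρ → headOr0 ρ ≤ suc x → headOr0 (trim ρ) ≤ suc x
  head≤ [] _ = z≤n
  head≤ (zero ∷ ρ) _ = z≤n
  head≤ (suc y ∷ ρ) le = le

trim-length : ∀ ρ → length (trim ρ) ≤ length ρ
trim-length [] = z≤n
trim-length (zero ∷ ρ) = z≤n
trim-length (suc x ∷ ρ) = s≤s (trim-length ρ)

-- Subtracting the indices from strictly increasing positions leaves weakly increasing row lengths;
-- reversing them and dropping zeros gives the partition.
unbead : ∀ t → Linked _<_ t → ∃ λ ρ → Partition ρ × length ρ ≤ length t × rowBeads ρ (length t) 0 ≡ t
unbead t lk = trim ρ , trim-partition ρ desc , subst (length (trim ρ) ≤_) len (trim-length ρ) , (begin
  rowBeads (trim ρ) (length t) 0 ≡⟨ rowBeads-cong (length t) 0 (λ r _ → trim-at ρ desc r) ⟩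
  rowBeads ρ (length t) 0        ≡⟨ cong (λ n → rowBeads ρ n 0) (sym len) ⟩
  rowBeads ρ (length ρ) 0        ≡⟨ sym (beads-rowBeads ρ) ⟩
  addIndex 0 (reverse ρ)         ≡⟨ cong (addIndex 0) (reverse-involutive (subIndex 0 t)) ⟩
  addIndex 0 (subIndex 0 t)      ≡⟨ add-subIndex 0 t lk (All.universal (λ _ → z≤n) t) ⟩
  t ∎)
  where
  open ≡-Reasoning
  ρ = reverse (subIndex 0 t)
  desc = reverse-descending (subIndex-ascending 0 t lk)
  len : length ρ ≡ length t
  len = trans (length-reverse (subIndex 0 t)) (length-subIndex 0 t)

ins-ascending : ∀ {b b'} r → Linked _<_ (b ∷ r) → b < b' → b' ∉ r → Linked _<_ (b ∷ ins b' r)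
ins-ascending [] lk lt _ = lt ∷ [-]
ins-ascending {b} {b'} (x ∷ r) (b<x ∷ lk) lt ∉r with b' <ᵇ x in e
... | true = lt ∷ <ᵇ-true⁻ e ∷ lk
... | false with m≤n⇒m<n∨m≡n (<ᵇ-false⁻ {b'} {x} e)
...   | inj₁ x<b' = b<x ∷ ins-ascending r lk x<b' (∉r ∘ there)
...   | inj₂ refl = ⊥-elim (∉r (here refl))

linked-drop : ∀ p {b q} → Linked _<_ (p ++ b ∷ q) → Linked _<_ (p ++ q)
linked-drop [] [-] = []
linked-drop [] (_ ∷ lk) = lk
linked-drop (x ∷ []) (_ ∷ [-]) = [-]
linked-drop (x ∷ []) (lt ∷ lt' ∷ lk) = <-trans lt lt' ∷ lk
linked-drop (x ∷ y ∷ p) (lt ∷ lk) = lt ∷ linked-drop (y ∷ p) lk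

linked-++ʳ : ∀ p {q} → Linked _<_ (p ++ q) → Linked _<_ q
linked-++ʳ [] lk = lk
linked-++ʳ (x ∷ []) [-] = []
linked-++ʳ (x ∷ []) (_ ∷ lk) = lk
linked-++ʳ (x ∷ y ∷ p) (_ ∷ lk) = linked-++ʳ (y ∷ p) lk

linked-replace : ∀ p {b q q'} → Linked _<_ (p ++ b ∷ q) → Linked _<_ (b ∷ q') → Linked _<_ (p ++ b ∷ q')
linked-replace [] _ lk = lk
linked-replace (x ∷ []) (lt ∷ _) lk = lt ∷ lk
linked-replace (x ∷ y ∷ p) (lt ∷ lk') lk = lt ∷ linked-replace (y ∷ p) lk' lk

ins-injective : ∀ b b' r → ins b r ≡ ins b' r → b ≡ b'
ins-injective b b' r e = +-cancelʳ-≡ (sum r) b b' (trans (sym (ins-sum b r)) (trans (cong sum e) (ins-sum b' r)))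

-- Each bead passed by b' falls back by one index: its row reappears one row lower and one cell
-- longer, which is `next-row`. h is the row in which b' lands.
ribbon-from-ins : ∀ {λ' ν} b' i d → (at ν i + d) < b' → b' ∉ rowBeads ν i (suc d) →
  rowBeads λ' (suc i) d ≡ ins b' (rowBeads ν i (suc d)) →
  ∃ λ h → h ≤ i × (∀ r → r < h → at λ' r ≡ at ν r) × at ν h < at λ' h × (∀ r → h ≤ r → r < i → at λ' (suc r) ≡ suc (at ν r))
ribbon-from-ins {λ'} {ν} b' zero d lt _ e = 0 , z≤n , (λ r ()) ,
  +-cancelʳ-< d _ _ (subst (at ν 0 + d <_) (sym (proj₁ (∷-injective e))) lt) , (λ r _ ())
ribbon-from-ins {λ'} {ν} b' (suc i) d lt ∉r e with b' <ᵇ (at ν i + suc d) in eq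
... | true = suc i , ≤-refl , (λ r r≤i → rowBeads-injective (suc i) (suc d) (proj₂ (∷-injective e)) r r≤i) ,
  +-cancelʳ-< d _ _ (subst (at ν (suc i) + d <_) (sym (proj₁ (∷-injective e))) lt) , (λ r le lt' → ⊥-elim (<⇒≱ lt' le))
... | false with m≤n⇒m<n∨m≡n (<ᵇ-false⁻ {b'} {at ν i + suc d} eq)
...   | inj₂ refl = ⊥-elim (∉r (here refl))
...   | inj₁ lt' with h , h≤i , same , head , next ← ribbon-from-ins {λ'} {ν} b' i (suc d) lt' (∉r ∘ there) (proj₂ (∷-injective e)) =
  h , m≤n⇒m≤1+n h≤i , same , head , λ r h≤r r≤i → case m≤n⇒m<n∨m≡n (s≤s⁻¹ r≤i) of λ
    { (inj₁ r<i) → next r h≤r r<i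
    ; (inj₂ refl) → +-cancelʳ-≡ d _ _ (trans (proj₁ (∷-injective e)) (+-suc (at ν i) d)) }

linked-later : ∀ {x b r} → Linked _<_ (x ∷ r) → b ∈ r → x < b
linked-later (lt ∷ lk) m = All.lookup (linked-lower lt lk) m

ribbon-passed : ∀ {λ' ν i h} → Linked _≥_ ν → Ribbon λ' ν i h → ∀ k d → h ≤ k → at ν k + suc d < at λ' h + suc (d + (k ∸ h))
ribbon-passed {h = h} lkν rib k d h≤k = +-mono-<-≤ (≤-<-trans (at-decreasing lkν h≤k) (Ribbon.head-row rib)) (s≤s (m≤m+n d (k ∸ h)))

module RibbonMoves (𝓡 : TorsionFreeRing) where
  open TorsionFreeRing 𝓡
  open Sums 𝓡
  open Signs 𝓡

  signPower : ℕ → R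
  signPower zero = 𝟙
  signPower (suc k) = ⊖ signPower k

  insSign-∈ : ∀ {b} r → Linked _<_ r → b ∈ r → insSign b r ≡ 𝟘
  insSign-∈ {b} (x ∷ r) lk (here refl) rewrite <ᵇ-false (≤-refl {b}) | ≡ᵇ-refl b = refl
  insSign-∈ {b} (x ∷ r) lk (there m) rewrite <ᵇ-false (<⇒≤ (linked-later lk m)) | ≡ᵇ-false (λ e → <⇒≢ (linked-later lk m) (sym e)) =
    trans (cong ⊖_ (insSign-∈ r (Linked.tail lk) m)) ⊖-𝟘

  -- For k = i, the bead of row i lands as the bead of row h and passes one bead for each of the
  -- rows h, ..., i - 1. Their number is the height, so re-sorting produces the sign of the ribbon.
  ribbon-ins : ∀ {λ' ν i h} → Linked _≥_ λ' → Linked _≥_ ν → Ribbon λ' ν i h → ∀ k d → h ≤ k → k ≤ i →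
    rowBeads λ' (suc k) d ≡ ins (at λ' h + (d + (k ∸ h))) (rowBeads ν k (suc d)) ×
    insSign (at λ' h + (d + (k ∸ h))) (rowBeads ν k (suc d)) ≡ signPower (k ∸ h)
  ribbon-ins {λ'} {ν} {i} {h} lkλ lkν rib k d h≤k k≤i with m≤n⇒m<n∨m≡n h≤k
  ... | inj₂ refl rewrite n∸n≡0 h | +-identityʳ d = top h above-same (λ r lt → at-decreasing lkλ (<⇒≤ lt))
    where
    open Ribbon rib
    top : ∀ h → (∀ r → r < h → at λ' r ≡ at ν r) → (∀ r → r < h → at λ' h ≤ at λ' r) →
      rowBeads λ' (suc h) d ≡ ins (at λ' h + d) (rowBeads ν h (suc d)) × insSign (at λ' h + d) (rowBeads ν h (suc d)) ≡ 𝟙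
    top zero _ _ = refl , refl
    top (suc h) same dec rewrite <ᵇ-true (subst (at λ' (suc h) + d <_) (sym (+-suc (at ν h) d))
      (s≤s (+-monoˡ-≤ d (≤-trans (dec h ≤-refl) (≤-reflexive (same h ≤-refl)))))) =
      cong (at λ' (suc h) + d ∷_) (rowBeads-cong (suc h) (suc d) same) , refl
  ribbon-ins {λ'} {ν} {i} {h} lkλ lkν rib (suc k) d h≤k k≤i | inj₁ (s≤s h≤k')
    with e₁ , e₂ ← ribbon-ins lkλ lkν rib k (suc d) h≤k' (<⇒≤ k≤i)
    rewrite +-∸-assoc 1 h≤k' | +-suc d (k ∸ h)
          | <ᵇ-false (<⇒≤ (ribbon-passed lkν rib k d h≤k')) | ≡ᵇ-false (λ e → <⇒≢ (ribbon-passed lkν rib k d h≤k') (sym e)) =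
    cong₂ _∷_ (trans (cong (_+ d) (Ribbon.next-row rib k h≤k' k≤i)) (sym (+-suc (at ν k) d))) e₁ , cong ⊖_ e₂

-- Tilings as chains of bead moves

record Scalars (𝓡 : TorsionFreeRing) : Set where
  open TorsionFreeRing 𝓡
  field
    ι : ℤ → R
    ι-0 : ι ℤ.0ℤ ≡ 𝟘
    ι-1 : ι ℤ.1ℤ ≡ 𝟙
    ι-+ : ∀ a b → ι (a ℤ.+ b) ≡ ι a ⊕ ι b
    ι-* : ∀ a b → ι (a ℤ.* b) ≡ ι a ⊗ ι b

at≤sum : ∀ ρ r → at ρ r ≤ sum ρ
at≤sum [] r = z≤n
at≤sum (x ∷ ρ) zero = m≤m+n x _
at≤sum (x ∷ ρ) (suc r) = ≤-trans (at≤sum ρ r) (m≤n+m _ x)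

module PartitionSums (𝓡 : TorsionFreeRing) where
  open TorsionFreeRing 𝓡
  open Sums 𝓡

  -- Says that q is listed exactly once: a sum against its indicator has a single term.
  ∑-partsBounded : ∀ f n m q (φ : List ℕ → R) → Partition q → sum q ≡ n → headOr0 q ≤ m → n ≤ f →
    ∑L (partsBounded f n m) (λ x → listEqᵇ x q ▷ φ x) ≡ φ q
  ∑-partsBounded f zero m [] φ _ _ _ _ = ⊕-identityʳ _
  ∑-partsBounded f zero m (zero ∷ q) φ (partition _ (() ∷ _)) _ _ _
  ∑-partsBounded f (suc n) m (zero ∷ q) φ (partition _ (() ∷ _)) _ _ _
  ∑-partsBounded (suc f) (suc n) m (suc x ∷ q) φ (partition lk (_ ∷ pos)) e x<m (s≤s n≤f) = begin
    ∑L (partsBounded (suc f) (suc n) m) (λ ρ → listEqᵇ ρ (suc x ∷ q) ▷ φ ρ)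
      ≡⟨ trans (∑L-concatMap (λ k → map (k ∷_) (partsBounded f (suc n ∸ k) k)) (map suc (upTo (m ⊓ suc n))) _)
           (trans (∑L-map suc (upTo (m ⊓ suc n)) _) (∑L-cong (upTo (m ⊓ suc n)) (λ k → ∑L-map (suc k ∷_) (partsBounded f (n ∸ k) (suc k)) _))) ⟩
    ∑ (m ⊓ suc n) (λ k → ∑L (partsBounded f (n ∸ k) (suc k)) (λ ρ → ((k ≡ᵇ x) ∧ listEqᵇ ρ q) ▷ φ (suc k ∷ ρ)))
      ≡⟨ ∑L-cong (upTo (m ⊓ suc n)) (λ k → trans (∑L-cong (partsBounded f (n ∸ k) (suc k)) (λ ρ → ▷-∧ (k ≡ᵇ x) _ _))
           (∑L-▷ (partsBounded f (n ∸ k) (suc k)) (k ≡ᵇ x) _)) ⟩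
    ∑ (m ⊓ suc n) (λ k → (k ≡ᵇ x) ▷ ∑L (partsBounded f (n ∸ k) (suc k)) (λ ρ → listEqᵇ ρ q ▷ φ (suc k ∷ ρ)))
      ≡⟨ ∑-δ (m ⊓ suc n) x _ (⊓-glb x<m (s≤s x≤n)) ⟩
    ∑L (partsBounded f (n ∸ x) (suc x)) (λ ρ → listEqᵇ ρ q ▷ φ (suc x ∷ ρ))
      ≡⟨ ∑-partsBounded f (n ∸ x) (suc x) q (φ ∘ (suc x ∷_)) (partition (Linked.tail lk) pos)
           (trans (sym (m+n∸m≡n x (sum q))) (cong (_∸ x) (suc-injective e))) (descending-head lk) (≤-trans (m∸n≤m n x) n≤f) ⟩
    φ (suc x ∷ q) ∎
    where
    open ≡-Reasoning
    x≤n : x ≤ n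
    x≤n = subst (x ≤_) (suc-injective e) (m≤m+n x (sum q))

  ∑-partitions : ∀ n q (φ : List ℕ → R) → Partition q → sum q ≡ n → ∑L (partitions n) (λ x → listEqᵇ x q ▷ φ x) ≡ φ q
  ∑-partitions n q φ part e = ∑-partsBounded n n n q φ part e (subst (headOr0 q ≤_) e (head≤sum q)) ≤-refl
    where
    head≤sum : ∀ q → headOr0 q ≤ sum q
    head≤sum [] = z≤n
    head≤sum (x ∷ q) = m≤m+n x _

  ∑-partitions-≢ : ∀ n q (φ : List ℕ → R) → sum q ≢ n → ∑L (partitions n) (λ x → listEqᵇ x q ▷ φ x) ≡ 𝟘
  ∑-partitions-≢ n q φ ne = ∑L-zero∈ (partitions n) (λ x x∈ → ▷-zero (listEqᵇ x q) (λ e →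
    ⊥-elim (ne (trans (cong sum (sym (listEqᵇ-true x q e))) (proj₂ (partitions-∈ n x x∈))))))

  ∑-partitionsUpTo : ∀ n q (φ : List ℕ → R) → Partition q → sum q ≤ n → ∑L (partitionsUpTo n) (λ x → listEqᵇ x q ▷ φ x) ≡ φ q
  ∑-partitionsUpTo n q φ part le = trans (∑L-concatMap partitions (upTo (suc n)) _)
    (trans (∑L-cong (upTo (suc n)) each) (∑-δ (suc n) (sum q) (λ _ → φ q) (s≤s le)))
    where
    each : ∀ k → ∑L (partitions k) (λ x → listEqᵇ x q ▷ φ x) ≡ ((k ≡ᵇ sum q) ▷ φ q)
    each k with k ≟ sum q
    ... | yes refl = trans (∑-partitions k q φ part refl) (sym (▷-true (≡ᵇ-refl (sum q))))
    ... | no ne = trans (∑-partitions-≢ k q φ (ne ∘ sym)) (sym (▷-false (≡ᵇ-false ne)))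

lastShape : List ℕ → List (List ℕ) → List ℕ
lastShape ν [] = ν
lastShape ν (λ' ∷ T) = lastShape λ' T

tilingShape-lastShape : ∀ T → tilingShape T ≡ lastShape [] T
tilingShape-lastShape [] = refl
tilingShape-lastShape (λ' ∷ T) = from λ' T
  where
  from : ∀ λ' T → tilingShape (λ' ∷ T) ≡ lastShape λ' T
  from λ' [] = refl
  from λ' (λ″ ∷ T) = from λ″ T

<ᵇ-suc : ∀ t m → (t <ᵇ suc m) ≡ (t <ᵇ m) ∨ (t ≡ᵇ m)
<ᵇ-suc zero zero = refl
<ᵇ-suc zero (suc m) = refl
<ᵇ-suc (suc t) zero = refl
<ᵇ-suc (suc t) (suc m) = <ᵇ-suc t m

module ChainSums (𝓡 : TorsionFreeRing) (𝓦 : GeometricSeries 𝓡) (𝓢 : Scalars 𝓡) where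
  open TorsionFreeRing 𝓡
  open Sums 𝓡
  open Signs 𝓡
  open GeometricSeries 𝓦
  open Chains 𝓡 𝓦
  open RibbonMoves 𝓡
  open PartitionSums 𝓡
  open Scalars 𝓢

  ι-⊖1 : ι ℤ.-1ℤ ≡ ⊖ 𝟙
  ι-⊖1 = begin
    ι ℤ.-1ℤ                    ≡⟨ sym (⊕-identityʳ _) ⟩
    ι ℤ.-1ℤ ⊕ 𝟘                ≡⟨ cong (ι ℤ.-1ℤ ⊕_) (sym (⊖-inverseʳ 𝟙)) ⟩
    ι ℤ.-1ℤ ⊕ (𝟙 ⊕ ⊖ 𝟙)        ≡⟨ sym (⊕-assoc _ _ _) ⟩
    (ι ℤ.-1ℤ ⊕ 𝟙) ⊕ ⊖ 𝟙        ≡⟨ cong (_⊕ ⊖ 𝟙) (trans (cong (ι ℤ.-1ℤ ⊕_) (sym ι-1)) (trans (sym (ι-+ ℤ.-1ℤ ℤ.1ℤ)) ι-0)) ⟩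
    𝟘 ⊕ ⊖ 𝟙                    ≡⟨ ⊕-identityˡ _ ⟩
    ⊖ 𝟙 ∎
    where open ≡-Reasoning

  ι-sign : ∀ k → ι (ℤ.-1ℤ ℤ.^ k) ≡ signPower k
  ι-sign zero = ι-1
  ι-sign (suc k) = trans (ι-* ℤ.-1ℤ (ℤ.-1ℤ ℤ.^ k)) (trans (cong₂ _⊗_ ι-⊖1 (ι-sign k))
    (trans (sym (⊖-⊗ˡ 𝟙 (signPower k))) (cong ⊖_ (⊗-identityˡ _))))

  zs : List ℕ → R
  zs = foldr (λ k v → z k ⊗ v) 𝟙

  -- Bead moves in `Y` may lead to partitions larger than n, which the chains do not contain. By
  -- `vanish` such configurations contribute nothing.
  module _ (N M n : ℕ) (n≤N : n ≤ N) (n+N≤M : n + N ≤ M) (f : List ℕ → R)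
           (vanish : ∀ t → length t ≡ N → n + sum (range 0 N) < sum t → f t ≡ 𝟘) where

    rows≤ : ∀ {ρ} → ρ ∈ partitionsUpTo n → length ρ ≤ N
    rows≤ {ρ} ρ∈ = let part , le = partitionsUpTo-∈ n ρ ρ∈ in ≤-trans (length≤sum (Partition.positive part)) (≤-trans le n≤N)

    -- Bead sum in which only the rows < m may still move.
    state : ℕ → List ℕ → ℕ → ℕ → R
    state s ν m d = Y M s (rowBeads ν m d) (f ∘ (lowBeads ν m d 0 ++_))

    module Row (s : ℕ) (ν : List ℕ) (lkν : Linked _≥_ ν) (ν≤N : length ν ≤ N) (i d : ℕ) (d+i : d + suc i ≡ N) where
      b : ℕ
      b = at ν i + d
      r low : List ℕ
      r = rowBeads ν i (suc d)
      low = lowBeads ν (suc i) d 0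
      Ψ : List ℕ → R
      Ψ t = Y M s t (f ∘ (low ++_))
      G : ℕ → R
      G b' = insSign b' r ⊗ (z (b' ∸ b) ⊗ Ψ (ins b' r))
      target : ℕ → List ℕ
      target b' = low ++ ins b' r
      hits : List ℕ → ℕ → Bool
      hits λ' b' = listEqᵇ (rowBeads λ' N 0) (target b')

      N∸i : N ∸ i ≡ suc d
      N∸i = trans (cong (_∸ i) (trans (sym d+i) (+-suc d i))) (m+n∸n≡m (suc d) i)

      split : ∀ λ' → rowBeads λ' N 0 ≡ lowBeads λ' (suc i) d 0 ++ rowBeads λ' (suc i) d
      split λ' = trans (cong (λ k → rowBeads λ' k 0) (sym d+i)) (trans (rowBeads-split λ' (suc i) d 0)
        (cong (λ k → lowBeads λ' (suc i) d 0 ++ rowBeads λ' (suc i) k) (+-identityʳ d)))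

      original-ascending : Linked _<_ (low ++ b ∷ r)
      original-ascending = subst (Linked _<_) (split ν) (rowBeads-ascending ν≤N lkν)

      target-ascending : ∀ {b'} → b < b' → b' ∉ r → Linked _<_ (target b')
      target-ascending lt ∉r = linked-drop low (linked-replace low original-ascending (ins-ascending r (linked-++ʳ low original-ascending) lt ∉r))

      length-target : ∀ b' → length (target b') ≡ N
      length-target b' = trans (length-++ low) (trans (cong₂ _+_ (length-lowBeads ν (suc i) d 0) (trans (ins-length b' r) (cong suc (length-rowBeads ν i (suc d))))) d+i)

      G-∈ : ∀ {b'} → b' ∈ r → G b' ≡ 𝟘
      G-∈ m = ⊗-zeroˡ′ _ (insSign-∈ r (Linked.tail (linked-++ʳ low original-ascending)) m)

      Ψ-zero : ∀ b' → n + sum (range 0 N) < sum (target b') → Ψ (ins b' r) ≡ 𝟘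
      Ψ-zero b' lt = Y-zero M s (ins b' r) _ (λ t l le → vanish (low ++ t)
        (trans (length-++ low) (trans (cong (length low +_) l) (trans (sym (length-++ low)) (length-target b'))))
        (<-≤-trans lt (subst₂ _≤_ (sym (ActionProperties.sum-++ low _)) (sym (ActionProperties.sum-++ low t)) (+-monoʳ-≤ (sum low) le))))

      hit-ribbon : ∀ {λ' b'} → Partition λ' → length λ' ≤ N → b < b' → b' ∉ r → hits λ' b' ≡ true → ∃ λ h → Ribbon λ' ν i h
      hit-ribbon {λ'} {b'} part λ≤N lt ∉r e =
        let eq = trans (sym (split λ')) (listEqᵇ-true _ _ e)
            e₁ , e₂ = ++-injective (trans (length-lowBeads λ' (suc i) d 0) (sym (length-lowBeads ν (suc i) d 0))) eq
            h , h≤i , same , head , next = ribbon-from-ins {λ'} {ν} b' i d lt ∉r e₂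
        in h , record { h≤i = h≤i ; above-same = same ; head-row = head ; next-row = next ; below-same = λ r i<r → same-below r i<r e₁ (r <? N) }
        where
        same-below : ∀ r → i < r → lowBeads λ' (suc i) d 0 ≡ low → Dec (r < N) → at λ' r ≡ at ν r
        same-below r i<r e₁ (yes r<N) = lowBeads-injective (suc i) d 0 e₁ r i<r (subst (r <_) (sym d+i) r<N)
        same-below r i<r e₁ (no r≥N) = trans (at-beyond λ' r (≤-trans λ≤N (≮⇒≥ r≥N))) (sym (at-beyond ν r (≤-trans ν≤N (≮⇒≥ r≥N))))

      ribbon-hit : ∀ {λ' h} → Linked _≥_ λ' → Ribbon λ' ν i h → hits λ' (at λ' h + (d + (i ∸ h))) ≡ true
      ribbon-hit {λ'} {h} lkλ rib = trans (cong (λ l → listEqᵇ l (target b*)) (trans (split λ') (cong₂ _++_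
        (lowBeads-cong {λ'} {ν} (suc i) d 0 (Ribbon.below-same rib)) (proj₁ (ribbon-ins lkλ lkν rib i d (Ribbon.h≤i rib) ≤-refl))))) (listEqᵇ-refl (target b*))
        where b* = at λ' h + (d + (i ∸ h))

      term : List ℕ → R
      term λ' = isRibbonᵇ λ' ν ▷ (tailRow λ' ν ≡ᵇ i) ▷ (signPower (ribbonHeight λ' ν) ⊗ (z (length (skewCells λ' ν)) ⊗ Ψ (rowBeads λ' (suc i) d)))

      -- Ribbons with tail in row i are the moves of b to a free higher position, and λ' determines
      -- that position by `ins-injective`. At an occupied position `G` is 0 through `insSign`.
      term-hits : ∀ λ' → λ' ∈ partitionsUpTo n → term λ' ≡ ∑ M (λ b' → (b <ᵇ b') ▷ hits λ' b' ▷ G b')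
      term-hits λ' λ∈ with isRibbonᵇ λ' ν in rib? | tailRow λ' ν ≡ᵇ i in tail?
      ... | true | true = sym (trans (∑L-cong (upTo M) only) (trans (∑-δ M b* G b*<M) value))
        where
        lkλ = Partition.descending (proj₁ (partitionsUpTo-∈ n λ' λ∈))
        found : ∃ λ h → Ribbon λ' ν i h
        found = let h , rib = ribbon⇒ λ' ν lkλ lkν rib? in h , subst (λ j → Ribbon λ' ν j h) (≡ᵇ-true tail?) rib
        h = proj₁ found
        rib = proj₂ found
        h≤i = Ribbon.h≤i rib
        b* = at λ' h + (d + (i ∸ h))
        b*<M : b* < M
        b*<M = ≤-trans (+-mono-≤-< (≤-trans (at≤sum λ' h) (proj₂ (partitionsUpTo-∈ n λ' λ∈)))
          (subst (d + (i ∸ h) <_) d+i (+-monoʳ-< d (s≤s (m∸n≤m i h))))) n+N≤M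
        b<b* : b < b*
        b<b* = +-mono-<-≤ (≤-<-trans (at-decreasing lkν h≤i) (Ribbon.head-row rib)) (m≤m+n d (i ∸ h))
        only : ∀ b' → ((b <ᵇ b') ▷ hits λ' b' ▷ G b') ≡ ((b' ≡ᵇ b*) ▷ G b')
        only b' with b' ≟ b*
        ... | yes refl = trans (▷-true (<ᵇ-true b<b*)) (trans (▷-true (ribbon-hit lkλ rib)) (sym (▷-true (≡ᵇ-refl b*))))
        ... | no ne = trans (▷-zero (b <ᵇ b') (λ _ → ▷-zero (hits λ' b') (λ e → ⊥-elim (ne (ins-injective b' b* r
                (++-cancelˡ low (ins b' r) (ins b* r) (trans (sym (listEqᵇ-true (rowBeads λ' N 0) (target b') e)) (listEqᵇ-true (rowBeads λ' N 0) (target b*) (ribbon-hit lkλ rib)))))))))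
              (sym (▷-false (≡ᵇ-false ne)))
        size : b* ∸ b ≡ length (skewCells λ' ν)
        size = trans (cong (_∸ b) (sym (suc-injective (trans (sym (trans (cong (k +_) (trans (cong (at ν i +_) N∸i) (+-suc (at ν i) d))) (+-suc k b)))
            (trans (ribbon-size lkλ lkν rib N (subst (i <_) d+i (m≤n+m (suc i) d))) (trans (cong (at λ' h +_) N∸h) (+-suc (at λ' h) _)))))))
          (m+n∸n≡m k b)
          where
          k = length (skewCells λ' ν)
          N∸h : N ∸ h ≡ suc (d + (i ∸ h))
          N∸h = trans (cong (_∸ h) (trans (sym d+i) (+-suc d i))) (+-∸-assoc (suc d) h≤i)
        value : G b* ≡ signPower (ribbonHeight λ' ν) ⊗ (z (length (skewCells λ' ν)) ⊗ Ψ (rowBeads λ' (suc i) d))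
        value = let e₁ , e₂ = ribbon-ins lkλ lkν rib i d h≤i ≤-refl in cong₂ _⊗_
          (trans e₂ (cong signPower (sym (ribbon-height lkλ lkν rib)))) (cong₂ (λ k t → z k ⊗ Ψ t) size (sym e₁))
      ... | false | _ = sym (∑L-zero∈ (upTo M) (λ b' _ → ▷-zero (b <ᵇ b') (λ lt → ▷-zero (hits λ' b') (λ e → none b' (<ᵇ-true⁻ lt) e (b' ∈? r)))))
        where
        none : ∀ b' → b < b' → hits λ' b' ≡ true → Dec (b' ∈ r) → G b' ≡ 𝟘
        none b' lt e (yes m) = G-∈ m
        none b' lt e (no ∉r) = let part , _ = partitionsUpTo-∈ n λ' λ∈
                                   h , rib = hit-ribbon part (rows≤ λ∈) lt ∉r e
          in case trans (sym rib?) (ribbon⇐ (Partition.descending part) lkν rib) of λ ()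
      ... | true | false = sym (∑L-zero∈ (upTo M) (λ b' _ → ▷-zero (b <ᵇ b') (λ lt → ▷-zero (hits λ' b') (λ e → none b' (<ᵇ-true⁻ lt) e (b' ∈? r)))))
        where
        none : ∀ b' → b < b' → hits λ' b' ≡ true → Dec (b' ∈ r) → G b' ≡ 𝟘
        none b' lt e (yes m) = G-∈ m
        none b' lt e (no ∉r) = let part , _ = partitionsUpTo-∈ n λ' λ∈
                                   h , rib = hit-ribbon part (rows≤ λ∈) lt ∉r e
          in case trans (sym tail?) (trans (cong (_≡ᵇ i) (ribbon-tailRow (Partition.descending part) lkν rib)) (≡ᵇ-refl i)) of λ ()

      -- A collision makes `G b'` zero. Otherwise `unbead` gives the only partition with these
      -- beads; if its size exceeds n, the chains miss it, but `Ψ-zero` kills the term as well.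
      ∑-hits : ∀ b' → b < b' → ∑L (partitionsUpTo n) (λ λ' → hits λ' b' ▷ G b') ≡ G b'
      ∑-hits b' lt with b' ∈? r
      ... | yes m = trans (∑L-zero∈ (partitionsUpTo n) (λ λ' _ → ▷-zero (hits λ' b') (λ _ → G-∈ m))) (sym (G-∈ m))
      ... | no ∉r with q , partq , len , e ← unbead (target b') (target-ascending lt ∉r) = decide (sum q ≤? n)
        where
        len′ : length q ≤ N
        len′ = subst (length q ≤_) (length-target b') len
        e′ : rowBeads q N 0 ≡ target b'
        e′ = trans (cong (λ k → rowBeads q k 0) (sym (length-target b'))) e
        hit⇒≡ : ∀ λ' → λ' ∈ partitionsUpTo n → hits λ' b' ≡ true → λ' ≡ q
        hit⇒≡ λ' λ∈ h = at-ext (Partition.positive (proj₁ (partitionsUpTo-∈ n λ' λ∈))) (Partition.positive partq) same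
          where
          same : ∀ r → at λ' r ≡ at q r
          same r with r <? N
          ... | yes r<N = rowBeads-injective N 0 (trans (listEqᵇ-true _ _ h) (sym e′)) r r<N
          ... | no r≥N = trans (at-beyond λ' r (≤-trans (rows≤ λ∈) (≮⇒≥ r≥N))) (sym (at-beyond q r (≤-trans len′ (≮⇒≥ r≥N))))
        decide : Dec (sum q ≤ n) → ∑L (partitionsUpTo n) (λ λ' → hits λ' b' ▷ G b') ≡ G b'
        decide (yes le) = trans (∑L-cong∈ (partitionsUpTo n) (λ λ' λ∈ → cong (_▷ G b') (true-iff
            (λ h → trans (cong (λ l → listEqᵇ l q) (hit⇒≡ λ' λ∈ h)) (listEqᵇ-refl q))
            (λ h → trans (cong (λ l → hits l b') (listEqᵇ-true λ' q h)) (trans (cong (λ l → listEqᵇ l (target b')) e′) (listEqᵇ-refl (target b')))))))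
          (∑-partitionsUpTo n q (λ _ → G b') partq le)
        decide (no nle) = trans (∑L-zero∈ (partitionsUpTo n) (λ λ' λ∈ → ▷-zero (hits λ' b') (λ h →
            ⊥-elim (nle (subst (λ l → sum l ≤ n) (hit⇒≡ λ' λ∈ h) (proj₂ (partitionsUpTo-∈ n λ' λ∈)))))))
          (sym (⊗-zeroʳ′ _ (⊗-zeroʳ′ _ (Ψ-zero b' (subst (n + sum (range 0 N) <_) (trans (sym (sum-rowBeads len′)) (cong sum e′)) (+-monoˡ-< _ (≰⇒> nle)))))))

      ∑-term : ∑L (partitionsUpTo n) term ≡ ∑ M (λ b' → (b <ᵇ b') ▷ G b')
      ∑-term = trans (∑L-cong∈ (partitionsUpTo n) term-hits) (trans (∑L-swap (partitionsUpTo n) (upTo M) _)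
        (∑L-cong (upTo M) (λ b' → trans (∑L-▷ (partitionsUpTo n) (b <ᵇ b') _) (▷-cong (b <ᵇ b') (λ lt → ∑-hits b' (<ᵇ-true⁻ lt))))))

    next : ℕ → List ℕ → List ℕ → R
    next s ν λ' = signPower (ribbonHeight λ' ν) ⊗ (z (length (skewCells λ' ν)) ⊗ state s λ' (suc (tailRow λ' ν)) (N ∸ suc (tailRow λ' ν)))

    -- Induction on the number m of movable rows, parallel to the recursion of `Y`: a ribbon with
    -- tail in the lowest of them moves its bead, and all other ribbons leave that bead frozen.
    state-suc : ∀ s ν → Linked _≥_ ν → length ν ≤ N → ∀ m d → d + m ≡ N →
      ∑L (partitionsUpTo n) (λ λ' → isRibbonᵇ λ' ν ▷ (tailRow λ' ν <ᵇ m) ▷ next s ν λ') ≡ state (suc s) ν m d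
    state-suc s ν lkν ν≤N zero d e = ∑L-zero∈ (partitionsUpTo n) (λ λ' _ → ▷-𝟘 (isRibbonᵇ λ' ν))
    state-suc s ν lkν ν≤N (suc i) d e = begin
      ∑L PU (λ λ' → isRibbonᵇ λ' ν ▷ (tailRow λ' ν <ᵇ suc i) ▷ next s ν λ')
        ≡⟨ ∑L-cong∈ PU (λ λ' λ∈ → trans (cong (isRibbonᵇ λ' ν ▷_) (splitRow (tailRow λ' ν) (next s ν λ'))) (trans (▷-⊕ (isRibbonᵇ λ' ν) _ _)
             (cong ((isRibbonᵇ λ' ν ▷ (tailRow λ' ν <ᵇ i) ▷ next s ν λ') ⊕_) (▷-cong (isRibbonᵇ λ' ν) (λ rib → ▷-cong (tailRow λ' ν ≡ᵇ i) (same λ' λ∈ rib)))))) ⟩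
      ∑L PU (λ λ' → (isRibbonᵇ λ' ν ▷ (tailRow λ' ν <ᵇ i) ▷ next s ν λ') ⊕ term λ')
        ≡⟨ ∑L-⊕ PU _ _ ⟩
      ∑L PU (λ λ' → isRibbonᵇ λ' ν ▷ (tailRow λ' ν <ᵇ i) ▷ next s ν λ') ⊕ ∑L PU term
        ≡⟨ cong₂ _⊕_ (trans (state-suc s ν lkν ν≤N i (suc d) (trans (sym (+-suc d i)) e)) frozen) ∑-term ⟩
      state (suc s) ν (suc i) d ∎
      where
      open ≡-Reasoning
      open Row s ν lkν ν≤N i d e
      PU = partitionsUpTo n
      splitRow : ∀ t x → ((t <ᵇ suc i) ▷ x) ≡ ((t <ᵇ i) ▷ x) ⊕ ((t ≡ᵇ i) ▷ x)
      splitRow t x rewrite <ᵇ-suc t i with t <ᵇ i in lt | t ≡ᵇ i in eq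
      ... | true | true = ⊥-elim (<⇒≢ (<ᵇ-true⁻ {t} {i} lt) (≡ᵇ-true {t} {i} eq))
      ... | true | false = sym (⊕-identityʳ x)
      ... | false | true = sym (⊕-identityˡ x)
      ... | false | false = sym (⊕-identityˡ 𝟘)
      frozen : state (suc s) ν i (suc d) ≡ Y M (suc s) r ((f ∘ (low ++_)) ∘ (b ∷_))
      frozen = Y-cong M (suc s) r (λ t → cong f (trans (cong (_++ t) (trans (lowBeads-∷ʳ ν i d 0)
        (cong (λ k → low ∷ʳ (at ν i + k)) (+-identityʳ d)))) (++-assoc low (b ∷ []) t)))
      same : ∀ λ' → λ' ∈ PU → isRibbonᵇ λ' ν ≡ true → (tailRow λ' ν ≡ᵇ i) ≡ true →
        next s ν λ' ≡ signPower (ribbonHeight λ' ν) ⊗ (z (length (skewCells λ' ν)) ⊗ Ψ (rowBeads λ' (suc i) d))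
      same λ' λ∈ rib? tail? with h , rib ← ribbon⇒ λ' ν (Partition.descending (proj₁ (partitionsUpTo-∈ n λ' λ∈))) lkν rib? =
        cong (λ v → signPower (ribbonHeight λ' ν) ⊗ (z (length (skewCells λ' ν)) ⊗ v)) (trans
          (cong₂ (λ k j → state s λ' (suc k) j) tail≡ (trans (cong (λ k → N ∸ suc k) tail≡) (trans (cong (_∸ suc i) (sym e)) (m+n∸n≡m d (suc i)))))
          (cong (λ l → Y M s (rowBeads λ' (suc i) d) (f ∘ (l ++_))) (lowBeads-cong (suc i) d 0 (λ r i<r → Ribbon.below-same rib r (subst (_< r) (sym tail≡) i<r)))))
        where
        tail≡ : tailRow λ' ν ≡ i
        tail≡ = ≡ᵇ-true tail?

    tilingSum : ℕ → List ℕ → Maybe ℕ → R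
    tilingSum s ν prev = ∑L (chains n s) (λ T → monotonicᵇ ν prev T ▷
      (ι (tilingSign ν T) ⊗ (zs (ribbonSizes ν T) ⊗ f (rowBeads (lastShape ν T) N 0))))

    tilingSum-suc : ∀ s ν prev → tilingSum (suc s) ν prev ≡ ∑L (partitionsUpTo n) (λ λ' → isRibbonᵇ λ' ν ▷ above prev (tailColumn λ' ν) ▷
      (ι (ribbonSign λ' ν) ⊗ (z (length (skewCells λ' ν)) ⊗ tilingSum s λ' (just (tailColumn λ' ν)))))
    tilingSum-suc s ν prev = trans (∑L-concatMap (λ q → map (q ∷_) (chains n s)) (partitionsUpTo n) _) (∑L-cong (partitionsUpTo n) (λ λ' →
      trans (∑L-map (λ' ∷_) (chains n s) _) (trans (∑L-cong (chains n s) (λ T → trans (▷-∧ (isRibbonᵇ λ' ν) _ _) (cong (isRibbonᵇ λ' ν ▷_) (trans (▷-∧ (above prev (tailColumn λ' ν)) _ _)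
        (cong (above prev (tailColumn λ' ν) ▷_) (trans (cong (monotonicᵇ λ' (just (tailColumn λ' ν)) T ▷_) (regroup λ' T)) (trans (▷-⊗ʳ (monotonicᵇ λ' (just (tailColumn λ' ν)) T) _ _)
          (cong (ι (ribbonSign λ' ν) ⊗_) (▷-⊗ʳ (monotonicᵇ λ' (just (tailColumn λ' ν)) T) _ _)))))))))
      (trans (∑L-▷ (chains n s) (isRibbonᵇ λ' ν) _) (cong (isRibbonᵇ λ' ν ▷_) (trans (∑L-▷ (chains n s) (above prev (tailColumn λ' ν)) _)
        (cong (above prev (tailColumn λ' ν) ▷_) (trans (∑L-⊗ˡ (chains n s) _ _) (cong (ι (ribbonSign λ' ν) ⊗_) (∑L-⊗ˡ (chains n s) _ _))))))))))
      where
      regroup : ∀ λ' T → ι (ribbonSign λ' ν ℤ.* tilingSign λ' T) ⊗ ((z (length (skewCells λ' ν)) ⊗ zs (ribbonSizes λ' T)) ⊗ f (rowBeads (lastShape λ' T) N 0)) ≡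
        ι (ribbonSign λ' ν) ⊗ (z (length (skewCells λ' ν)) ⊗ (ι (tilingSign λ' T) ⊗ (zs (ribbonSizes λ' T) ⊗ f (rowBeads (lastShape λ' T) N 0))))
      regroup λ' T = trans (cong₂ _⊗_ (ι-* (ribbonSign λ' ν) _) (⊗-assoc _ _ _)) (trans (⊗-assoc _ _ _) (cong (ι (ribbonSign λ' ν) ⊗_) (⊗-left-comm _ _ _)))

    -- The last hypothesis translates monotonicity. A ribbon added with tail in row i has tail
    -- column ν_i, so lying east of the previous tail means that row i is still movable.
    tilingSum-state : ∀ s ν prev m d → Linked _≥_ ν → length ν ≤ N → d + m ≡ N →
      (∀ i → i < N → above prev (at ν i) ≡ (i <ᵇ m)) → tilingSum s ν prev ≡ state s ν m d
    tilingSum-state zero ν prev m d lkν ν≤N e inv = trans (⊕-identityʳ _) (trans (cong₂ _⊗_ ι-1 (⊗-identityˡ _)) (trans (⊗-identityˡ _)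
      (cong f (trans (cong (λ k → rowBeads ν k 0) (sym e)) (trans (rowBeads-split ν m d 0) (cong (λ k → lowBeads ν m d 0 ++ rowBeads ν m k) (+-identityʳ d)))))))
    tilingSum-state (suc s) ν prev m d lkν ν≤N e inv = trans (tilingSum-suc s ν prev)
      (trans (∑L-cong∈ (partitionsUpTo n) (λ λ' λ∈ → ▷-cong (isRibbonᵇ λ' ν) (each λ' λ∈))) (state-suc s ν lkν ν≤N m d e))
      where
      each : ∀ λ' → λ' ∈ partitionsUpTo n → isRibbonᵇ λ' ν ≡ true →
        (above prev (tailColumn λ' ν) ▷ (ι (ribbonSign λ' ν) ⊗ (z (length (skewCells λ' ν)) ⊗ tilingSum s λ' (just (tailColumn λ' ν))))) ≡
        ((tailRow λ' ν <ᵇ m) ▷ next s ν λ')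
      each λ' λ∈ rib? with h , rib ← ribbon⇒ λ' ν (Partition.descending (proj₁ (partitionsUpTo-∈ n λ' λ∈))) lkν rib? =
        cong₂ _▷_ (trans (cong (above prev) col) (inv i i<N)) (cong₂ _⊗_ (ι-sign (ribbonHeight λ' ν)) (cong (z (length (skewCells λ' ν)) ⊗_)
          (trans (cong (λ c → tilingSum s λ' (just c)) col) (tilingSum-state s λ' (just (at ν i)) (suc i) (N ∸ suc i) lkλ (rows≤ λ∈) (m∸n+n≡m i<N) inv′))))
        where
        lkλ = Partition.descending (proj₁ (partitionsUpTo-∈ n λ' λ∈))
        i = tailRow λ' ν
        occupied : at ν i < at λ' i
        occupied = ribbon-row-occupied lkλ lkν rib i (Ribbon.h≤i rib) ≤-refl
        i<N : i < N
        i<N = <-≤-trans (ribbon-rows lkλ lkν rib) (rows≤ λ∈)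
        col : tailColumn λ' ν ≡ at ν i
        col = tailColumn-≡ λ' ν occupied
        -- Row i itself remains movable, since its next tail column λ'_i exceeds ν_i; the rows below
        -- are unchanged and do not lie east of it.
        inv′ : ∀ k → k < N → (at ν i <ᵇ at λ' k) ≡ (k <ᵇ suc i)
        inv′ k _ with k ≤? i
        ... | yes k≤i = trans (<ᵇ-true (<-≤-trans occupied (at-decreasing lkλ k≤i))) (sym (<ᵇ-true (s≤s k≤i)))
        ... | no k≰i = trans (<ᵇ-false (subst (_≤ at ν i) (sym (Ribbon.below-same rib k (≰⇒> k≰i))) (at-decreasing lkν (<⇒≤ (≰⇒> k≰i))))) (sym (<ᵇ-false (≰⇒> k≰i)))

-- The Cauchy identity and nilpotent variables

module Cauchy (𝓡 : TorsionFreeRing) (𝓦 : GeometricSeries 𝓡) where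
  open TorsionFreeRing 𝓡
  open Sums 𝓡
  open Signs 𝓡
  open GeometricSeries 𝓦
  open Chains 𝓡 𝓦
  open Lowering 𝓡
  open Alternants 𝓡
  open Pieri 𝓡 𝓦

  Y-suc-zero : ∀ M s γ f → (∀ t → length t ≡ length γ → sum γ < sum t → f t ≡ 𝟘) → Y M (suc s) γ f ≡ 𝟘
  Y-suc-zero M s [] f e = refl
  Y-suc-zero M s (b ∷ r) f e = trans (cong₂ _⊕_
      (Y-suc-zero M s r (f ∘ (b ∷_)) (λ t l lt → e (b ∷ t) (cong suc l) (+-monoʳ-< b lt)))
      (∑L-zero∈ (upTo M) (λ b' _ → ▷-zero (b <ᵇ b') (λ lt → ⊗-zeroʳ′ _ (⊗-zeroʳ′ _ (Y-zero M s (ins b' r) f (λ t l le → e t (trans l (ins-length b' r))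
        (<-≤-trans (+-monoˡ-< (sum r) (<ᵇ-true⁻ lt)) (subst (_≤ sum t) (ins-sum b' r) le)))))))))
    (⊕-identityˡ 𝟘)

  ∏w : List ℕ → R
  ∏w = foldr (λ a v → w a ⊗ v) 𝟙

  -- In the expansion by `∑-Y` every actual move increases the sum of the positions, where the
  -- staircase function vanishes by degree. Only the unmoved staircase counts.
  L-staircase : ∀ N → L N (range 0 N) (staircase N) ≡ 𝟙
  L-staircase N = begin
    L N γ (staircase N)
      ≡⟨ sym (∑-Y N (deficit N γ) γ (staircase N) (staircase-alternating N) (range-< 0 N) ≤-refl) ⟩
    ∑ (suc (deficit N γ)) (λ i → Y N i γ (staircase N))
      ≡⟨ ∑-suc (deficit N γ) _ ⟩
    staircase N γ ⊕ ∑ (deficit N γ) (λ i → Y N (suc i) γ (staircase N))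
      ≡⟨ ⊕-identityʳ′ _ (∑L-zero∈ (upTo (deficit N γ)) (λ i _ → Y-suc-zero N i γ _ (λ t l lt →
           schur-size N [] t (trans l (length-range 0 N)) (λ e → <⇒≢ lt (sym (trans e (+-identityʳ _))))))) ⟩
    staircase N γ
      ≡⟨ staircase-one N γ (range-ascending 0 N) (range-< 0 N) ⟩
    𝟙 ∎
    where
    open ≡-Reasoning
    γ = range 0 N

  L-schur : ∀ N r → length r ≤ N → L (suc (bound N r)) (range 0 (suc N)) (schur (suc N) r) ≡ ∏w r
  L-schur N [] le = L-staircase (suc N)
  L-schur N (a ∷ r) le = trans
    (pieri a (bound N r) N (schur (suc N) r) (schur-alternating (suc N) r) (schur-bounded N r) (schur-no-zero N r (<⇒≤ le)))
    (cong (w a ⊗_) (L-schur N r (<⇒≤ le)))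

bound-≥ : ∀ (𝓡 : TorsionFreeRing) N r → sum r + N ≤ Alternants.bound 𝓡 N r
bound-≥ 𝓡 N [] = ≤-refl
bound-≥ 𝓡 N (a ∷ r) = begin
  a + sum r + N                                 ≡⟨ +-assoc a (sum r) N ⟩
  a + (sum r + N)                               ≤⟨ +-monoʳ-≤ a (bound-≥ 𝓡 N r) ⟩
  a + Alternants.bound 𝓡 N r                    ≡⟨ +-comm a _ ⟩
  Alternants.bound 𝓡 N r + a                    ≤⟨ n≤1+n _ ⟩
  suc (Alternants.bound 𝓡 N r) + a ∎
  where open ≤-Reasoning

-- Iterated dual numbers over the integers

ℤ-ring : TorsionFreeRing
ℤ-ring = record
  { R = ℤ ; _⊕_ = ℤ._+_ ; _⊗_ = ℤ._*_ ; ⊖_ = ℤ.-_ ; 𝟘 = ℤ.0ℤ ; 𝟙 = ℤ.1ℤ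
  ; isCommutativeRing = ℤₚ.+-*-isCommutativeRing
  ; 2-torsionFree = λ { (ℤ.+ zero) _ → refl ; (ℤ.+ suc n) () ; ℤ.-[1+ n ] () } }

-- R[ε]/(ε²), with a + b ε represented by (a , b).
module Dual (𝓡 : TorsionFreeRing) where
  open TorsionFreeRing 𝓡

  dual : TorsionFreeRing
  dual = record
    { R = R × R
    ; _⊕_ = λ (a , b) (c , d) → a ⊕ c , b ⊕ d
    ; _⊗_ = λ (a , b) (c , d) → a ⊗ c , a ⊗ d ⊕ b ⊗ c
    ; ⊖_ = λ (a , b) → ⊖ a , ⊖ b
    ; 𝟘 = 𝟘 , 𝟘
    ; 𝟙 = 𝟙 , 𝟘
    ; isCommutativeRing = record
      { isRing = record
        { +-isAbelianGroup = record
          { isGroup = record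
            { isMonoid = record
              { isSemigroup = record
                { isMagma = record { isEquivalence = isEquivalence ; ∙-cong = cong₂ _ }
                ; assoc = λ _ _ _ → cong₂ _,_ (⊕-assoc _ _ _) (⊕-assoc _ _ _) }
              ; identity = (λ _ → cong₂ _,_ (⊕-identityˡ _) (⊕-identityˡ _)) , (λ _ → cong₂ _,_ (⊕-identityʳ _) (⊕-identityʳ _)) }
            ; inverse = (λ _ → cong₂ _,_ (⊖-inverseˡ _) (⊖-inverseˡ _)) , (λ _ → cong₂ _,_ (⊖-inverseʳ _) (⊖-inverseʳ _))
            ; ⁻¹-cong = λ { refl → refl } }
          ; comm = λ _ _ → cong₂ _,_ (⊕-comm _ _) (⊕-comm _ _) }
        ; *-cong = cong₂ _
        ; *-assoc = λ (a , b) (c , d) (e , f) → cong₂ _,_ (⊗-assoc a c e) (assoc₂ a b c d e f)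
        ; *-identity = (λ (a , b) → cong₂ _,_ (⊗-identityˡ a) (trans (cong₂ _⊕_ (⊗-identityˡ b) (⊗-zeroˡ a)) (⊕-identityʳ b)))
                     , (λ (a , b) → cong₂ _,_ (⊗-identityʳ a) (trans (cong₂ _⊕_ (⊗-zeroʳ a) (⊗-identityʳ b)) (⊕-identityˡ b)))
        ; distrib = (λ (a , b) (c , d) (e , f) → cong₂ _,_ (⊗-distribˡ a c e) (trans (cong₂ _⊕_ (⊗-distribˡ a d f) (⊗-distribˡ b c e)) (⊕-interchange _ _ _ _)))
                  , (λ (a , b) (c , d) (e , f) → cong₂ _,_ (⊗-distribʳ a c e) (trans (cong₂ _⊕_ (⊗-distribʳ b c e) (⊗-distribʳ a d f)) (⊕-interchange _ _ _ _))) }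
      ; *-comm = λ (a , b) (c , d) → cong₂ _,_ (⊗-comm a c) (trans (⊕-comm _ _) (cong₂ _⊕_ (⊗-comm b c) (⊗-comm a d))) }
    ; 2-torsionFree = λ (a , b) e → cong₂ _,_ (2-torsionFree a (cong proj₁ e)) (2-torsionFree b (cong proj₂ e)) }
    where
    assoc₂ : ∀ a b c d e f → (a ⊗ c) ⊗ f ⊕ (a ⊗ d ⊕ b ⊗ c) ⊗ e ≡ a ⊗ (c ⊗ f ⊕ d ⊗ e) ⊕ b ⊗ (c ⊗ e)
    assoc₂ a b c d e f = begin
      (a ⊗ c) ⊗ f ⊕ (a ⊗ d ⊕ b ⊗ c) ⊗ e             ≡⟨ cong₂ _⊕_ (⊗-assoc a c f) (⊗-distribʳ e _ _) ⟩
      a ⊗ (c ⊗ f) ⊕ ((a ⊗ d) ⊗ e ⊕ (b ⊗ c) ⊗ e)     ≡⟨ cong (a ⊗ (c ⊗ f) ⊕_) (cong₂ _⊕_ (⊗-assoc a d e) (⊗-assoc b c e)) ⟩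
      a ⊗ (c ⊗ f) ⊕ (a ⊗ (d ⊗ e) ⊕ b ⊗ (c ⊗ e))     ≡⟨ sym (⊕-assoc _ _ _) ⟩
      (a ⊗ (c ⊗ f) ⊕ a ⊗ (d ⊗ e)) ⊕ b ⊗ (c ⊗ e)     ≡⟨ cong (_⊕ b ⊗ (c ⊗ e)) (sym (⊗-distribˡ a _ _)) ⟩
      a ⊗ (c ⊗ f ⊕ d ⊗ e) ⊕ b ⊗ (c ⊗ e) ∎
      where open ≡-Reasoning

  module ∑ᴿ = Sums 𝓡
  module ∑ᴰ = Sums dual

  proj₁-∑ : ∀ {A : Set} (xs : List A) f → proj₁ (∑ᴰ.∑L xs f) ≡ ∑ᴿ.∑L xs (proj₁ ∘ f)
  proj₁-∑ [] f = refl
  proj₁-∑ (x ∷ xs) f = cong (proj₁ (f x) ⊕_) (proj₁-∑ xs f)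

  proj₂-∑ : ∀ {A : Set} (xs : List A) f → proj₂ (∑ᴰ.∑L xs f) ≡ ∑ᴿ.∑L xs (proj₂ ∘ f)
  proj₂-∑ [] f = refl
  proj₂-∑ (x ∷ xs) f = cong (proj₂ (f x) ⊕_) (proj₂-∑ xs f)

-- One nilpotent variable ε_m for each part m of the list.
tower : List ℕ → TorsionFreeRing
tower [] = ℤ-ring
tower (m ∷ ms) = Dual.dual (tower ms)

⟦_⟧ : List ℕ → Set
⟦ ms ⟧ = TorsionFreeRing.R (tower ms)

-- The coefficient of the product of all variables.
top : ∀ ms → ⟦ ms ⟧ → ℤ
top [] c = c
top (m ∷ ms) (_ , b) = top ms b

scalars : ∀ ms → Scalars (tower ms)
scalars [] = record { ι = id ; ι-0 = refl ; ι-1 = refl ; ι-+ = λ _ _ → refl ; ι-* = λ _ _ → refl }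
scalars (m ∷ ms) = record
  { ι = λ c → ι c , 𝟘
  ; ι-0 = cong (_, 𝟘) ι-0
  ; ι-1 = cong (_, 𝟘) ι-1
  ; ι-+ = λ a b → cong₂ _,_ (ι-+ a b) (sym (⊕-identityˡ 𝟘))
  ; ι-* = λ a b → cong₂ _,_ (ι-* a b) (sym (trans (cong₂ _⊕_ (⊗-zeroʳ _) (⊗-zeroˡ _)) (⊕-identityˡ 𝟘))) }
  where
  open TorsionFreeRing (tower ms)
  open Scalars (scalars ms)

top-⊕ : ∀ ms x y → top ms (TorsionFreeRing._⊕_ (tower ms) x y) ≡ top ms x ℤ.+ top ms y
top-⊕ [] x y = refl
top-⊕ (m ∷ ms) (_ , x) (_ , y) = top-⊕ ms x y

top-𝟘 : ∀ ms → top ms (TorsionFreeRing.𝟘 (tower ms)) ≡ ℤ.0ℤ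
top-𝟘 [] = refl
top-𝟘 (m ∷ ms) = top-𝟘 ms

top-ι : ∀ ms c x → top ms (TorsionFreeRing._⊗_ (tower ms) (Scalars.ι (scalars ms) c) x) ≡ c ℤ.* top ms x
top-ι [] c x = refl
top-ι (m ∷ ms) c (a , b) = trans (cong (top ms) (⊕-identityʳ′ _ (⊗-zeroˡ a))) (top-ι ms c b)
  where
  open TorsionFreeRing (tower ms)
  open Sums (tower ms)

module ℤΣ = Sums ℤ-ring
open ℤΣ using () renaming (∑L to ∑ℤ; _▷_ to _▷ℤ_)

top-∑ : ∀ ms {A : Set} (xs : List A) f → top ms (Sums.∑L (tower ms) xs f) ≡ ∑ℤ xs (top ms ∘ f)
top-∑ ms [] f = top-𝟘 ms
top-∑ ms (x ∷ xs) f = trans (top-⊕ ms _ _) (cong (λ v → top ms (f x) ℤ.+ v) (top-∑ ms xs f))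

top-▷ : ∀ ms b x → top ms (Sums._▷_ (tower ms) b x) ≡ b ▷ℤ top ms x
top-▷ ms true x = refl
top-▷ ms false x = top-𝟘 ms

module Generators where
  open TorsionFreeRing using (R; 𝟘; 𝟙)

  multiple : ∀ ms → ℕ → ⟦ ms ⟧ → ⟦ ms ⟧
  multiple ms k x = TorsionFreeRing._⊗_ (tower ms) (Scalars.ι (scalars ms) (ℤ.+ k)) x

  -- z_k = Σ_{m = k} ε_m
  variable-of-size : ∀ ms → ℕ → ⟦ ms ⟧
  variable-of-size [] j = ℤ.0ℤ
  variable-of-size (m ∷ ms) j = variable-of-size ms j , Sums._▷_ (tower ms) (j ≡ᵇ m) (𝟙 (tower ms))

  -- The coefficient of y^a in W^k: since (A - ε y^m)^{-k} = A^{-k} + k ε y^m A^{-(k+1)}.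
  power : ∀ ms → ℕ → ℕ → ⟦ ms ⟧
  power [] k zero = ℤ.1ℤ
  power [] k (suc a) = ℤ.0ℤ
  power (m ∷ ms) k a = power ms k a , Sums._▷_ (tower ms) (m ≤ᵇ a) (multiple ms k (power ms (suc k) (a ∸ m)))

  power-degree0 : ∀ ms → All (1 ≤_) ms → ∀ k → power ms k 0 ≡ 𝟙 (tower ms)
  power-degree0 [] _ k = refl
  power-degree0 (suc m ∷ ms) (_ ∷ pos) k = cong (_, _) (power-degree0 ms pos k)

  multiple-0 : ∀ ms x → multiple ms 0 x ≡ 𝟘 (tower ms)
  multiple-0 ms x = trans (cong (_⊗ x) (Scalars.ι-0 (scalars ms))) (⊗-zeroˡ x)
    where open TorsionFreeRing (tower ms) using (_⊗_; ⊗-zeroˡ)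

  multiple-suc : ∀ ms k x → multiple ms (suc k) x ≡ TorsionFreeRing._⊕_ (tower ms) x (multiple ms k x)
  multiple-suc ms k x = trans (cong (_⊗ x) (trans (ι-+ ℤ.1ℤ (ℤ.+ k)) (cong (_⊕ ι (ℤ.+ k)) ι-1)))
    (trans (⊗-distribʳ x _ _) (cong (_⊕ ι (ℤ.+ k) ⊗ x) (⊗-identityˡ x)))
    where
    open TorsionFreeRing (tower ms) hiding (R; 𝟘; 𝟙)
    open Scalars (scalars ms)

  power-0 : ∀ ms a → power ms 0 (suc a) ≡ 𝟘 (tower ms)
  power-0 [] a = refl
  power-0 (m ∷ ms) a = cong₂ _,_ (power-0 ms a) (Sums.▷-zero (tower ms) (m ≤ᵇ suc a) (λ _ → multiple-0 ms _))

  -- The identity W^{k+1} = W^k + (Σ z_j y^j) W^{k+1}, coefficient by coefficient. All k are treated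
  -- together because the ε-part of a power involves the next higher power.
  power-suc : ∀ ms → All (1 ≤_) ms → ∀ k a → power ms (suc k) a ≡
    TorsionFreeRing._⊕_ (tower ms) (power ms k a) (Sums.∑ (tower ms) a (λ j →
      TorsionFreeRing._⊗_ (tower ms) (variable-of-size ms (suc j)) (power ms (suc k) (a ∸ suc j))))
  power-suc [] _ k a = sym (trans (cong (λ v → power [] k a ℤ.+ v) (ℤΣ.∑L-zero∈ (upTo a) (λ j _ → ℤₚ.*-zeroˡ (power [] (suc k) (a ∸ suc j)))))
    (trans (ℤₚ.+-identityʳ _) (same a)))
    where
    same : ∀ a → power [] k a ≡ power [] (suc k) a
    same zero = refl
    same (suc a) = refl
  power-suc (m ∷ ms) (1≤m ∷ pos) k a = cong₂ _,_
      (trans (power-suc ms pos k a) (cong (power ms k a ⊕_) (sym (proj₁-∑ (upTo a) _))))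
      (trans second (cong (((m ≤ᵇ a) ▷ multiple ms k (power ms (suc k) (a ∸ m))) ⊕_) (sym (proj₂-∑ (upTo a) _))))
    where
    open TorsionFreeRing (tower ms) hiding (R; 𝟘; 𝟙)
    open Sums (tower ms)
    open Dual (tower ms) using (proj₁-∑; proj₂-∑)
    open Scalars (scalars ms)
    Z : ℕ → ⟦ ms ⟧
    Z = variable-of-size ms
    tail : ℕ → ⟦ ms ⟧
    tail j = Z (suc j) ⊗ ((m ≤ᵇ a ∸ suc j) ▷ multiple ms (suc k) (power ms (suc (suc k)) (a ∸ suc j ∸ m)))
    head : ℕ → ⟦ ms ⟧
    head j = ((suc j ≡ᵇ m) ▷ 𝟙 (tower ms)) ⊗ power ms (suc k) (a ∸ suc j)
    c : ⟦ ms ⟧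
    c = ι (ℤ.+ suc k)
    -- The ε-parts: (k+1) y^m W^{k+2} equals k y^m W^{k+1} plus `tail`, from the ε-free part of z,
    -- plus `head`, which is y^m W^{k+1} from its ε-part. This is k + 1 times the induction
    -- hypothesis at k + 1.
    second : ((m ≤ᵇ a) ▷ multiple ms (suc k) (power ms (suc (suc k)) (a ∸ m))) ≡
      ((m ≤ᵇ a) ▷ multiple ms k (power ms (suc k) (a ∸ m))) ⊕ ∑ a (λ j → tail j ⊕ head j)
    second with m ≤? a
    ... | no m≰a = sym (trans (cong₂ _⊕_ (▷-false (≤ᵇ-false (≰⇒> m≰a))) (∑-zero< a zeros)) (trans (⊕-identityˡ _) (sym (▷-false (≤ᵇ-false (≰⇒> m≰a))))))
      where
      zeros : ∀ j → j < a → tail j ⊕ head j ≡ 𝟘 (tower ms)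
      zeros j j<a = trans (cong₂ _⊕_ (⊗-zeroʳ′ _ (▷-false (≤ᵇ-false (≤-<-trans (m∸n≤m a (suc j)) (≰⇒> m≰a)))))
          (⊗-zeroˡ′ _ (▷-false (≡ᵇ-false (λ e → m≰a (subst (_≤ a) e j<a))))))
        (⊕-identityˡ _)
    ... | yes m≤a = begin
      (m ≤ᵇ a) ▷ c ⊗ power ms (suc (suc k)) (a ∸ m)
        ≡⟨ ▷-true (≤ᵇ-true m≤a) ⟩
      c ⊗ power ms (suc (suc k)) (a ∸ m)
        ≡⟨ cong (c ⊗_) (power-suc ms pos (suc k) (a ∸ m)) ⟩
      c ⊗ (power ms (suc k) (a ∸ m) ⊕ ∑ (a ∸ m) (λ j → Z (suc j) ⊗ power ms (suc (suc k)) (a ∸ m ∸ suc j)))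
        ≡⟨ ⊗-distribˡ c _ _ ⟩
      c ⊗ power ms (suc k) (a ∸ m) ⊕ c ⊗ ∑ (a ∸ m) (λ j → Z (suc j) ⊗ power ms (suc (suc k)) (a ∸ m ∸ suc j))
        ≡⟨ cong₂ _⊕_ (trans (multiple-suc ms k _) (⊕-comm _ _)) (sym tails) ⟩
      (multiple ms k (power ms (suc k) (a ∸ m)) ⊕ power ms (suc k) (a ∸ m)) ⊕ ∑ a tail
        ≡⟨ trans (⊕-assoc _ _ _) (cong (multiple ms k (power ms (suc k) (a ∸ m)) ⊕_) (⊕-comm _ _)) ⟩
      multiple ms k (power ms (suc k) (a ∸ m)) ⊕ (∑ a tail ⊕ power ms (suc k) (a ∸ m))
        ≡⟨ cong₂ _⊕_ (sym (▷-true (≤ᵇ-true m≤a))) (trans (cong (∑ a tail ⊕_) (sym (heads 1≤m m≤a))) (sym (∑L-⊕ (upTo a) tail head))) ⟩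
      ((m ≤ᵇ a) ▷ multiple ms k (power ms (suc k) (a ∸ m))) ⊕ ∑ a (λ j → tail j ⊕ head j) ∎
      where
      open ≡-Reasoning
      heads : ∀ {m} → 1 ≤ m → m ≤ a → ∑ a (λ j → ((suc j ≡ᵇ m) ▷ 𝟙 (tower ms)) ⊗ power ms (suc k) (a ∸ suc j)) ≡ power ms (suc k) (a ∸ m)
      heads {suc m'} _ m≤a = trans (∑L-cong (upTo a) (λ j → trans (sym (▷-⊗ˡ (j ≡ᵇ m') _ _)) (cong ((j ≡ᵇ m') ▷_) (⊗-identityˡ _)))) (∑-δ a m' _ m≤a)
      tails : ∑ a tail ≡ c ⊗ ∑ (a ∸ m) (λ j → Z (suc j) ⊗ power ms (suc (suc k)) (a ∸ m ∸ suc j))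
      tails = trans (∑-trunc′ tail (m∸n≤m a m) (λ j le j<a → ⊗-zeroʳ′ _ (▷-false (≤ᵇ-false (short j le j<a)))))
        (trans (∑-cong< (a ∸ m) (λ j lt → trans (cong (Z (suc j) ⊗_) (▷-true (≤ᵇ-true (long j lt))))
          (trans (⊗-left-comm _ _ _) (cong (λ n → c ⊗ (Z (suc j) ⊗ power ms (suc (suc k)) n)) (∸-comm a (suc j) m)))))
          (∑L-⊗ˡ (upTo (a ∸ m)) c _))
        where
        ∸-comm : ∀ a b c → a ∸ b ∸ c ≡ a ∸ c ∸ b
        ∸-comm a b c = trans (∸-+-assoc a b c) (trans (cong (a ∸_) (+-comm b c)) (sym (∸-+-assoc a c b)))
        short : ∀ j → a ∸ m ≤ j → j < a → a ∸ suc j < m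
        short j le j<a = +-cancelʳ-< (suc j) _ _ (subst (_< m + suc j) (sym (m∸n+n≡m j<a))
          (subst (a <_) (sym (+-suc m j)) (s≤s (≤-trans (≤-reflexive (sym (m+[n∸m]≡n m≤a))) (+-monoʳ-≤ m le)))))
        long : ∀ j → j < a ∸ m → m ≤ a ∸ suc j
        long j lt = m+n≤o⇒m≤o∸n m (≤-trans (+-monoʳ-≤ m lt) (≤-reflexive (m+[n∸m]≡n m≤a)))
        ∑-trunc′ : ∀ {p q} f → p ≤ q → (∀ i → p ≤ i → i < q → f i ≡ 𝟘 (tower ms)) → ∑ q f ≡ ∑ p f
        ∑-trunc′ {p} {q} f le e = begin
          ∑ q f                                   ≡⟨ cong (λ k → ∑ k f) (sym (m+[n∸m]≡n le)) ⟩
          ∑ (p + (q ∸ p)) f                       ≡⟨ ∑-+ p (q ∸ p) f ⟩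
          ∑ p f ⊕ ∑ (q ∸ p) (λ i → f (p + i))     ≡⟨ ⊕-identityʳ′ _ (∑-zero< (q ∸ p) (λ i lt → e (p + i) (m≤m+n p i)
                                                      (subst (p + i <_) (m+[n∸m]≡n le) (+-monoʳ-< p lt)))) ⟩
          ∑ p f ∎

  series : ∀ ms → All (1 ≤_) ms → GeometricSeries (tower ms)
  series ms pos = record
    { z = variable-of-size ms
    ; w = power ms 1
    ; w-zero = power-degree0 ms pos 1
    ; w-suc = λ m → trans (power-suc ms pos 0 (suc m)) (Sums.⊕-identityˡ′ (tower ms) _ (power-0 ms m)) }

-- Extracting the coefficient of a multiset of ribbon sizes

count-here : ∀ x xs → count x (x ∷ xs) ≡ suc (count x xs)
count-here x xs rewrite ≡ᵇ-refl x = refl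

count-there : ∀ {x y} xs → x ≢ y → count x (y ∷ xs) ≡ count x xs
count-there xs ne rewrite ≡ᵇ-false ne = refl

count-∷ : ∀ x y xs → count x (y ∷ xs) ≡ (if x ≡ᵇ y then 1 else 0) + count x xs
count-∷ x y xs with x ≡ᵇ y
... | true = refl
... | false = refl

bagEqᵇ⁻ : ∀ xs ys → bagEqᵇ xs ys ≡ true → ∀ x → count x xs ≡ count x ys
bagEqᵇ⁻ xs ys e x with x ∈? (xs ++ ys)
... | yes m = ≡ᵇ-true (all-true⁻ _ (xs ++ ys) e x m)
... | no m = trans (absent xs (m ∘ ∈ₚ.∈-++⁺ˡ)) (sym (absent ys (m ∘ ∈ₚ.∈-++⁺ʳ xs)))
  where
  absent : ∀ zs → x ∉ zs → count x zs ≡ 0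
  absent zs ∉ = count-absent x zs (All.tabulate (λ {z} z∈ e → ∉ (subst (_∈ zs) (sym e) z∈)))

bagEqᵇ⁺ : ∀ xs ys → (∀ x → count x xs ≡ count x ys) → bagEqᵇ xs ys ≡ true
bagEqᵇ⁺ xs ys e = all-true⁺ _ (xs ++ ys) (λ x _ → trans (cong (_≡ᵇ count x ys) (e x)) (≡ᵇ-refl (count x ys)))

bagEqᵇ-cong : ∀ xs xs' ys ys' → ((∀ x → count x xs ≡ count x ys) → ∀ x → count x xs' ≡ count x ys') →
  ((∀ x → count x xs' ≡ count x ys') → ∀ x → count x xs ≡ count x ys) → bagEqᵇ xs ys ≡ bagEqᵇ xs' ys'
bagEqᵇ-cong xs xs' ys ys' f g = true-iff (λ e → bagEqᵇ⁺ xs' ys' (f (bagEqᵇ⁻ xs ys e))) (λ e → bagEqᵇ⁺ xs ys (g (bagEqᵇ⁻ xs' ys' e)))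

count-middle : ∀ x p k v → count x (p ++ k ∷ v) ≡ count x (k ∷ p ++ v)
count-middle x p k v = begin
  count x (p ++ k ∷ v)                                            ≡⟨ count-++ x p (k ∷ v) ⟩
  count x p + count x (k ∷ v)                                     ≡⟨ cong (count x p +_) (count-∷ x k v) ⟩
  count x p + ((if x ≡ᵇ k then 1 else 0) + count x v)             ≡⟨ sym (+-assoc (count x p) _ _) ⟩
  count x p + (if x ≡ᵇ k then 1 else 0) + count x v               ≡⟨ cong (_+ count x v) (+-comm (count x p) _) ⟩
  (if x ≡ᵇ k then 1 else 0) + count x p + count x v               ≡⟨ +-assoc (if x ≡ᵇ k then 1 else 0) _ _ ⟩
  (if x ≡ᵇ k then 1 else 0) + (count x p + count x v)             ≡⟨ cong ((if x ≡ᵇ k then 1 else 0) +_) (sym (count-++ x p v)) ⟩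
  (if x ≡ᵇ k then 1 else 0) + count x (p ++ v)                    ≡⟨ sym (count-∷ x k (p ++ v)) ⟩
  count x (k ∷ p ++ v) ∎
  where open ≡-Reasoning

bagEqᵇ-middle : ∀ p k v ys → bagEqᵇ (p ++ k ∷ v) ys ≡ bagEqᵇ (k ∷ p ++ v) ys
bagEqᵇ-middle p k v ys = bagEqᵇ-cong (p ++ k ∷ v) (k ∷ p ++ v) ys ys
  (λ e x → trans (sym (count-middle x p k v)) (e x)) (λ e x → trans (count-middle x p k v) (e x))

bagEqᵇ-∷ : ∀ k xs ys → bagEqᵇ (k ∷ xs) (k ∷ ys) ≡ bagEqᵇ xs ys
bagEqᵇ-∷ k xs ys = bagEqᵇ-cong (k ∷ xs) xs (k ∷ ys) ys
  (λ e x → +-cancelˡ-≡ (if x ≡ᵇ k then 1 else 0) _ _ (trans (sym (count-∷ x k xs)) (trans (e x) (count-∷ x k ys))))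
  (λ e x → trans (count-∷ x k xs) (trans (cong ((if x ≡ᵇ k then 1 else 0) +_) (e x)) (sym (count-∷ x k ys))))

count-↭ : ∀ x {xs ys} → xs ↭ ys → count x xs ≡ count x ys
count-↭ x ↭.refl = refl
count-↭ x {y ∷ xs} {_ ∷ ys} (↭.prep .y p) = trans (count-∷ x y xs) (trans (cong ((if x ≡ᵇ y then 1 else 0) +_) (count-↭ x p)) (sym (count-∷ x y ys)))
count-↭ x {y ∷ z ∷ xs} {_ ∷ _ ∷ ys} (↭.swap .y .z p) = trans (count-middle x (y ∷ []) z xs) (trans (count-∷ x z (y ∷ xs)) (trans
  (cong ((if x ≡ᵇ z then 1 else 0) +_) (trans (count-∷ x y xs) (trans (cong ((if x ≡ᵇ y then 1 else 0) +_) (count-↭ x p)) (sym (count-∷ x y ys)))))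
  (sym (count-∷ x z (y ∷ ys)))))
count-↭ x (↭.trans p q) = trans (count-↭ x p) (count-↭ x q)

bagEqᵇ-↭ : ∀ xs ys → bagEqᵇ xs ys ≡ true → xs ↭ ys
bagEqᵇ-↭ [] [] e = ↭.refl
bagEqᵇ-↭ [] (y ∷ ys) e = ⊥-elim (0≢1+n (trans (bagEqᵇ⁻ [] (y ∷ ys) e y) (count-here y ys)))
bagEqᵇ-↭ (x ∷ xs) ys e = ↭-trans (↭.prep x (bagEqᵇ-↭ xs (remove ys) (bagEqᵇ⁺ xs (remove ys) same))) (remove-↭ ys present)
  where
  remove : List ℕ → List ℕ
  remove [] = []
  remove (y ∷ ys) = if x ≡ᵇ y then ys else y ∷ remove ys
  present : 0 < count x ys
  present = subst (0 <_) (trans (sym (count-here x xs)) (bagEqᵇ⁻ (x ∷ xs) ys e x)) (s≤s z≤n)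
  remove-↭ : ∀ ys → 0 < count x ys → x ∷ remove ys ↭ ys
  remove-↭ (y ∷ ys) lt with x ≡ᵇ y in eq
  ... | true with refl ← ≡ᵇ-true {x} {y} eq = ↭.refl
  ... | false = ↭-trans (↭.swap x y ↭.refl) (↭.prep y (remove-↭ ys lt))
  same : ∀ u → count u xs ≡ count u (remove ys)
  same u = +-cancelˡ-≡ (if u ≡ᵇ x then 1 else 0) _ _ (trans (sym (count-∷ u x xs)) (trans (bagEqᵇ⁻ (x ∷ xs) ys e u)
    (trans (count-↭ u (↭-sym (remove-↭ ys present))) (count-∷ u x (remove ys)))))

bagEqᵇ-length : ∀ xs ys → bagEqᵇ xs ys ≡ true → length xs ≡ length ys
bagEqᵇ-length xs ys e = ↭ₚ.↭-length (bagEqᵇ-↭ xs ys e)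

prodTo : (ℕ → ℕ) → ℕ → ℕ
prodTo f zero = 1
prodTo f (suc n) = prodTo f n * f n

product-map-upTo : ∀ f n → product (map f (upTo n)) ≡ prodTo f n
product-map-upTo f zero = refl
product-map-upTo f (suc n) = begin
  product (map f (upTo (suc n)))            ≡⟨ cong (product ∘ map f) (sym (upTo-∷ʳ n)) ⟩
  product (map f (upTo n ∷ʳ n))             ≡⟨ cong product (map-++ f (upTo n) (n ∷ [])) ⟩
  product (map f (upTo n) ∷ʳ f n)           ≡⟨ ActionProperties.product-++ (map f (upTo n)) (f n ∷ []) ⟩
  product (map f (upTo n)) * (f n * 1)      ≡⟨ cong₂ _*_ (product-map-upTo f n) (*-identityʳ (f n)) ⟩
  prodTo f n * f n ∎
  where open ≡-Reasoning

-- A further part m changes only the factor of its own size, from c! to (c + 1)!. The product also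
-- runs further, but no part of ms exceeds `sum ms`, so the additional factors are 0! = 1.
multFactorial-∷ : ∀ m ms → 1 ≤ m → multFactorial (m ∷ ms) ≡ suc (count m ms) * multFactorial ms
multFactorial-∷ (suc m) ms _ = begin
  multFactorial (suc m ∷ ms)                  ≡⟨ product-map-upTo g' (suc m + sum ms) ⟩
  prodTo g' (suc m + sum ms)                  ≡⟨ changed (suc m + sum ms) (s≤s (m≤m+n m (sum ms))) ⟩
  suc (count (suc m) ms) * prodTo g (suc m + sum ms)
    ≡⟨ cong (suc (count (suc m) ms) *_) (trans (cong (prodTo g) (+-comm (suc m) (sum ms))) (truncate (suc m))) ⟩
  suc (count (suc m) ms) * prodTo g (sum ms)  ≡⟨ cong (suc (count (suc m) ms) *_) (sym (product-map-upTo g (sum ms))) ⟩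
  suc (count (suc m) ms) * multFactorial ms ∎
  where
  open ≡-Reasoning
  g g' : ℕ → ℕ
  g i = count (suc i) ms !
  g' i = count (suc i) (suc m ∷ ms) !
  other : ∀ i → i ≢ m → g' i ≡ g i
  other i ne = cong _! (count-there ms (ne ∘ suc-injective))
  unchanged : ∀ n → n ≤ m → prodTo g' n ≡ prodTo g n
  unchanged zero _ = refl
  unchanged (suc n) n<m = cong₂ _*_ (unchanged n (<⇒≤ n<m)) (other n (<⇒≢ n<m))
  changed : ∀ n → m < n → prodTo g' n ≡ suc (count (suc m) ms) * prodTo g n
  changed (suc n) (s≤s m≤n) with m≤n⇒m<n∨m≡n m≤n
  ... | inj₁ m<n = trans (cong₂ _*_ (changed n m<n) (other n (λ e → <⇒≢ m<n (sym e)))) (*-assoc (suc (count (suc m) ms)) (prodTo g n) (g n))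
  ... | inj₂ refl = begin
    prodTo g' m * g' m                                          ≡⟨ cong₂ _*_ (unchanged m ≤-refl) (cong _! (count-here (suc m) ms)) ⟩
    prodTo g m * (suc (count (suc m) ms) * g m)                 ≡⟨ sym (*-assoc (prodTo g m) (suc (count (suc m) ms)) (g m)) ⟩
    prodTo g m * suc (count (suc m) ms) * g m                   ≡⟨ cong (_* g m) (*-comm (prodTo g m) _) ⟩
    suc (count (suc m) ms) * prodTo g m * g m                   ≡⟨ *-assoc (suc (count (suc m) ms)) (prodTo g m) (g m) ⟩
    suc (count (suc m) ms) * (prodTo g m * g m) ∎
  truncate : ∀ d → prodTo g (sum ms + d) ≡ prodTo g (sum ms)
  truncate zero = cong (prodTo g) (+-identityʳ (sum ms))
  truncate (suc d) = trans (cong (prodTo g) (+-suc (sum ms) d)) (trans (cong₂ _*_ (truncate d)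
    (cong _! (count-absent (suc (sum ms + d)) ms (All.tabulate (λ {x} x∈ e → <⇒≱ (s≤s (m≤m+n (sum ms) d)) (subst (_≤ sum ms) (sym e) (member≤sum x∈)))))))
    (*-identityʳ _))
    where
    member≤sum : ∀ {x xs} → x ∈ xs → x ≤ sum xs
    member≤sum {x} (here refl) = m≤m+n x _
    member≤sum (there m) = ≤-trans (member≤sum m) (m≤n+m _ _)

module Coefficients where
  open Generators

  zsᵗ : ∀ ms → List ℕ → ⟦ ms ⟧
  zsᵗ ms = foldr (λ k v → TorsionFreeRing._⊗_ (tower ms) (variable-of-size ms k) v) (TorsionFreeRing.𝟙 (tower ms))

  proj₁-zs : ∀ m ms v → proj₁ (zsᵗ (m ∷ ms) v) ≡ zsᵗ ms v
  proj₁-zs m ms [] = refl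
  proj₁-zs m ms (k ∷ v) = cong (TorsionFreeRing._⊗_ (tower ms) (variable-of-size ms k)) (proj₁-zs m ms v)

  -- Each factor z_{v_i} has to supply a different variable, so the coefficient counts the
  -- bijections between v and ms that match equal sizes.
  top-zs : ∀ ms → All (1 ≤_) ms → ∀ v → top ms (zsᵗ ms v) ≡ bagEqᵇ v ms ▷ℤ (ℤ.+ multFactorial ms)
  top-zs [] _ [] = refl
  top-zs [] _ (k ∷ v) = sym (ℤΣ.▷-false (not-empty k v))
    where
    not-empty : ∀ k v → bagEqᵇ (k ∷ v) [] ≡ false
    not-empty k v with bagEqᵇ (k ∷ v) [] in e
    ... | false = refl
    ... | true = ⊥-elim (0≢1+n (sym (bagEqᵇ-length (k ∷ v) [] e)))
  top-zs (m ∷ ms) (1≤m ∷ pos) v = trans (cong (top ms) (sym (⊗-identityˡ _))) (trans (splits [] v) (total v))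
    where
    open TorsionFreeRing (tower ms)
    open Sums (tower ms)
    Fact : ℤ
    Fact = ℤ.+ multFactorial ms
    -- The product rule locates the entry of v that supplies ε_m; p collects the entries already
    -- passed. Each entry equal to m contributes the coefficient for the remaining parts.
    splits : ∀ p v → top ms (zsᵗ ms p ⊗ proj₂ (zsᵗ (m ∷ ms) v)) ≡ bagEqᵇ (p ++ v) (m ∷ ms) ▷ℤ ((ℤ.+ count m v) ℤ.* Fact)
    splits p [] = trans (cong (top ms) (⊗-zeroʳ _)) (trans (top-𝟘 ms) (sym (ℤΣ.▷-𝟘 (bagEqᵇ (p ++ []) (m ∷ ms)))))
    splits p (k ∷ v) = begin
      top ms (zsᵗ ms p ⊗ (variable-of-size ms k ⊗ proj₂ (zsᵗ (m ∷ ms) v) ⊕ ((k ≡ᵇ m) ▷ 𝟙) ⊗ proj₁ (zsᵗ (m ∷ ms) v)))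
        ≡⟨ trans (cong (top ms) (⊗-distribˡ _ _ _)) (top-⊕ ms _ _) ⟩
      top ms (zsᵗ ms p ⊗ (variable-of-size ms k ⊗ proj₂ (zsᵗ (m ∷ ms) v))) ℤ.+ top ms (zsᵗ ms p ⊗ (((k ≡ᵇ m) ▷ 𝟙) ⊗ proj₁ (zsᵗ (m ∷ ms) v)))
        ≡⟨ cong₂ ℤ._+_ (trans (cong (top ms) (trans (⊗-left-comm _ _ _) (sym (⊗-assoc _ _ _)))) (splits (k ∷ p) v))
                       (trans (cong (top ms) pick) (trans (top-▷ ms (k ≡ᵇ m) _) (cong ((k ≡ᵇ m) ▷ℤ_) (top-zs ms pos (p ++ v))))) ⟩
      (bagEqᵇ (k ∷ p ++ v) (m ∷ ms) ▷ℤ ((ℤ.+ count m v) ℤ.* Fact)) ℤ.+ ((k ≡ᵇ m) ▷ℤ (bagEqᵇ (p ++ v) ms ▷ℤ Fact))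
        ≡⟨ combine (k ≟ m) ⟩
      bagEqᵇ (k ∷ p ++ v) (m ∷ ms) ▷ℤ ((ℤ.+ count m (k ∷ v)) ℤ.* Fact)
        ≡⟨ cong (_▷ℤ ((ℤ.+ count m (k ∷ v)) ℤ.* Fact)) (sym (bagEqᵇ-middle p k v (m ∷ ms))) ⟩
      bagEqᵇ (p ++ k ∷ v) (m ∷ ms) ▷ℤ ((ℤ.+ count m (k ∷ v)) ℤ.* Fact) ∎
      where
      open ≡-Reasoning
      zs-++ : ∀ p v → zsᵗ ms p ⊗ zsᵗ ms v ≡ zsᵗ ms (p ++ v)
      zs-++ [] v = ⊗-identityˡ _
      zs-++ (k ∷ p) v = trans (⊗-assoc _ _ _) (cong (variable-of-size ms k ⊗_) (zs-++ p v))
      pick : zsᵗ ms p ⊗ (((k ≡ᵇ m) ▷ 𝟙) ⊗ proj₁ (zsᵗ (m ∷ ms) v)) ≡ ((k ≡ᵇ m) ▷ zsᵗ ms (p ++ v))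
      pick = trans (cong (zsᵗ ms p ⊗_) (trans (sym (▷-⊗ˡ (k ≡ᵇ m) _ _)) (cong ((k ≡ᵇ m) ▷_) (trans (⊗-identityˡ _) (proj₁-zs m ms v)))))
        (trans (sym (▷-⊗ʳ (k ≡ᵇ m) _ _)) (cong ((k ≡ᵇ m) ▷_) (zs-++ p v)))
      combine : Dec (k ≡ m) → (bagEqᵇ (k ∷ p ++ v) (m ∷ ms) ▷ℤ ((ℤ.+ count m v) ℤ.* Fact)) ℤ.+ ((k ≡ᵇ m) ▷ℤ (bagEqᵇ (p ++ v) ms ▷ℤ Fact)) ≡
        (bagEqᵇ (k ∷ p ++ v) (m ∷ ms) ▷ℤ ((ℤ.+ count m (k ∷ v)) ℤ.* Fact))
      combine (no ne) = trans (cong (λ u → (bagEqᵇ (k ∷ p ++ v) (m ∷ ms) ▷ℤ ((ℤ.+ count m v) ℤ.* Fact)) ℤ.+ u) (ℤΣ.▷-false (≡ᵇ-false ne))) (trans (ℤₚ.+-identityʳ (bagEqᵇ (k ∷ p ++ v) (m ∷ ms) ▷ℤ ((ℤ.+ count m v) ℤ.* Fact)))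
        (cong (λ c → bagEqᵇ (k ∷ p ++ v) (m ∷ ms) ▷ℤ ((ℤ.+ c) ℤ.* Fact)) (sym (count-there v (ne ∘ sym)))))
      combine (yes refl) = trans (cong₂ ℤ._+_ (cong (_▷ℤ ((ℤ.+ count k v) ℤ.* Fact)) (bagEqᵇ-∷ k (p ++ v) ms)) (ℤΣ.▷-true (≡ᵇ-refl k)))
        (trans (sym (ℤΣ.▷-⊕ (bagEqᵇ (p ++ v) ms) _ _)) (cong₂ _▷ℤ_ (sym (bagEqᵇ-∷ k (p ++ v) ms)) (begin
          (ℤ.+ count k v) ℤ.* Fact ℤ.+ Fact     ≡⟨ ℤₚ.+-comm ((ℤ.+ count k v) ℤ.* Fact) Fact ⟩
          Fact ℤ.+ (ℤ.+ count k v) ℤ.* Fact     ≡⟨ sym (ℤₚ.suc-* (ℤ.+ count k v) Fact) ⟩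
          ℤ.suc (ℤ.+ count k v) ℤ.* Fact        ≡⟨ cong (λ c → (ℤ.+ c) ℤ.* Fact) (sym (count-here k v)) ⟩
          (ℤ.+ count k (k ∷ v)) ℤ.* Fact ∎)))
    total : ∀ v → (bagEqᵇ v (m ∷ ms) ▷ℤ ((ℤ.+ count m v) ℤ.* Fact)) ≡ (bagEqᵇ v (m ∷ ms) ▷ℤ (ℤ.+ multFactorial (m ∷ ms)))
    total v = ℤΣ.▷-cong (bagEqᵇ v (m ∷ ms)) (λ e → trans (sym (ℤₚ.pos-* (count m v) (multFactorial ms)))
      (cong ℤ.+_ (trans (cong (_* multFactorial ms) (trans (bagEqᵇ⁻ v (m ∷ ms) e m) (count-here m ms))) (sym (multFactorial-∷ m ms 1≤m)))))

-- The tiling sum as a coefficient of a product of series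

Σₛ-∑ : ∀ {A : Set} (xs : List A) (f : A → Series) α → Σₛ xs f α ≡ ∑ℤ xs (λ x → f x α)
Σₛ-∑ [] f α = refl
Σₛ-∑ (x ∷ xs) f α = cong (λ v → f x α ℤ.+ v) (Σₛ-∑ xs f α)

length-ribbonSizes : ∀ ν T → length (ribbonSizes ν T) ≡ length T
length-ribbonSizes ν [] = refl
length-ribbonSizes ν (λ' ∷ T) = cong suc (length-ribbonSizes λ' T)

module RightHandSide (μ : List ℕ) (pos : All (1 ≤_) μ) (α : List ℕ) (size : sum μ ≡ sum α) where
  open Generators
  open Coefficients
  private
    𝓡 = tower μ
    𝓦 = series μ pos
    𝓢 = scalars μ
  open TorsionFreeRing 𝓡
  open Sums 𝓡
  open Scalars 𝓢
  open Chains 𝓡 𝓦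
  open Alternants 𝓡
  open Cauchy 𝓡 𝓦
  open Tableaux 𝓡
  open ChainSums 𝓡 𝓦 𝓢

  -- N' ≥ `length α` leaves one bead more than there are variables, as `L-schur` requires; N ≥ n
  -- gives room for every partition of size at most n; f vanishes at positions from M on.
  n N' N M : ℕ
  n = sum μ
  N' = n + length α
  N = suc N'
  M = suc (bound N' (reverse α))

  f : List ℕ → R
  f = schur N (reverse α)

  n≤N : n ≤ N
  n≤N = m≤n⇒m≤1+n (m≤m+n n (length α))

  sum-α : sum (reverse α) ≡ n
  sum-α = trans (sum-reverse α) (sym size)

  n+N≤M : n + N ≤ M
  n+N≤M = subst (_≤ M) (trans (cong suc (cong (_+ N') sum-α)) (sym (+-suc n N'))) (s≤s (bound-≥ 𝓡 N' (reverse α)))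

  vanish : ∀ t → length t ≡ N → n + sum (range 0 N) < sum t → f t ≡ 𝟘
  vanish t l lt = schur-size N (reverse α) t l (λ e → <⇒≢ lt (sym (trans e (trans (cong (sum (range 0 N) +_) sum-α) (+-comm _ n)))))

  tilings : ℕ → R
  tilings s = tilingSum N M n n≤N n+N≤M f vanish s [] nothing

  tilings-Y : ∀ s → tilings s ≡ Y M s (range 0 N) f
  tilings-Y s = trans (tilingSum-state N M n n≤N n+N≤M f vanish s [] nothing N 0 [] z≤n refl (λ i lt → sym (<ᵇ-true lt)))
    (cong (λ γ → Y M s γ f) (empty N 0))
    where
    empty : ∀ m j → rowBeads [] m j ≡ range j m
    empty zero j = refl
    empty (suc m) j = cong (j ∷_) (empty m (suc j))

  ι-count : ∀ {A : Set} (p : A → Bool) xs → ι (ℤ.+ length (filterᵇ p xs)) ≡ ∑L xs (λ x → p x ▷ 𝟙)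
  ι-count p [] = ι-0
  ι-count p (x ∷ xs) with p x
  ... | true = trans (ι-+ ℤ.1ℤ (ℤ.+ length (filterᵇ p xs))) (cong₂ _⊕_ ι-1 (ι-count p xs))
  ... | false = trans (ι-count p xs) (sym (⊕-identityˡ _))

  schur-shape : ∀ ρ → Linked _≥_ ρ → length ρ ≤ N → f (rowBeads ρ N 0) ≡ ι (s ρ α)
  schur-shape ρ lk le = begin
    schur N (reverse α) (rowBeads ρ N 0)
      ≡⟨ cong₂ (λ k t → schur k (reverse α) t) (sym (length-padRows {N} {ρ} le)) (rowBeads-padRows le) ⟩
    schur (length (padRows N ρ)) (reverse α) (beads (padRows N ρ))
      ≡⟨ schur-beads (reverse α) (padRows N ρ) (padRows-descending (N ∸ length ρ) lk) ⟩
    schurCoeff (padRows N ρ) (reverse (reverse α))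
      ≡⟨ cong (schurCoeff (padRows N ρ)) (reverse-involutive α) ⟩
    schurCoeff (padRows N ρ) α
      ≡⟨ schurCoeff-pad ρ (N ∸ length ρ) α ⟩
    schurCoeff ρ α
      ≡⟨ sym (ι-count _ (fillings ρ (length α))) ⟩
    ι (s ρ α) ∎
    where open ≡-Reasoning

  chains-∈ : ∀ s T → T ∈ chains n s → length T ≡ s × (∀ ν → Partition ν × length ν ≤ N → Partition (lastShape ν T) × length (lastShape ν T) ≤ N)
  chains-∈ zero .[] (here refl) = refl , λ _ p → p
  chains-∈ (suc s) T T∈ with q , q∈ , T∈′ ← find (∈ₚ.∈-concatMap⁻ (λ q → map (q ∷_) (chains n s)) {xs = partitionsUpTo n} T∈)
    with T' , T'∈ , refl ← ∈ₚ.∈-map⁻ (q ∷_) T∈′ =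
    let l , last = chains-∈ s T' T'∈ in cong suc l , λ _ _ →
      last q (proj₁ (partitionsUpTo-∈ n q q∈) , rows≤ N M n n≤N n+N≤M f vanish q∈)

  top-tilings : ∀ s → top μ (tilings s) ≡
    ∑ℤ (chains n s) (λ T → monotonicᵇ [] nothing T ▷ℤ (bagEqᵇ (ribbonSizes [] T) μ ▷ℤ ((ℤ.+ multFactorial μ) ℤ.* (tilingSign [] T ℤ.* Defs.s (lastShape [] T) α))))
  top-tilings s = trans (top-∑ μ (chains n s) _) (ℤΣ.∑L-cong∈ (chains n s) (λ T T∈ → trans (top-▷ μ (monotonicᵇ [] nothing T) _)
      (cong (monotonicᵇ [] nothing T ▷ℤ_) (value T (proj₂ (chains-∈ s T T∈) [] (partition [] [] , z≤n))))))
    where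
    value : ∀ T → Partition (lastShape [] T) × length (lastShape [] T) ≤ N →
      top μ (ι (tilingSign [] T) ⊗ (zs (ribbonSizes [] T) ⊗ f (rowBeads (lastShape [] T) N 0))) ≡
      (bagEqᵇ (ribbonSizes [] T) μ ▷ℤ ((ℤ.+ multFactorial μ) ℤ.* (tilingSign [] T ℤ.* Defs.s (lastShape [] T) α)))
    value T (part , le) = begin
      top μ (ι sg ⊗ (zs sizes ⊗ f (rowBeads ρ N 0)))
        ≡⟨ top-ι μ sg _ ⟩
      sg ℤ.* top μ (zs sizes ⊗ f (rowBeads ρ N 0))
        ≡⟨ cong (λ v → sg ℤ.* top μ v) (trans (⊗-comm _ _) (cong (_⊗ zs sizes) (schur-shape ρ (Partition.descending part) le))) ⟩
      sg ℤ.* top μ (ι (Defs.s ρ α) ⊗ zs sizes)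
        ≡⟨ cong (λ v → sg ℤ.* v) (trans (top-ι μ (Defs.s ρ α) _) (cong (λ v → Defs.s ρ α ℤ.* v) (top-zs μ pos sizes))) ⟩
      sg ℤ.* (Defs.s ρ α ℤ.* (bagEqᵇ sizes μ ▷ℤ (ℤ.+ multFactorial μ)))
        ≡⟨ trans (sym (ℤₚ.*-assoc sg _ _)) (sym (ℤΣ.▷-⊗ʳ (bagEqᵇ sizes μ) (sg ℤ.* Defs.s ρ α) _)) ⟩
      bagEqᵇ sizes μ ▷ℤ ((sg ℤ.* Defs.s ρ α) ℤ.* (ℤ.+ multFactorial μ))
        ≡⟨ cong (bagEqᵇ sizes μ ▷ℤ_) (ℤₚ.*-comm (sg ℤ.* Defs.s ρ α) _) ⟩
      bagEqᵇ sizes μ ▷ℤ ((ℤ.+ multFactorial μ) ℤ.* (sg ℤ.* Defs.s ρ α)) ∎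
      where
      open ≡-Reasoning
      sg = tilingSign [] T
      sizes = ribbonSizes [] T
      ρ = lastShape [] T

  -- `∑-Y` evaluates the sum over all numbers of ribbons. Matching the sizes with μ forces
  -- `length μ` of them, so that sum reduces to the wanted term.
  top-tilings-≢ : ∀ s → s ≢ length μ → top μ (tilings s) ≡ ℤ.0ℤ
  top-tilings-≢ s ne = trans (top-tilings s) (ℤΣ.∑L-zero∈ (chains n s) (λ T T∈ → ℤΣ.▷-zero (monotonicᵇ [] nothing T) (λ _ → ℤΣ.▷-zero (bagEqᵇ (ribbonSizes [] T) μ)
    (λ e → ⊥-elim (ne (trans (sym (proj₁ (chains-∈ s T T∈))) (trans (sym (length-ribbonSizes [] T)) (bagEqᵇ-length (ribbonSizes [] T) μ e))))))))

  pathMNRhs-tilings : pathMNRhs μ α ≡ top μ (tilings (length μ))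
  pathMNRhs-tilings = begin
    (ℤ.+ multFactorial μ) ℤ.* Σₛ (tilingsFor μ) (λ T → tilingSign [] T ·ₛ Defs.s (tilingShape T)) α
      ≡⟨ cong (λ v → (ℤ.+ multFactorial μ) ℤ.* v) (trans (Σₛ-∑ (tilingsFor μ) (λ T → tilingSign [] T ·ₛ Defs.s (tilingShape T)) α) (ℤΣ.∑L-filter (λ T → monotonicᵇ [] nothing T ∧ bagEqᵇ (ribbonSizes [] T) μ) (chains n (length μ)) _)) ⟩
    (ℤ.+ multFactorial μ) ℤ.* ∑ℤ (chains n (length μ)) (λ T → (monotonicᵇ [] nothing T ∧ bagEqᵇ (ribbonSizes [] T) μ) ▷ℤ (tilingSign [] T ℤ.* Defs.s (tilingShape T) α))
      ≡⟨ sym (ℤΣ.∑L-⊗ˡ (chains n (length μ)) (ℤ.+ multFactorial μ) _) ⟩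
    ∑ℤ (chains n (length μ)) (λ T → (ℤ.+ multFactorial μ) ℤ.* ((monotonicᵇ [] nothing T ∧ bagEqᵇ (ribbonSizes [] T) μ) ▷ℤ (tilingSign [] T ℤ.* Defs.s (tilingShape T) α)))
      ≡⟨ ℤΣ.∑L-cong (chains n (length μ)) (λ T → trans (sym (ℤΣ.▷-⊗ʳ (monotonicᵇ [] nothing T ∧ bagEqᵇ (ribbonSizes [] T) μ) (ℤ.+ multFactorial μ) (tilingSign [] T ℤ.* Defs.s (tilingShape T) α))) (trans (ℤΣ.▷-∧ (monotonicᵇ [] nothing T) _ _)
           (cong (λ ρ → monotonicᵇ [] nothing T ▷ℤ (bagEqᵇ (ribbonSizes [] T) μ ▷ℤ ((ℤ.+ multFactorial μ) ℤ.* (tilingSign [] T ℤ.* Defs.s ρ α)))) (tilingShape-lastShape T)))) ⟩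
    _ ≡⟨ sym (top-tilings (length μ)) ⟩
    top μ (tilings (length μ)) ∎
    where open ≡-Reasoning

  pathMNRhs-∏ : pathMNRhs μ α ≡ top μ (∏w (reverse α))
  pathMNRhs-∏ = begin
    pathMNRhs μ α
      ≡⟨ pathMNRhs-tilings ⟩
    top μ (tilings (length μ))
      ≡⟨ sym (ℤΣ.∑-δ (suc S) (length μ) (λ i → top μ (tilings i)) (s≤s (m≤m+n (length μ) _))) ⟩
    ℤΣ.∑ (suc S) (λ i → (i ≡ᵇ length μ) ▷ℤ top μ (tilings i))
      ≡⟨ ℤΣ.∑L-cong (upTo (suc S)) (λ i → only i (i ≟ length μ)) ⟩
    ℤΣ.∑ (suc S) (λ i → top μ (tilings i))
      ≡⟨ sym (top-∑ μ (upTo (suc S)) _) ⟩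
    top μ (∑ (suc S) tilings)
      ≡⟨ cong (top μ) (∑L-cong (upTo (suc S)) tilings-Y) ⟩
    top μ (∑ (suc S) (λ i → Y M i (range 0 N) f))
      ≡⟨ cong (top μ) (∑-Y M S (range 0 N) f (schur-alternating N (reverse α)) (All.map (λ lt → <-≤-trans lt N≤M) (range-< 0 N)) (m≤n+m _ (length μ))) ⟩
    top μ (L M (range 0 N) f)
      ≡⟨ cong (top μ) (L-schur N' (reverse α) (subst (_≤ N') (sym (length-reverse α)) (m≤n+m (length α) n))) ⟩
    top μ (∏w (reverse α)) ∎
    where
    open ≡-Reasoning
    -- Large enough both to include the term `length μ` and to satisfy the bound of `∑-Y`.
    S = length μ + deficit M (range 0 N)
    N≤M : N ≤ M
    N≤M = ≤-trans (m≤n+m N n) n+N≤M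
    only : ∀ i → Dec (i ≡ length μ) → ((i ≡ᵇ length μ) ▷ℤ top μ (tilings i)) ≡ top μ (tilings i)
    only i (yes refl) = ℤΣ.▷-true (≡ᵇ-refl i)
    only i (no ne) = trans (ℤΣ.▷-false (≡ᵇ-false ne)) (sym (top-tilings-≢ i ne))

-- Colourings of parts

raise : (ℕ → ℕ) → ℕ → ℕ → ℕ
raise k j i = if j ≡ᵇ i then suc (k i) else k i

lower : (ℕ → ℕ) → ℕ → ℕ → ℕ → ℕ
lower a j m i = if j ≡ᵇ i then a i ∸ m else a i

-- The pairs are (part , colour).
load : List (ℕ × ℕ) → ℕ → ℕ
load [] j = 0
load ((m , c) ∷ ps) j = (if c ≡ᵇ j then m else 0) + load ps j

agreeᵇ : ℕ → (ℕ → ℕ) → (ℕ → ℕ) → Bool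
agreeᵇ zero f g = true
agreeᵇ (suc ℓ) f g = (f 0 ≡ᵇ g 0) ∧ agreeᵇ ℓ (f ∘ suc) (g ∘ suc)

agreeᵇ⁺ : ∀ ℓ {f g} → (∀ j → j < ℓ → f j ≡ g j) → agreeᵇ ℓ f g ≡ true
agreeᵇ⁺ zero e = refl
agreeᵇ⁺ (suc ℓ) {f} {g} e = cong₂ _∧_ (trans (cong (_≡ᵇ g 0) (e 0 (s≤s z≤n))) (≡ᵇ-refl (g 0))) (agreeᵇ⁺ ℓ (λ j lt → e (suc j) (s≤s lt)))

agreeᵇ⁻ : ∀ ℓ {f g} → agreeᵇ ℓ f g ≡ true → ∀ j → j < ℓ → f j ≡ g j
agreeᵇ⁻ (suc ℓ) {f} {g} e zero _ = ≡ᵇ-true (proj₁ (∧-true {f 0 ≡ᵇ g 0} e))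
agreeᵇ⁻ (suc ℓ) {f} {g} e (suc j) (s≤s lt) = agreeᵇ⁻ ℓ (proj₂ (∧-true {f 0 ≡ᵇ g 0} e)) j lt

agreeᵇ-cong : ∀ ℓ {f f' g g' : ℕ → ℕ} → (∀ j → f j ≡ f' j) → (∀ j → g j ≡ g' j) → agreeᵇ ℓ f g ≡ agreeᵇ ℓ f' g'
agreeᵇ-cong zero e e' = refl
agreeᵇ-cong (suc ℓ) e e' = cong₂ _∧_ (cong₂ _≡ᵇ_ (e 0) (e' 0)) (agreeᵇ-cong ℓ (e ∘ suc) (e' ∘ suc))

agreeᵇ-load-∷ : ∀ ℓ m c ps a → c < ℓ → agreeᵇ ℓ (load ((m , c) ∷ ps)) a ≡ (m ≤ᵇ a c) ∧ agreeᵇ ℓ (load ps) (lower a c m)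
agreeᵇ-load-∷ ℓ m c ps a c<ℓ = true-iff
  (λ e → let at-c = subst (λ b → (if b then m else 0) + load ps c ≡ a c) (≡ᵇ-refl c) (agreeᵇ⁻ ℓ e c c<ℓ) in
    cong₂ _∧_ (≤ᵇ-true (subst (m ≤_) at-c (m≤m+n m _))) (agreeᵇ⁺ ℓ (λ j lt → to j (agreeᵇ⁻ ℓ e j lt))))
  (λ e → let e₁ , e₂ = ∧-true {m ≤ᵇ a c} e in agreeᵇ⁺ ℓ (λ j lt → from (≤ᵇ-true⁻ e₁) j (agreeᵇ⁻ ℓ e₂ j lt)))
  where
  to : ∀ j → (if c ≡ᵇ j then m else 0) + load ps j ≡ a j → load ps j ≡ lower a c m j
  to j e with c ≡ᵇ j
  ... | true = trans (sym (m+n∸m≡n m (load ps j))) (cong (_∸ m) e)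
  ... | false = e
  from : m ≤ a c → ∀ j → load ps j ≡ lower a c m j → (if c ≡ᵇ j then m else 0) + load ps j ≡ a j
  from le j e with c ≡ᵇ j in eq
  ... | true with refl ← ≡ᵇ-true {c} {j} eq = trans (cong (m +_) e) (m+[n∸m]≡n le)
  ... | false = e

-- The number of ways to insert the elements one at a time into linear orders, one for each colour,
-- starting with k j possible places in colour j.
rise : (ℕ → ℕ) → List ℕ → ℕ
rise k [] = 1
rise k (c ∷ cs) = k c * rise (raise k c) cs

rise-cong : ∀ {k k' : ℕ → ℕ} cs → (∀ j → k j ≡ k' j) → rise k cs ≡ rise k' cs
rise-cong [] e = refl
rise-cong (c ∷ cs) e = cong₂ _*_ (e c) (rise-cong cs (λ j → cong (λ v → if c ≡ᵇ j then suc v else v) (e j)))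

raise-comm : ∀ k c c' j → raise (raise k c) c' j ≡ raise (raise k c') c j
raise-comm k c c' j with c ≡ᵇ j | c' ≡ᵇ j
... | true | true = refl
... | true | false = refl
... | false | true = refl
... | false | false = refl

raise-swap : ∀ k c c' → k c * raise k c c' ≡ k c' * raise k c' c
raise-swap k c c' with c ≟ c'
... | yes refl = refl
... | no ne rewrite ≡ᵇ-false ne | ≡ᵇ-false (ne ∘ sym) = *-comm (k c) (k c')

rise-swap : ∀ k c c' cs → rise k (c ∷ c' ∷ cs) ≡ rise k (c' ∷ c ∷ cs)
rise-swap k c c' cs = begin
  k c * (raise k c c' * rise (raise (raise k c) c') cs)   ≡⟨ sym (*-assoc (k c) _ _) ⟩
  k c * raise k c c' * rise (raise (raise k c) c') cs     ≡⟨ cong₂ _*_ (raise-swap k c c') (rise-cong cs (raise-comm k c c')) ⟩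
  k c' * raise k c' c * rise (raise (raise k c') c) cs    ≡⟨ *-assoc (k c') _ _ ⟩
  k c' * (raise k c' c * rise (raise (raise k c') c) cs) ∎
  where open ≡-Reasoning

-- By `rise-swap` the order of insertion is immaterial. Inserted last, c finds the `k c` initial
-- places and one more for each earlier element of its colour.
rise-∷ : ∀ k c cs → rise k (c ∷ cs) ≡ (k c + count c cs) * rise k cs
rise-∷ k c [] = cong (_* 1) (sym (+-identityʳ (k c)))
rise-∷ k c (c' ∷ cs) = begin
  rise k (c ∷ c' ∷ cs)                                    ≡⟨ rise-swap k c c' cs ⟩
  k c' * rise (raise k c') (c ∷ cs)                       ≡⟨ cong (k c' *_) (rise-∷ (raise k c') c cs) ⟩
  k c' * ((raise k c' c + count c cs) * rise (raise k c') cs) ≡⟨ cong (λ v → k c' * (v * rise (raise k c') cs)) same ⟩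
  k c' * ((k c + count c (c' ∷ cs)) * rise (raise k c') cs)
    ≡⟨ *-left-comm (k c') (k c + count c (c' ∷ cs)) (rise (raise k c') cs) ⟩
  (k c + count c (c' ∷ cs)) * rise k (c' ∷ cs) ∎
  where
  open ≡-Reasoning
  *-left-comm : ∀ a b c → a * (b * c) ≡ b * (a * c)
  *-left-comm a b c = trans (sym (*-assoc a b c)) (trans (cong (_* c) (*-comm a b)) (*-assoc b a c))
  same : raise k c' c + count c cs ≡ k c + count c (c' ∷ cs)
  same with c ≟ c'
  ... | yes refl rewrite ≡ᵇ-refl c = sym (+-suc (k c) _)
  ... | no ne rewrite ≡ᵇ-false ne | ≡ᵇ-false (ne ∘ sym) = refl

Colourings : ℕ → List ℕ → (List (ℕ × ℕ) → ℤ) → ℤ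
Colourings ℓ [] φ = φ []
Colourings ℓ (m ∷ ms) φ = ℤΣ.∑ ℓ (λ c → Colourings ℓ ms (φ ∘ ((m , c) ∷_)))

Colourings-cong : ∀ ℓ ms {φ ψ : List (ℕ × ℕ) → ℤ} → (∀ ps → φ ps ≡ ψ ps) → Colourings ℓ ms φ ≡ Colourings ℓ ms ψ
Colourings-cong ℓ [] e = e []
Colourings-cong ℓ (m ∷ ms) e = ℤΣ.∑L-cong (upTo ℓ) (λ c → Colourings-cong ℓ ms (λ ps → e ((m , c) ∷ ps)))

Colourings-⊗ : ∀ ℓ ms x (φ : List (ℕ × ℕ) → ℤ) → Colourings ℓ ms (λ ps → x ℤ.* φ ps) ≡ x ℤ.* Colourings ℓ ms φ
Colourings-⊗ ℓ [] x φ = refl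
Colourings-⊗ ℓ (m ∷ ms) x φ = trans (ℤΣ.∑L-cong (upTo ℓ) (λ c → Colourings-⊗ ℓ ms x (φ ∘ ((m , c) ∷_)))) (ℤΣ.∑L-⊗ˡ (upTo ℓ) x _)

Colourings-▷ : ∀ ℓ ms b (φ : List (ℕ × ℕ) → ℤ) → Colourings ℓ ms (λ ps → b ▷ℤ φ ps) ≡ (b ▷ℤ Colourings ℓ ms φ)
Colourings-▷ ℓ ms true φ = refl
Colourings-▷ ℓ [] false φ = refl
Colourings-▷ ℓ (m ∷ ms) false φ = ℤΣ.∑L-zero∈ (upTo ℓ) (λ c _ → Colourings-▷ ℓ ms false (φ ∘ ((m , c) ∷_)))

Colourings-↭ : ∀ ℓ {ms ms'} → ms ↭ ms' → (φ : List (ℕ × ℕ) → ℤ) → (∀ {ps ps'} → ps ↭ ps' → φ ps ≡ φ ps') → Colourings ℓ ms φ ≡ Colourings ℓ ms' φ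
Colourings-↭ ℓ ↭.refl φ inv = refl
Colourings-↭ ℓ (↭.prep m p) φ inv = ℤΣ.∑L-cong (upTo ℓ) (λ c → Colourings-↭ ℓ p (φ ∘ ((m , c) ∷_)) (λ q → inv (↭.prep _ q)))
Colourings-↭ ℓ {m ∷ m' ∷ ms} {_ ∷ _ ∷ ms'} (↭.swap .m .m' p) φ inv = trans (ℤΣ.∑L-swap (upTo ℓ) (upTo ℓ) _) (ℤΣ.∑L-cong (upTo ℓ) (λ c' → ℤΣ.∑L-cong (upTo ℓ) (λ c →
  trans (Colourings-cong ℓ ms (λ ps → inv (↭.swap (m , c) (m' , c') ↭.refl)))
        (Colourings-↭ ℓ p (λ ps → φ ((m' , c') ∷ (m , c) ∷ ps)) (λ q → inv (↭.prep _ (↭.prep _ q)))))))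
Colourings-↭ ℓ (↭.trans p q) φ inv = trans (Colourings-↭ ℓ p φ inv) (Colourings-↭ ℓ q φ inv)

load-↭ : ∀ {ps ps'} → ps ↭ ps' → ∀ j → load ps j ≡ load ps' j
load-↭ ↭.refl j = refl
load-↭ (↭.prep (m , c) p) j = cong ((if c ≡ᵇ j then m else 0) +_) (load-↭ p j)
load-↭ {_ ∷ _ ∷ ps} {_ ∷ _ ∷ ps'} (↭.swap (m , c) (m' , c') p) j = begin
  x + (x' + load ps j)   ≡⟨ cong (λ v → x + (x' + v)) (load-↭ p j) ⟩
  x + (x' + load ps' j)  ≡⟨ sym (+-assoc x x' _) ⟩
  x + x' + load ps' j    ≡⟨ cong (_+ load ps' j) (+-comm x x') ⟩
  x' + x + load ps' j    ≡⟨ +-assoc x' x _ ⟩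
  x' + (x + load ps' j) ∎
  where
  open ≡-Reasoning
  x = if c ≡ᵇ j then m else 0
  x' = if c' ≡ᵇ j then m' else 0
load-↭ (↭.trans p q) j = trans (load-↭ p j) (load-↭ q j)

rise-↭ : ∀ {cs cs'} → cs ↭ cs' → ∀ k → rise k cs ≡ rise k cs'
rise-↭ ↭.refl k = refl
rise-↭ (↭.prep c p) k = cong (k c *_) (rise-↭ p (raise k c))
rise-↭ {_ ∷ _ ∷ cs} {_ ∷ _ ∷ cs'} (↭.swap c c' p) k = trans (rise-swap k c c' cs)
  (cong (λ v → k c' * (raise k c' c * v)) (rise-↭ p (raise (raise k c') c)))
rise-↭ (↭.trans p q) k = trans (rise-↭ p k) (rise-↭ q k)

at-decAt : ∀ j k α i → at (decAt j k α) i ≡ lower (at α) j k i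
at-decAt j k [] i with j ≡ᵇ i
... | true = sym (0∸n≡0 k)
... | false = refl
at-decAt zero k (x ∷ α) zero = refl
at-decAt zero k (x ∷ α) (suc i) = refl
at-decAt (suc j) k (x ∷ α) zero = refl
at-decAt (suc j) k (x ∷ α) (suc i) = at-decAt j k α i

length-decAt : ∀ j k α → length (decAt j k α) ≡ length α
length-decAt j k [] = refl
length-decAt zero k (x ∷ α) = refl
length-decAt (suc j) k (x ∷ α) = cong suc (length-decAt j k α)

sum-decAt : ∀ j k α → k ≤ at α j → k + sum (decAt j k α) ≡ sum α
sum-decAt j .0 [] z≤n = refl
sum-decAt zero k (x ∷ α) le = trans (sym (+-assoc k _ _)) (cong (_+ sum α) (m+[n∸m]≡n le))
sum-decAt (suc j) k (x ∷ α) le = trans (sym (+-assoc k x _)) (trans (cong (_+ sum (decAt j k α)) (+-comm k x))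
  (trans (+-assoc x k _) (cong (x +_) (sum-decAt j k α le))))

pos-sum : ∀ xs → ℤ.+ sum xs ≡ ∑ℤ xs (λ x → ℤ.+ x)
pos-sum [] = refl
pos-sum (x ∷ xs) = trans (ℤₚ.pos-+ x (sum xs)) (cong (λ v → (ℤ.+ x) ℤ.+ v) (pos-sum xs))

powerSum-∷ : ∀ k ms α → p (k ∷ ms) α ≡ ℤΣ.∑ (length α) (λ j → (k ≤ᵇ at α j) ▷ℤ p ms (decAt j k α))
powerSum-∷ k ms α = trans (pos-sum (map term (upTo (length α)))) (trans (ℤΣ.∑L-map term (upTo (length α)) (λ x → ℤ.+ x)) (ℤΣ.∑L-cong (upTo (length α)) (λ j → push (k ≤ᵇ at α j))))
  where
  term : ℕ → ℕ
  term j = if k ≤ᵇ at α j then powerSumCoeff ms (decAt j k α) else 0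
  push : ∀ b {x} → ℤ.+ (if b then x else 0) ≡ b ▷ℤ (ℤ.+ x)
  push true = refl
  push false = refl

powerSum-size : ∀ ms α → sum ms ≢ sum α → p ms α ≡ ℤ.0ℤ
powerSum-size [] α ne with all (_≡ᵇ 0) α in e
... | false = refl
... | true = ⊥-elim (ne (sym (zero-sum α e)))
  where
  zero-sum : ∀ α → all (_≡ᵇ 0) α ≡ true → sum α ≡ 0
  zero-sum [] e = refl
  zero-sum (zero ∷ α) e = zero-sum α e
powerSum-size (k ∷ ms) α ne = trans (powerSum-∷ k ms α) (ℤΣ.∑L-zero∈ (upTo (length α)) (λ j _ → ℤΣ.▷-zero (k ≤ᵇ at α j) (λ e →
  powerSum-size ms (decAt j k α) (λ e' → ne (trans (cong (k +_) e') (sum-decAt j k α (≤ᵇ-true⁻ e)))))))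

-- Expanding the product, the variable x_j chosen from the factor p_k is the colour of the part k.
powerSum-colourings : ∀ ms α → p ms α ≡ Colourings (length α) ms (λ ps → agreeᵇ (length α) (load ps) (at α) ▷ℤ ℤ.1ℤ)
powerSum-colourings [] α = trans (push (all (_≡ᵇ 0) α)) (cong (_▷ℤ ℤ.1ℤ) (zeros α))
  where
  push : ∀ b → ℤ.+ (if b then 1 else 0) ≡ b ▷ℤ ℤ.1ℤ
  push true = refl
  push false = refl
  zeros : ∀ α → all (_≡ᵇ 0) α ≡ agreeᵇ (length α) (λ _ → 0) (at α)
  zeros [] = refl
  zeros (zero ∷ α) = zeros α
  zeros (suc x ∷ α) = refl
powerSum-colourings (k ∷ ms) α = trans (powerSum-∷ k ms α) (ℤΣ.∑-cong< (length α) (λ j lt → begin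
  (k ≤ᵇ at α j) ▷ℤ p ms (decAt j k α)
    ≡⟨ cong ((k ≤ᵇ at α j) ▷ℤ_) (trans (powerSum-colourings ms (decAt j k α)) (trans (cong (λ ℓ → Colourings ℓ ms (λ ps → agreeᵇ ℓ (load ps) (at (decAt j k α)) ▷ℤ ℤ.1ℤ)) (length-decAt j k α))
         (Colourings-cong (length α) ms (λ ps → cong (_▷ℤ ℤ.1ℤ) (agreeᵇ-cong (length α) (λ _ → refl) (at-decAt j k α)))))) ⟩
  (k ≤ᵇ at α j) ▷ℤ Colourings (length α) ms (λ ps → agreeᵇ (length α) (load ps) (lower (at α) j k) ▷ℤ ℤ.1ℤ)
    ≡⟨ sym (Colourings-▷ (length α) ms (k ≤ᵇ at α j) _) ⟩
  Colourings (length α) ms (λ ps → (k ≤ᵇ at α j) ▷ℤ (agreeᵇ (length α) (load ps) (lower (at α) j k) ▷ℤ ℤ.1ℤ))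
    ≡⟨ Colourings-cong (length α) ms (λ ps → trans (sym (ℤΣ.▷-∧ (k ≤ᵇ at α j) _ _)) (cong (_▷ℤ ℤ.1ℤ) (sym (agreeᵇ-load-∷ (length α) k j ps (at α) lt)))) ⟩
  Colourings (length α) ms (λ ps → agreeᵇ (length α) (load ((k , j) ∷ ps)) (at α) ▷ℤ ℤ.1ℤ) ∎))
  where open ≡-Reasoning

powerSum-↭ : ∀ {ms ms'} α → ms ↭ ms' → p ms α ≡ p ms' α
powerSum-↭ {ms} {ms'} α q = trans (powerSum-colourings ms α) (trans
  (Colourings-↭ (length α) q _ (λ r → cong (_▷ℤ ℤ.1ℤ) (agreeᵇ-cong (length α) (load-↭ r) (λ _ → refl))))
  (sym (powerSum-colourings ms' α)))

-- Coefficients of products of powers of W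

module TopProducts where
  open Generators

  ∏< : ∀ ms → ℕ → (ℕ → ⟦ ms ⟧) → ⟦ ms ⟧
  ∏< ms zero x = TorsionFreeRing.𝟙 (tower ms)
  ∏< ms (suc ℓ) x = TorsionFreeRing._⊗_ (tower ms) (x 0) (∏< ms ℓ (x ∘ suc))

  ∏<-cong : ∀ ms ℓ {x y : ℕ → ⟦ ms ⟧} → (∀ j → j < ℓ → x j ≡ y j) → ∏< ms ℓ x ≡ ∏< ms ℓ y
  ∏<-cong ms zero e = refl
  ∏<-cong ms (suc ℓ) e = cong₂ (TorsionFreeRing._⊗_ (tower ms)) (e 0 (s≤s z≤n)) (∏<-cong ms ℓ (λ j lt → e (suc j) (s≤s lt)))

  proj₁-∏< : ∀ m ms ℓ x → proj₁ (∏< (m ∷ ms) ℓ x) ≡ ∏< ms ℓ (proj₁ ∘ x)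
  proj₁-∏< m ms zero x = refl
  proj₁-∏< m ms (suc ℓ) x = cong (TorsionFreeRing._⊗_ (tower ms) (proj₁ (x 0))) (proj₁-∏< m ms ℓ (x ∘ suc))

  -- The Leibniz rule: exactly one factor j contributes its ε-part.
  proj₂-∏< : ∀ m ms ℓ x → proj₂ (∏< (m ∷ ms) ℓ x) ≡
    Sums.∑ (tower ms) ℓ (λ j → ∏< ms ℓ (λ i → if j ≡ᵇ i then proj₂ (x i) else proj₁ (x i)))
  proj₂-∏< m ms zero x = refl
  proj₂-∏< m ms (suc ℓ) x = begin
    proj₁ (x 0) ⊗ proj₂ (∏< (m ∷ ms) ℓ (x ∘ suc)) ⊕ proj₂ (x 0) ⊗ proj₁ (∏< (m ∷ ms) ℓ (x ∘ suc))
      ≡⟨ ⊕-comm _ _ ⟩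
    proj₂ (x 0) ⊗ proj₁ (∏< (m ∷ ms) ℓ (x ∘ suc)) ⊕ proj₁ (x 0) ⊗ proj₂ (∏< (m ∷ ms) ℓ (x ∘ suc))
      ≡⟨ cong₂ _⊕_ (cong (proj₂ (x 0) ⊗_) (proj₁-∏< m ms ℓ (x ∘ suc)))
           (trans (cong (proj₁ (x 0) ⊗_) (proj₂-∏< m ms ℓ (x ∘ suc))) (sym (∑L-⊗ˡ (upTo ℓ) (proj₁ (x 0)) _))) ⟩
    proj₂ (x 0) ⊗ ∏< ms ℓ (proj₁ ∘ x ∘ suc) ⊕ ∑ ℓ (λ j → proj₁ (x 0) ⊗ ∏< ms ℓ (λ i → if j ≡ᵇ i then proj₂ (x (suc i)) else proj₁ (x (suc i))))
      ≡⟨ sym (∑-suc ℓ _) ⟩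
    ∑ (suc ℓ) (λ j → ∏< ms (suc ℓ) (λ i → if j ≡ᵇ i then proj₂ (x i) else proj₁ (x i))) ∎
    where
    open ≡-Reasoning
    open TorsionFreeRing (tower ms)
    open Sums (tower ms)

  ∏<-scale : ∀ ms ℓ j c (x y : ℕ → ⟦ ms ⟧) → j < ℓ →
    ∏< ms ℓ (λ i → if j ≡ᵇ i then TorsionFreeRing._⊗_ (tower ms) c (x i) else y i) ≡
    TorsionFreeRing._⊗_ (tower ms) c (∏< ms ℓ (λ i → if j ≡ᵇ i then x i else y i))
  ∏<-scale ms (suc ℓ) zero c x y _ = TorsionFreeRing.⊗-assoc (tower ms) c (x 0) _
  ∏<-scale ms (suc ℓ) (suc j) c x y (s≤s lt) = trans (cong (TorsionFreeRing._⊗_ (tower ms) (y 0)) (∏<-scale ms ℓ j c (x ∘ suc) (y ∘ suc) lt))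
    (TorsionFreeRing.⊗-left-comm (tower ms) _ _ _)

  -- Taking ε_m from the factor j puts the part m into colour j: by the formula for `power` this
  -- gives the factor k_j, raises the exponent k_j by 1 and lowers the degree a_j by m. This is the
  -- recursion of `rise`.
  top-∏<-∷ : ∀ m ms ℓ k a → top (m ∷ ms) (∏< (m ∷ ms) ℓ (λ j → power (m ∷ ms) (k j) (a j))) ≡
    ℤΣ.∑ ℓ (λ j → (m ≤ᵇ a j) ▷ℤ ((ℤ.+ k j) ℤ.* top ms (∏< ms ℓ (λ i → power ms (raise k j i) (lower a j m i)))))
  top-∏<-∷ m ms ℓ k a = trans (cong (top ms) (proj₂-∏< m ms ℓ _)) (trans (top-∑ ms (upTo ℓ) _) (ℤΣ.∑-cong< ℓ each))
    where
    open TorsionFreeRing (tower ms)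
    open Sums (tower ms)
    open Scalars (scalars ms)
    each : ∀ j → j < ℓ → top ms (∏< ms ℓ (λ i → if j ≡ᵇ i then (m ≤ᵇ a i) ▷ multiple ms (k i) (power ms (suc (k i)) (a i ∸ m)) else power ms (k i) (a i))) ≡
      ((m ≤ᵇ a j) ▷ℤ ((ℤ.+ k j) ℤ.* top ms (∏< ms ℓ (λ i → power ms (raise k j i) (lower a j m i)))))
    each j lt = begin
      top ms (∏< ms ℓ (λ i → if j ≡ᵇ i then (m ≤ᵇ a i) ▷ multiple ms (k i) (power ms (suc (k i)) (a i ∸ m)) else power ms (k i) (a i)))
        ≡⟨ cong (top ms) (∏<-cong ms ℓ (λ i _ → at-j i)) ⟩
      top ms (∏< ms ℓ (λ i → if j ≡ᵇ i then ((m ≤ᵇ a j) ▷ ι (ℤ.+ k j)) ⊗ power ms (suc (k i)) (a i ∸ m) else power ms (k i) (a i)))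
        ≡⟨ cong (top ms) (∏<-scale ms ℓ j _ (λ i → power ms (suc (k i)) (a i ∸ m)) (λ i → power ms (k i) (a i)) lt) ⟩
      top ms (((m ≤ᵇ a j) ▷ ι (ℤ.+ k j)) ⊗ ∏< ms ℓ (λ i → if j ≡ᵇ i then power ms (suc (k i)) (a i ∸ m) else power ms (k i) (a i)))
        ≡⟨ cong (top ms) (sym (▷-⊗ˡ (m ≤ᵇ a j) _ _)) ⟩
      top ms ((m ≤ᵇ a j) ▷ ι (ℤ.+ k j) ⊗ ∏< ms ℓ (λ i → if j ≡ᵇ i then power ms (suc (k i)) (a i ∸ m) else power ms (k i) (a i)))
        ≡⟨ trans (top-▷ ms (m ≤ᵇ a j) _) (cong ((m ≤ᵇ a j) ▷ℤ_) (top-ι ms (ℤ.+ k j) _)) ⟩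
      ((m ≤ᵇ a j) ▷ℤ ((ℤ.+ k j) ℤ.* top ms (∏< ms ℓ (λ i → if j ≡ᵇ i then power ms (suc (k i)) (a i ∸ m) else power ms (k i) (a i)))))
        ≡⟨ cong (λ v → (m ≤ᵇ a j) ▷ℤ ((ℤ.+ k j) ℤ.* top ms v)) (∏<-cong ms ℓ (λ i _ → pull i)) ⟩
      ((m ≤ᵇ a j) ▷ℤ ((ℤ.+ k j) ℤ.* top ms (∏< ms ℓ (λ i → power ms (raise k j i) (lower a j m i))))) ∎
      where
      open ≡-Reasoning
      at-j : ∀ i → (if j ≡ᵇ i then (m ≤ᵇ a i) ▷ multiple ms (k i) (power ms (suc (k i)) (a i ∸ m)) else power ms (k i) (a i)) ≡
        (if j ≡ᵇ i then ((m ≤ᵇ a j) ▷ ι (ℤ.+ k j)) ⊗ power ms (suc (k i)) (a i ∸ m) else power ms (k i) (a i))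
      at-j i with j ≡ᵇ i in e
      ... | false = refl
      ... | true with refl ← ≡ᵇ-true {j} {i} e = ▷-⊗ˡ (m ≤ᵇ a j) _ _
      pull : ∀ i → (if j ≡ᵇ i then power ms (suc (k i)) (a i ∸ m) else power ms (k i) (a i)) ≡ power ms (raise k j i) (lower a j m i)
      pull i with j ≡ᵇ i
      ... | true = refl
      ... | false = refl

  top-∏<-colourings : ∀ ms ℓ k a → top ms (∏< ms ℓ (λ j → power ms (k j) (a j))) ≡
    Colourings ℓ ms (λ ps → agreeᵇ ℓ (load ps) a ▷ℤ (ℤ.+ rise k (map proj₂ ps)))
  top-∏<-colourings [] ℓ k a = base ℓ k a
    where
    base : ∀ ℓ (k a : ℕ → ℕ) → ∏< [] ℓ (λ j → power [] (k j) (a j)) ≡ (agreeᵇ ℓ (λ _ → 0) a ▷ℤ ℤ.1ℤ)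
    base zero k a = refl
    base (suc ℓ) k a with a 0
    ... | zero = trans (ℤₚ.*-identityˡ _) (base ℓ (k ∘ suc) (a ∘ suc))
    ... | suc _ = ℤₚ.*-zeroˡ (∏< [] ℓ (λ j → power [] (k (suc j)) (a (suc j))))
  top-∏<-colourings (m ∷ ms) ℓ k a = trans (top-∏<-∷ m ms ℓ k a) (ℤΣ.∑-cong< ℓ (λ j lt → begin
    (m ≤ᵇ a j) ▷ℤ ((ℤ.+ k j) ℤ.* top ms (∏< ms ℓ (λ i → power ms (raise k j i) (lower a j m i))))
      ≡⟨ cong (λ v → (m ≤ᵇ a j) ▷ℤ ((ℤ.+ k j) ℤ.* v)) (top-∏<-colourings ms ℓ (raise k j) (lower a j m)) ⟩
    (m ≤ᵇ a j) ▷ℤ ((ℤ.+ k j) ℤ.* Colourings ℓ ms (λ ps → agreeᵇ ℓ (load ps) (lower a j m) ▷ℤ (ℤ.+ rise (raise k j) (map proj₂ ps))))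
      ≡⟨ cong ((m ≤ᵇ a j) ▷ℤ_) (sym (Colourings-⊗ ℓ ms (ℤ.+ k j) _)) ⟩
    (m ≤ᵇ a j) ▷ℤ Colourings ℓ ms (λ ps → (ℤ.+ k j) ℤ.* (agreeᵇ ℓ (load ps) (lower a j m) ▷ℤ (ℤ.+ rise (raise k j) (map proj₂ ps))))
      ≡⟨ sym (Colourings-▷ ℓ ms (m ≤ᵇ a j) _) ⟩
    Colourings ℓ ms (λ ps → (m ≤ᵇ a j) ▷ℤ ((ℤ.+ k j) ℤ.* (agreeᵇ ℓ (load ps) (lower a j m) ▷ℤ (ℤ.+ rise (raise k j) (map proj₂ ps)))))
      ≡⟨ Colourings-cong ℓ ms (λ ps → trans (cong ((m ≤ᵇ a j) ▷ℤ_) (sym (ℤΣ.▷-⊗ʳ (agreeᵇ ℓ (load ps) (lower a j m)) (ℤ.+ k j) (ℤ.+ rise (raise k j) (map proj₂ ps)))))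
           (trans (sym (ℤΣ.▷-∧ (m ≤ᵇ a j) _ _)) (cong₂ _▷ℤ_ (sym (agreeᵇ-load-∷ ℓ m j ps a lt)) (sym (ℤₚ.pos-* (k j) _))))) ⟩
    Colourings ℓ ms (λ ps → agreeᵇ ℓ (load ((m , j) ∷ ps)) a ▷ℤ (ℤ.+ rise k (j ∷ map proj₂ ps))) ∎))
    where open ≡-Reasoning

  ∏w-∏< : ∀ ms (pos : All (1 ≤_) ms) α → Cauchy.∏w (tower ms) (series ms pos) α ≡ ∏< ms (length α) (λ j → power ms 1 (at α j))
  ∏w-∏< ms pos [] = refl
  ∏w-∏< ms pos (a ∷ α) = cong (TorsionFreeRing._⊗_ (tower ms) (power ms 1 a)) (∏w-∏< ms pos α)

  ∏w-↭ : ∀ ms (pos : All (1 ≤_) ms) {α β} → α ↭ β → Cauchy.∏w (tower ms) (series ms pos) α ≡ Cauchy.∏w (tower ms) (series ms pos) β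
  ∏w-↭ ms pos ↭.refl = refl
  ∏w-↭ ms pos (↭.prep a q) = cong (TorsionFreeRing._⊗_ (tower ms) (power ms 1 a)) (∏w-↭ ms pos q)
  ∏w-↭ ms pos (↭.swap a b q) = trans (TorsionFreeRing.⊗-left-comm (tower ms) _ _ _)
    (cong (λ v → TorsionFreeRing._⊗_ (tower ms) (power ms 1 b) (TorsionFreeRing._⊗_ (tower ms) (power ms 1 a) v)) (∏w-↭ ms pos q))
  ∏w-↭ ms pos (↭.trans q r) = trans (∏w-↭ ms pos q) (∏w-↭ ms pos r)

  top-∏w : ∀ ms (pos : All (1 ≤_) ms) α → top ms (Cauchy.∏w (tower ms) (series ms pos) (reverse α)) ≡
    Colourings (length α) ms (λ ps → agreeᵇ (length α) (load ps) (at α) ▷ℤ (ℤ.+ rise (λ _ → 1) (map proj₂ ps)))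
  top-∏w ms pos α = trans (cong (top ms) (trans (∏w-↭ ms pos (↭ₚ.↭-reverse α)) (∏w-∏< ms pos α)))
    (top-∏<-colourings ms (length α) (λ _ → 1) (at α))

-- Colourings of a finite set, block by block

Colourings-cong∈ : ∀ ℓ ms {φ ψ : List (ℕ × ℕ) → ℤ} → (∀ ps → map proj₁ ps ≡ ms → φ ps ≡ ψ ps) → Colourings ℓ ms φ ≡ Colourings ℓ ms ψ
Colourings-cong∈ ℓ [] e = e [] refl
Colourings-cong∈ ℓ (m ∷ ms) e = ℤΣ.∑L-cong (upTo ℓ) (λ c → Colourings-cong∈ ℓ ms (λ ps q → e ((m , c) ∷ ps) (cong (m ∷_) q)))

finEqᵇ-refl : ∀ {n} (x : Fin n) → finEqᵇ x x ≡ true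
finEqᵇ-refl x = ≡ᵇ-refl (toℕ x)

finEqᵇ-true : ∀ {n} {x y : Fin n} → finEqᵇ x y ≡ true → x ≡ y
finEqᵇ-true e = Finₚ.toℕ-injective (≡ᵇ-true e)

finEqᵇ-false : ∀ {n} {x y : Fin n} → x ≢ y → finEqᵇ x y ≡ false
finEqᵇ-false ne = ≡ᵇ-false (ne ∘ Finₚ.toℕ-injective)

∑ℤ-↭ : ∀ {A : Set} {xs ys : List A} → xs ↭ ys → (f : A → ℤ) → ∑ℤ xs f ≡ ∑ℤ ys f
∑ℤ-↭ ↭.refl f = refl
∑ℤ-↭ (↭.prep x p) f = cong (λ v → f x ℤ.+ v) (∑ℤ-↭ p f)
∑ℤ-↭ {xs = _ ∷ _ ∷ xs} {_ ∷ _ ∷ ys} (↭.swap x y p) f = trans (TorsionFreeRing.⊕-left-comm ℤ-ring (f x) (f y) (∑ℤ xs f)) (cong (λ v → f y ℤ.+ (f x ℤ.+ v)) (∑ℤ-↭ p f))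
∑ℤ-↭ (↭.trans p q) f = trans (∑ℤ-↭ p f) (∑ℤ-↭ q f)

module Assignments (n : ℕ) where
  Assignment : Set
  Assignment = Fin n → ℕ

  _[_↦_] : Assignment → Fin n → ℕ → Assignment
  (f [ x ↦ c ]) y = if finEqᵇ x y then c else f y

  update-same : ∀ f x c → (f [ x ↦ c ]) x ≡ c
  update-same f x c rewrite finEqᵇ-refl x = refl

  update-other : ∀ f x y c → x ≢ y → (f [ x ↦ c ]) y ≡ f y
  update-other f x y c ne rewrite finEqᵇ-false ne = refl

  Assign : ℕ → List (Fin n) → (Assignment → ℤ) → Assignment → ℤ
  Assign ℓ [] φ f = φ f
  Assign ℓ (x ∷ X) φ f = ℤΣ.∑ ℓ (λ c → Assign ℓ X φ (f [ x ↦ c ]))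

  -- Updating two points in different orders gives assignments that agree pointwise, and this is all
  -- that permuting the points in `Assign-↭` uses.
  Respects : (Assignment → ℤ) → Set
  Respects φ = ∀ f g → (∀ x → f x ≡ g x) → φ f ≡ φ g

  Assign-respects : ∀ ℓ X {φ} → Respects φ → Respects (Assign ℓ X φ)
  Assign-respects ℓ [] r = r
  Assign-respects ℓ (x ∷ X) r f g e = ℤΣ.∑L-cong (upTo ℓ) (λ c → Assign-respects ℓ X r _ _ (λ y → cong (λ v → if finEqᵇ x y then c else v) (e y)))

  Assign-cong : ∀ ℓ X {φ ψ : Assignment → ℤ} → (∀ f → φ f ≡ ψ f) → ∀ f → Assign ℓ X φ f ≡ Assign ℓ X ψ f
  Assign-cong ℓ [] e f = e f
  Assign-cong ℓ (x ∷ X) e f = ℤΣ.∑L-cong (upTo ℓ) (λ c → Assign-cong ℓ X e (f [ x ↦ c ]))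

  Assign-∑ : ∀ ℓ X {A : Set} (ws : List A) (φ : A → Assignment → ℤ) f → Assign ℓ X (λ f → ∑ℤ ws (λ w → φ w f)) f ≡ ∑ℤ ws (λ w → Assign ℓ X (φ w) f)
  Assign-∑ ℓ [] ws φ f = refl
  Assign-∑ ℓ (x ∷ X) ws φ f = trans (ℤΣ.∑L-cong (upTo ℓ) (λ c → Assign-∑ ℓ X ws φ (f [ x ↦ c ]))) (ℤΣ.∑L-swap (upTo ℓ) ws _)

  Assign-↭ : ∀ ℓ {X Y} → X ↭ Y → ∀ {φ} → Respects φ → ∀ f → Assign ℓ X φ f ≡ Assign ℓ Y φ f
  Assign-↭ ℓ ↭.refl r f = refl
  Assign-↭ ℓ (↭.prep x p) r f = ℤΣ.∑L-cong (upTo ℓ) (λ c → Assign-↭ ℓ p r (f [ x ↦ c ]))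
  Assign-↭ ℓ {_ ∷ _ ∷ X} (↭.swap x y p) r f with x Finₚ.≟ y
  ... | yes refl = ℤΣ.∑L-cong (upTo ℓ) (λ c → ℤΣ.∑L-cong (upTo ℓ) (λ c' → Assign-↭ ℓ p r _))
  ... | no ne = trans (ℤΣ.∑L-swap (upTo ℓ) (upTo ℓ) _) (ℤΣ.∑L-cong (upTo ℓ) (λ c' → ℤΣ.∑L-cong (upTo ℓ) (λ c →
      trans (Assign-respects ℓ X r _ _ (comm c c')) (Assign-↭ ℓ p r _))))
    where
    comm : ∀ c c' z → ((f [ x ↦ c ]) [ y ↦ c' ]) z ≡ ((f [ y ↦ c' ]) [ x ↦ c ]) z
    comm c c' z with finEqᵇ y z in e₁ | finEqᵇ x z in e₂
    ... | true | true = ⊥-elim (ne (trans (finEqᵇ-true e₂) (sym (finEqᵇ-true e₁))))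
    ... | true | false = refl
    ... | false | true = refl
    ... | false | false = refl
  Assign-↭ ℓ (↭.trans p q) r f = trans (Assign-↭ ℓ p r f) (Assign-↭ ℓ q r f)

  Assign-zero : ∀ ℓ X {φ : Assignment → ℤ} f → (∀ g → (∀ y → y ∉ X → g y ≡ f y) → φ g ≡ ℤ.0ℤ) → Assign ℓ X φ f ≡ ℤ.0ℤ
  Assign-zero ℓ [] f e = e f (λ _ _ → refl)
  Assign-zero ℓ (x ∷ X) f e = ℤΣ.∑L-zero∈ (upTo ℓ) (λ c _ → Assign-zero ℓ X (f [ x ↦ c ]) (λ g same → e g (λ y y∉ →
    trans (same y (y∉ ∘ there)) (update-other f x y c (λ { refl → y∉ (here refl) })))))

  fill : List (Fin n) → ℕ → Assignment → Assignment
  fill [] c f = f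
  fill (x ∷ X) c f = fill X c (f [ x ↦ c ])

  fill-∉ : ∀ X c f {y} → y ∉ X → fill X c f y ≡ f y
  fill-∉ [] c f _ = refl
  fill-∉ (x ∷ X) c f {y} ∉ = trans (fill-∉ X c _ (∉ ∘ there)) (update-other f x y c (λ { refl → ∉ (here refl) }))

  fill-keeps : ∀ X c f {y} → f y ≡ c → fill X c f y ≡ c
  fill-keeps [] c f e = e
  fill-keeps (x ∷ X) c f {y} e = fill-keeps X c _ kept
    where
    kept : (f [ x ↦ c ]) y ≡ c
    kept with finEqᵇ x y
    ... | true = refl
    ... | false = e

  fill-∈ : ∀ X c f {y} → y ∈ X → fill X c f y ≡ c
  fill-∈ (x ∷ X) c f (here refl) = fill-keeps X c _ (update-same f x c)
  fill-∈ (x ∷ X) c f (there m) = fill-∈ X c _ m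

  paint : List (List (Fin n)) → List ℕ → Assignment → Assignment
  paint (b ∷ bs) (c ∷ g) f = paint bs g (fill b c f)
  paint _ _ f = f

  paint-∉ : ∀ bs g f {y} → y ∉ concat bs → paint bs g f y ≡ f y
  paint-∉ [] g f _ = refl
  paint-∉ (b ∷ bs) [] f _ = refl
  paint-∉ (b ∷ bs) (c ∷ g) f ∉ = trans (paint-∉ bs g _ (∉ ∘ ∈ₚ.∈-++⁺ʳ b)) (fill-∉ b c f (∉ ∘ ∈ₚ.∈-++⁺ˡ))

  unique-++ : ∀ {A : Set} (b : List A) {X} → Unique (b ++ X) → (∀ {y} → y ∈ b → y ∉ X) × Unique X
  unique-++ [] u = (λ ()) , u
  unique-++ (x ∷ b) (ne ∷ u) = let d , u' = unique-++ b u in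
    (λ { (here refl) m → All.lookup ne (∈ₚ.∈-++⁺ʳ b m) refl ; (there m) → d m }) , u'

  paint-head : ∀ b bs c g f → Unique (concat (b ∷ bs)) → ∀ {y} → y ∈ b → paint (b ∷ bs) (c ∷ g) f y ≡ c
  paint-head b bs c g f u m = trans (paint-∉ bs g _ (proj₁ (unique-++ b u) m)) (fill-∈ b c f m)

  paint-constant : ∀ bs g f → Unique (concat bs) → length g ≡ length bs → ∀ {b} → b ∈ bs → ∀ {y y'} → y ∈ b → y' ∈ b → paint bs g f y ≡ paint bs g f y'
  paint-constant (b ∷ bs) (c ∷ g) f u l (here refl) m m' = trans (paint-head b bs c g f u m) (sym (paint-head b bs c g f u m'))
  paint-constant (b ∷ bs) (c ∷ g) f u l (there b∈) m m' = paint-constant bs g _ (proj₂ (unique-++ b u)) (suc-injective l) b∈ m m'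

  count-paint : ∀ bs ps f → Unique (concat bs) → map proj₁ ps ≡ map length bs → ∀ j → count j (map (paint bs (map proj₂ ps) f) (concat bs)) ≡ load ps j
  count-paint [] [] f u e j = refl
  count-paint (b ∷ bs) ((m , c) ∷ ps) f u e j = begin
    count j (map h (b ++ concat bs))                    ≡⟨ cong (count j) (map-++ h b (concat bs)) ⟩
    count j (map h b ++ map h (concat bs))              ≡⟨ count-++ j (map h b) _ ⟩
    count j (map h b) + count j (map h (concat bs))     ≡⟨ cong₂ _+_ (trans (constant b (λ m → paint-head b bs c (map proj₂ ps) f u m)) (cong (λ k → if c ≡ᵇ j then k else 0) (sym (proj₁ (∷-injective e)))))
                                                             (count-paint bs ps _ (proj₂ (unique-++ b u)) (proj₂ (∷-injective e)) j) ⟩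
    (if c ≡ᵇ j then m else 0) + load ps j ∎
    where
    open ≡-Reasoning
    h = paint (b ∷ bs) (c ∷ map proj₂ ps) f
    constant : ∀ X → (∀ {y} → y ∈ X → h y ≡ c) → count j (map h X) ≡ (if c ≡ᵇ j then length X else 0)
    constant [] _ with c ≡ᵇ j
    ... | true = refl
    ... | false = refl
    constant (x ∷ X) e = trans (cong (λ v → count j (v ∷ map h X)) (e (here refl))) (trans (count-∷ j c (map h X)) (trans (cong ((if j ≡ᵇ c then 1 else 0) +_) (constant X (e ∘ there))) (add (j ≟ c))))
      where
      add : Dec (j ≡ c) → (if j ≡ᵇ c then 1 else 0) + (if c ≡ᵇ j then length X else 0) ≡ (if c ≡ᵇ j then suc (length X) else 0)
      add (yes refl) rewrite ≡ᵇ-refl j = refl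
      add (no ne) rewrite ≡ᵇ-false ne | ≡ᵇ-false (ne ∘ sym) = refl

  -- The point x already has colour c, and φ vanishes unless the points of Y share it, so each sum
  -- over the colour of such a point keeps one term.
  Assign-fill : ∀ ℓ φ c x Y X f → c < ℓ → f x ≡ c → x ∉ Y ++ X → Unique (Y ++ X) →
    (∀ y → y ∈ Y → ∀ g → g y ≢ g x → φ g ≡ ℤ.0ℤ) → Assign ℓ (Y ++ X) φ f ≡ Assign ℓ X φ (fill Y c f)
  Assign-fill ℓ φ c x [] X f c<ℓ e x∉ u vanish = refl
  Assign-fill ℓ φ c x (y ∷ Y) X f c<ℓ e x∉ (y∉ ∷ u) vanish = begin
    ℤΣ.∑ ℓ (λ c' → Assign ℓ (Y ++ X) φ (f [ y ↦ c' ]))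
      ≡⟨ ℤΣ.∑L-cong (upTo ℓ) (λ c' → only c' (c' ≟ c)) ⟩
    ℤΣ.∑ ℓ (λ c' → (c' ≡ᵇ c) ▷ℤ Assign ℓ (Y ++ X) φ (f [ y ↦ c' ]))
      ≡⟨ ℤΣ.∑-δ ℓ c _ c<ℓ ⟩
    Assign ℓ (Y ++ X) φ (f [ y ↦ c ])
      ≡⟨ Assign-fill ℓ φ c x Y X _ c<ℓ (trans (update-other f y x c y≢x) e) (x∉ ∘ there) u (λ z m → vanish z (there m)) ⟩
    Assign ℓ X φ (fill (y ∷ Y) c f) ∎
    where
    open ≡-Reasoning
    y≢x : y ≢ x
    y≢x refl = x∉ (here refl)
    only : ∀ c' → Dec (c' ≡ c) → Assign ℓ (Y ++ X) φ (f [ y ↦ c' ]) ≡ ((c' ≡ᵇ c) ▷ℤ Assign ℓ (Y ++ X) φ (f [ y ↦ c' ]))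
    only c' (yes refl) = sym (ℤΣ.▷-true (≡ᵇ-refl c))
    only c' (no ne) = trans (Assign-zero ℓ (Y ++ X) _ (λ g same → vanish y (here refl) g (λ e' → ne (begin
        c'                ≡⟨ sym (update-same f y c') ⟩
        (f [ y ↦ c' ]) y  ≡⟨ sym (same y (λ m → All.lookup y∉ m refl)) ⟩
        g y               ≡⟨ e' ⟩
        g x               ≡⟨ same x (x∉ ∘ there) ⟩
        (f [ y ↦ c' ]) x  ≡⟨ trans (update-other f y x c' y≢x) e ⟩
        c ∎)))) (sym (ℤΣ.▷-false (≡ᵇ-false ne)))

  -- Only assignments constant on the blocks contribute, one for each colouring of the blocks. Empty
  -- blocks are excluded, as they would receive a free colour on the right.
  Assign-blocks : ∀ ℓ φ bs f → Unique (concat bs) → All (λ b → 1 ≤ length b) bs →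
    (∀ {b} → b ∈ bs → ∀ {y y'} → y ∈ b → y' ∈ b → ∀ g → g y ≢ g y' → φ g ≡ ℤ.0ℤ) →
    Assign ℓ (concat bs) φ f ≡ Colourings ℓ (map length bs) (λ ps → φ (paint bs (map proj₂ ps) f))
  Assign-blocks ℓ φ [] f u _ vanish = refl
  Assign-blocks ℓ φ ((x ∷ Y) ∷ bs) f (x∉ ∷ u) (_ ∷ ne) vanish = ℤΣ.∑-cong< ℓ (λ c c<ℓ → trans
    (Assign-fill ℓ φ c x Y (concat bs) _ c<ℓ (update-same f x c) (λ m → All.lookup x∉ m refl) u (λ y m g → vanish (here refl) (there m) (here refl) g))
    (Assign-blocks ℓ φ bs _ (proj₂ (unique-++ Y u)) ne (λ b∈ → vanish (there b∈))))

-- Orbits of a permutation and power sums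

unique-set-↭ : ∀ {A : Set} {xs ys : List A} → Unique xs → Unique ys → (∀ {x} → x ∈ xs → x ∈ ys) → (∀ {x} → x ∈ ys → x ∈ xs) → xs ↭ ys
unique-set-↭ u v f g = ∼bag⇒↭ (unique∧set⇒bag u v (mk⇔ f g))

unique-↭ : ∀ {A : Set} {xs ys : List A} → xs ↭ ys → Unique xs → Unique ys
unique-↭ p = SetoidPermutation.Unique-resp-↭ (setoid _) (↭.↭⇒↭ₛ p)

insertDesc-↭ : ∀ x ys → insertDesc x ys ↭ x ∷ ys
insertDesc-↭ x [] = ↭.refl
insertDesc-↭ x (y ∷ ys) with y ≤ᵇ x
... | true = ↭.refl
... | false = ↭.trans (↭.prep y (insertDesc-↭ x ys)) (↭.swap y x ↭.refl)

sortDesc-↭ : ∀ xs → sortDesc xs ↭ xs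
sortDesc-↭ [] = ↭.refl
sortDesc-↭ (x ∷ xs) = ↭.trans (insertDesc-↭ x (sortDesc xs)) (↭.prep x (sortDesc-↭ xs))

insertDesc-descending : ∀ x ys → Linked _≥_ ys → Linked _≥_ (insertDesc x ys)
insertDesc-descending x [] lk = [-]
insertDesc-descending x (y ∷ ys) lk with y ≤ᵇ x in e
... | true = ≤ᵇ-true⁻ e ∷ lk
... | false = descending-∷ (head≤ ys (descending-head lk)) (insertDesc-descending x ys (Linked.tail lk))
  where
  head≤ : ∀ ys → headOr0 ys ≤ y → headOr0 (insertDesc x ys) ≤ y
  head≤ [] _ = <⇒≤ (≤ᵇ-false⁻ e)
  head≤ (z ∷ ys) le with z ≤ᵇ x
  ... | true = <⇒≤ (≤ᵇ-false⁻ e)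
  ... | false = le

sortDesc-descending : ∀ xs → Linked _≥_ (sortDesc xs)
sortDesc-descending [] = []
sortDesc-descending (x ∷ xs) = insertDesc-descending x (sortDesc xs) (sortDesc-descending xs)

firstTrue-spec : ∀ n g (q : ℕ → Bool) → (∃ λ k → k < n × q (g k) ≡ true) →
  ∃ λ k → k < n × firstTrue (applyUpTo g n) q ≡ g k × q (g k) ≡ true × (∀ j → j < k → q (g j) ≡ false)
firstTrue-spec (suc n) g q (k , k<n , e) with q (g 0) in eq
... | true = 0 , s≤s z≤n , refl , eq , (λ j ())
firstTrue-spec (suc n) g q (zero , _ , e) | false = case trans (sym eq) e of λ ()
firstTrue-spec (suc n) g q (suc k , s≤s k<n , e) | false with k' , lt , e₁ , e₂ , first ← firstTrue-spec n (g ∘ suc) q (k , k<n , e) =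
  suc k' , s≤s lt , e₁ , e₂ , λ { zero _ → eq ; (suc j) (s≤s j<) → first j j< }

argmin : ∀ (g : ℕ → ℕ) b → 1 ≤ b → ∃ λ k → k < b × (∀ j → j < b → g k ≤ g j)
argmin g (suc zero) _ = 0 , s≤s z≤n , λ { zero _ → ≤-refl ; (suc j) (s≤s ()) }
argmin g (suc (suc b)) _ with k , k< , min ← argmin g (suc b) (s≤s z≤n) with g k ≤? g (suc b)
... | yes le = k , m<n⇒m<1+n k< , λ j j< → case m≤n⇒m<n∨m≡n (s≤s⁻¹ j<) of λ { (inj₁ lt) → min j lt ; (inj₂ refl) → le }
... | no nle = suc b , ≤-refl , λ j j< → case m≤n⇒m<n∨m≡n (s≤s⁻¹ j<) of λ { (inj₁ lt) → ≤-trans (<⇒≤ (≰⇒> nle)) (min j lt) ; (inj₂ refl) → ≤-refl }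

module Orbits {n : ℕ} (w : Vec (Fin n) n) (injective : ∀ {i j} → lookup w i ≡ lookup w j → i ≡ j) where

  iter-+ : ∀ a b i → iter w (a + b) i ≡ iter w a (iter w b i)
  iter-+ zero b i = refl
  iter-+ (suc a) b i = cong (lookup w) (iter-+ a b i)

  iter-injective : ∀ a {i j} → iter w a i ≡ iter w a j → i ≡ j
  iter-injective zero e = e
  iter-injective (suc a) e = iter-injective a (injective e)

  iter-cancel : ∀ {a b i} → a ≤ b → iter w a i ≡ iter w b i → iter w (b ∸ a) i ≡ i
  iter-cancel {a} {b} {i} a≤b e = iter-injective a (trans (sym (iter-+ a (b ∸ a) i)) (trans (cong (λ k → iter w k i) (m+[n∸m]≡n a≤b)) (sym e)))

  -- Two of the n + 1 iterates from 0 to n coincide, and injectivity cancels their common part.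
  periodic : ∀ i → ∃ λ k → k < n × finEqᵇ (iter w (suc k) i) i ≡ true
  periodic i with a , b , a<b , e ← Finₚ.pigeonhole ≤-refl (λ (k : Fin (suc n)) → iter w (toℕ k) i) =
    period (toℕ b ∸ toℕ a) (m<n⇒0<n∸m a<b) (≤-trans (m∸n≤m (toℕ b) (toℕ a)) (s≤s⁻¹ (Finₚ.toℕ<n b))) (iter-cancel (<⇒≤ a<b) e)
    where
    period : ∀ k → 0 < k → k ≤ n → iter w k i ≡ i → ∃ λ k → k < n × finEqᵇ (iter w (suc k) i) i ≡ true
    period (suc k) _ k<n e = k , k<n , trans (cong (λ v → finEqᵇ v i) e) (finEqᵇ-refl i)

  cycleLength-spec : ∀ i → 1 ≤ cycleLength w i × cycleLength w i ≤ n × iter w (cycleLength w i) i ≡ i ×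
    (∀ j → 1 ≤ j → j < cycleLength w i → iter w j i ≢ i)
  cycleLength-spec i with k , k<n , e₁ , e₂ , first ← firstTrue-spec n suc (λ k → finEqᵇ (iter w k i) i) (periodic i)
    rewrite trans (cong (λ l → firstTrue l (λ k → finEqᵇ (iter w k i) i)) (map-upTo suc n)) e₁ =
    s≤s z≤n , k<n , finEqᵇ-true e₂ , λ { (suc j) _ (s≤s lt) e → case trans (sym (first j lt)) (trans (cong (λ v → finEqᵇ v i) e) (finEqᵇ-refl i)) of λ () }

  orbit : Fin n → List (Fin n)
  orbit i = map (λ k → iter w k i) (upTo (cycleLength w i))

  iter-reduce : ∀ i k → ∃ λ k' → k' < cycleLength w i × iter w k i ≡ iter w k' i
  iter-reduce i zero = 0 , proj₁ (cycleLength-spec i) , refl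
  iter-reduce i (suc k) with k' , lt , e ← iter-reduce i k with m≤n⇒m<n∨m≡n lt
  ... | inj₁ lt' = suc k' , lt' , cong (lookup w) e
  ... | inj₂ e' = 0 , proj₁ (cycleLength-spec i) , trans (cong (lookup w) e)
    (trans (cong (λ k → iter w k i) e') (proj₁ (proj₂ (proj₂ (cycleLength-spec i)))))

  iter-∈-orbit : ∀ i k → iter w k i ∈ orbit i
  iter-∈-orbit i k with k' , lt , e ← iter-reduce i k = subst (_∈ orbit i) (sym e) (∈ₚ.∈-map⁺ (λ k → iter w k i) (∈ₚ.∈-upTo⁺ lt))

  orbit-iter : ∀ {i y} → y ∈ orbit i → ∃ λ k → k < cycleLength w i × y ≡ iter w k i
  orbit-iter y∈ with k , k∈ , e ← ∈ₚ.∈-map⁻ _ y∈ = k , ∈ₚ.∈-upTo⁻ k∈ , e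

  iter-back : ∀ i k → ∃ λ j → iter w j (iter w k i) ≡ i
  iter-back i k with k' , lt , e ← iter-reduce i k = cycleLength w i ∸ k' , trans (cong (iter w (cycleLength w i ∸ k')) e)
    (trans (sym (iter-+ (cycleLength w i ∸ k') k' i)) (trans (cong (λ k → iter w k i) (m∸n+n≡m (<⇒≤ lt))) (proj₁ (proj₂ (proj₂ (cycleLength-spec i))))))

  orbit-unique : ∀ i → Unique (orbit i)
  orbit-unique i = distinct (cycleLength w i) ≤-refl
    where
    different : ∀ {a b} → a < b → b < cycleLength w i → iter w a i ≢ iter w b i
    different {a} {b} a<b b<L e = proj₂ (proj₂ (proj₂ (cycleLength-spec i))) (b ∸ a) (m<n⇒0<n∸m a<b) (≤-<-trans (m∸n≤m b a) b<L) (iter-cancel (<⇒≤ a<b) e)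
    distinct : ∀ m → m ≤ cycleLength w i → Unique (map (λ k → iter w k i) (upTo m))
    distinct m le = subst Unique (sym (map-upTo (λ k → iter w k i) m)) (Uniqueₚ.applyUpTo⁺₁ (λ k → iter w k i) m (λ a<b b<m → different a<b (<-≤-trans b<m le)))

  minima : List (Fin n)
  minima = filterᵇ (isCycleMin w) (allFin n)

  orbits : List (List (Fin n))
  orbits = map orbit minima

  minimum-≤ : ∀ {m} → m ∈ minima → ∀ k → toℕ m ≤ toℕ (iter w k m)
  minimum-≤ {m} m∈ k with k' , lt , e ← iter-reduce m k = subst (λ v → toℕ m ≤ toℕ v) (sym e)
    (≤ᵇ-true⁻ (all-true⁻ (λ k → toℕ m ≤ᵇ toℕ (iter w k m)) (upTo n) (proj₂ (filterᵇ-∈⁻ (isCycleMin w) (allFin n) m∈)) k'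
      (∈ₚ.∈-upTo⁺ (<-≤-trans lt (proj₁ (proj₂ (cycleLength-spec m)))))))

  ∈-orbits : ∀ i → ∃ λ m → m ∈ minima × i ∈ orbit m
  ∈-orbits i with k , _ , min ← argmin (λ k → toℕ (iter w k i)) (cycleLength w i) (proj₁ (cycleLength-spec i)) =
    iter w k i ,
    filterᵇ-∈⁺ (isCycleMin w) (allFin n) (∈ₚ.∈-allFin _) (all-true⁺ _ (upTo n) (λ j _ → ≤ᵇ-true (minimal j))) ,
    (let j , e = iter-back i k in subst (_∈ orbit (iter w k i)) e (iter-∈-orbit (iter w k i) j))
    where
    minimal : ∀ j → toℕ (iter w k i) ≤ toℕ (iter w j (iter w k i))
    minimal j with j' , lt , e ← iter-reduce i (j + k) = subst (λ v → toℕ (iter w k i) ≤ toℕ v) (trans (sym e) (iter-+ j k i)) (min j' lt)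

  orbits-disjoint : ∀ {m m' y} → m ∈ minima → m' ∈ minima → y ∈ orbit m → y ∈ orbit m' → m ≡ m'
  orbits-disjoint {m} {m'} m∈ m'∈ y∈ y∈' with k , _ , e ← orbit-iter y∈ | k' , _ , e' ← orbit-iter y∈' =
    Finₚ.toℕ-injective (≤-antisym (le k k' m∈ (trans (sym e) e')) (le k' k m'∈ (trans (sym e') e)))
    where
    le : ∀ {m m'} k k' → m ∈ minima → iter w k m ≡ iter w k' m' → toℕ m ≤ toℕ m'
    le {m} {m'} k k' m∈ e with j , e″ ← iter-back m' k' = subst (λ v → toℕ m ≤ toℕ v)
      (trans (iter-+ j k m) (trans (cong (iter w j) e) e″)) (minimum-≤ m∈ (j + k))

  -- Every point lies in the orbit of the minimum of its cycle, and an orbit has only one minimum.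
  concat-orbits-↭ : concat orbits ↭ allFin n
  concat-orbits-↭ = unique-set-↭ unique (Uniqueₚ.allFin⁺ n) (λ _ → ∈ₚ.∈-allFin _) (λ {i} _ →
      let m , m∈ , i∈ = ∈-orbits i in ∈ₚ.∈-concat⁺′ i∈ (∈ₚ.∈-map⁺ orbit m∈))
    where
    pairwise : ∀ ms → (∀ {m} → m ∈ ms → m ∈ minima) → Unique ms → Unique (concat (map orbit ms))
    pairwise [] _ _ = []
    pairwise (m ∷ ms) sub (m∉ ∷ u) = Uniqueₚ.++⁺ (orbit-unique m) (pairwise ms (sub ∘ there) u) (λ { {y} (y∈ , y∈') →
      let b , y∈b , b∈ = ∈ₚ.∈-concat⁻′ (map orbit ms) y∈'
          m' , m'∈ , e = ∈ₚ.∈-map⁻ orbit b∈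
      in All.lookup m∉ m'∈ (orbits-disjoint (sub (here refl)) (sub (there m'∈)) y∈ (subst (y ∈_) e y∈b)) })
    filter-unique : ∀ {xs : List (Fin n)} → Unique xs → Unique (filterᵇ (isCycleMin w) xs)
    filter-unique [] = []
    filter-unique {x ∷ xs} (x∉ ∷ u) with isCycleMin w x
    ... | true = All.tabulate (λ y∈ → All.lookup x∉ (proj₁ (filterᵇ-∈⁻ (isCycleMin w) xs y∈))) ∷ filter-unique u
    ... | false = filter-unique u
    unique : Unique (concat orbits)
    unique = pairwise minima id (filter-unique (Uniqueₚ.allFin⁺ n))

  orbit-sizes : map length orbits ≡ map (cycleLength w) minima
  orbit-sizes = trans (sym (map-∘ minima)) (map-cong (λ m → trans (length-map _ (upTo (cycleLength w m))) (length-upTo _)) minima)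

  cycleType-partition : Partition (cycleType w)
  cycleType-partition = partition (sortDesc-descending lengths) (↭ₚ.All-resp-↭ (↭-sym (sortDesc-↭ lengths))
    (Allₚ.map⁺ (All.tabulate (λ {m} _ → proj₁ (cycleLength-spec m)))))
    where lengths = map (cycleLength w) minima

  concat-unique : Unique (concat orbits)
  concat-unique = unique-↭ (↭-sym concat-orbits-↭) (Uniqueₚ.allFin⁺ n)

module CycleColourings (n : ℕ) where
  open Assignments n

  invariantᵇ : Vec (Fin n) n → Assignment → Bool
  invariantᵇ w f = all (λ i → f (lookup w i) ≡ᵇ f i) (allFin n)

  invariant⁻ : ∀ w f → invariantᵇ w f ≡ true → ∀ i → f (lookup w i) ≡ f i
  invariant⁻ w f e i = ≡ᵇ-true (all-true⁻ _ (allFin n) e i (∈ₚ.∈-allFin i))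

  contentᵇ : List ℕ → Assignment → Bool
  contentᵇ α f = agreeᵇ (length α) (λ j → count j (map f (allFin n))) (at α)

  invariantᵇ-cong : ∀ w f g → (∀ x → f x ≡ g x) → invariantᵇ w f ≡ invariantᵇ w g
  invariantᵇ-cong w f g e = and-map-cong (allFin n) (λ i _ → cong₂ _≡ᵇ_ (e (lookup w i)) (e i))

  contentᵇ-cong : ∀ α f g → (∀ x → f x ≡ g x) → contentᵇ α f ≡ contentᵇ α g
  contentᵇ-cong α f g e = agreeᵇ-cong (length α) (λ j → cong (count j) (map-cong e (allFin n))) (λ _ → refl)

  contentᵇ-paint : ∀ α bs ps → concat bs ↭ allFin n → Unique (concat bs) → map proj₁ ps ≡ map length bs →
    contentᵇ α (paint bs (map proj₂ ps) (λ _ → 0)) ≡ agreeᵇ (length α) (load ps) (at α)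
  contentᵇ-paint α bs ps perm u e = agreeᵇ-cong (length α) (λ j → trans (count-↭ j (↭ₚ.map⁺ h (↭-sym perm))) (count-paint bs ps _ u e j)) (λ _ → refl)
    where h = paint bs (map proj₂ ps) (λ _ → 0)

  -- The assignments invariant under w are those constant on its orbits, so `Assign-blocks` turns
  -- them into colourings of the cycle lengths.
  powerSum-invariant : ∀ w (inj : ∀ {i j} → lookup w i ≡ lookup w j → i ≡ j) α →
    p (cycleType w) α ≡ Assign (length α) (allFin n) (λ f → contentᵇ α f ▷ℤ (invariantᵇ w f ▷ℤ ℤ.1ℤ)) (λ _ → 0)
  powerSum-invariant w inj α = begin
    p (cycleType w) α
      ≡⟨ powerSum-↭ {cycleType w} α (sortDesc-↭ (map (cycleLength w) minima)) ⟩
    p (map (cycleLength w) minima) α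
      ≡⟨ cong (λ ms → p ms α) (sym orbit-sizes) ⟩
    p (map length orbits) α
      ≡⟨ powerSum-colourings (map length orbits) α ⟩
    Colourings ℓ (map length orbits) (λ ps → agreeᵇ ℓ (load ps) (at α) ▷ℤ ℤ.1ℤ)
      ≡⟨ Colourings-cong∈ ℓ (map length orbits) (λ ps e → sym (cong₂ _▷ℤ_ (contentᵇ-paint α orbits ps concat-orbits-↭ concat-unique e)
           (ℤΣ.▷-true (painted-invariant ps e)))) ⟩
    Colourings ℓ (map length orbits) (λ ps → φ (paint orbits (map proj₂ ps) (λ _ → 0)))
      ≡⟨ sym (Assign-blocks ℓ φ orbits (λ _ → 0) concat-unique (Allₚ.map⁺ (All.tabulate (λ {m} _ → nonempty m))) vanish) ⟩
    Assign ℓ (concat orbits) φ (λ _ → 0)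
      ≡⟨ Assign-↭ ℓ concat-orbits-↭ respects (λ _ → 0) ⟩
    Assign ℓ (allFin n) φ (λ _ → 0) ∎
    where
    open ≡-Reasoning
    open Orbits w inj
    ℓ = length α
    φ : Assignment → ℤ
    φ f = contentᵇ α f ▷ℤ (invariantᵇ w f ▷ℤ ℤ.1ℤ)
    respects : Respects φ
    respects f g e = cong₂ (λ a b → a ▷ℤ (b ▷ℤ ℤ.1ℤ)) (contentᵇ-cong α f g e) (invariantᵇ-cong w f g e)
    nonempty : ∀ m → 1 ≤ length (orbit m)
    nonempty m = subst (1 ≤_) (sym (trans (length-map _ (upTo (cycleLength w m))) (length-upTo _))) (proj₁ (cycleLength-spec m))
    constant : ∀ g → invariantᵇ w g ≡ true → ∀ m k → g (iter w k m) ≡ g m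
    constant g e m zero = refl
    constant g e m (suc k) = trans (invariant⁻ w g e (iter w k m)) (constant g e m k)
    vanish : ∀ {b} → b ∈ orbits → ∀ {y y'} → y ∈ b → y' ∈ b → ∀ g → g y ≢ g y' → φ g ≡ ℤ.0ℤ
    vanish b∈ {y} {y'} y∈ y'∈ g ne with m , _ , refl ← ∈ₚ.∈-map⁻ orbit b∈ with k , _ , refl ← orbit-iter y∈ | k' , _ , refl ← orbit-iter y'∈ =
      ℤΣ.▷-zero (contentᵇ α g) (λ _ → ℤΣ.▷-zero (invariantᵇ w g) (λ e → ⊥-elim (ne (trans (constant g e m k) (sym (constant g e m k'))))))
    painted-invariant : ∀ ps → map proj₁ ps ≡ map length orbits → invariantᵇ w (paint orbits (map proj₂ ps) (λ _ → 0)) ≡ true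
    painted-invariant ps e = all-true⁺ _ (allFin n) (λ i _ → same i (∈-orbits i))
      where
      h = paint orbits (map proj₂ ps) (λ _ → 0)
      len : length (map proj₂ ps) ≡ length orbits
      len = trans (length-map proj₂ ps) (trans (sym (length-map proj₁ ps)) (trans (cong length e) (length-map length orbits)))
      same : ∀ i → (∃ λ m → m ∈ minima × i ∈ orbit m) → (h (lookup w i) ≡ᵇ h i) ≡ true
      same i (m , m∈ , i∈) with k , _ , refl ← orbit-iter i∈ = trans (cong (_≡ᵇ h (iter w k m))
        (paint-constant orbits (map proj₂ ps) _ concat-unique len (∈ₚ.∈-map⁺ orbit m∈) (iter-∈-orbit m (suc k)) (iter-∈-orbit m k))) (≡ᵇ-refl (h (iter w k m)))

-- Permanents

module Permanents (n : ℕ) where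

  _∖_ : (Fin n → Bool) → Fin n → Fin n → Bool
  (av ∖ b) x = av x ∧ not (finEqᵇ b x)

  -- The permanent of a 0-1 matrix, restricted to the available columns.
  per : List (Fin n → Bool) → (Fin n → Bool) → ℤ
  per [] av = ℤ.1ℤ
  per (ρ ∷ ρs) av = ∑ℤ (allFin n) (λ b → av b ▷ℤ (ρ b ▷ℤ per ρs (av ∖ b)))

  per-cong : ∀ ρs {av av' : Fin n → Bool} → (∀ x → av x ≡ av' x) → per ρs av ≡ per ρs av'
  per-cong [] e = refl
  per-cong (ρ ∷ ρs) e = ℤΣ.∑L-cong (allFin n) (λ b → cong₂ (λ a v → a ▷ℤ (ρ b ▷ℤ v)) (e b) (per-cong ρs (λ x → cong (_∧ not (finEqᵇ b x)) (e x))))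

  per-cong-rows : ∀ {A : Set} (X : List A) {ρ ρ' : A → Fin n → Bool} av → (∀ x → x ∈ X → ∀ b → ρ x b ≡ ρ' x b) → per (map ρ X) av ≡ per (map ρ' X) av
  per-cong-rows [] av e = refl
  per-cong-rows (x ∷ X) av e = ℤΣ.∑L-cong (allFin n) (λ b → cong (av b ▷ℤ_) (cong₂ _▷ℤ_ (e x (here refl) b) (per-cong-rows X (av ∖ b) (λ y m → e y (there m)))))

  per-↭ : ∀ {A : Set} {X Y : List A} → X ↭ Y → (ρ : A → Fin n → Bool) → ∀ av → per (map ρ X) av ≡ per (map ρ Y) av
  per-↭ ↭.refl ρ av = refl
  per-↭ (↭.prep x p) ρ av = ℤΣ.∑L-cong (allFin n) (λ b → cong (λ v → av b ▷ℤ (ρ x b ▷ℤ v)) (per-↭ p ρ (av ∖ b)))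
  per-↭ (↭.trans p q) ρ av = trans (per-↭ p ρ av) (per-↭ q ρ av)
  per-↭ {X = _ ∷ _ ∷ X} {_ ∷ _ ∷ Y} (↭.swap x y p) ρ av = begin
    ∑ℤ (allFin n) (λ b → av b ▷ℤ (ρ x b ▷ℤ ∑ℤ (allFin n) (λ c → (av ∖ b) c ▷ℤ (ρ y c ▷ℤ per (map ρ X) ((av ∖ b) ∖ c)))))
      ≡⟨ ℤΣ.∑L-cong (allFin n) (λ b → inward b x) ⟩
    ∑ℤ (allFin n) (λ b → ∑ℤ (allFin n) (λ c → av b ▷ℤ (ρ x b ▷ℤ ((av ∖ b) c ▷ℤ (ρ y c ▷ℤ per (map ρ X) ((av ∖ b) ∖ c))))))
      ≡⟨ ℤΣ.∑L-swap (allFin n) (allFin n) _ ⟩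
    ∑ℤ (allFin n) (λ c → ∑ℤ (allFin n) (λ b → av b ▷ℤ (ρ x b ▷ℤ ((av ∖ b) c ▷ℤ (ρ y c ▷ℤ per (map ρ X) ((av ∖ b) ∖ c))))))
      ≡⟨ ℤΣ.∑L-cong (allFin n) (λ c → ℤΣ.∑L-cong (allFin n) (λ b → exchange b c)) ⟩
    ∑ℤ (allFin n) (λ c → ∑ℤ (allFin n) (λ b → av c ▷ℤ (ρ y c ▷ℤ ((av ∖ c) b ▷ℤ (ρ x b ▷ℤ per (map ρ Y) ((av ∖ c) ∖ b))))))
      ≡⟨ ℤΣ.∑L-cong (allFin n) (λ c → sym (inward c y)) ⟩
    ∑ℤ (allFin n) (λ c → av c ▷ℤ (ρ y c ▷ℤ ∑ℤ (allFin n) (λ b → (av ∖ c) b ▷ℤ (ρ x b ▷ℤ per (map ρ Y) ((av ∖ c) ∖ b))))) ∎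
    where
    open ≡-Reasoning
    inward : ∀ b x {g : Fin n → ℤ} → (av b ▷ℤ (ρ x b ▷ℤ ∑ℤ (allFin n) g)) ≡ ∑ℤ (allFin n) (λ c → av b ▷ℤ (ρ x b ▷ℤ g c))
    inward b x = sym (trans (ℤΣ.∑L-▷ (allFin n) (av b) _) (cong (av b ▷ℤ_) (ℤΣ.∑L-▷ (allFin n) (ρ x b) _)))
    removals : ∀ b c z → ((av ∖ b) ∖ c) z ≡ ((av ∖ c) ∖ b) z
    removals b c z with av z | finEqᵇ b z | finEqᵇ c z
    ... | false | _ | _ = refl
    ... | true | true | true = refl
    ... | true | true | false = refl
    ... | true | false | true = refl
    ... | true | false | false = refl
    bools : ∀ a b d e x y {v : ℤ} → d ≡ e → (a ▷ℤ (x ▷ℤ ((b ∧ d) ▷ℤ (y ▷ℤ v)))) ≡ (b ▷ℤ (y ▷ℤ ((a ∧ e) ▷ℤ (x ▷ℤ v))))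
    bools true true true _ true true refl = refl
    bools true true true _ true false refl = refl
    bools true true true _ false true refl = refl
    bools true true true _ false false refl = refl
    bools true true false _ true true refl = refl
    bools true true false _ true false refl = refl
    bools true true false _ false true refl = refl
    bools true true false _ false false refl = refl
    bools true false d _ true y refl = refl
    bools true false d _ false y refl = refl
    bools false true d _ x true refl = refl
    bools false true d _ x false refl = refl
    bools false false d _ x y refl = refl
    exchange : ∀ b c → (av b ▷ℤ (ρ x b ▷ℤ ((av ∖ b) c ▷ℤ (ρ y c ▷ℤ per (map ρ X) ((av ∖ b) ∖ c))))) ≡
      (av c ▷ℤ (ρ y c ▷ℤ ((av ∖ c) b ▷ℤ (ρ x b ▷ℤ per (map ρ Y) ((av ∖ c) ∖ b)))))
    exchange b c = trans (cong (λ v → av b ▷ℤ (ρ x b ▷ℤ ((av ∖ b) c ▷ℤ (ρ y c ▷ℤ v)))) (trans (per-↭ p ρ _) (per-cong (map ρ Y) (removals b c))))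
      (bools (av b) (av c) (not (finEqᵇ b c)) (not (finEqᵇ c b)) (ρ x b) (ρ y c) (cong not (finEq-sym b c)))
      where
      finEq-sym : ∀ (b c : Fin n) → finEqᵇ b c ≡ finEqᵇ c b
      finEq-sym b c = true-iff (λ e → trans (cong (finEqᵇ c) (finEqᵇ-true {x = b} {c} e)) (finEqᵇ-refl c)) (λ e → trans (cong (finEqᵇ b) (finEqᵇ-true {x = c} {b} e)) (finEqᵇ-refl b))

  ∑-Fin-δ : ∀ y (φ : Fin n → ℤ) → ∑ℤ (allFin n) (λ b → finEqᵇ y b ▷ℤ φ b) ≡ φ y
  ∑-Fin-δ y φ = go (allFin n) (Uniqueₚ.allFin⁺ n) (∈ₚ.∈-allFin y)
    where
    go : ∀ xs → Unique xs → y ∈ xs → ∑ℤ xs (λ b → finEqᵇ y b ▷ℤ φ b) ≡ φ y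
    go (x ∷ xs) (x∉ ∷ u) (here refl) = trans (cong₂ ℤ._+_ (ℤΣ.▷-true (finEqᵇ-refl x))
      (ℤΣ.∑L-zero∈ xs (λ z z∈ → ℤΣ.▷-false (finEqᵇ-false {x = x} {z} (All.lookup x∉ z∈))))) (ℤₚ.+-identityʳ (φ x))
    go (x ∷ xs) (x∉ ∷ u) (there m) = trans (cong₂ ℤ._+_ (ℤΣ.▷-false {x = φ x} (finEqᵇ-false {x = y} {x} (λ { refl → All.lookup x∉ m refl }))) (go xs u m))
      (ℤₚ.+-identityˡ (φ y))

  removeAll : (Fin n → Bool) → List (Fin n) → Fin n → Bool
  removeAll av [] = av
  removeAll av (y ∷ Y) = removeAll (av ∖ y) Y

  removeAll-∉ : ∀ av Y {x} → x ∉ Y → removeAll av Y x ≡ av x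
  removeAll-∉ av [] _ = refl
  removeAll-∉ av (y ∷ Y) {x} ∉ = trans (removeAll-∉ (av ∖ y) Y (∉ ∘ there))
    (trans (cong (λ b → av x ∧ not b) (finEqᵇ-false {x = y} {x} (λ { refl → ∉ (here refl) }))) (∧-trueʳ (av x)))
    where
    ∧-trueʳ : ∀ b → b ∧ true ≡ b
    ∧-trueʳ true = refl
    ∧-trueʳ false = refl

  removeAll-false : ∀ av Y {x} → av x ≡ false → removeAll av Y x ≡ false
  removeAll-false av [] e = e
  removeAll-false av (y ∷ Y) {x} e = removeAll-false (av ∖ y) Y (cong (_∧ not (finEqᵇ y x)) e)

  removeAll-∈ : ∀ av Y {x} → x ∈ Y → removeAll av Y x ≡ false
  removeAll-∈ av (y ∷ Y) {x} (here refl) = removeAll-false (av ∖ y) Y (trans (cong (λ b → av y ∧ not b) (finEqᵇ-refl y)) (∧-false (av y)))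
    where
    ∧-false : ∀ b → b ∧ false ≡ false
    ∧-false true = refl
    ∧-false false = refl
  removeAll-∈ av (y ∷ Y) (there m) = removeAll-∈ (av ∖ y) Y m

  -- Expanding along a row whose single 1 stands in column y strikes out that column.
  per-forced : ∀ (E : List (Fin n × Fin n)) (ρ : Fin n → Fin n → Bool) R av → Unique (map proj₂ E) → (∀ e → e ∈ E → av (proj₂ e) ≡ true) →
    (∀ e → e ∈ E → ∀ b → ρ (proj₁ e) b ≡ finEqᵇ (proj₂ e) b) → per (map ρ (map proj₁ E) ++ R) av ≡ per R (removeAll av (map proj₂ E))
  per-forced [] ρ R av u free forced = refl
  per-forced ((x , y) ∷ E) ρ R av (y∉ ∷ u) free forced = begin
    ∑ℤ (allFin n) (λ b → av b ▷ℤ (ρ x b ▷ℤ per rest (av ∖ b)))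
      ≡⟨ ℤΣ.∑L-cong (allFin n) (λ b → trans (ℤΣ.▷-comm (av b) (ρ x b) _) (cong (_▷ℤ (av b ▷ℤ per rest (av ∖ b))) (forced (x , y) (here refl) b))) ⟩
    ∑ℤ (allFin n) (λ b → finEqᵇ y b ▷ℤ (av b ▷ℤ per rest (av ∖ b)))
      ≡⟨ ∑-Fin-δ y _ ⟩
    av y ▷ℤ per rest (av ∖ y)
      ≡⟨ ℤΣ.▷-true (free (x , y) (here refl)) ⟩
    per rest (av ∖ y)
      ≡⟨ per-forced E ρ R (av ∖ y) u (λ e m → cong₂ _∧_ (free e (there m)) (cong not (finEqᵇ-false {x = y} {proj₂ e} (All.lookup y∉ (∈ₚ.∈-map⁺ proj₂ m))))) (λ e m → forced e (there m)) ⟩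
    per R (removeAll av (map proj₂ ((x , y) ∷ E))) ∎
    where
    open ≡-Reasoning
    rest = map ρ (map proj₁ E) ++ R

  -- A row of colour c can take any available column of colour c; all choices leave the same numbers
  -- of columns. The result is the product of the factorials of the class sizes, which is `rise`
  -- with one initial place per colour.
  per-colours : ∀ (f : Fin n → ℕ) cs av → (∀ c → ∑ℤ (allFin n) (λ x → av x ▷ℤ ((f x ≡ᵇ c) ▷ℤ ℤ.1ℤ)) ≡ ℤ.+ count c cs) →
    per (map (λ c b → f b ≡ᵇ c) cs) av ≡ ℤ.+ rise (λ _ → 1) cs
  per-colours f [] av e = refl
  per-colours f (c ∷ cs) av e = begin
    ∑ℤ (allFin n) (λ b → av b ▷ℤ ((f b ≡ᵇ c) ▷ℤ per (map (λ c b → f b ≡ᵇ c) cs) (av ∖ b)))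
      ≡⟨ ℤΣ.∑L-cong (allFin n) (λ b → trans (ℤΣ.▷-cong (av b) (λ ok → ℤΣ.▷-cong (f b ≡ᵇ c) (λ col → trans (per-colours f cs (av ∖ b) (remaining b ok (≡ᵇ-true col))) (sym (ℤₚ.*-identityʳ r)))))
           (trans (cong (av b ▷ℤ_) (ℤΣ.▷-⊗ʳ (f b ≡ᵇ c) r ℤ.1ℤ)) (ℤΣ.▷-⊗ʳ (av b) r ((f b ≡ᵇ c) ▷ℤ ℤ.1ℤ)))) ⟩
    ∑ℤ (allFin n) (λ b → r ℤ.* (av b ▷ℤ ((f b ≡ᵇ c) ▷ℤ ℤ.1ℤ)))
      ≡⟨ ℤΣ.∑L-⊗ˡ (allFin n) r _ ⟩
    r ℤ.* ∑ℤ (allFin n) (λ b → av b ▷ℤ ((f b ≡ᵇ c) ▷ℤ ℤ.1ℤ))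
      ≡⟨ trans (cong (λ v → r ℤ.* v) (trans (e c) (cong (λ k → ℤ.+ k) (count-here c cs)))) (trans (ℤₚ.*-comm r (ℤ.+ suc (count c cs))) (sym (ℤₚ.pos-* (suc (count c cs)) (rise (λ _ → 1) cs)))) ⟩
    ℤ.+ (suc (count c cs) * rise (λ _ → 1) cs)
      ≡⟨ cong (λ k → ℤ.+ k) (sym (rise-∷ (λ _ → 1) c cs)) ⟩
    ℤ.+ rise (λ _ → 1) (c ∷ cs) ∎
    where
    open ≡-Reasoning
    r = ℤ.+ rise (λ _ → 1) cs
    remaining : ∀ b → av b ≡ true → f b ≡ c → ∀ c' → ∑ℤ (allFin n) (λ x → (av ∖ b) x ▷ℤ ((f x ≡ᵇ c') ▷ℤ ℤ.1ℤ)) ≡ ℤ.+ count c' cs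
    remaining b ok refl c' = TorsionFreeRing.⊕-cancelˡ ℤ-ring ((f b ≡ᵇ c') ▷ℤ ℤ.1ℤ) _ _ (begin
      ((f b ≡ᵇ c') ▷ℤ ℤ.1ℤ) ℤ.+ ∑ℤ (allFin n) (λ x → (av ∖ b) x ▷ℤ ((f x ≡ᵇ c') ▷ℤ ℤ.1ℤ))
        ≡⟨ cong (λ v → v ℤ.+ ∑ℤ (allFin n) (λ x → (av ∖ b) x ▷ℤ ((f x ≡ᵇ c') ▷ℤ ℤ.1ℤ))) (sym (∑-Fin-δ b (λ x → (f x ≡ᵇ c') ▷ℤ ℤ.1ℤ))) ⟩
      ∑ℤ (allFin n) (λ x → finEqᵇ b x ▷ℤ ((f x ≡ᵇ c') ▷ℤ ℤ.1ℤ)) ℤ.+ ∑ℤ (allFin n) (λ x → (av ∖ b) x ▷ℤ ((f x ≡ᵇ c') ▷ℤ ℤ.1ℤ))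
        ≡⟨ sym (ℤΣ.∑L-⊕ (allFin n) _ _) ⟩
      ∑ℤ (allFin n) (λ x → (finEqᵇ b x ▷ℤ ((f x ≡ᵇ c') ▷ℤ ℤ.1ℤ)) ℤ.+ ((av ∖ b) x ▷ℤ ((f x ≡ᵇ c') ▷ℤ ℤ.1ℤ)))
        ≡⟨ ℤΣ.∑L-cong (allFin n) merge ⟩
      ∑ℤ (allFin n) (λ x → av x ▷ℤ ((f x ≡ᵇ c') ▷ℤ ℤ.1ℤ))
        ≡⟨ e c' ⟩
      ℤ.+ count c' (f b ∷ cs)
        ≡⟨ trans (cong (λ k → ℤ.+ k) (count-∷ c' (f b) cs)) (trans (ℤₚ.pos-+ (if c' ≡ᵇ f b then 1 else 0) _) (cong (λ v → v ℤ.+ (ℤ.+ count c' cs)) (flip (c' ≟ f b)))) ⟩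
      ((f b ≡ᵇ c') ▷ℤ ℤ.1ℤ) ℤ.+ (ℤ.+ count c' cs) ∎)
      where
      flip : Dec (c' ≡ f b) → ℤ.+ (if c' ≡ᵇ f b then 1 else 0) ≡ ((f b ≡ᵇ c') ▷ℤ ℤ.1ℤ)
      flip (yes refl) rewrite ≡ᵇ-refl (f b) = refl
      flip (no ne) rewrite ≡ᵇ-false ne | ≡ᵇ-false (ne ∘ sym) = refl
      merge : ∀ x → (finEqᵇ b x ▷ℤ ((f x ≡ᵇ c') ▷ℤ ℤ.1ℤ)) ℤ.+ ((av ∖ b) x ▷ℤ ((f x ≡ᵇ c') ▷ℤ ℤ.1ℤ)) ≡ av x ▷ℤ ((f x ≡ᵇ c') ▷ℤ ℤ.1ℤ)
      merge x with finEqᵇ b x in eq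
      ... | true with refl ← finEqᵇ-true {x = b} {x} eq rewrite ok = ℤₚ.+-identityʳ _
      ... | false with av x
      ...   | true = ℤₚ.+-identityˡ _
      ...   | false = refl

  allowed : ∀ {k} → (Fin k → Fin n → Bool) → Vec (Fin n) k → Bool
  allowed ρ Vec.[] = true
  allowed ρ (a Vec.∷ w) = ρ Fin.zero a ∧ allowed (ρ ∘ Fin.suc) w

  allowed⁺ : ∀ {k} (ρ : Fin k → Fin n → Bool) w → (∀ i → ρ i (lookup w i) ≡ true) → allowed ρ w ≡ true
  allowed⁺ ρ Vec.[] e = refl
  allowed⁺ ρ (a Vec.∷ w) e = cong₂ _∧_ (e Fin.zero) (allowed⁺ (ρ ∘ Fin.suc) w (e ∘ Fin.suc))

  allowed⁻ : ∀ {k} (ρ : Fin k → Fin n → Bool) w → allowed ρ w ≡ true → ∀ i → ρ i (lookup w i) ≡ true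
  allowed⁻ ρ (a Vec.∷ w) e Fin.zero = proj₁ (∧-true {ρ Fin.zero a} e)
  allowed⁻ ρ (a Vec.∷ w) e (Fin.suc i) = allowed⁻ (ρ ∘ Fin.suc) w (proj₂ (∧-true {ρ Fin.zero a} e)) i

  ∑-injections : ∀ k (ρ : Fin k → Fin n → Bool) av →
    ∑ℤ (allVecs n k) (λ w → injectiveᵇ (toList w) ▷ℤ (all av (toList w) ▷ℤ (allowed ρ w ▷ℤ ℤ.1ℤ))) ≡ per (tabulate ρ) av
  ∑-injections zero ρ av = refl
  ∑-injections (suc k) ρ av = trans (ℤΣ.∑L-concatMap (λ a → map (a Vec.∷_) (allVecs n k)) (allFin n) _) (ℤΣ.∑L-cong (allFin n) (λ a →
    trans (ℤΣ.∑L-map (a Vec.∷_) (allVecs n k) _) (begin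
      ∑ℤ (allVecs n k) (λ w → (not (any (finEqᵇ a) (toList w)) ∧ injectiveᵇ (toList w)) ▷ℤ ((av a ∧ all av (toList w)) ▷ℤ ((ρ Fin.zero a ∧ allowed (ρ ∘ Fin.suc) w) ▷ℤ ℤ.1ℤ)))
        ≡⟨ ℤΣ.∑L-cong (allVecs n k) (λ w → regroup (any (finEqᵇ a) (toList w)) (injectiveᵇ (toList w)) (av a) (all av (toList w)) (ρ Fin.zero a) (allowed (ρ ∘ Fin.suc) w) (avoiding a (toList w))) ⟩
      ∑ℤ (allVecs n k) (λ w → av a ▷ℤ (ρ Fin.zero a ▷ℤ (injectiveᵇ (toList w) ▷ℤ (all (av ∖ a) (toList w) ▷ℤ (allowed (ρ ∘ Fin.suc) w ▷ℤ ℤ.1ℤ)))))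
        ≡⟨ trans (ℤΣ.∑L-▷ (allVecs n k) (av a) _) (cong (av a ▷ℤ_) (ℤΣ.∑L-▷ (allVecs n k) (ρ Fin.zero a) _)) ⟩
      av a ▷ℤ (ρ Fin.zero a ▷ℤ ∑ℤ (allVecs n k) (λ w → injectiveᵇ (toList w) ▷ℤ (all (av ∖ a) (toList w) ▷ℤ (allowed (ρ ∘ Fin.suc) w ▷ℤ ℤ.1ℤ))))
        ≡⟨ cong (λ v → av a ▷ℤ (ρ Fin.zero a ▷ℤ v)) (∑-injections k (ρ ∘ Fin.suc) (av ∖ a)) ⟩
      av a ▷ℤ (ρ Fin.zero a ▷ℤ per (tabulate (ρ ∘ Fin.suc)) (av ∖ a)) ∎)))
    where
    open ≡-Reasoning
    avoiding : ∀ a xs → (not (any (finEqᵇ a) xs) ∧ all av xs) ≡ all (av ∖ a) xs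
    avoiding a [] = refl
    avoiding a (x ∷ xs) = trans (bools (finEqᵇ a x) (any (finEqᵇ a) xs) (av x) (all av xs)) (cong ((av ∖ a) x ∧_) (avoiding a xs))
      where
      bools : ∀ e d b c → (not (e ∨ d) ∧ (b ∧ c)) ≡ ((b ∧ not e) ∧ (not d ∧ c))
      bools true d true c = refl
      bools true d false c = refl
      bools false true true c = refl
      bools false true false c = refl
      bools false false true c = refl
      bools false false false c = refl
    regroup : ∀ d i a b r o {q} → (not d ∧ b) ≡ q → ((not d ∧ i) ▷ℤ ((a ∧ b) ▷ℤ ((r ∧ o) ▷ℤ ℤ.1ℤ))) ≡ (a ▷ℤ (r ▷ℤ (i ▷ℤ (q ▷ℤ (o ▷ℤ ℤ.1ℤ)))))
    regroup true i a b r o refl = sym (trans (cong (λ v → a ▷ℤ (r ▷ℤ v)) (ℤΣ.▷-𝟘 i)) (trans (cong (a ▷ℤ_) (ℤΣ.▷-𝟘 r)) (ℤΣ.▷-𝟘 a)))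
    regroup false i false b r o refl = ℤΣ.▷-𝟘 i
    regroup false i true b false o refl = trans (cong (i ▷ℤ_) (ℤΣ.▷-𝟘 b)) (ℤΣ.▷-𝟘 i)
    regroup false i true b true o refl = refl

  ∑-permutations : ∀ (ρ : Fin n → Fin n → Bool) → ∑ℤ (symmetricGroup n) (λ w → allowed ρ w ▷ℤ ℤ.1ℤ) ≡ per (map ρ (allFin n)) (λ _ → true)
  ∑-permutations ρ = trans (ℤΣ.∑L-filter (λ w → injectiveᵇ (toList w)) (allVecs n n) _) (trans
    (ℤΣ.∑L-cong (allVecs n n) (λ w → cong (injectiveᵇ (toList w) ▷ℤ_) (sym (ℤΣ.▷-true (all-true⁺ (λ _ → true) (toList w) (λ _ _ → refl))))))
    (trans (∑-injections n ρ (λ _ → true)) (cong (λ ρs → per ρs (λ _ → true)) (sym (map-tabulate id ρ)))))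

symmetricGroup-injective : ∀ {n} (w : Vec (Fin n) n) → w ∈ symmetricGroup n → ∀ {i j} → lookup w i ≡ lookup w j → i ≡ j
symmetricGroup-injective {n} w w∈ = go w (proj₂ (filterᵇ-∈⁻ (λ w → injectiveᵇ (toList w)) (allVecs n n) w∈))
  where
  absent : ∀ {k} (a : Fin n) (w : Vec (Fin n) k) → any (finEqᵇ a) (toList w) ≡ false → ∀ j → a ≢ lookup w j
  absent a (b Vec.∷ w) e Fin.zero refl rewrite finEqᵇ-refl a = case e of λ ()
  absent a (b Vec.∷ w) e (Fin.suc j) eq with finEqᵇ a b
  ... | false = absent a w e j eq
  go : ∀ {k} (w : Vec (Fin n) k) → injectiveᵇ (toList w) ≡ true → ∀ {i j} → lookup w i ≡ lookup w j → i ≡ j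
  go (a Vec.∷ w) e {Fin.zero} {Fin.zero} eq = refl
  go (a Vec.∷ w) e {Fin.zero} {Fin.suc j} eq with any (finEqᵇ a) (toList w) in none
  ... | false = ⊥-elim (absent a w none j eq)
  go (a Vec.∷ w) e {Fin.suc i} {Fin.zero} eq with any (finEqᵇ a) (toList w) in none
  ... | false = ⊥-elim (absent a w none i (sym eq))
  go (a Vec.∷ w) e {Fin.suc i} {Fin.suc j} eq = cong Fin.suc (go w (proj₂ (∧-true {not (any (finEqᵇ a) (toList w))} e)) eq)

-- Permutations extending a path configuration

sources : ∀ {A : Set} → List (List A) → List A
sources [] = []
sources ([] ∷ ps) = sources ps
sources ((x ∷ _) ∷ ps) = x ∷ sources ps

endpoint : ∀ {A : Set} → A → List A → A
endpoint x [] = x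
endpoint x (y ∷ ys) = endpoint y ys

sinks : ∀ {A : Set} → List (List A) → List A
sinks [] = []
sinks ([] ∷ ps) = sinks ps
sinks ((x ∷ xs) ∷ ps) = endpoint x xs ∷ sinks ps

endpoint-∈ : ∀ {A : Set} (x : A) xs → endpoint x xs ∈ x ∷ xs
endpoint-∈ x [] = here refl
endpoint-∈ x (y ∷ ys) = there (endpoint-∈ y ys)

path-heads : ∀ {A : Set} (x : A) xs → map proj₁ (consecutivePairs (x ∷ xs)) ++ endpoint x xs ∷ [] ≡ x ∷ xs
path-heads x [] = refl
path-heads x (y ∷ ys) = cong (x ∷_) (path-heads y ys)

path-tails : ∀ {A : Set} (x : A) xs → map proj₂ (consecutivePairs (x ∷ xs)) ≡ xs
path-tails x [] = refl
path-tails x (y ∷ ys) = cong (y ∷_) (path-tails y ys)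

-- Every vertex but the last of its path starts exactly one edge.
heads-sinks-↭ : ∀ {A : Set} (ps : List (List A)) → map proj₁ (concatMap consecutivePairs ps) ++ sinks ps ↭ concat ps
heads-sinks-↭ [] = ↭.refl
heads-sinks-↭ ([] ∷ ps) = heads-sinks-↭ ps
heads-sinks-↭ ((x ∷ xs) ∷ ps) = ↭-trans (↭-reflexive (trans (cong (_++ endpoint x xs ∷ sinks ps) (map-++ proj₁ (consecutivePairs (x ∷ xs)) E)) (++-assoc H (map proj₁ E) _)))
  (↭-trans (↭ₚ.++⁺ˡ H (↭ₚ.shift (endpoint x xs) (map proj₁ E) (sinks ps)))
    (↭-trans (↭-reflexive (trans (sym (++-assoc H (endpoint x xs ∷ []) _)) (cong (_++ (map proj₁ E ++ sinks ps)) (path-heads x xs))))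
      (↭ₚ.++⁺ˡ (x ∷ xs) (heads-sinks-↭ ps))))
  where
  E = concatMap consecutivePairs ps
  H = map proj₁ (consecutivePairs (x ∷ xs))

-- Every vertex but the first of its path is the target of exactly one edge.
sources-tails-↭ : ∀ {A : Set} (ps : List (List A)) → sources ps ++ map proj₂ (concatMap consecutivePairs ps) ↭ concat ps
sources-tails-↭ [] = ↭.refl
sources-tails-↭ ([] ∷ ps) = sources-tails-↭ ps
sources-tails-↭ ((x ∷ xs) ∷ ps) = ↭.prep x (↭-trans (↭-reflexive (cong (sources ps ++_) (trans (map-++ proj₂ (consecutivePairs (x ∷ xs)) E) (cong (_++ map proj₂ E) (path-tails x xs)))))
  (↭-trans (↭ₚ.shifts (sources ps) xs) (↭ₚ.++⁺ˡ xs (sources-tails-↭ ps))))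
  where E = concatMap consecutivePairs ps

edge-in-path : ∀ {A : Set} (b : List A) {e} → e ∈ consecutivePairs b → proj₁ e ∈ b × proj₂ e ∈ b
edge-in-path (x ∷ y ∷ b) (here refl) = here refl , there (here refl)
edge-in-path (x ∷ y ∷ b) (there m) = let m₁ , m₂ = edge-in-path (y ∷ b) m in there m₁ , there m₂

unique-prefix : ∀ {A : Set} {xs ys : List A} → Unique (xs ++ ys) → Unique xs
unique-prefix {xs = []} u = []
unique-prefix {xs = x ∷ xs} (x∉ ∷ u) = All.tabulate (λ m → All.lookup x∉ (∈ₚ.∈-++⁺ˡ m)) ∷ unique-prefix u

unique-image : ∀ {A B : Set} {h : A → B} {xs : List A} → Unique (map h xs) → ∀ {x y} → x ∈ xs → y ∈ xs → h x ≡ h y → x ≡ y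
unique-image u (here refl) (here refl) e = refl
unique-image {h = h} (x∉ ∷ u) (here refl) (there m) e = ⊥-elim (All.lookup x∉ (∈ₚ.∈-map⁺ h m) e)
unique-image {h = h} (x∉ ∷ u) (there m) (here refl) e = ⊥-elim (All.lookup x∉ (∈ₚ.∈-map⁺ h m) (sym e))
unique-image (x∉ ∷ u) (there m) (there m') e = unique-image u m m' e

path-constant : ∀ {A : Set} (f : A → ℕ) x xs → (∀ {e} → e ∈ consecutivePairs (x ∷ xs) → f (proj₁ e) ≡ f (proj₂ e)) → ∀ {y} → y ∈ x ∷ xs → f y ≡ f x
path-constant f x xs e (here refl) = refl
path-constant f x (y ∷ ys) e (there m) = trans (path-constant f y ys (e ∘ there) m) (sym (e (here refl)))

count-∑ : ∀ {A : Set} c (f : A → ℕ) xs → ∑ℤ xs (λ x → (f x ≡ᵇ c) ▷ℤ ℤ.1ℤ) ≡ ℤ.+ count c (map f xs)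
count-∑ c f [] = refl
count-∑ c f (x ∷ xs) = trans (cong₂ ℤ._+_ (flip (c ≟ f x)) (count-∑ c f xs)) (trans (sym (ℤₚ.pos-+ (if c ≡ᵇ f x then 1 else 0) _)) (cong (λ k → ℤ.+ k) (sym (count-∷ c (f x) (map f xs)))))
  where
  flip : Dec (c ≡ f x) → ((f x ≡ᵇ c) ▷ℤ ℤ.1ℤ) ≡ ℤ.+ (if c ≡ᵇ f x then 1 else 0)
  flip (yes refl) rewrite ≡ᵇ-refl (f x) = refl
  flip (no ne) rewrite ≡ᵇ-false ne | ≡ᵇ-false (ne ∘ sym) = refl

count-filter : ∀ {A : Set} (q : A → Bool) xs → ℤ.+ length (filterᵇ q xs) ≡ ∑ℤ xs (λ x → q x ▷ℤ ℤ.1ℤ)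
count-filter q [] = refl
count-filter q (x ∷ xs) with q x
... | true = trans (ℤₚ.pos-+ 1 _) (cong (λ v → ℤ.1ℤ ℤ.+ v) (count-filter q xs))
... | false = trans (count-filter q xs) (sym (ℤₚ.+-identityˡ _))

module LeftHandSide (n : ℕ) (μ : List ℕ) (pos : All (1 ≤_) μ) (I J : List (Fin n)) (pp : PathPair n μ I J) where
  open PathPair pp
  open Assignments n
  open CycleColourings n
  open Permanents n

  edges : List (Fin n × Fin n)
  edges = concatMap consecutivePairs paths

  unique-paths : Unique (concat paths)
  unique-paths = unique-↭ (↭-sym vertexPartition) (Uniqueₚ.allFin⁺ n)

  unique-heads : Unique (map proj₁ edges ++ sinks paths)
  unique-heads = unique-↭ (↭-sym (heads-sinks-↭ paths)) unique-paths

  unique-tails : Unique (sources paths ++ map proj₂ edges)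
  unique-tails = unique-↭ (↭-sym (sources-tails-↭ paths)) unique-paths

  nonempty : All (λ b → 1 ≤ length b) paths
  nonempty = Allₚ.map⁻ (↭ₚ.All-resp-↭ (↭-sym pathSizes) pos)

  edge-path : ∀ {e} → e ∈ edges → ∃ λ b → b ∈ paths × proj₁ e ∈ b × proj₂ e ∈ b
  edge-path e∈ = let b , b∈ , e∈b = find (∈ₚ.∈-concatMap⁻ consecutivePairs {xs = paths} e∈)
                     m₁ , m₂ = edge-in-path b e∈b in b , b∈ , m₁ , m₂

  extensions : Assignment → ℤ
  extensions f = ∑ℤ (symmetricGroup n) (λ w → respectsᵇ w I J ▷ℤ (invariantᵇ w f ▷ℤ ℤ.1ℤ))

  -- Extending the edges and preserving the colours are both conditions on the single pairs (i,
  -- w(i)), so the permutations in question are counted by a permanent.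
  row : Assignment → Fin n → Fin n → Bool
  row f i b = (f b ≡ᵇ f i) ∧ all (λ e → not (finEqᵇ (proj₁ e) i) ∨ finEqᵇ b (proj₂ e)) (zip I J)

  allowed-row : ∀ f w → (respectsᵇ w I J ∧ invariantᵇ w f) ≡ allowed (row f) w
  allowed-row f w = true-iff
    (λ e → let e₁ , e₂ = ∧-true {respectsᵇ w I J} e in allowed⁺ (row f) w (λ i → cong₂ _∧_
      (all-true⁻ _ (allFin n) e₂ i (∈ₚ.∈-allFin i))
      (all-true⁺ _ (zip I J) (λ ed m → edge-ok ed i (all-true⁻ _ (zip I J) e₁ ed m)))))
    (λ e → cong₂ _∧_
      (all-true⁺ _ (zip I J) (λ ed m → edge-ok⁻ ed (all-true⁻ _ (zip I J) (proj₂ (∧-true {f (lookup w (proj₁ ed)) ≡ᵇ f (proj₁ ed)} (allowed⁻ (row f) w e (proj₁ ed)))) ed m)))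
      (all-true⁺ _ (allFin n) (λ i _ → proj₁ (∧-true {f (lookup w i) ≡ᵇ f i} (allowed⁻ (row f) w e i)))))
    where
    edge-ok : ∀ ed i → finEqᵇ (lookup w (proj₁ ed)) (proj₂ ed) ≡ true → (not (finEqᵇ (proj₁ ed) i) ∨ finEqᵇ (lookup w i) (proj₂ ed)) ≡ true
    edge-ok (x , y) i e with finEqᵇ x i in eq
    ... | true with refl ← finEqᵇ-true {x = x} {i} eq = e
    ... | false = refl
    edge-ok⁻ : ∀ ed → (not (finEqᵇ (proj₁ ed) (proj₁ ed)) ∨ finEqᵇ (lookup w (proj₁ ed)) (proj₂ ed)) ≡ true → finEqᵇ (lookup w (proj₁ ed)) (proj₂ ed) ≡ true
    edge-ok⁻ (x , y) e rewrite finEqᵇ-refl x = e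

  extensions-per : ∀ f → extensions f ≡ per (map (row f) (allFin n)) (λ _ → true)
  extensions-per f = trans (ℤΣ.∑L-cong (symmetricGroup n) (λ w → trans (sym (ℤΣ.▷-∧ (respectsᵇ w I J) _ _)) (cong (_▷ℤ ℤ.1ℤ) (allowed-row f w)))) (∑-permutations (row f))

  module _ (f : Assignment) (constant : ∀ {b} → b ∈ paths → ∀ {y y'} → y ∈ b → y' ∈ b → f y ≡ f y') where

    -- Edges have distinct starting points, so no other edge constrains this row; constancy on the
    -- paths makes the target admissible.
    row-edge : ∀ e → e ∈ edges → ∀ b → row f (proj₁ e) b ≡ finEqᵇ (proj₂ e) b
    row-edge (x , y) e∈ b = true-iff
      (λ r → let hit = all-true⁻ (λ e → not (finEqᵇ (proj₁ e) x) ∨ finEqᵇ b (proj₂ e)) (zip I J) (proj₂ (∧-true {f b ≡ᵇ f x} r)) (x , y) (↭ₚ.∈-resp-↭ (↭-sym edgeSet) e∈)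
             in target hit)
      (λ r → from (finEqᵇ-true {x = y} {b} r))
      where
      target : (not (finEqᵇ x x) ∨ finEqᵇ b y) ≡ true → finEqᵇ y b ≡ true
      target e rewrite finEqᵇ-refl x with refl ← finEqᵇ-true {x = b} {y} e = finEqᵇ-refl b
      from : y ≡ b → row f x b ≡ true
      from refl = cong₂ _∧_ (let _ , b∈ , m₁ , m₂ = edge-path e∈ in trans (cong (_≡ᵇ f x) (constant b∈ m₂ m₁)) (≡ᵇ-refl (f x)))
        (all-true⁺ _ (zip I J) (λ e m → other e (↭ₚ.∈-resp-↭ edgeSet m)))
        where
        other : ∀ e → e ∈ edges → (not (finEqᵇ (proj₁ e) x) ∨ finEqᵇ y (proj₂ e)) ≡ true
        other (x' , y') m with finEqᵇ x' x in eq
        ... | false = refl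
        ... | true with refl ← unique-image {h = proj₁} (unique-prefix unique-heads) m e∈ (finEqᵇ-true {x = x'} {x} eq) = finEqᵇ-refl y

    row-sink : ∀ x → x ∈ sinks paths → ∀ b → row f x b ≡ (f b ≡ᵇ f x)
    row-sink x x∈ b = trans (cong ((f b ≡ᵇ f x) ∧_) (all-true⁺ _ (zip I J) (λ e m → free e (↭ₚ.∈-resp-↭ edgeSet m)))) (∧-trueʳ (f b ≡ᵇ f x))
      where
      ∧-trueʳ : ∀ b → b ∧ true ≡ b
      ∧-trueʳ true = refl
      ∧-trueʳ false = refl
      free : ∀ e → e ∈ edges → (not (finEqᵇ (proj₁ e) x) ∨ finEqᵇ b (proj₂ e)) ≡ true
      free e m rewrite finEqᵇ-false {x = proj₁ e} {x} (λ { refl → proj₁ (unique-++ (map proj₁ edges) unique-heads) (∈ₚ.∈-map⁺ proj₁ m) x∈ }) = refl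

    colours-sources : ∀ ps → (∀ {b} → b ∈ ps → b ∈ paths) → map f (sources ps) ≡ map f (sinks ps)
    colours-sources [] sub = refl
    colours-sources ([] ∷ ps) sub = colours-sources ps (sub ∘ there)
    colours-sources ((x ∷ xs) ∷ ps) sub = cong₂ _∷_ (constant (sub (here refl)) (here refl) (endpoint-∈ x xs)) (colours-sources ps (sub ∘ there))

    -- The edges force all rows but those of the last vertices and use up all columns but those of
    -- the first vertices. Both kinds carry the colours of their paths, so a last vertex may be sent
    -- to the first vertex of any path of the same colour.
    extensions-constant : extensions f ≡ ℤ.+ rise (λ _ → 1) (map f (sinks paths))
    extensions-constant = begin
      extensions f
        ≡⟨ extensions-per f ⟩
      per (map (row f) (allFin n)) (λ _ → true)
        ≡⟨ per-↭ (↭-trans (↭-sym vertexPartition) (↭-sym (heads-sinks-↭ paths))) (row f) (λ _ → true) ⟩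
      per (map (row f) (map proj₁ edges ++ sinks paths)) (λ _ → true)
        ≡⟨ cong (λ ρs → per ρs (λ _ → true)) (map-++ (row f) (map proj₁ edges) (sinks paths)) ⟩
      per (map (row f) (map proj₁ edges) ++ map (row f) (sinks paths)) (λ _ → true)
        ≡⟨ per-forced edges (row f) (map (row f) (sinks paths)) (λ _ → true) (proj₂ (unique-++ (sources paths) unique-tails)) (λ _ _ → refl) row-edge ⟩
      per (map (row f) (sinks paths)) av
        ≡⟨ per-cong-rows (sinks paths) av row-sink ⟩
      per (map (λ x b → f b ≡ᵇ f x) (sinks paths)) av
        ≡⟨ cong (λ ρs → per ρs av) (map-∘ (sinks paths)) ⟩
      per (map (λ c b → f b ≡ᵇ c) (map f (sinks paths))) av
        ≡⟨ per-colours f (map f (sinks paths)) av available ⟩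
      ℤ.+ rise (λ _ → 1) (map f (sinks paths)) ∎
      where
      open ≡-Reasoning
      av : Fin n → Bool
      av = removeAll (λ _ → true) (map proj₂ edges)
      available : ∀ c → ∑ℤ (allFin n) (λ x → av x ▷ℤ ((f x ≡ᵇ c) ▷ℤ ℤ.1ℤ)) ≡ ℤ.+ count c (map f (sinks paths))
      available c = begin
        ∑ℤ (allFin n) g
          ≡⟨ ∑ℤ-↭ (↭-trans (↭-sym vertexPartition) (↭-sym (sources-tails-↭ paths))) g ⟩
        ∑ℤ (sources paths ++ map proj₂ edges) g
          ≡⟨ ℤΣ.∑L-++ (sources paths) (map proj₂ edges) g ⟩
        ∑ℤ (sources paths) g ℤ.+ ∑ℤ (map proj₂ edges) g
          ≡⟨ cong₂ ℤ._+_ (ℤΣ.∑L-cong∈ (sources paths) (λ x m → ℤΣ.▷-true (removeAll-∉ (λ _ → true) (map proj₂ edges) (proj₁ (unique-++ (sources paths) unique-tails) m))))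
                         (ℤΣ.∑L-zero∈ (map proj₂ edges) (λ x m → ℤΣ.▷-false (removeAll-∈ (λ _ → true) (map proj₂ edges) m))) ⟩
        ∑ℤ (sources paths) (λ x → (f x ≡ᵇ c) ▷ℤ ℤ.1ℤ) ℤ.+ ℤ.0ℤ
          ≡⟨ trans (ℤₚ.+-identityʳ _) (count-∑ c f (sources paths)) ⟩
        ℤ.+ count c (map f (sources paths))
          ≡⟨ cong (λ l → ℤ.+ count c l) (colours-sources paths id) ⟩
        ℤ.+ count c (map f (sinks paths)) ∎
        where
        g : Fin n → ℤ
        g x = av x ▷ℤ ((f x ≡ᵇ c) ▷ℤ ℤ.1ℤ)

  extensions-zero : ∀ f {b} → b ∈ paths → ∀ {y y'} → y ∈ b → y' ∈ b → f y ≢ f y' → extensions f ≡ ℤ.0ℤ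
  extensions-zero f {x ∷ xs} b∈ {y} {y'} y∈ y'∈ ne = ℤΣ.∑L-zero∈ (symmetricGroup n) (λ w _ → ℤΣ.▷-zero (respectsᵇ w I J) (λ r → ℤΣ.▷-zero (invariantᵇ w f) (λ inv →
    ⊥-elim (ne (trans (same w r inv y∈) (sym (same w r inv y'∈)))))))
    where
    same : ∀ w → respectsᵇ w I J ≡ true → invariantᵇ w f ≡ true → ∀ {y} → y ∈ x ∷ xs → f y ≡ f x
    same w r inv = path-constant f x xs (λ {e} m → trans (sym (invariant⁻ w f inv (proj₁ e))) (cong f (finEqᵇ-true {x = lookup w (proj₁ e)} {proj₂ e}
      (all-true⁻ _ (zip I J) r e (↭ₚ.∈-resp-↭ (↭-sym edgeSet) (∈ₚ.∈-concatMap⁺ consecutivePairs (lose b∈ m)))))))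

  extensions-respects : Respects extensions
  extensions-respects f g e = ℤΣ.∑L-cong (symmetricGroup n) (λ w → cong (λ b → respectsᵇ w I J ▷ℤ (b ▷ℤ ℤ.1ℤ)) (invariantᵇ-cong w f g e))

  sinks-paint : ∀ bs g f → Unique (concat bs) → length g ≡ length bs → All (λ b → 1 ≤ length b) bs → map (paint bs g f) (sinks bs) ≡ g
  sinks-paint [] [] f u l _ = refl
  sinks-paint ((x ∷ xs) ∷ bs) (c ∷ g) f u l (_ ∷ ne) = cong₂ _∷_ (paint-head (x ∷ xs) bs c g f u (endpoint-∈ x xs))
    (sinks-paint bs g _ (proj₂ (unique-++ (x ∷ xs) u)) (suc-injective l) ne)

  pathPowerSum-permutations : ∀ α → n ≡ sum α → pathPowerSum n I J α ≡ ∑ℤ (symmetricGroup n) (λ w → respectsᵇ w I J ▷ℤ p (cycleType w) α)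
  pathPowerSum-permutations α size = begin
    pathPowerSum n I J α
      ≡⟨ Σₛ-∑ (partitions n) (λ λ' → (ℤ.+ aCoeff n I J λ') ·ₛ p λ') α ⟩
    ∑ℤ (partitions n) (λ λ' → (ℤ.+ aCoeff n I J λ') ℤ.* p λ' α)
      ≡⟨ ℤΣ.∑L-cong (partitions n) (λ λ' → trans (cong (λ v → v ℤ.* p λ' α) (count-filter (λ w → respectsᵇ w I J ∧ listEqᵇ (cycleType w) λ') (symmetricGroup n)))
           (trans (sym (ℤΣ.∑L-⊗ʳ (symmetricGroup n) (p λ' α) _)) (ℤΣ.∑L-cong (symmetricGroup n) (λ w → coefficient w λ')))) ⟩
    ∑ℤ (partitions n) (λ λ' → ∑ℤ (symmetricGroup n) (λ w → respectsᵇ w I J ▷ℤ (listEqᵇ λ' (cycleType w) ▷ℤ p λ' α)))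
      ≡⟨ ℤΣ.∑L-swap (partitions n) (symmetricGroup n) _ ⟩
    ∑ℤ (symmetricGroup n) (λ w → ∑ℤ (partitions n) (λ λ' → respectsᵇ w I J ▷ℤ (listEqᵇ λ' (cycleType w) ▷ℤ p λ' α)))
      ≡⟨ ℤΣ.∑L-cong∈ (symmetricGroup n) (λ w w∈ → trans (ℤΣ.∑L-▷ (partitions n) (respectsᵇ w I J) _) (cong (respectsᵇ w I J ▷ℤ_)
           (select w (Orbits.cycleType-partition w (symmetricGroup-injective w w∈)) (sum (cycleType w) ≟ n)))) ⟩
    ∑ℤ (symmetricGroup n) (λ w → respectsᵇ w I J ▷ℤ p (cycleType w) α) ∎
    where
    open ≡-Reasoning
    coefficient : ∀ w λ' → (((respectsᵇ w I J ∧ listEqᵇ (cycleType w) λ') ▷ℤ ℤ.1ℤ) ℤ.* p λ' α) ≡ (respectsᵇ w I J ▷ℤ (listEqᵇ λ' (cycleType w) ▷ℤ p λ' α))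
    coefficient w λ' = trans (sym (ℤΣ.▷-⊗ˡ (respectsᵇ w I J ∧ listEqᵇ (cycleType w) λ') ℤ.1ℤ (p λ' α))) (trans (ℤΣ.▷-∧ (respectsᵇ w I J) _ _)
      (cong (respectsᵇ w I J ▷ℤ_) (cong₂ _▷ℤ_ (true-iff {listEqᵇ (cycleType w) λ'}
        (λ e → trans (cong (listEqᵇ λ') (listEqᵇ-true _ _ e)) (listEqᵇ-refl λ')) (λ e → trans (cong (listEqᵇ (cycleType w)) (listEqᵇ-true _ _ e)) (listEqᵇ-refl (cycleType w))))
        (ℤₚ.*-identityˡ (p λ' α)))))
    select : ∀ w → Partition (cycleType w) → Dec (sum (cycleType w) ≡ n) → ∑ℤ (partitions n) (λ λ' → listEqᵇ λ' (cycleType w) ▷ℤ p λ' α) ≡ p (cycleType w) α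
    select w part (yes e) = PartitionSums.∑-partitions ℤ-ring n (cycleType w) (λ λ' → p λ' α) part e
    -- If the cycle lengths did not add up to n, no partition would match them and `p` would vanish
    -- at α by degree.
    select w part (no ne) = trans (PartitionSums.∑-partitions-≢ ℤ-ring n (cycleType w) (λ λ' → p λ' α) ne)
      (sym (powerSum-size (cycleType w) α (λ e → ne (trans e (sym size)))))

  pathPowerSum-colourings : ∀ α → n ≡ sum α → pathPowerSum n I J α ≡
    Colourings (length α) μ (λ ps → agreeᵇ (length α) (load ps) (at α) ▷ℤ (ℤ.+ rise (λ _ → 1) (map proj₂ ps)))
  pathPowerSum-colourings α size = begin
    pathPowerSum n I J α
      ≡⟨ pathPowerSum-permutations α size ⟩
    ∑ℤ (symmetricGroup n) (λ w → respectsᵇ w I J ▷ℤ p (cycleType w) α)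
      ≡⟨ ℤΣ.∑L-cong∈ (symmetricGroup n) (λ w w∈ → trans (cong (respectsᵇ w I J ▷ℤ_) (powerSum-invariant w (symmetricGroup-injective w w∈) α)) (assign-▷ w)) ⟩
    ∑ℤ (symmetricGroup n) (λ w → Assign ℓ (allFin n) (λ f → contentᵇ α f ▷ℤ (respectsᵇ w I J ▷ℤ (invariantᵇ w f ▷ℤ ℤ.1ℤ))) (λ _ → 0))
      ≡⟨ sym (Assign-∑ ℓ (allFin n) (symmetricGroup n) _ (λ _ → 0)) ⟩
    Assign ℓ (allFin n) (λ f → ∑ℤ (symmetricGroup n) (λ w → contentᵇ α f ▷ℤ (respectsᵇ w I J ▷ℤ (invariantᵇ w f ▷ℤ ℤ.1ℤ)))) (λ _ → 0)
      ≡⟨ Assign-cong ℓ (allFin n) (λ f → ℤΣ.∑L-▷ (symmetricGroup n) (contentᵇ α f) _) (λ _ → 0) ⟩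
    Assign ℓ (allFin n) φ (λ _ → 0)
      ≡⟨ Assign-↭ ℓ (↭-sym vertexPartition) (λ f g e → cong₂ _▷ℤ_ (contentᵇ-cong α f g e) (extensions-respects f g e)) (λ _ → 0) ⟩
    Assign ℓ (concat paths) φ (λ _ → 0)
      ≡⟨ Assign-blocks ℓ φ paths (λ _ → 0) unique-paths nonempty (λ b∈ y∈ y'∈ g ne → ℤΣ.▷-zero (contentᵇ α g) (λ _ → extensions-zero g b∈ y∈ y'∈ ne)) ⟩
    Colourings ℓ (map length paths) (λ ps → φ (paint paths (map proj₂ ps) (λ _ → 0)))
      ≡⟨ Colourings-cong∈ ℓ (map length paths) (λ ps e → cong₂ _▷ℤ_ (contentᵇ-paint α paths ps vertexPartition unique-paths e) (painted ps e)) ⟩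
    Colourings ℓ (map length paths) ψ
      ≡⟨ Colourings-↭ ℓ pathSizes ψ (λ q → cong₂ (λ b k → b ▷ℤ (ℤ.+ k)) (agreeᵇ-cong ℓ (load-↭ q) (λ _ → refl)) (rise-↭ (↭ₚ.map⁺ proj₂ q) (λ _ → 1))) ⟩
    Colourings ℓ μ ψ ∎
    where
    open ≡-Reasoning
    ℓ = length α
    φ : Assignment → ℤ
    φ f = contentᵇ α f ▷ℤ extensions f
    ψ : List (ℕ × ℕ) → ℤ
    ψ ps = agreeᵇ ℓ (load ps) (at α) ▷ℤ (ℤ.+ rise (λ _ → 1) (map proj₂ ps))
    assign-▷ : ∀ w → (respectsᵇ w I J ▷ℤ Assign ℓ (allFin n) (λ f → contentᵇ α f ▷ℤ (invariantᵇ w f ▷ℤ ℤ.1ℤ)) (λ _ → 0)) ≡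
      Assign ℓ (allFin n) (λ f → contentᵇ α f ▷ℤ (respectsᵇ w I J ▷ℤ (invariantᵇ w f ▷ℤ ℤ.1ℤ))) (λ _ → 0)
    assign-▷ w with respectsᵇ w I J
    ... | true = refl
    ... | false = sym (Assign-zero ℓ (allFin n) (λ _ → 0) (λ f _ → ℤΣ.▷-𝟘 (contentᵇ α f)))
    painted : ∀ ps → map proj₁ ps ≡ map length paths → extensions (paint paths (map proj₂ ps) (λ _ → 0)) ≡ ℤ.+ rise (λ _ → 1) (map proj₂ ps)
    painted ps e = trans (extensions-constant h (paint-constant paths (map proj₂ ps) _ unique-paths len))
      (cong (λ g → ℤ.+ rise (λ _ → 1) g) (sinks-paint paths (map proj₂ ps) _ unique-paths len nonempty))
      where
      h = paint paths (map proj₂ ps) (λ _ → 0)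
      len : length (map proj₂ ps) ≡ length paths
      len = trans (length-map proj₂ ps) (trans (sym (length-map proj₁ ps)) (trans (cong length e) (length-map length paths)))

-- Monomials of a degree other than n

pathPowerSum-size : ∀ n I J α → n ≢ sum α → pathPowerSum n I J α ≡ ℤ.0ℤ
pathPowerSum-size n I J α ne = trans (Σₛ-∑ (partitions n) (λ λ' → (ℤ.+ aCoeff n I J λ') ·ₛ p λ') α) (ℤΣ.∑L-zero∈ (partitions n) (λ λ' λ∈ →
  ℤΣ.⊗-zeroʳ′ (ℤ.+ aCoeff n I J λ') (powerSum-size λ' α (λ e → ne (trans (sym (proj₂ (partitions-∈ n λ' λ∈))) e)))))

schur-degree : ∀ ρ α → sum ρ ≢ sum α → s ρ α ≡ ℤ.0ℤ
schur-degree ρ α ne = trans (count-filter (λ t → isSSYT t ∧ hasContent α t) (fillings ρ (length α))) (ℤΣ.∑L-zero∈ (fillings ρ (length α)) (λ t t∈ → ℤΣ.▷-zero (isSSYT t ∧ hasContent α t) (λ e →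
  ⊥-elim (ne (trans (sym (length-concat-filling (fillings-member ρ (length α) t t∈))) (≡ᵇ-true (proj₂ (∧-true {and (map (λ j → count (suc j) (concat t) ≡ᵇ at α j) (upTo (length α)))} (proj₂ (∧-true {isSSYT t} e))))))))))

rowSum-at : ∀ ρ d → rowSum (at ρ) (length ρ + d) ≡ sum ρ
rowSum-at [] zero = refl
rowSum-at [] (suc d) = trans (+-identityʳ _) (rowSum-at [] d)
rowSum-at (x ∷ ρ) d = trans (rowSum-shift (at (x ∷ ρ)) (length ρ + d)) (cong (x +_) (rowSum-at ρ d))

skewCells-size : ∀ λ' ν → Partition ν → containedᵇ ν λ' ≡ true → length (skewCells λ' ν) + sum ν ≡ sum λ'
skewCells-size λ' ν part c = begin
  length (skewCells λ' ν) + sum ν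
    ≡⟨ cong₂ _+_ (length-skewCells λ' ν) (trans (sym (rowSum-at ν (length λ' ∸ length ν))) (cong (rowSum (at ν)) (m+[n∸m]≡n rows))) ⟩
  rowSum (λ r → at λ' r ∸ at ν r) (length λ') + rowSum (at ν) (length λ')
    ≡⟨ add (length λ') ⟩
  rowSum (at λ') (length λ')
    ≡⟨ trans (cong (rowSum (at λ')) (sym (+-identityʳ (length λ')))) (rowSum-at λ' 0) ⟩
  sum λ' ∎
  where
  open ≡-Reasoning
  contained = contained⁻ ν λ' c
  at-positive : ∀ {ν} → All (1 ≤_) ν → ∀ r → r < length ν → 0 < at ν r
  at-positive (p ∷ _) zero _ = p
  at-positive (_ ∷ ps) (suc r) (s≤s lt) = at-positive ps r lt
  rows : length ν ≤ length λ'
  rows with length ν ≤? length λ'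
  ... | yes le = le
  ... | no nle = ⊥-elim (<⇒≱ (at-positive (Partition.positive part) (length λ') (≰⇒> nle)) (≤-trans (contained (length λ')) (≤-reflexive (at-beyond λ' (length λ') ≤-refl))))
  add : ∀ m → rowSum (λ r → at λ' r ∸ at ν r) m + rowSum (at ν) m ≡ rowSum (at λ') m
  add zero = refl
  add (suc m) = begin
    A + D + (B + at ν m)    ≡⟨ +-assoc A D _ ⟩
    A + (D + (B + at ν m))  ≡⟨ cong (A +_) (trans (sym (+-assoc D B _)) (trans (cong (_+ at ν m) (+-comm D B)) (+-assoc B D _))) ⟩
    A + (B + (D + at ν m))  ≡⟨ trans (sym (+-assoc A B _)) (cong₂ _+_ (add m) (m∸n+n≡m (contained m))) ⟩
    rowSum (at λ') m + at λ' m ∎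
    where
    A = rowSum (λ r → at λ' r ∸ at ν r) m
    B = rowSum (at ν) m
    D = at λ' m ∸ at ν m

tiling-size : ∀ n s ν prev T → Partition ν → T ∈ chains n s → monotonicᵇ ν prev T ≡ true → sum (ribbonSizes ν T) + sum ν ≡ sum (lastShape ν T)
tiling-size n zero ν prev .[] part (here refl) m = refl
tiling-size n (suc s) ν prev T part T∈ m with q , q∈ , T∈′ ← find (∈ₚ.∈-concatMap⁻ (λ q → map (q ∷_) (chains n s)) {xs = partitionsUpTo n} T∈)
  with T' , T'∈ , refl ← ∈ₚ.∈-map⁻ (q ∷_) T∈′ =
  let e₁ , e₂ = ∧-true {isRibbonᵇ q ν} m in begin
    k + sum (ribbonSizes q T') + sum ν    ≡⟨ trans (cong (_+ sum ν) (+-comm k (sum (ribbonSizes q T')))) (+-assoc (sum (ribbonSizes q T')) k (sum ν)) ⟩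
    sum (ribbonSizes q T') + (k + sum ν)  ≡⟨ cong (sum (ribbonSizes q T') +_) (skewCells-size q ν part (proj₁ (∧-true {containedᵇ ν q} e₁))) ⟩
    sum (ribbonSizes q T') + sum q        ≡⟨ tiling-size n s q _ T' (proj₁ (partitionsUpTo-∈ n q q∈)) T'∈ (proj₂ (∧-true {above prev (tailColumn q ν)} e₂)) ⟩
    sum (lastShape q T') ∎
  where
  open ≡-Reasoning
  k = length (skewCells q ν)

pathMNRhs-size : ∀ μ α → sum μ ≢ sum α → pathMNRhs μ α ≡ ℤ.0ℤ
pathMNRhs-size μ α ne = ℤΣ.⊗-zeroʳ′ (ℤ.+ multFactorial μ) (trans (Σₛ-∑ (tilingsFor μ) (λ T → tilingSign [] T ·ₛ s (tilingShape T)) α)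
  (ℤΣ.∑L-zero∈ (tilingsFor μ) (λ T T∈ → ℤΣ.⊗-zeroʳ′ (tilingSign [] T) (schur-degree (tilingShape T) α (λ e →
    ne (trans (sym (shape-size T (filterᵇ-∈⁻ (λ T → monotonicᵇ [] nothing T ∧ bagEqᵇ (ribbonSizes [] T) μ) (chains (sum μ) (length μ)) T∈))) e))))))
  where
  open ≡-Reasoning
  shape-size : ∀ T → T ∈ chains (sum μ) (length μ) × (monotonicᵇ [] nothing T ∧ bagEqᵇ (ribbonSizes [] T) μ) ≡ true → sum (tilingShape T) ≡ sum μ
  shape-size T (T∈ , e) with mono , bag ← ∧-true {monotonicᵇ [] nothing T} e = begin
    sum (tilingShape T)         ≡⟨ cong sum (tilingShape-lastShape T) ⟩
    sum (lastShape [] T)        ≡⟨ sym (tiling-size (sum μ) (length μ) [] nothing T (partition [] []) T∈ mono) ⟩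
    sum (ribbonSizes [] T) + 0  ≡⟨ +-identityʳ _ ⟩
    sum (ribbonSizes [] T)      ≡⟨ ActionProperties.sum-↭ (bagEqᵇ-↭ (ribbonSizes [] T) μ bag) ⟩
    sum μ ∎

theorem5p12 : (n : ℕ) (μ : List ℕ) → All (1 ≤_) μ → Linked _≥_ μ → sum μ ≡ n →
    (I J : List (Fin n)) → PathPair n μ I J →
    (α : List ℕ) → pathPowerSum n I J α ≡ pathMNRhs μ α
theorem5p12 n μ pos _ refl I J pp α with sum μ ≟ sum α
-- Both sides are homogeneous of degree `sum μ`; the coefficient computations need α to have this
-- degree.
... | no ne = trans (pathPowerSum-size (sum μ) I J α ne) (sym (pathMNRhs-size μ α ne))
... | yes size = trans (LeftHandSide.pathPowerSum-colourings (sum μ) μ pos I J pp α size)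
  (sym (trans (RightHandSide.pathMNRhs-∏ μ pos α size) (TopProducts.top-∏w μ pos α)))
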